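{- For $|q|<1$, $$\mathrm{C}\Phi_{13}(q)=\frac{1}{(q^{13};q^{13})_\infty}+169\Big(q\frac{(q^{13};q^{13})_\infty}{(q;q)_\infty^2}+36q^2\frac{(q^{13};q^{13})_\infty^3}{(q;q)_\infty^4}+494q^3\frac{(q^{13};q^{13})_\infty^5}{(q;q)_\infty^6}+3380q^4\frac{(q^{13};q^{13})_\infty^7}{(q;q)_\infty^8}$$ $$+13182q^5\frac{(q^{13};q^{13})_\infty^9}{(q;q)_\infty^{10}}+28561q^6\frac{(q^{13};q^{13})_\infty^{11}}{(q;q)_\infty^{12}}+28561q^7\frac{(q^{13};q^{13})_\infty^{13}}{(q;q)_\infty^{14}}\Big)$$ $$=\frac{1}{(q^{13};q^{13})_\infty}+13\sum_{j=1}^\infty p(13j-7)q^j+26q\frac{(q^{13};q^{13})_\infty}{(q;q)_\infty^2}.$$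
   Context: A $k$-colored generalized Frobenius symbol is a two-row array with $d\ge 0$ columns whose entries are colored nonnegative integers $\ell_c$ ($\ell\ge 0$, color $c\in\{1,\dots,k\}$), each row strictly decreasing with respect to the total order $0_1\prec 0_2\prec\cdots\prec 0_k\prec 1_1\prec\cdots\prec 1_k\prec 2_1\prec\cdots$. It is a $k$-colored generalized Frobenius partition of $n=d+\sum(\text{integer values of all entries})$. $c\phi_k(n)$ is the number of such partitions of $n$ (with $c\phi_k(0)=1$), and $\mathrm{C}\Phi_k(q)=\sum_{n\ge0}c\phi_k(n)q^n$. $(a;q)_\infty=\prod_{j\ge1}(1-aq^{j-1})$ and $p(n)$ is the number of ordinary partitions of $n$. -}

module Defs where

open import Data.Nat as ℕ using (ℕ; zero; suc; _∸_; _≤?_; _≟_)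
open import Data.Nat.Divisibility using (_∣?_)
open import Data.Fin using (Fin)

open import Data.List using (List; []; _∷_; _++_; concatMap; map; upTo; allFin)

open import Data.Product using (_×_; _,_; proj₁)
open import Data.Integer as ℤ using (ℤ; +_; -_)
open import Relation.Nullary using (yes; no)

sumℕ : ℕ → (ℕ → ℕ) → ℕ
sumℕ zero    f = f 0
sumℕ (suc n) f = sumℕ n f ℕ.+ f (suc n)

sumℤ : ℕ → (ℕ → ℤ) → ℤ
sumℤ zero    f = f 0
sumℤ (suc n) f = sumℤ n f ℤ.+ f (suc n)

-- Colored integers ℓ_c : value ℓ, colour c ∈ Fin k (c = 1..k ↦ 0..k-1)

Colored : ℕ → Set
Colored k = ℕ × Fin k

value : ∀ {k} → Colored k → ℕ
value = proj₁

-- All colored integers with value ≤ n, listed in increasing ≺-order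
-- 0_1 ≺ … ≺ 0_k ≺ 1_1 ≺ … ≺ n_k.
candidates : (k n : ℕ) → List (Colored k)
candidates k n = concatMap (λ ℓ → map (λ c → (ℓ , c)) (allFin k)) (upTo (suc n))

-- A strictly decreasing row is the same as a finite set of colored
-- integers (listed in decreasing order).  subCount xs d s counts the
-- sub-lists (= subsets) of xs with exactly d elements and value-sum s.
subCount : ∀ {k} → List (Colored k) → ℕ → ℕ → ℕ
subCount []       zero    zero    = 1
subCount []       _       _       = 0
subCount (x ∷ xs) zero    s       = subCount xs zero s
subCount (x ∷ xs) (suc d) s with value x ≤? s
... | yes _ = subCount xs (suc d) s ℕ.+ subCount xs d (s ∸ value x)
... | no  _ = subCount xs (suc d) s

-- number of strictly decreasing rows of length d of k-colored integers
-- whose integer values sum to s (all entries have value ≤ s)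
rows : (k d s : ℕ) → ℕ
rows k d s = subCount (candidates k s) d s

-- cφ_k(n): number of two-row symbols with d columns, top row sum a,
-- bottom row sum b, and d + a + b = n.
cφ : ℕ → ℕ → ℕ
cφ k n = sumℕ n (λ d → sumℕ (n ∸ d) (λ a → rows k d a ℕ.* rows k d (n ∸ d ∸ a)))

-- partsCount L n : number of ways to write n = Σ_{x ∈ L} m_x · x with
-- multiplicities m_x ≥ 0 (L a list of distinct positive parts).
partsCount : List ℕ → ℕ → ℕ
partsCount []       zero    = 1
partsCount []       (suc _) = 0
partsCount (x ∷ xs) n =
  sumℕ n (λ m → helper (m ℕ.* x ≤? n) m)
  where
  open import Relation.Nullary using (Dec)
  helper : ∀ {P} → Dec P → ℕ → ℕ
  helper (yes _) m = partsCount xs (n ∸ m ℕ.* x)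
  helper (no _)  m = 0

p : ℕ → ℕ
p n = partsCount (map suc (upTo n)) n

PS : Set
PS = ℕ → ℤ

one : PS
one zero    = + 1
one (suc _) = + 0

mono : ℕ → PS
mono e n with n ≟ e
... | yes _ = + 1
... | no  _ = + 0

infixl 6 _⊕_ _⊖_
infixl 7 _⊛_

_⊕_ : PS → PS → PS
(f ⊕ g) n = f n ℤ.+ g n

_⊖_ : PS → PS → PS
(f ⊖ g) n = f n ℤ.- g n

_⊛_ : PS → PS → PS
(f ⊛ g) n = sumℤ n (λ i → f i ℤ.* g (n ∸ i))

scale : ℤ → PS → PS
scale c f n = c ℤ.* f n

shift : ℕ → PS → PS
shift e f n with e ≤? n
... | yes _ = f (n ∸ e)
... | no  _ = + 0

pow : PS → ℕ → PS
pow f zero    = one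
pow f (suc m) = f ⊛ pow f m

prodTo : ℕ → (ℕ → PS) → PS
prodTo zero    F = one
prodTo (suc N) F = prodTo N F ⊛ F (suc N)

-- geometric series 1/(1 - q^e) = Σ_t q^{e t}  (e ≥ 1 when used)
geom : ℕ → PS
geom e n with e ∣? n
... | yes _ = + 1
... | no  _ = + 0

-- (q^m;q^m)_∞ = ∏_{j≥1} (1 - q^{m j}); for m ≥ 1 the coefficient of q^n
-- only depends on the factors with j ≤ n.
poch : ℕ → PS
poch m n = prodTo n (λ j → one ⊖ mono (m ℕ.* j)) n

invPoch : ℕ → PS
invPoch m n = prodTo n (λ j → geom (m ℕ.* j)) n

CΦ : ℕ → PS
CΦ k n = + cφ k n

term : ℤ → ℕ → PS
term c t = scale c (shift t (pow (poch 13) (2 ℕ.* t ∸ 1) ⊛ pow (invPoch 1) (2 ℕ.* t)))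

rhs1 : PS
rhs1 = invPoch 13 ⊕ scale (+ 169)
  (term (+ 1) 1 ⊕ term (+ 36) 2 ⊕ term (+ 494) 3 ⊕ term (+ 3380) 4
   ⊕ term (+ 13182) 5 ⊕ term (+ 28561) 6 ⊕ term (+ 28561) 7)

pSeries : PS
pSeries zero    = + 0
pSeries (suc j) = + p (13 ℕ.* suc j ∸ 7)

rhs2 : PS
rhs2 = invPoch 13 ⊕ scale (+ 13) pSeries ⊕ term (+ 26) 1

-- By the definition of Frobenius symbols, CΦ₁₃ is the constant term in z of the
-- thirteenth power of a theta product.  The z-coefficients of such a power form
-- an array that is symmetric and quasi-periodic, hence determined by seven
-- classes, and these by seven odd moments.  An array built from the right-hand
-- side obeys the same rules, so it suffices to compare moments.  Each moment of
-- the difference is, up to an eta quotient, the trace from level 13 to level 1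
-- of a weight two form; it vanishes by the residue theorem for the Hauptmodul
-- of Γ₀(13), after a finite computation with the polynomials in t.  The
-- expression of ∑ p(13j − 7) qʲ as a polynomial in t (Zuckerman's identity)
-- comes from the equation of degree 13 satisfied over ℤ[ζ₁₃] by the conjugates
-- of q^(1/13), and Newton's identities.
module Submission where

open import Defs
open import Algebra.Bundles using (CommutativeRing)
open import Data.Bool.Base using (Bool; true; false; _∧_)
open import Data.Empty using (⊥; ⊥-elim)
open import Data.Fin.Base using (Fin; zero; suc)
open import Data.Integer.Base as Z using (ℤ; +_; -[1+_])
import Data.Integer.Properties as ZP
open import Data.List.Base as List using (List; []; _∷_; _++_; length)
open import Data.Nat.Base as N using (ℕ; zero; suc; z≤n; s≤s; _∸_)
import Data.Nat.Properties as NP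
open import Data.Product.Base using (_×_; _,_; proj₁; proj₂; ∃; Σ)
open import Data.Sum.Base using (_⊎_; inj₁; inj₂)
open import Data.Vec.Base as Vec using (Vec; []; _∷_)
open import Function.Base using (_∘_; id; case_of_)
open import Level using (0ℓ)
open import Relation.Binary.PropositionalEquality as ≡ using (_≡_; refl; sym; trans; cong; cong₂; subst)
open import Relation.Nullary using (¬_; Dec; yes; no)
import Relation.Binary.Definitions
open import Data.Nat.DivMod
open import Data.Nat.Divisibility using (divides; _∣_)
open import Data.Vec.Properties using (lookup-map)
open import Data.Unit.Base using (⊤; tt)
open import Data.Integer.Tactic.RingSolver using (solve-∀)
open import Data.List.Properties using (upTo-∷ʳ; concatMap-++; length-tabulate; ++-identityʳ)

-- All series are formal, so no transformation law in the upper half plane is available. A form of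
-- level 13 is carried as a pair, its expansion at infinity and the one at the other cusp, and the
-- Fricke involution becomes the reversal p(t) ↦ (13t)ᵈ p(1/(13t)) of polynomials. Likewise no
-- valence formula is at hand: the Eisenstein series of level 1 are expressed through t because the
-- errors of the proposed expressions satisfy a linear differential system that is singular in three
-- degrees only. Ramanujan's equations, which feed that system, come from odd moments of the
-- quintuple product. The weights of the seven moments are (-1)^m times odd polynomials in 2m + 13
-- of degree at most 13. On ϑ¹³ those of degree below 13 give 0, since (1 + z⁻¹)¹³ acts as a
-- thirteenth difference, and a monic one of degree 13 in 2m + 13 gives 2¹³·13! π³⁹. On the array of
-- the right-hand side a multiplier of weight 14 - 2k and level 1 turns the k-th moment into a
-- trace. For k = 6 that weight is 2, where level 1 has no form; there the nonzero value appears.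

pattern 2+ n = suc (suc n)
pattern 3+ n = suc (2+ n)
pattern 4+ n = 2+ (2+ n)
pattern 8+ n = 4+ (4+ n)

infixr 5 _,,_ _,-_
pattern _,,_ n l = + n ∷ l
pattern _,-_ n l = -[1+ n ] ∷ l

-- Polynomials over ℤ in several variables as nested coefficient lists, the
-- constant coefficient first; they decide ring identities.
Poly : ℕ -> Set
Poly zero = ℤ
Poly (suc n) = List (Poly n)

zeroP : ∀ n -> Poly n
zeroP zero = + 0
zeroP (suc n) = []

constP : ∀ n -> ℤ -> Poly n
constP zero c = c
constP (suc n) c = constP n c ∷ []

varP : ∀ {n} -> Fin n -> Poly n
varP {suc n} zero = zeroP n ∷ constP n (+ 1) ∷ []
varP {suc n} (suc i) = varP i ∷ []

addP : ∀ n -> Poly n -> Poly n -> Poly n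
addP zero p q = p Z.+ q
addP (suc n) [] q = q
addP (suc n) (a ∷ p) [] = a ∷ p
addP (suc n) (a ∷ p) (b ∷ q) = addP n a b ∷ addP (suc n) p q

negP : ∀ n -> Poly n -> Poly n
negP zero p = Z.- p
negP (suc n) [] = []
negP (suc n) (a ∷ p) = negP n a ∷ negP (suc n) p

mulP : ∀ n -> Poly n -> Poly n -> Poly n
scaleP : ∀ n -> Poly n -> List (Poly n) -> List (Poly n)
mulP zero p q = p Z.* q
mulP (suc n) [] q = []
mulP (suc n) (a ∷ p) q = addP (suc n) (scaleP n a q) (zeroP n ∷ mulP (suc n) p q)
scaleP n a [] = []
scaleP n a (b ∷ q) = mulP n a b ∷ scaleP n a q

powP : ∀ n -> Poly n -> ℕ -> Poly n
powP n p zero = constP n (+ 1)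
powP n p (suc k) = mulP n p (powP n p k)

isZero : ∀ n -> Poly n -> Bool
isZero zero (+ zero) = true
isZero zero _ = false
isZero (suc n) [] = true
isZero (suc n) (a ∷ p) = isZero n a ∧ isZero (suc n) p

infixl 6 _:+_ _:-_
infixl 7 _:*_
infix 8 :-_
infixr 9 _:^_

data Expr (n : ℕ) : Set where
 K : ℤ -> Expr n
 X : Fin n -> Expr n
 _:+_ _:*_ : Expr n -> Expr n -> Expr n
 :-_ : Expr n -> Expr n
 _:^_ : Expr n -> ℕ -> Expr n

pattern # n = K (+ n)

_:-_ : ∀ {n} -> Expr n -> Expr n -> Expr n
a :- b = a :+ (:- b)

norm : ∀ {n} -> Expr n -> Poly n
norm {n} (K c) = constP n c
norm (X i) = varP i
norm {n} (a :+ b) = addP n (norm a) (norm b)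
norm {n} (a :* b) = mulP n (norm a) (norm b)
norm {n} (:- a) = negP n (norm a)
norm {n} (a :^ k) = powP n (norm a) k

v0 : ∀ {n} -> Expr (1 N.+ n)
v0 = X zero
v1 : ∀ {n} -> Expr (2 N.+ n)
v1 = X (suc zero)
v2 : ∀ {n} -> Expr (3 N.+ n)
v2 = X (2+ zero)
v3 : ∀ {n} -> Expr (4 N.+ n)
v3 = X (3+ zero)
v4 : ∀ {n} -> Expr (5 N.+ n)
v4 = X (4+ zero)
v5 : ∀ {n} -> Expr (6 N.+ n)
v5 = X (4+ (suc zero))
v6 : ∀ {n} -> Expr (7 N.+ n)
v6 = X (4+ (2+ zero))
v7 : ∀ {n} -> Expr (8 N.+ n)
v7 = X (4+ (3+ zero))

hE : ∀ {n} -> List ℤ -> Expr n -> Expr n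
hE [] e = # 0
hE (c ∷ cs) e = K c :+ e :* hE cs e

-- Commutative rings: the image of the integers and a reflective solver

module RingTheory (R : CommutativeRing 0ℓ 0ℓ) where

 open CommutativeRing R hiding (zero) renaming (Carrier to C; refl to ≈-refl; sym to sy; +-congʳ to +ʳ; +-congˡ to +ˡ; *-congʳ to *ʳ; *-congˡ to *ˡ; trans to tr) public
 open import Algebra.Properties.Ring ring public using (-‿involutive; -‿distribˡ-*; -‿distribʳ-*; -0#≈0#)
 open import Algebra.Properties.AbelianGroup +-abelianGroup public using () renaming (⁻¹-∙-comm to -‿+-comm)
 open import Relation.Binary.Reasoning.Setoid setoid public
 import Algebra.Properties.Semiring.Mult semiring as M

 infixr 8 _^_
 _^_ : C -> ℕ -> C
 x ^ zero = 1#
 x ^ suc n = x * x ^ n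

 ^-cong : ∀ {x y} n -> x ≈ y -> x ^ n ≈ y ^ n
 ^-cong zero h = ≈-refl
 ^-cong (suc n) h = *-cong h (^-cong n h)

 +-swap : ∀ a b c d -> (a + b) + (c + d) ≈ (a + c) + (b + d)
 +-swap a b c d = begin
  (a + b) + (c + d) ≈⟨ +-assoc a b (c + d) ⟩
  a + (b + (c + d)) ≈⟨ +ˡ (+-assoc b c d) ⟨
  a + ((b + c) + d) ≈⟨ +ˡ (+ʳ (+-comm b c)) ⟩
  a + ((c + b) + d) ≈⟨ +ˡ (+-assoc c b d) ⟩
  a + (c + (b + d)) ≈⟨ +-assoc a c (b + d) ⟨
  (a + c) + (b + d) ∎

 x-x : ∀ {x y} -> x ≈ y -> x - y ≈ 0#
 x-x {x} {y} h = tr (+ʳ h) (-‿inverseʳ y)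

 from-diff : ∀ {x y} -> x - y ≈ 0# -> x ≈ y
 from-diff {x} {y} h = begin
  x ≈⟨ +-identityʳ x ⟨
  x + 0# ≈⟨ +ˡ (-‿inverseˡ y) ⟨
  x + (- y + y) ≈⟨ +-assoc x (- y) y ⟨
  (x - y) + y ≈⟨ +ʳ h ⟩
  0# + y ≈⟨ +-identityˡ y ⟩
  y ∎

 opaque
  -- Opaque, so that the large integer constants of the level 13 computations do not unfold into
  -- unary sums of `1#`; the homomorphism laws below are the access to it.
  ι : ℤ -> C
  ι (+ n) = n M.× 1#
  ι -[1+ n ] = - (suc n M.× 1#)

 private opaque
  unfolding ι
  ι-⊖ : ∀ m n -> ι (m Z.⊖ n) ≈ m M.× 1# - n M.× 1#
  ι-⊖ zero zero = sy (-‿inverseʳ 0#)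
  ι-⊖ (suc m) zero = sy (tr (+ˡ -0#≈0#) (+-identityʳ _))
  ι-⊖ zero (suc n) = sy (+-identityˡ _)
  ι-⊖ (suc m) (suc n) = begin
   ι (suc m Z.⊖ suc n) ≡⟨ cong ι (ZP.[1+m]⊖[1+n]≡m⊖n m n) ⟩
   ι (m Z.⊖ n) ≈⟨ ι-⊖ m n ⟩
   m M.× 1# - n M.× 1# ≈⟨ +-identityˡ _ ⟨
   0# + (m M.× 1# - n M.× 1#) ≈⟨ +ʳ (-‿inverseʳ 1#) ⟨
   (1# - 1#) + (m M.× 1# - n M.× 1#) ≈⟨ +-swap 1# (- 1#) _ _ ⟩
   (1# + m M.× 1#) + (- 1# - n M.× 1#) ≈⟨ +ˡ (-‿+-comm 1# _) ⟩
   (1# + m M.× 1#) - (1# + n M.× 1#) ∎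

  ι-◃⁻ : ∀ n -> ι (Z.- (+ n)) ≈ - (n M.× 1#)
  ι-◃⁻ zero = sy -0#≈0#
  ι-◃⁻ (suc n) = ≈-refl

  ×1-* : ∀ m n -> (m N.* n) M.× 1# ≈ m M.× 1# * n M.× 1#
  ×1-* m n = M.×1-homo-* m n

 opaque
  unfolding ι
  ι-0 : ι (+ 0) ≈ 0#
  ι-0 = ≈-refl

  ι-1 : ι (+ 1) ≈ 1#
  ι-1 = +-identityʳ 1#

  ι-+ : ∀ i j -> ι (i Z.+ j) ≈ ι i + ι j
  ι-+ (+ m) (+ n) = M.×-homo-+ 1# m n
  ι-+ (+ m) -[1+ n ] = ι-⊖ m (suc n)
  ι-+ -[1+ m ] (+ n) = tr (ι-⊖ n (suc m)) (+-comm _ _)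
  ι-+ -[1+ m ] -[1+ n ] = tr (-‿cong (tr (reflexive (cong (M._× 1#) (cong suc (sym (NP.+-suc m n))))) (M.×-homo-+ 1# (suc m) (suc n)))) (sy (-‿+-comm _ _))

  ι-neg : ∀ i -> ι (Z.- i) ≈ - ι i
  ι-neg (+ n) = ι-◃⁻ n
  ι-neg -[1+ n ] = sy (-‿involutive _)

  ι-* : ∀ i j -> ι (i Z.* j) ≈ ι i * ι j
  ι-* (+ m) (+ n) = tr (reflexive (cong ι (sym (ZP.pos-* m n)))) (×1-* m n)
  ι-* (+ m) -[1+ n ] = begin
   ι (+ m Z.* -[1+ n ]) ≡⟨ cong ι (ZP.neg-distribʳ-* (+ m) (+ suc n)) ⟨
   ι (Z.- (+ m Z.* + suc n)) ≡⟨ cong (\ z -> ι (Z.- z)) (ZP.pos-* m (suc n)) ⟨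
   ι (Z.- (+ (m N.* suc n))) ≈⟨ ι-◃⁻ (m N.* suc n) ⟩
   - ((m N.* suc n) M.× 1#) ≈⟨ -‿cong (×1-* m (suc n)) ⟩
   - (m M.× 1# * suc n M.× 1#) ≈⟨ -‿distribʳ-* _ _ ⟩
   m M.× 1# * - (suc n M.× 1#) ∎
  ι-* -[1+ m ] (+ n) = begin
   ι (-[1+ m ] Z.* + n) ≡⟨ cong ι (ZP.neg-distribˡ-* (+ suc m) (+ n)) ⟨
   ι (Z.- (+ suc m Z.* + n)) ≡⟨ cong (\ z -> ι (Z.- z)) (ZP.pos-* (suc m) n) ⟨
   ι (Z.- (+ (suc m N.* n))) ≈⟨ ι-◃⁻ (suc m N.* n) ⟩
   - ((suc m N.* n) M.× 1#) ≈⟨ -‿cong (×1-* (suc m) n) ⟩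
   - (suc m M.× 1# * n M.× 1#) ≈⟨ -‿distribˡ-* _ _ ⟩
   - (suc m M.× 1#) * n M.× 1# ∎
  ι-* -[1+ m ] -[1+ n ] = begin
   (suc m N.* suc n) M.× 1# ≈⟨ ×1-* (suc m) (suc n) ⟩
   suc m M.× 1# * suc n M.× 1# ≈⟨ -‿involutive _ ⟨
   - (- (suc m M.× 1# * suc n M.× 1#)) ≈⟨ -‿cong (-‿distribˡ-* _ _) ⟩
   - (- (suc m M.× 1#) * suc n M.× 1#) ≈⟨ -‿distribʳ-* _ _ ⟩
   - (suc m M.× 1#) * - (suc n M.× 1#) ∎

 ⟦_⟧ : ∀ {n} -> Expr n -> Vec C n -> C
 ⟦ K c ⟧ ρ = ι c
 ⟦ X i ⟧ ρ = Vec.lookup ρ i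
 ⟦ a :+ b ⟧ ρ = ⟦ a ⟧ ρ + ⟦ b ⟧ ρ
 ⟦ a :* b ⟧ ρ = ⟦ a ⟧ ρ * ⟦ b ⟧ ρ
 ⟦ :- a ⟧ ρ = - ⟦ a ⟧ ρ
 ⟦ a :^ k ⟧ ρ = ⟦ a ⟧ ρ ^ k

 horner : List ℤ -> C -> C
 horner [] x = ι (+ 0)
 horner (c ∷ cs) x = ι c + x * horner cs x

 ⟦hornerE⟧ : ∀ {n} cs (e : Expr n) ρ -> ⟦ hE cs e ⟧ ρ ≡ horner cs (⟦ e ⟧ ρ)
 ⟦hornerE⟧ [] e ρ = refl
 ⟦hornerE⟧ (c ∷ cs) e ρ = cong (\ z -> ι c + ⟦ e ⟧ ρ * z) (⟦hornerE⟧ cs e ρ)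

 private
  eval : ∀ {n} -> Poly n -> Vec C n -> C
  eval {zero} c ρ = ι c
  eval {suc n} [] ρ = 0#
  eval {suc n} (a ∷ p) (x ∷ ρ) = eval a ρ + x * eval {suc n} p (x ∷ ρ)

  eval-zero : ∀ n (ρ : Vec C n) -> eval (zeroP n) ρ ≈ 0#
  eval-zero zero ρ = ι-0
  eval-zero (suc n) ρ = ≈-refl

  +x*0 : ∀ {a x z} -> z ≈ 0# -> a + x * z ≈ a
  +x*0 {a} {x} h = tr (+ˡ (tr (*ˡ h) (zeroʳ x))) (+-identityʳ a)

  eval-const : ∀ n c (ρ : Vec C n) -> eval (constP n c) ρ ≈ ι c
  eval-const zero c ρ = ≈-refl
  eval-const (suc n) c (x ∷ ρ) = tr (+x*0 ≈-refl) (eval-const n c ρ)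

  eval-var : ∀ {n} (i : Fin n) ρ -> eval (varP i) ρ ≈ Vec.lookup ρ i
  eval-var {suc n} zero (x ∷ ρ) = begin
   eval (zeroP n) ρ + x * (eval (constP n (+ 1)) ρ + x * 0#)
     ≈⟨ +-cong (eval-zero n ρ) (*ˡ (tr (+x*0 ≈-refl) (tr (eval-const n (+ 1) ρ) ι-1))) ⟩
   0# + x * 1# ≈⟨ +-identityˡ _ ⟩
   x * 1# ≈⟨ *-identityʳ x ⟩
   x ∎
  eval-var {suc n} (suc i) (x ∷ ρ) = tr (+x*0 ≈-refl) (eval-var i ρ)

  eval-add : ∀ n p q (ρ : Vec C n) -> eval (addP n p q) ρ ≈ eval p ρ + eval q ρ
  eval-add zero p q ρ = ι-+ p q
  eval-add (suc n) [] q ρ = sy (+-identityˡ _)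
  eval-add (suc n) (a ∷ p) [] ρ = sy (+-identityʳ _)
  eval-add (suc n) (a ∷ p) (b ∷ q) (x ∷ ρ) = begin
   eval (addP n a b) ρ + x * eval (addP (suc n) p q) (x ∷ ρ)
     ≈⟨ +-cong (eval-add n a b ρ) (tr (*ˡ (eval-add (suc n) p q (x ∷ ρ))) (distribˡ x _ _)) ⟩
   (eval a ρ + eval b ρ) + (x * eval {suc n} p (x ∷ ρ) + x * eval {suc n} q (x ∷ ρ))
     ≈⟨ +-swap _ _ _ _ ⟩
   (eval a ρ + x * eval {suc n} p (x ∷ ρ)) + (eval b ρ + x * eval {suc n} q (x ∷ ρ)) ∎

  eval-neg : ∀ n p (ρ : Vec C n) -> eval (negP n p) ρ ≈ - eval p ρ
  eval-neg zero p ρ = ι-neg p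
  eval-neg (suc n) [] ρ = sy -0#≈0#
  eval-neg (suc n) (a ∷ p) (x ∷ ρ) = begin
   eval (negP n a) ρ + x * eval (negP (suc n) p) (x ∷ ρ)
     ≈⟨ +-cong (eval-neg n a ρ) (tr (*ˡ (eval-neg (suc n) p (x ∷ ρ))) (sy (-‿distribʳ-* x _))) ⟩
   - eval a ρ + - (x * eval {suc n} p (x ∷ ρ)) ≈⟨ -‿+-comm _ _ ⟩
   - (eval a ρ + x * eval {suc n} p (x ∷ ρ)) ∎

  eval-mul : ∀ n p q (ρ : Vec C n) -> eval (mulP n p q) ρ ≈ eval p ρ * eval q ρ
  eval-scale : ∀ n a q x (ρ : Vec C n) -> eval {suc n} (scaleP n a q) (x ∷ ρ) ≈ eval a ρ * eval {suc n} q (x ∷ ρ)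
  eval-mul zero p q ρ = ι-* p q
  eval-mul (suc n) [] q ρ = sy (zeroˡ _)
  eval-mul (suc n) (a ∷ p) q (x ∷ ρ) = begin
   eval (addP (suc n) (scaleP n a q) (zeroP n ∷ mulP (suc n) p q)) (x ∷ ρ)
     ≈⟨ eval-add (suc n) (scaleP n a q) (zeroP n ∷ mulP (suc n) p q) (x ∷ ρ) ⟩
   eval {suc n} (scaleP n a q) (x ∷ ρ) + (eval (zeroP n) ρ + x * eval (mulP (suc n) p q) (x ∷ ρ))
     ≈⟨ +-cong (eval-scale n a q x ρ) (tr (+-cong (eval-zero n ρ) (*ˡ (eval-mul (suc n) p q (x ∷ ρ)))) (+-identityˡ _)) ⟩
   eval a ρ * Q + x * (eval {suc n} p (x ∷ ρ) * Q) ≈⟨ +ˡ (*-assoc x _ Q) ⟨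
   eval a ρ * Q + (x * eval {suc n} p (x ∷ ρ)) * Q ≈⟨ distribʳ Q _ _ ⟨
   (eval a ρ + x * eval {suc n} p (x ∷ ρ)) * Q ∎
   where Q = eval {suc n} q (x ∷ ρ)
  eval-scale n a [] x ρ = sy (zeroʳ _)
  eval-scale n a (b ∷ q) x ρ = begin
   eval (mulP n a b) ρ + x * eval {suc n} (scaleP n a q) (x ∷ ρ)
     ≈⟨ +-cong (eval-mul n a b ρ) (*ˡ (eval-scale n a q x ρ)) ⟩
   eval a ρ * eval b ρ + x * (eval a ρ * Q) ≈⟨ +ˡ (tr (sy (*-assoc x _ Q)) (tr (*ʳ (*-comm x _)) (*-assoc _ x Q))) ⟩
   eval a ρ * eval b ρ + eval a ρ * (x * Q) ≈⟨ distribˡ _ _ _ ⟨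
   eval a ρ * (eval b ρ + x * Q) ∎
   where Q = eval {suc n} q (x ∷ ρ)

  eval-pow : ∀ n p k (ρ : Vec C n) -> eval (powP n p k) ρ ≈ eval p ρ ^ k
  eval-pow n p zero ρ = tr (eval-const n (+ 1) ρ) ι-1
  eval-pow n p (suc k) ρ = tr (eval-mul n p _ ρ) (*ˡ (eval-pow n p k ρ))

  eval-norm : ∀ {n} (e : Expr n) ρ -> eval (norm e) ρ ≈ ⟦ e ⟧ ρ
  eval-norm {n} (K c) ρ = eval-const n c ρ
  eval-norm (X i) ρ = eval-var i ρ
  eval-norm {n} (a :+ b) ρ = tr (eval-add n (norm a) (norm b) ρ) (+-cong (eval-norm a ρ) (eval-norm b ρ))
  eval-norm {n} (a :* b) ρ = tr (eval-mul n (norm a) (norm b) ρ) (*-cong (eval-norm a ρ) (eval-norm b ρ))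
  eval-norm {n} (:- a) ρ = tr (eval-neg n (norm a) ρ) (-‿cong (eval-norm a ρ))
  eval-norm {n} (a :^ k) ρ = tr (eval-pow n (norm a) k ρ) (^-cong k (eval-norm a ρ))

  ∧-true : ∀ a b -> (a ∧ b) ≡ true -> (a ≡ true) × (b ≡ true)
  ∧-true true b h = refl , h

  eval-isZero : ∀ n p (ρ : Vec C n) -> isZero n p ≡ true -> eval p ρ ≈ 0#
  eval-isZero zero (+ zero) ρ h = ι-0
  eval-isZero (suc n) [] ρ h = ≈-refl
  eval-isZero (suc n) (a ∷ p) (x ∷ ρ) h with ∧-true (isZero n a) _ h
  ... | ha , hp = tr (+x*0 (eval-isZero (suc n) p (x ∷ ρ) hp)) (eval-isZero n a ρ ha)

 opaque
  -- The difference of both sides is normalised, and `isZero` accepts any nested list whose integer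
  -- entries all vanish; hence no canonical form and no trimming of zeros is required.
  solve : ∀ {n} (a b : Expr n) -> isZero n (norm (a :- b)) ≡ true -> ∀ ρ -> ⟦ a ⟧ ρ ≈ ⟦ b ⟧ ρ
  solve {n} a b h ρ = from-diff (tr (sy (eval-norm (a :- b) ρ)) (eval-isZero n (norm (a :- b)) ρ h))

 -- x ≈ y once x - y is a combination of differences known to vanish
 by1 : ∀ {x y c a b} -> a ≈ b -> x ≈ y + c * (a - b) -> x ≈ y
 by1 {x} {y} {c} h e = tr e (+x*0 (x-x h))

 by2 : ∀ {x y c a b c' a' b'} -> a ≈ b -> a' ≈ b' -> x ≈ y + c * (a - b) + c' * (a' - b') -> x ≈ y
 by2 h h' e = by1 h (by1 h' e)

 by3 : ∀ {x y c a b c' a' b' c″ a″ b″} -> a ≈ b -> a' ≈ b' -> a″ ≈ b″ ->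
     x ≈ y + c * (a - b) + c' * (a' - b') + c″ * (a″ - b″) -> x ≈ y
 by3 h h' h″ e = by2 h h' (by1 h″ e)

 horner-add : ∀ p r x -> horner (addP 1 p r) x ≈ horner p x + horner r x
 horner-add [] r x = sy (tr (+ʳ ι-0) (+-identityˡ _))
 horner-add (a ∷ p) [] x = sy (tr (+ˡ ι-0) (+-identityʳ _))
 horner-add (a ∷ p) (b ∷ r) x = tr (+-cong (ι-+ a b) (tr (*ˡ (horner-add p r x)) (distribˡ x _ _))) (+-swap _ _ _ _)

 horner-neg : ∀ p x -> horner (negP 1 p) x ≈ - horner p x
 horner-neg [] x = tr ι-0 (sy (tr (-‿cong ι-0) -0#≈0#))
 horner-neg (a ∷ p) x = tr (+-cong (ι-neg a) (tr (*ˡ (horner-neg p x)) (sy (-‿distribʳ-* x _)))) (-‿+-comm _ _)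

-- Formal power series over a commutative ring

module PowerSeries (A : CommutativeRing 0ℓ 0ℓ) where

 private module A = RingTheory A
 open A using (C)

 Ser : Set
 Ser = ℕ -> C

 infix 4 _~_
 record _~_ (f g : Ser) : Set where
  constructor mk
  field at : ∀ n -> f n A.≈ g n
 open _~_ public

 -- Structural recursion in the degree, which suits the inductive proofs of the ring laws;
 -- `conv-sum` identifies it with the sum `_⊛_` of the statement.
 conv : Ser -> Ser -> Ser
 conv f g zero = f 0 A.* g 0
 conv f g (suc n) = f 0 A.* g (suc n) A.+ conv (f ∘ suc) g n

 opaque
  _+ˢ_ : Ser -> Ser -> Ser
  (f +ˢ g) n = f n A.+ g n

  -ˢ_ : Ser -> Ser
  (-ˢ f) n = A.- f n

  +-at : ∀ f g n -> (f +ˢ g) n ≡ f n A.+ g n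
  +-at f g n = refl

  neg-at : ∀ f n -> (-ˢ f) n ≡ A.- f n
  neg-at f n = refl

 constˢ : C -> Ser
 constˢ c zero = c
 constˢ c (suc _) = A.0#

 private
  conv-cong : ∀ {f f' g g'} -> (∀ n -> f n A.≈ f' n) -> (∀ n -> g n A.≈ g' n) -> ∀ n -> conv f g n A.≈ conv f' g' n
  conv-cong h k zero = A.*-cong (h 0) (k 0)
  conv-cong h k (suc n) = A.+-cong (A.*-cong (h 0) (k (suc n))) (conv-cong (h ∘ suc) k n)

  conv-zeroˡ : ∀ {f g} -> (∀ n -> f n A.≈ A.0#) -> ∀ n -> conv f g n A.≈ A.0#
  conv-zeroˡ h zero = A.tr (A.*ʳ (h 0)) (A.zeroˡ _)
  conv-zeroˡ h (suc n) = A.tr (A.+-cong (A.tr (A.*ʳ (h 0)) (A.zeroˡ _)) (conv-zeroˡ (h ∘ suc) n)) (A.+-identityˡ _)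

  conv-distribʳ : ∀ f g h n -> conv (\ i -> f i A.+ g i) h n A.≈ conv f h n A.+ conv g h n
  conv-distribʳ f g h zero = A.distribʳ _ _ _
  conv-distribʳ f g h (suc n) = A.tr (A.+-cong (A.distribʳ _ _ _) (conv-distribʳ (f ∘ suc) (g ∘ suc) h n)) (A.+-swap _ _ _ _)

  conv-scale : ∀ c f g n -> conv (\ i -> c A.* f i) g n A.≈ c A.* conv f g n
  conv-scale c f g zero = A.*-assoc _ _ _
  conv-scale c f g (suc n) = A.tr (A.+-cong (A.*-assoc _ _ _) (conv-scale c (f ∘ suc) g n)) (A.sy (A.distribˡ _ _ _))

  conv-assoc : ∀ f g h n -> conv (conv f g) h n A.≈ conv f (conv g h) n
  conv-assoc f g h zero = A.*-assoc _ _ _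
  conv-assoc f g h (suc n) = A.begin
   (f 0 A.* g 0) A.* h (suc n) A.+ conv (\ i -> f 0 A.* g (suc i) A.+ conv (f ∘ suc) g i) h n
     A.≈⟨ A.+-cong (A.*-assoc _ _ _) (conv-distribʳ (\ i -> f 0 A.* g (suc i)) (conv (f ∘ suc) g) h n) ⟩
   f 0 A.* (g 0 A.* h (suc n)) A.+ (conv (\ i -> f 0 A.* g (suc i)) h n A.+ conv (conv (f ∘ suc) g) h n)
     A.≈⟨ A.+ˡ (A.+-cong (conv-scale (f 0) (g ∘ suc) h n) (conv-assoc (f ∘ suc) g h n)) ⟩
   f 0 A.* (g 0 A.* h (suc n)) A.+ (f 0 A.* conv (g ∘ suc) h n A.+ conv (f ∘ suc) (conv g h) n)
     A.≈⟨ A.+-assoc _ _ _ ⟨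
   (f 0 A.* (g 0 A.* h (suc n)) A.+ f 0 A.* conv (g ∘ suc) h n) A.+ conv (f ∘ suc) (conv g h) n
     A.≈⟨ A.+ʳ (A.distribˡ _ _ _) ⟨
   f 0 A.* (g 0 A.* h (suc n) A.+ conv (g ∘ suc) h n) A.+ conv (f ∘ suc) (conv g h) n A.∎

  conv-suc : ∀ f g n -> conv f g (suc n) A.≈ f (suc n) A.* g 0 A.+ conv f (g ∘ suc) n
  conv-suc f g zero = A.+-comm _ _
  conv-suc f g (suc n) = A.begin
   f 0 A.* g (2+ n) A.+ conv (f ∘ suc) g (suc n)
     A.≈⟨ A.+ˡ (conv-suc (f ∘ suc) g n) ⟩
   f 0 A.* g (2+ n) A.+ (f (2+ n) A.* g 0 A.+ conv (f ∘ suc) (g ∘ suc) n)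
     A.≈⟨ A.+-assoc _ _ _ ⟨
   (f 0 A.* g (2+ n) A.+ f (2+ n) A.* g 0) A.+ conv (f ∘ suc) (g ∘ suc) n
     A.≈⟨ A.+ʳ (A.+-comm _ _) ⟩
   (f (2+ n) A.* g 0 A.+ f 0 A.* g (2+ n)) A.+ conv (f ∘ suc) (g ∘ suc) n
     A.≈⟨ A.+-assoc _ _ _ ⟩
   f (2+ n) A.* g 0 A.+ (f 0 A.* g (2+ n) A.+ conv (f ∘ suc) (g ∘ suc) n) A.∎

  conv-comm : ∀ f g n -> conv f g n A.≈ conv g f n
  conv-comm f g zero = A.*-comm _ _
  conv-comm f g (suc n) = A.tr (A.+-cong (A.*-comm _ _) (conv-comm (f ∘ suc) g n)) (A.sy (conv-suc g f n))

  conv-const : ∀ c g n -> conv (constˢ c) g n A.≈ c A.* g n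
  conv-const c g zero = A.≈-refl
  conv-const c g (suc n) = A.tr (A.+ˡ (conv-zeroˡ (\ _ -> A.≈-refl) n)) (A.+-identityʳ _)

 private opaque
  unfolding _+ˢ_
  +ˢ-cong : ∀ {f f' g g'} -> f ~ f' -> g ~ g' -> f +ˢ g ~ f' +ˢ g'
  +ˢ-cong h k = mk \ n -> A.+-cong (at h n) (at k n)

  +ˢ-assoc : ∀ f g h -> (f +ˢ g) +ˢ h ~ f +ˢ (g +ˢ h)
  +ˢ-assoc f g h = mk \ n -> A.+-assoc _ _ _

  +ˢ-comm : ∀ f g -> f +ˢ g ~ g +ˢ f
  +ˢ-comm f g = mk \ n -> A.+-comm _ _

  +ˢ-identityˡ : ∀ f -> (\ _ -> A.0#) +ˢ f ~ f
  +ˢ-identityˡ f = mk \ n -> A.+-identityˡ _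

  -ˢ-inverseˡ : ∀ f -> (-ˢ f) +ˢ f ~ \ _ -> A.0#
  -ˢ-inverseˡ f = mk \ n -> A.-‿inverseˡ _

  -ˢ-cong : ∀ {f g} -> f ~ g -> -ˢ f ~ -ˢ g
  -ˢ-cong h = mk \ n -> A.-‿cong (at h n)

  *-distribʳˢ : ∀ f g h -> conv (g +ˢ h) f ~ conv g f +ˢ conv h f
  *-distribʳˢ f g h = mk (conv-distribʳ g h f)

 private
  ≋-trans : ∀ {f g h} -> f ~ g -> g ~ h -> f ~ h
  ≋-trans h k = mk \ n -> A.tr (at h n) (at k n)

  *ˢ-comm : ∀ f g -> conv f g ~ conv g f
  *ˢ-comm f g = mk (conv-comm f g)

  *ˢ-identityˡ : ∀ f -> conv (constˢ A.1#) f ~ f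
  *ˢ-identityˡ f = mk \ n -> A.tr (conv-const A.1# f n) (A.*-identityˡ _)

 seriesRing : CommutativeRing 0ℓ 0ℓ
 seriesRing = record
  { Carrier = Ser ; _≈_ = _~_ ; _+_ = _+ˢ_ ; _*_ = conv ; -_ = -ˢ_
  ; 0# = \ _ -> A.0# ; 1# = constˢ A.1#
  ; isCommutativeRing = record
   { isRing = record
     { +-isAbelianGroup = record
       { isGroup = record
         { isMonoid = record
           { isSemigroup = record
             { isMagma = record
               { isEquivalence = record
                { refl = mk (\ _ -> A.≈-refl) ; sym = \ h -> mk (\ n -> A.sy (at h n))
                ; trans = ≋-trans }
               ; ∙-cong = +ˢ-cong }
             ; assoc = +ˢ-assoc }
           ; identity = +ˢ-identityˡ , (\ f -> ≋-trans (+ˢ-comm f _) (+ˢ-identityˡ f)) }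
         ; inverse = -ˢ-inverseˡ , (\ f -> ≋-trans (+ˢ-comm f (-ˢ f)) (-ˢ-inverseˡ f))
         ; ⁻¹-cong = -ˢ-cong }
       ; comm = +ˢ-comm }
     ; *-cong = \ h k -> mk (conv-cong (at h) (at k))
     ; *-assoc = \ f g h -> mk (conv-assoc f g h)
     ; *-identity = *ˢ-identityˡ , (\ f -> ≋-trans (*ˢ-comm f _) (*ˢ-identityˡ f))
     ; distrib = (\ f g h -> ≋-trans (*ˢ-comm f (g +ˢ h)) (≋-trans (*-distribʳˢ f g h) (+ˢ-cong (*ˢ-comm g f) (*ˢ-comm h f))))
               , *-distribʳˢ
     }
   ; *-comm = *ˢ-comm
   }
  }

 open RingTheory seriesRing public hiding (C; semiring; rawRing)

 const-* : ∀ c f n -> (constˢ c * f) n A.≈ c A.* f n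
 const-* = conv-const

 ι-at-0 : ∀ i -> ι i 0 A.≈ A.ι i
 ι-const : ∀ i -> ι i ~ constˢ (A.ι i)
 ι-at-0 i = at (ι-const i) 0
 ι-const i = mk (go i) where
  0+0 : ∀ {x} -> x A.≈ A.0# -> A.0# A.+ x A.≈ A.0#
  0+0 h = A.tr (A.+-identityˡ _) h
  nat : ∀ k n -> ι (+ k) n A.≈ constˢ (A.ι (+ k)) n
  nat-suc : ∀ k n -> ι (+ suc k) n A.≈ 1# n A.+ ι (+ k) n
  nat-suc k n = A.tr (at (tr (ι-+ (+ 1) (+ k)) (+ʳ ι-1)) n) (A.reflexive (+-at 1# (ι (+ k)) n))
  nat zero zero = A.tr (at ι-0 0) (A.sy A.ι-0)
  nat zero (suc n) = at ι-0 (suc n)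
  nat (suc k) zero = A.tr (nat-suc k 0) (A.tr (A.+-cong (A.sy A.ι-1) (nat k 0)) (A.sy (A.ι-+ (+ 1) (+ k))))
  nat (suc k) (suc n) = A.tr (nat-suc k (suc n)) (0+0 (nat k (suc n)))
  neg-suc : ∀ k n -> ι -[1+ k ] n A.≈ A.- ι (+ suc k) n
  neg-suc k n = A.tr (at (ι-neg (+ suc k)) n) (A.reflexive (neg-at (ι (+ suc k)) n))
  go : ∀ i n -> ι i n A.≈ constˢ (A.ι i) n
  go (+ k) n = nat k n
  go -[1+ k ] zero = A.tr (neg-suc k 0) (A.tr (A.-‿cong (nat (suc k) 0)) (A.sy (A.ι-neg (+ suc k))))
  go -[1+ k ] (suc n) = A.tr (neg-suc k (suc n)) (A.tr (A.-‿cong (nat (suc k) (suc n))) A.-0#≈0#)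

 ι-*ˢ : ∀ i f n -> (ι i * f) n A.≈ A.ι i A.* f n
 ι-*ˢ i f n = A.tr (at (*ʳ {f} (ι-const i)) n) (const-* (A.ι i) f n)

 const-cong : ∀ {a b} -> a A.≈ b -> constˢ a ~ constˢ b
 const-cong h = mk \ { zero -> h ; (suc _) -> A.≈-refl }

 -- Truncation

 infix 4 _≈[_]_
 _≈[_]_ : Ser -> ℕ -> Ser -> Set
 f ≈[ N ] g = ∀ i -> i N.≤ N -> f i A.≈ g i

 *-cong[] : ∀ {f f' g g'} N -> f ≈[ N ] f' -> g ≈[ N ] g' -> (f * g) ≈[ N ] (f' * g')
 *-cong[] N h k zero le = A.*-cong (h 0 z≤n) (k 0 z≤n)
 *-cong[] (suc N) h k (suc i) (s≤s le) =
  A.+-cong (A.*-cong (h 0 z≤n) (k (suc i) (s≤s le)))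
   (*-cong[] N (\ j l -> h (suc j) (s≤s l)) (\ j l -> k j (NP.m≤n⇒m≤1+n l)) i le)

 private
  conv-high : ∀ f g n -> (∀ i -> i N.< n -> g i A.≈ A.0#) -> conv f g n A.≈ f 0 A.* g n
  conv-high f g zero h = A.≈-refl
  conv-high f g (suc n) h = A.tr (A.+ˡ (A.tr (conv-high (f ∘ suc) g n (\ i l -> h i (NP.m≤n⇒m≤1+n l)))
   (A.tr (A.*ˡ (h n NP.≤-refl)) (A.zeroʳ _)))) (A.+-identityʳ _)

 *-leading : ∀ f g n -> (∀ i -> i N.< n -> g i A.≈ A.0#) -> (f * g) n A.≈ f 0 A.* g n
 *-leading = conv-high

 strong : (Q : ℕ -> Set) -> (∀ n -> (∀ i -> i N.< n -> Q i) -> Q n) -> ∀ n -> Q n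
 strong Q step n = go (suc n) n NP.≤-refl where
  go : ∀ m i -> i N.< m -> Q i
  go (suc m) i (s≤s l) = step i (\ j l' -> go m j (NP.<-≤-trans l' l))

 -- Stands in for division: an identity is multiplied by a regular series, proved in that form, and
 -- cancelled. No fraction field and no Laurent tail in q is ever formed.
 Regular : Ser -> Set
 Regular f = ∀ g -> f * g ~ 0# -> g ~ 0#

 regular-head : ∀ f -> (∀ a -> f 0 A.* a A.≈ A.0# -> a A.≈ A.0#) -> Regular f
 regular-head f reg g h = mk (strong _ \ n ih -> reg (g n) (A.tr (A.sy (*-leading f g n ih)) (at h n)))

 regular-cancel : ∀ {f} -> Regular f -> ∀ {g h} -> f * g ~ f * h -> g ~ h
 regular-cancel {f} reg {g} {h} e = from-diff (reg (g - h) (tr (distribˡ f g (- h))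
  (tr (+ˡ (sy (-‿distribʳ-* f h))) (x-x e))))

 regular-* : ∀ {f g} -> Regular f -> Regular g -> Regular (f * g)
 regular-* {f} {g} rf rg h e = rg h (rf (g * h) (tr (sy (*-assoc f g h)) e))

 q : Ser
 q zero = A.0#
 q (suc zero) = A.1#
 q (2+ n) = A.0#

 q*-suc : ∀ f n -> (q * f) (suc n) A.≈ f n
 q*-suc f n = A.tr (A.+-cong (A.zeroˡ _) (go n)) (A.+-identityˡ _) where
  go : ∀ n -> conv (q ∘ suc) f n A.≈ f n
  go n = A.tr (conv-cong {q ∘ suc} {constˢ A.1#} {f} {f} (\ { zero -> A.≈-refl ; (suc _) -> A.≈-refl }) (\ _ -> A.≈-refl) n)
                 (A.tr (conv-const A.1# f n) (A.*-identityˡ _))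

 q*-zero : ∀ f -> (q * f) 0 A.≈ A.0#
 q*-zero f = A.zeroˡ _

 q^-shift : ∀ k f n -> (q ^ k * f) (k N.+ n) A.≈ f n
 q^-shift zero f n = at (*-identityˡ f) n
 q^-shift (suc k) f n = A.tr (at (*-assoc q (q ^ k) f) (suc (k N.+ n))) (A.tr (q*-suc (q ^ k * f) (k N.+ n)) (q^-shift k f n))

 q^-low : ∀ k f n -> n N.< k -> (q ^ k * f) n A.≈ A.0#
 q^-low (suc k) f zero l = A.tr (at (*-assoc q (q ^ k) f) 0) (q*-zero (q ^ k * f))
 q^-low (suc k) f (suc n) (s≤s l) = A.tr (at (*-assoc q (q ^ k) f) (suc n)) (A.tr (q*-suc (q ^ k * f) n) (q^-low k f n l))

 regular-q : Regular q
 regular-q g h = mk \ n -> A.tr (A.sy (q*-suc g n)) (at h (suc n))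

 regular-q^ : ∀ k -> Regular (q ^ k)
 regular-q^ zero g h = tr (sy (*-identityˡ g)) h
 regular-q^ (suc k) = regular-* {q} {q ^ k} regular-q (regular-q^ k)

 -- Inverses of series with constant term 1; the list holds the first
 -- coefficients of the inverse in reverse order.

 private
  dot : Ser -> List C -> C
  dot f [] = A.0#
  dot f (x ∷ xs) = f 0 A.* x A.+ dot (f ∘ suc) xs

  invs : Ser -> ℕ -> List C
  invs f zero = A.1# ∷ []
  invs f (suc n) = (A.- dot (f ∘ suc) (invs f n)) ∷ invs f n

  hd : List C -> C
  hd [] = A.0#
  hd (x ∷ _) = x

 inv : Ser -> Ser
 inv f n = hd (invs f n)

 private
  dot-invs : ∀ f g n -> dot f (invs g n) A.≈ conv f (inv g) n
  dot-invs f g zero = A.+-identityʳ _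
  dot-invs f g (suc n) = A.+ˡ (dot-invs (f ∘ suc) g n)

 inv-inverse : ∀ f -> f 0 A.≈ A.1# -> f * inv f ~ 1#
 inv-inverse f h = mk λ
  { zero -> A.tr (A.*ʳ h) (A.*-identityˡ _)
  ; (suc n) -> A.tr (A.+-cong (A.tr (A.*ʳ h) (A.*-identityˡ _)) (A.sy (dot-invs (f ∘ suc) f n))) (A.-‿inverseˡ _) }

 -- Infinite products of factors F j ≡ 1 mod q^j, read off diagonally

 prod : ℕ -> (ℕ -> Ser) -> Ser
 prod zero F = 1#
 prod (suc N) F = prod N F * F (suc N)

 prod∞ : (ℕ -> Ser) -> Ser
 prod∞ F n = prod n F n

 Unital : (ℕ -> Ser) -> Set
 Unital F = ∀ j i -> i N.< j -> F j i A.≈ 1# i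

 prod-stable : ∀ F -> Unital F -> ∀ k n -> prod (k N.+ n) F n A.≈ prod∞ F n
 prod-stable F u zero n = A.≈-refl
 prod-stable F u (suc k) n = A.tr
  (*-cong[] {prod (k N.+ n) F} {prod (k N.+ n) F} {F (suc (k N.+ n))} {1#} n (\ _ _ -> A.≈-refl)
    (\ i l -> u (suc (k N.+ n)) i (s≤s (NP.≤-trans l (NP.m≤n+m n k)))) n NP.≤-refl)
  (A.tr (at (*-identityʳ (prod (k N.+ n) F)) n) (prod-stable F u k n))

 prod-approx : ∀ F -> Unital F -> ∀ N -> prod N F ≈[ N ] prod∞ F
 prod-approx F u N i l = A.tr (A.reflexive (cong (\ m -> prod m F i) (sym (NP.m∸n+n≡m l)))) (prod-stable F u (N ∸ i) i)

 prod-* : ∀ F G N -> prod N (\ j -> F j * G j) ~ prod N F * prod N G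
 prod-* F G zero = sy (*-identityˡ 1#)
 prod-* F G (suc N) = tr (*ʳ (prod-* F G N))
  (solve (v0 :* v1 :* (v2 :* v3)) (v0 :* v2 :* (v1 :* v3)) refl
        (prod N F ∷ prod N G ∷ F (suc N) ∷ G (suc N) ∷ []))

 prod-cong : ∀ {F G} -> (∀ j -> F (suc j) ~ G (suc j)) -> ∀ N -> prod N F ~ prod N G
 prod-cong h zero = ≈-refl
 prod-cong h (suc N) = *-cong (prod-cong h N) (h N)

 prod∞-cong : ∀ {F G} -> (∀ j -> F (suc j) ~ G (suc j)) -> prod∞ F ~ prod∞ G
 prod∞-cong h = mk \ n -> at (prod-cong h n) n

 prod∞-* : ∀ F G -> Unital F -> Unital G -> prod∞ (\ j -> F j * G j) ~ prod∞ F * prod∞ G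
 prod∞-* F G u w = mk \ n -> A.tr (at (prod-* F G n) n)
  (*-cong[] {prod n F} {prod∞ F} {prod n G} {prod∞ G} n (prod-approx F u n) (prod-approx G w n) n NP.≤-refl)

-- Substitution q ↦ q^d and extraction of the exponents r mod d.
module Dissection (A : CommutativeRing 0ℓ 0ℓ) (k : ℕ) where

 private module A = RingTheory A
 open PowerSeries A

 d : ℕ
 d = suc k

 private
  pick : ℕ -> A.C -> A.C
  pick zero x = x
  pick (suc _) x = A.0#

 V : Ser -> Ser
 V f n = pick (n % d) (f (n / d))

 H : ℕ -> Ser -> Ser
 H r f n = f (r N.+ n N.* d)

 V-multiple : ∀ f n -> V f (n N.* d) ≡ f n
 V-multiple f n = cong₂ pick (m*n%n≡0 n d) (cong f (m*n/n≡m n d))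

 V-other : ∀ f r n -> suc r N.< d -> V f (suc r N.+ n N.* d) ≡ A.0#
 V-other f r n l = cong (\ m -> pick m (f ((suc r N.+ n N.* d) / d))) (trans ([m+kn]%n≡m%n (suc r) n d) (m<n⇒m%n≡m l))

 by-class : (Q : ℕ -> Set) -> (∀ r n -> r N.< d -> Q (r N.+ n N.* d)) -> ∀ n -> Q n
 by-class Q h n = subst Q (sym (m≡m%n+[m/n]*n n d)) (h (n % d) (n / d) (m%n<n n d))

 V-elim : (Q : ℕ -> Set) -> (∀ n -> Q (n N.* d)) -> (∀ r n -> suc r N.< d -> Q (suc r N.+ n N.* d)) -> ∀ n -> Q n
 V-elim Q h0 h1 = by-class Q \ { zero n l -> h0 n ; (suc r) n l -> h1 r n l }

 sections : ∀ {f g} -> (∀ r -> r N.< d -> H r f ~ H r g) -> f ~ g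
 sections {f} {g} h = mk (by-class (\ n -> f n A.≈ g n) \ r n l -> at (h r l) n)

 H-V : ∀ f -> H 0 (V f) ~ f
 H-V f = mk \ n -> A.reflexive (V-multiple f n)

 H-V-other : ∀ f r -> suc r N.< d -> H (suc r) (V f) ~ 0#
 H-V-other f r l = mk \ n -> A.reflexive (V-other f r n l)

 V-0 : ∀ f -> V f 0 ≡ f 0
 V-0 f = V-multiple f 0

 V-cong : ∀ {f g} -> f ~ g -> V f ~ V g
 V-cong {f} {g} h = mk (V-elim _ (\ n -> A.tr (A.reflexive (V-multiple f n)) (A.tr (at h n) (A.reflexive (sym (V-multiple g n)))))
  (\ r n l -> A.reflexive (trans (V-other f r n l) (sym (V-other g r n l)))))

 H-cong : ∀ r {f g} -> f ~ g -> H r f ~ H r g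
 H-cong r h = mk \ n -> at h (r N.+ n N.* d)

 private
  conv-drop : ∀ j G Y n -> (∀ i -> i N.< j -> G i A.≈ A.0#) -> (G * Y) (j N.+ n) A.≈ ((\ i -> G (j N.+ i)) * Y) n
  conv-drop zero G Y n h = A.≈-refl
  conv-drop (suc j) G Y n h = A.tr (A.+-cong (A.tr (A.*ʳ (h 0 (s≤s z≤n))) (A.zeroˡ _))
   (conv-drop j (G ∘ suc) Y n (\ i l -> h (suc i) (s≤s l)))) (A.+-identityˡ _)

  conv-small : ∀ G Y r -> (∀ i -> i N.≤ r -> G i A.≈ A.0#) -> (G * Y) r A.≈ A.0#
  conv-small G Y zero h = A.tr (A.*ʳ (h 0 z≤n)) (A.zeroˡ _)
  conv-small G Y (suc r) h = A.tr (A.+-cong (A.tr (A.*ʳ (h 0 z≤n)) (A.zeroˡ _)) (conv-small (G ∘ suc) Y r (\ i l -> h (suc i) (s≤s l)))) (A.+-identityˡ _)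

  V-shift : ∀ f i -> V f (d N.+ i) ≡ V (f ∘ suc) i
  V-shift f i = cong₂ pick (trans (cong (_% d) (NP.+-comm d i)) ([m+n]%n≡m%n i d))
                   (cong f (trans (+-distrib-/-∣ˡ {d} i {d} (divides 1 (sym (NP.*-identityˡ d)))) (cong (N._+ (i / d)) (n/n≡1 d))))

  V-gap : ∀ f i -> i N.< k -> V f (suc i) A.≈ A.0#
  V-gap f i l = A.reflexive (trans (cong (V f) (sym (NP.+-identityʳ (suc i)))) (V-other f i 0 (s≤s l)))

 -- Multiplication by a series in `q ^ d` does not mix the residue classes of exponents, so it
 -- commutes with their extraction; `H 0` is linear over the image of `V`.
 H-V* : ∀ r f Y -> r N.< d -> H r (V f * Y) ~ f * H r Y
 H-V* r f Y (s≤s l) = mk (go f) where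
  go : ∀ f n -> H r (V f * Y) n A.≈ (f * H r Y) n
  go f zero = A.tr (A.reflexive (cong (V f * Y) (NP.+-identityʳ r))) (A.tr (base r l) (A.*ˡ (A.reflexive (cong Y (sym (NP.+-identityʳ r))))))
   where
   base : ∀ r -> r N.≤ k -> (V f * Y) r A.≈ f 0 A.* Y r
   base zero l = A.*ʳ (A.reflexive (V-0 f))
   base (suc r) l = A.tr (A.+-cong (A.*ʳ (A.reflexive (V-0 f))) (conv-small (V f ∘ suc) Y r (\ i l' -> V-gap f i (NP.≤-trans (s≤s l') l)))) (A.+-identityʳ _)
  -- The constant term of `f` is split off: the next `k` coefficients of `V f` vanish, and what
  -- follows them is `V (f ∘ suc)`.
  go f (suc n) = A.tr (A.reflexive (cong (V f * Y) idx)) (A.+-cong (A.*-cong (A.reflexive (V-0 f)) (A.reflexive (cong Y (sym idx))))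
   (A.tr (conv-drop k (V f ∘ suc) Y (r N.+ n N.* d) (V-gap f))
   (A.tr (at (*ʳ {Y} (mk \ i -> A.reflexive (V-shift f i))) (r N.+ n N.* d)) (go (f ∘ suc) n))))
   where
   idx : r N.+ suc n N.* d ≡ suc (k N.+ (r N.+ n N.* d))
   idx = trans (sym (NP.+-assoc r d (n N.* d))) (trans (cong (N._+ n N.* d) (NP.+-comm r d)) (NP.+-assoc d r (n N.* d)))

 V-* : ∀ f g -> V (f * g) ~ V f * V g
 V-* f g = sections λ
  { zero l -> tr (H-V (f * g)) (sy (tr (H-V* 0 f (V g) l) (*ˡ (H-V g))))
  ; (suc r) l -> tr (H-V-other (f * g) r l) (sy (tr (H-V* (suc r) f (V g) l) (tr (*ˡ (H-V-other g r l)) (zeroʳ f)))) }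

 V-+ : ∀ f g -> V (f + g) ~ V f + V g
 V-+ f g = mk \ n -> A.tr (V-elim (\ n -> V (f + g) n A.≈ V f n A.+ V g n)
  (\ n -> A.reflexive (trans (V-multiple (f + g) n) (trans (+-at f g n) (sym (cong₂ A._+_ (V-multiple f n) (V-multiple g n))))))
  (\ r n l -> A.tr (A.reflexive (V-other (f + g) r n l)) (A.sy (A.tr (A.+-cong (A.reflexive (V-other f r n l)) (A.reflexive (V-other g r n l))) (A.+-identityˡ _)))) n)
  (A.reflexive (sym (+-at (V f) (V g) n)))

 V-neg : ∀ f -> V (- f) ~ - V f
 V-neg f = mk \ n -> A.tr (V-elim (\ n -> V (- f) n A.≈ A.- V f n)
  (\ n -> A.reflexive (trans (V-multiple (- f) n) (trans (neg-at f n) (sym (cong A.-_ (V-multiple f n))))))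
  (\ r n l -> A.tr (A.reflexive (V-other (- f) r n l)) (A.sy (A.tr (A.-‿cong (A.reflexive (V-other f r n l))) A.-0#≈0#))) n)
  (A.reflexive (sym (neg-at (V f) n)))

 V-const : ∀ c -> V (constˢ c) ~ constˢ c
 V-const c = mk (V-elim _ (\ { zero -> A.reflexive (V-multiple (constˢ c) 0) ; (suc n) -> A.reflexive (V-multiple (constˢ c) (suc n)) })
  (\ r n l -> A.reflexive (V-other (constˢ c) r n l)))

 V-ι : ∀ i -> V (ι i) ~ ι i
 V-ι i = tr (V-cong (ι-const i)) (tr (V-const (A.ι i)) (sy (ι-const i)))

 V-^ : ∀ f n -> V (f ^ n) ~ V f ^ n
 V-^ f zero = V-const A.1#
 V-^ f (suc n) = tr (V-* f (f ^ n)) (*ˡ (V-^ f n))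

 V-⟦⟧ : ∀ {n} (e : Expr n) ρ -> V (⟦ e ⟧ ρ) ~ ⟦ e ⟧ (Vec.map V ρ)
 V-⟦⟧ (K c) ρ = V-ι c
 V-⟦⟧ (X i) ρ = reflexive (sym (lookup-map i V ρ))
 V-⟦⟧ (a :+ b) ρ = tr (V-+ (⟦ a ⟧ ρ) (⟦ b ⟧ ρ)) (+-cong (V-⟦⟧ a ρ) (V-⟦⟧ b ρ))
 V-⟦⟧ (a :* b) ρ = tr (V-* (⟦ a ⟧ ρ) (⟦ b ⟧ ρ)) (*-cong (V-⟦⟧ a ρ) (V-⟦⟧ b ρ))
 V-⟦⟧ (:- a) ρ = tr (V-neg (⟦ a ⟧ ρ)) (-‿cong (V-⟦⟧ a ρ))
 V-⟦⟧ (a :^ n) ρ = tr (V-^ (⟦ a ⟧ ρ) n) (^-cong n (V-⟦⟧ a ρ))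

ℤring : CommutativeRing 0ℓ 0ℓ
ℤring = ZP.+-*-commutativeRing

module ℤR = RingTheory ℤring

ι-ℤ : ∀ i -> ℤR.ι i ≡ i
ι-ℤ (+ n)    = nat n where
 nat : ∀ n -> ℤR.ι (+ n) ≡ + n
 nat zero = ℤR.ι-0
 nat (suc n) = trans (ℤR.ι-+ (+ 1) (+ n)) (cong₂ Z._+_ ℤR.ι-1 (nat n))
ι-ℤ -[1+ n ] = trans (ℤR.ι-neg (+ suc n)) (cong Z.-_ (ι-ℤ (+ suc n)))

-- The group ring of (ℤ, +), an element being a list of terms (coefficient,
-- exponent).  Two elements are equal when no test function of the given
-- translation invariant class separates them: all functions give the Laurent
-- polynomials, those killed by a cyclotomic polynomial give its root adjoined.
module GroupRing (T : (ℤ -> ℤ) -> Set) (T-shift : ∀ φ -> T φ -> ∀ m -> T (\ n -> φ (m Z.+ n))) where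

 Elt : Set
 Elt = List (ℤ × ℤ)

 ⟪_,_⟫ : Elt -> (ℤ -> ℤ) -> ℤ
 ⟪ [] , φ ⟫ = + 0
 ⟪ (c , n) ∷ p , φ ⟫ = c Z.* φ n Z.+ ⟪ p , φ ⟫

 infix 4 _∼_
 record _∼_ (p r : Elt) : Set where
  constructor mk∼
  field test : ∀ φ -> T φ -> ⟪ p , φ ⟫ ≡ ⟪ r , φ ⟫
 open _∼_ public

 scaleE : ℤ -> ℤ -> Elt -> Elt
 scaleE c n [] = []
 scaleE c n ((e , m) ∷ p) = (c Z.* e , n Z.+ m) ∷ scaleE c n p

 mulE : Elt -> Elt -> Elt
 mulE [] r = []
 mulE ((c , n) ∷ p) r = scaleE c n r ++ mulE p r

 negE : Elt -> Elt
 negE [] = []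
 negE ((c , n) ∷ p) = (Z.- c , n) ∷ negE p

 ⟪⟫-cong : ∀ p {φ ψ} -> (∀ n -> φ n ≡ ψ n) -> ⟪ p , φ ⟫ ≡ ⟪ p , ψ ⟫
 ⟪⟫-cong [] h = refl
 ⟪⟫-cong ((c , n) ∷ p) h = cong₂ (\ a b -> c Z.* a Z.+ b) (h n) (⟪⟫-cong p h)

 ⟪⟫-++ : ∀ p r φ -> ⟪ p ++ r , φ ⟫ ≡ ⟪ p , φ ⟫ Z.+ ⟪ r , φ ⟫
 ⟪⟫-++ [] r φ = sym (ZP.+-identityˡ _)
 ⟪⟫-++ ((c , n) ∷ p) r φ = trans (cong (\ z -> c Z.* φ n Z.+ z) (⟪⟫-++ p r φ)) (sym (ZP.+-assoc (c Z.* φ n) ⟪ p , φ ⟫ ⟪ r , φ ⟫))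

 ⟪⟫-neg : ∀ p φ -> ⟪ negE p , φ ⟫ ≡ Z.- ⟪ p , φ ⟫
 ⟪⟫-neg [] φ = refl
 ⟪⟫-neg ((c , n) ∷ p) φ = trans (cong₂ Z._+_ (sym (ZP.neg-distribˡ-* c (φ n))) (⟪⟫-neg p φ)) (sym (ZP.neg-distrib-+ (c Z.* φ n) ⟪ p , φ ⟫))

 ⟪⟫-scale : ∀ c n p φ -> ⟪ scaleE c n p , φ ⟫ ≡ c Z.* ⟪ p , (\ m -> φ (n Z.+ m)) ⟫
 ⟪⟫-scale c n [] φ = sym (ZP.*-zeroʳ c)
 ⟪⟫-scale c n ((e , m) ∷ p) φ = trans (cong₂ Z._+_ (ZP.*-assoc c e _) (⟪⟫-scale c n p φ)) (sym (ZP.*-distribˡ-+ c _ _))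

 ⟪_,_,_⟫2 : Elt -> Elt -> (ℤ -> ℤ -> ℤ) -> ℤ
 ⟪ p , r , Φ ⟫2 = ⟪ p , (\ a -> ⟪ r , Φ a ⟫) ⟫

 ⟪⟫-mul : ∀ p r φ -> ⟪ mulE p r , φ ⟫ ≡ ⟪ p , r , (\ a b -> φ (a Z.+ b)) ⟫2
 ⟪⟫-mul [] r φ = refl
 ⟪⟫-mul ((c , n) ∷ p) r φ = trans (⟪⟫-++ (scaleE c n r) (mulE p r) φ) (cong₂ Z._+_ (⟪⟫-scale c n r φ) (⟪⟫-mul p r φ))

 ⟪⟫-zero : ∀ p -> ⟪ p , (\ _ -> + 0) ⟫ ≡ + 0
 ⟪⟫-zero [] = refl
 ⟪⟫-zero ((c , n) ∷ p) = cong₂ Z._+_ (ZP.*-zeroʳ c) (⟪⟫-zero p)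

 ⟪⟫-+ : ∀ p φ ψ -> ⟪ p , (\ n -> φ n Z.+ ψ n) ⟫ ≡ ⟪ p , φ ⟫ Z.+ ⟪ p , ψ ⟫
 ⟪⟫-+ [] φ ψ = refl
 ⟪⟫-+ ((c , n) ∷ p) φ ψ = trans (cong₂ Z._+_ (ZP.*-distribˡ-+ c (φ n) (ψ n)) (⟪⟫-+ p φ ψ)) (ℤR.+-swap (c Z.* φ n) (c Z.* ψ n) ⟪ p , φ ⟫ ⟪ p , ψ ⟫)

 ⟪⟫-*ˡ : ∀ p e φ -> ⟪ p , (\ n -> e Z.* φ n) ⟫ ≡ e Z.* ⟪ p , φ ⟫
 ⟪⟫-*ˡ [] e φ = sym (ZP.*-zeroʳ e)
 ⟪⟫-*ˡ ((c , n) ∷ p) e φ = trans (cong₂ Z._+_ lem (⟪⟫-*ˡ p e φ)) (sym (ZP.*-distribˡ-+ e _ _))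
  where
  lem : c Z.* (e Z.* φ n) ≡ e Z.* (c Z.* φ n)
  lem = trans (sym (ZP.*-assoc c e _)) (trans (cong (Z._* φ n) (ZP.*-comm c e)) (ZP.*-assoc e c _))

 ⟪⟫-swap : ∀ p r Φ -> ⟪ p , r , Φ ⟫2 ≡ ⟪ r , p , (\ b a -> Φ a b) ⟫2
 ⟪⟫-swap [] r Φ = sym (⟪⟫-zero r)
 ⟪⟫-swap ((c , n) ∷ p) r Φ = trans (cong₂ Z._+_ (sym (⟪⟫-*ˡ r c (Φ n))) (⟪⟫-swap p r Φ)) (sym (⟪⟫-+ r (\ b -> c Z.* Φ n b) (\ b -> ⟪ p , (\ a -> Φ a b) ⟫)))

 groupRing : CommutativeRing 0ℓ 0ℓ
 groupRing = record
  { Carrier = Elt ; _≈_ = _∼_ ; _+_ = _++_ ; _*_ = mulE ; -_ = negE ; 0# = [] ; 1# = (+ 1 , + 0) ∷ []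
  ; isCommutativeRing = record
   { isRing = record
     { +-isAbelianGroup = record
       { isGroup = record
         { isMonoid = record
           { isSemigroup = record
             { isMagma = record
               { isEquivalence = record
                { refl = mk∼ \ _ _ -> refl ; sym = \ h -> mk∼ \ φ t -> sym (test h φ t)
                ; trans = \ h k -> mk∼ \ φ t -> trans (test h φ t) (test k φ t) }
               ; ∙-cong = \ {p} {p'} {r} {r'} h k -> mk∼ \ φ t -> trans (⟪⟫-++ p r φ) (trans (cong₂ Z._+_ (test h φ t) (test k φ t)) (sym (⟪⟫-++ p' r' φ))) }
             ; assoc = \ p r s -> mk∼ \ φ t -> trans (⟪⟫-++ (p ++ r) s φ) (trans (cong (Z._+ ⟪ s , φ ⟫) (⟪⟫-++ p r φ)) (trans (ZP.+-assoc ⟪ p , φ ⟫ ⟪ r , φ ⟫ ⟪ s , φ ⟫) (sym (trans (⟪⟫-++ p (r ++ s) φ) (cong (\ z -> ⟪ p , φ ⟫ Z.+ z) (⟪⟫-++ r s φ)))))) }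
           ; identity = (\ p -> mk∼ \ φ t -> refl) , (\ p -> mk∼ \ φ t -> trans (⟪⟫-++ p [] φ) (ZP.+-identityʳ _)) }
         ; inverse = (\ p -> mk∼ \ φ t -> trans (⟪⟫-++ (negE p) p φ) (trans (cong (Z._+ ⟪ p , φ ⟫) (⟪⟫-neg p φ)) (ZP.+-inverseˡ ⟪ p , φ ⟫)))
                  , (\ p -> mk∼ \ φ t -> trans (⟪⟫-++ p (negE p) φ) (trans (cong (\ z -> ⟪ p , φ ⟫ Z.+ z) (⟪⟫-neg p φ)) (ZP.+-inverseʳ ⟪ p , φ ⟫)))
         ; ⁻¹-cong = \ {p} {p'} h -> mk∼ \ φ t -> trans (⟪⟫-neg p φ) (trans (cong Z.-_ (test h φ t)) (sym (⟪⟫-neg p' φ))) }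
       ; comm = \ p r -> mk∼ \ φ t -> trans (⟪⟫-++ p r φ) (trans (ZP.+-comm ⟪ p , φ ⟫ ⟪ r , φ ⟫) (sym (⟪⟫-++ r p φ))) }
     ; *-cong = \ {p} {p'} {r} {r'} h k -> mk∼ \ φ t -> trans (mul-congʳ p r r' k φ t) (trans (mul-comm p r' φ) (trans (mul-congʳ r' p p' h φ t) (mul-comm r' p' φ)))
     ; *-assoc = \ p r s -> mk∼ \ φ t -> mul-assoc p r s φ
     ; *-identity = (\ p -> mk∼ \ φ t -> mul-1 p φ)
                 , (\ p -> mk∼ \ φ t -> trans (mul-comm p ((+ 1 , + 0) ∷ []) φ) (mul-1 p φ))
     ; distrib = (\ p r s -> mk∼ \ φ t -> trans (mul-comm p (r ++ s) φ) (trans (mul-distribʳ p r s φ) (trans (⟪⟫-++ (mulE r p) (mulE s p) φ) (trans (cong₂ Z._+_ (mul-comm r p φ) (mul-comm s p φ)) (sym (⟪⟫-++ (mulE p r) (mulE p s) φ))))))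
               , (\ p r s -> mk∼ \ φ t -> mul-distribʳ p r s φ)
     }
   ; *-comm = \ p r -> mk∼ \ φ t -> mul-comm p r φ
   }
  }
  where
  mul-comm : ∀ p r φ -> ⟪ mulE p r , φ ⟫ ≡ ⟪ mulE r p , φ ⟫
  mul-comm p r φ = trans (⟪⟫-mul p r φ) (trans (⟪⟫-swap p r (\ a b -> φ (a Z.+ b)))
   (trans (⟪⟫-cong r (\ b -> ⟪⟫-cong p (\ a -> cong φ (ZP.+-comm a b)))) (sym (⟪⟫-mul r p φ))))
  mul-congʳ : ∀ p r r' -> r ∼ r' -> ∀ φ -> T φ -> ⟪ mulE p r , φ ⟫ ≡ ⟪ mulE p r' , φ ⟫
  mul-congʳ p r r' k φ t = trans (⟪⟫-mul p r φ) (trans (⟪⟫-cong p (\ a -> test k (\ b -> φ (a Z.+ b)) (T-shift φ t a))) (sym (⟪⟫-mul p r' φ)))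
  mul-assoc : ∀ p r s φ -> ⟪ mulE (mulE p r) s , φ ⟫ ≡ ⟪ mulE p (mulE r s) , φ ⟫
  mul-assoc p r s φ = trans (⟪⟫-mul (mulE p r) s φ) (trans (⟪⟫-mul p r _) (trans
   (⟪⟫-cong p (\ a -> trans (⟪⟫-cong r (\ b -> ⟪⟫-cong s (\ c -> cong φ (ZP.+-assoc a b c)))) (sym (⟪⟫-mul r s (\ m -> φ (a Z.+ m))))))
   (sym (⟪⟫-mul p (mulE r s) φ))))
  mul-1 : ∀ p φ -> ⟪ mulE ((+ 1 , + 0) ∷ []) p , φ ⟫ ≡ ⟪ p , φ ⟫
  mul-1 p φ = trans (⟪⟫-mul ((+ 1 , + 0) ∷ []) p φ) (trans (ZP.+-identityʳ _) (trans (ZP.*-identityˡ _) (⟪⟫-cong p (\ b -> cong φ (ZP.+-identityˡ b)))))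
  mul-distribʳ : ∀ p r s φ -> ⟪ mulE (r ++ s) p , φ ⟫ ≡ ⟪ mulE r p ++ mulE s p , φ ⟫
  mul-distribʳ p r s φ = trans (⟪⟫-mul (r ++ s) p φ) (trans (⟪⟫-++ r s _) (trans (cong₂ Z._+_ (sym (⟪⟫-mul r p φ)) (sym (⟪⟫-mul s p φ))) (sym (⟪⟫-++ (mulE r p) (mulE s p) φ))))

module PSℤ = PowerSeries ℤring

-- Series over a group ring, tested coefficientwise
module Moments (T : (ℤ -> ℤ) -> Set) (T-shift : ∀ φ -> T φ -> ∀ m -> T (\ n -> φ (m Z.+ n))) where

 open GroupRing T T-shift public
 module PSL = PowerSeries groupRing
 open PSℤ hiding (at)
 open PSL using (at)

 moment : (ℤ -> ℤ) -> PSL.Ser -> Ser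
 moment φ F n = ⟪ F n , φ ⟫

 moment-cong : ∀ φ {F G} -> T φ -> F PSL.~ G -> moment φ F ~ moment φ G
 moment-cong φ t h = mk \ n -> test (at h n) φ t

 moment-ext : ∀ {φ ψ} F -> (∀ n -> φ n ≡ ψ n) -> moment φ F ~ moment ψ F
 moment-ext F h = mk \ n -> ⟪⟫-cong (F n) h

 moment-+ : ∀ φ F G -> moment φ (F PSL.+ G) ~ moment φ F + moment φ G
 moment-+ φ F G = mk \ n -> trans (cong (\ p -> ⟪ p , φ ⟫) (PSL.+-at F G n)) (trans (⟪⟫-++ (F n) (G n) φ) (sym (+-at (moment φ F) (moment φ G) n)))

 moment-φ+ : ∀ φ ψ F -> moment (\ n -> φ n Z.+ ψ n) F ~ moment φ F + moment ψ F
 moment-φ+ φ ψ F = mk \ n -> trans (⟪⟫-+ (F n) φ ψ) (sym (+-at (moment φ F) (moment ψ F) n))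

 moment-φ* : ∀ c φ F -> moment (\ n -> c Z.* φ n) F ~ ι c * moment φ F
 moment-φ* c φ F = mk \ n -> trans (⟪⟫-*ˡ (F n) c φ) (sym (trans (ι-*ˢ c (moment φ F) n) (cong (Z._* moment φ F n) (ι-ℤ c))))

 moment2 : (ℤ -> ℤ -> ℤ) -> PSL.Ser -> PSL.Ser -> Ser
 moment2 Φ F G zero = ⟪ F 0 , G 0 , Φ ⟫2
 moment2 Φ F G (suc n) = ⟪ F 0 , G (suc n) , Φ ⟫2 Z.+ moment2 Φ (F ∘ suc) G n

 moment-* : ∀ φ F G n -> moment φ (F PSL.* G) n ≡ moment2 (\ a b -> φ (a Z.+ b)) F G n
 moment-* φ F G zero = ⟪⟫-mul (F 0) (G 0) φ
 moment-* φ F G (suc n) = trans (⟪⟫-++ (mulE (F 0) (G (suc n))) _ φ) (cong₂ Z._+_ (⟪⟫-mul (F 0) (G (suc n)) φ) (moment-* φ (F ∘ suc) G n))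

 moment2-cong : ∀ {Φ Ψ} -> (∀ a b -> Φ a b ≡ Ψ a b) -> ∀ F G n -> moment2 Φ F G n ≡ moment2 Ψ F G n
 moment2-cong h F G zero = ⟪⟫-cong (F 0) (\ a -> ⟪⟫-cong (G 0) (h a))
 moment2-cong h F G (suc n) = cong₂ Z._+_ (⟪⟫-cong (F 0) (\ a -> ⟪⟫-cong (G (suc n)) (h a))) (moment2-cong h (F ∘ suc) G n)

 moment2-sep : ∀ α β F G n -> moment2 (\ a b -> α a Z.* β b) F G n ≡ (moment α F * moment β G) n
 moment2-sep α β F G n = go F n where
  pt : ∀ p r -> ⟪ p , r , (\ a b -> α a Z.* β b) ⟫2 ≡ ⟪ p , α ⟫ Z.* ⟪ r , β ⟫
  pt p r = trans (⟪⟫-cong p (\ a -> trans (⟪⟫-*ˡ r (α a) β) (ZP.*-comm (α a) ⟪ r , β ⟫))) (trans (⟪⟫-*ˡ p ⟪ r , β ⟫ α) (ZP.*-comm ⟪ r , β ⟫ ⟪ p , α ⟫))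
  go : ∀ F n -> moment2 (\ a b -> α a Z.* β b) F G n ≡ (moment α F * moment β G) n
  go F zero = pt (F 0) (G 0)
  go F (suc n) = cong₂ Z._+_ (pt (F 0) (G (suc n))) (go (F ∘ suc) n)

 -- A multiplicative `φ` is an evaluation of the variable of the group ring; for `σ` it is the
 -- evaluation at z = -1.
 moment-mult : ∀ φ -> (∀ a b -> φ (a Z.+ b) ≡ φ a Z.* φ b) -> ∀ F G -> moment φ (F PSL.* G) ~ moment φ F * moment φ G
 moment-mult φ h F G = mk \ n -> trans (moment-* φ F G n) (trans (moment2-cong h F G n) (moment2-sep φ φ F G n))

-- Sums over ℤ of functions of finite support

ind : ∀ {P : Set} -> Dec P -> ℤ
ind (yes _) = + 1
ind (no _) = + 0

ind-yes : ∀ {P : Set} (p? : Dec P) -> P -> ind p? ≡ + 1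
ind-yes (yes _) p = refl
ind-yes (no ¬p) p = ⊥-elim (¬p p)

ind-no : ∀ {P : Set} (p? : Dec P) -> ¬ P -> ind p? ≡ + 0
ind-no (yes p) ¬p = ⊥-elim (¬p p)
ind-no (no _) ¬p = refl

ind-iff : ∀ {P Q : Set} (p? : Dec P) (q? : Dec Q) -> (P -> Q) -> (Q -> P) -> ind p? ≡ ind q?
ind-iff (yes p) q? f g = sym (ind-yes q? (f p))
ind-iff (no ¬p) q? f g = sym (ind-no q? (¬p ∘ g))

δ : ℤ -> ℤ -> ℤ
δ m n = ind (n ZP.≟ m)

Zsum : ℕ -> (ℤ -> ℤ) -> ℤ
Zsum zero f = f (+ 0)
Zsum (suc B) f = Zsum B f Z.+ (f (+ suc B) Z.+ f -[1+ B ])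

Zsum-cong : ∀ B {f g} -> (∀ m -> f m ≡ g m) -> Zsum B f ≡ Zsum B g
Zsum-cong zero h = h (+ 0)
Zsum-cong (suc B) h = cong₂ Z._+_ (Zsum-cong B h) (cong₂ Z._+_ (h (+ suc B)) (h -[1+ B ]))

Zsum-zero : ∀ B -> Zsum B (\ _ -> + 0) ≡ + 0
Zsum-zero zero = refl
Zsum-zero (suc B) = cong (Z._+ (+ 0)) (Zsum-zero B)

Zsum-+ : ∀ B f g -> Zsum B (\ m -> f m Z.+ g m) ≡ Zsum B f Z.+ Zsum B g
Zsum-+ zero f g = refl
Zsum-+ (suc B) f g = trans (cong₂ Z._+_ (Zsum-+ B f g) (ℤR.+-swap (f (+ suc B)) (g (+ suc B)) (f -[1+ B ]) (g -[1+ B ])))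
 (ℤR.+-swap (Zsum B f) (Zsum B g) (f (+ suc B) Z.+ f -[1+ B ]) (g (+ suc B) Z.+ g -[1+ B ]))

Zsum-* : ∀ B c f -> Zsum B (\ m -> c Z.* f m) ≡ c Z.* Zsum B f
Zsum-* zero c f = refl
Zsum-* (suc B) c f = trans (cong₂ Z._+_ (Zsum-* B c f) (sym (ZP.*-distribˡ-+ c (f (+ suc B)) (f -[1+ B ]))))
 (sym (ZP.*-distribˡ-+ c (Zsum B f) (f (+ suc B) Z.+ f -[1+ B ])))

Zsum-reflect : ∀ B f -> Zsum B (\ m -> f (Z.- m)) ≡ Zsum B f
Zsum-reflect zero f = refl
Zsum-reflect (suc B) f = cong₂ Z._+_ (Zsum-reflect B f) (ZP.+-comm (f -[1+ B ]) (f (+ suc B)))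

Supp : ℕ -> (ℤ -> ℤ) -> Set
Supp B f = ∀ m -> B N.< Z.∣ m ∣ -> f m ≡ + 0

Zsum-extend : ∀ k {B f} -> Supp B f -> Zsum (k N.+ B) f ≡ Zsum B f
Zsum-extend zero h = refl
Zsum-extend (suc k) {B} {f} h = trans (cong₂ Z._+_ (Zsum-extend k {B} {f} h)
 (cong₂ Z._+_ (h (+ suc (k N.+ B)) (s≤s (NP.m≤n+m B k))) (h -[1+ k N.+ B ] (s≤s (NP.m≤n+m B k))))) (ZP.+-identityʳ _)

Zsum-mono : ∀ {B B' f} -> B N.≤ B' -> Supp B f -> Zsum B' f ≡ Zsum B f
Zsum-mono {B} {B'} {f} l h = trans (cong (\ k -> Zsum k f) (sym (NP.m∸n+n≡m l))) (Zsum-extend (B' ∸ B) {B} {f} h)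

Zsum-agree : ∀ {B B' f} -> Supp B f -> Supp B' f -> Zsum B f ≡ Zsum B' f
Zsum-agree {B} {B'} {f} h h' with NP.≤-total B B'
... | inj₁ l = sym (Zsum-mono {f = f} l h)
... | inj₂ l = Zsum-mono {f = f} l h'

Zsum-supp0 : ∀ B f -> (∀ m -> Z.∣ m ∣ N.≤ B -> f m ≡ + 0) -> Zsum B f ≡ + 0
Zsum-supp0 zero f h = h (+ 0) z≤n
Zsum-supp0 (suc B) f h = cong₂ Z._+_ (Zsum-supp0 B f (\ m l -> h m (NP.m≤n⇒m≤1+n l))) (cong₂ Z._+_ (h (+ suc B) NP.≤-refl) (h -[1+ B ] NP.≤-refl))

private
 Zsum-step : ∀ B f -> Zsum B (\ m -> f (+ 1 Z.+ m)) Z.+ f (Z.- (+ B)) ≡ Zsum B f Z.+ f (+ suc B)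
 Zsum-step zero f = ZP.+-comm (f (+ 1)) (f (+ 0))
 Zsum-step (suc B) f = trans (cong (\ y -> Zsum B (\ m -> f (+ 1 Z.+ m)) Z.+ (f (+ 2+ B) Z.+ y) Z.+ f -[1+ B ]) (cong f (neg B)))
  (trans (r1 (Zsum B (\ m -> f (+ 1 Z.+ m))) (f (+ 2+ B)) (f (Z.- (+ B))) (f -[1+ B ])) (trans (cong (\ y -> y Z.+ (f (+ 2+ B) Z.+ f -[1+ B ])) (Zsum-step B f)) (r2 (Zsum B f) (f (+ suc B)) (f (+ 2+ B)) (f -[1+ B ]))))
  where
  neg : ∀ B -> + 1 Z.+ -[1+ B ] ≡ Z.- (+ B)
  neg zero = refl
  neg (suc B) = refl
  r1 : ∀ s a b c -> s Z.+ (a Z.+ b) Z.+ c ≡ (s Z.+ b) Z.+ (a Z.+ c)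
  r1 = solve-∀
  r2 : ∀ s a b c -> (s Z.+ a) Z.+ (b Z.+ c) ≡ s Z.+ (a Z.+ c) Z.+ b
  r2 = solve-∀

Zsum-suc : ∀ {B f} -> Supp B f -> Zsum (suc B) (\ m -> f (+ 1 Z.+ m)) ≡ Zsum B f
Zsum-suc {B} {f} h = trans (sym (ZP.+-identityʳ _)) (trans (cong (\ y -> Zsum (suc B) (\ m -> f (+ 1 Z.+ m)) Z.+ y) (sym (h -[1+ B ] NP.≤-refl)))
 (trans (Zsum-step (suc B) f) (trans (cong (\ y -> Zsum (suc B) f Z.+ y) (h (+ 2+ B) (s≤s (NP.n≤1+n B)))) (trans (ZP.+-identityʳ _) (Zsum-extend 1 {B} {f} h)))))

private
 ∣+∣-lower : ∀ m n -> Z.∣ n ∣ N.≤ Z.∣ m Z.+ n ∣ N.+ Z.∣ m ∣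
 ∣+∣-lower m n = subst (N._≤ Z.∣ m Z.+ n ∣ N.+ Z.∣ m ∣) (cong Z.∣_∣ (lem m n)) (ZP.∣i-j∣≤∣i∣+∣j∣ (m Z.+ n) m)
  where
  lem : ∀ m n -> (m Z.+ n) Z.- m ≡ n
  lem = solve-∀

Supp-shift : ∀ {B f} m -> Supp B f -> Supp (B N.+ Z.∣ m ∣) (\ n -> f (m Z.+ n))
Supp-shift {B} {f} m h n l = h (m Z.+ n) (NP.+-cancelʳ-< Z.∣ m ∣ B Z.∣ m Z.+ n ∣ (NP.<-≤-trans l (∣+∣-lower m n)))

Zsum-shift : ∀ {B f} m -> Supp B f -> Zsum (B N.+ Z.∣ m ∣) (\ n -> f (m Z.+ n)) ≡ Zsum B f
Zsum-shift {B} {f} (+ k) h = pos k where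
 pos : ∀ k -> Zsum (B N.+ k) (\ n -> f (+ k Z.+ n)) ≡ Zsum B f
 pos zero = trans (cong (\ j -> Zsum j (\ n -> f (+ 0 Z.+ n))) (NP.+-identityʳ B)) (Zsum-cong B (\ n -> cong f (ZP.+-identityˡ n)))
 pos (suc k) = trans (cong (\ j -> Zsum j (\ n -> f (+ suc k Z.+ n))) (NP.+-suc B k)) (trans (Zsum-cong (suc (B N.+ k)) (\ n -> cong f (trans (cong (Z._+ n) (ZP.+-comm (+ 1) (+ k))) (ZP.+-assoc (+ k) (+ 1) n))))
  (trans (Zsum-suc {B N.+ k} {\ n -> f (+ k Z.+ n)} (Supp-shift (+ k) h)) (pos k)))
Zsum-shift {B} {f} -[1+ k ] h = sym (trans (sym (Zsum-mono {f = f} (NP.≤-trans (NP.m≤m+n B (suc k)) (NP.m≤m+n (B N.+ suc k) (suc k))) h))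
 (trans (Zsum-cong (B N.+ suc k N.+ suc k) (\ n -> cong f (sym (lem n)))) (Zsum-shift {B N.+ suc k} {\ n -> f (-[1+ k ] Z.+ n)} (+ suc k) (Supp-shift -[1+ k ] h))))
 where
 lem : ∀ n -> -[1+ k ] Z.+ (+ suc k Z.+ n) ≡ n
 lem n = trans (sym (ZP.+-assoc -[1+ k ] (+ suc k) n)) (trans (cong (Z._+ n) (ZP.+-inverseˡ (+ suc k))) (ZP.+-identityˡ n))

Zsum-δ : ∀ B a (φ : ℤ -> ℤ) -> Z.∣ a ∣ N.≤ B -> Zsum B (\ m -> φ m Z.* δ m a) ≡ φ a
Zsum-δ zero (+ zero) φ l = ZP.*-identityʳ _
Zsum-δ (suc B) a φ l with Z.∣ a ∣ NP.≤? B
... | yes l' = trans (cong₂ Z._+_ (Zsum-δ B a φ l') (cong₂ Z._+_ (z (+ suc B) NP.≤-refl) (z -[1+ B ] NP.≤-refl))) (ZP.+-identityʳ _)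
 where
 z : ∀ m -> B N.< Z.∣ m ∣ -> φ m Z.* δ m a ≡ + 0
 z m b = trans (cong (φ m Z.*_) (ind-no (a ZP.≟ m) \ { refl -> NP.<-irrefl refl (NP.<-≤-trans b l') })) (ZP.*-zeroʳ (φ m))
... | no ¬l = go a (NP.≤-antisym l (NP.≰⇒> ¬l))
 where
 low : ∀ a -> Z.∣ a ∣ ≡ suc B -> Zsum B (\ m -> φ m Z.* δ m a) ≡ + 0
 low a e = Zsum-supp0 B _ \ m b -> trans (cong (φ m Z.*_) (ind-no (a ZP.≟ m) \ { refl -> NP.<-irrefl refl (subst (N._≤ B) e b) })) (ZP.*-zeroʳ (φ m))
 go : ∀ a -> Z.∣ a ∣ ≡ suc B -> Zsum (suc B) (\ m -> φ m Z.* δ m a) ≡ φ a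
 go (+ suc B) refl = trans (cong₂ Z._+_ (low (+ suc B) refl) (cong₂ Z._+_ (trans (cong (φ (+ suc B) Z.*_) (ind-yes (+ suc B ZP.≟ + suc B) refl)) (ZP.*-identityʳ (φ (+ suc B)))) (ZP.*-zeroʳ (φ -[1+ B ])))) (trans (ZP.+-identityˡ (φ (+ suc B) Z.+ + 0)) (ZP.+-identityʳ (φ (+ suc B))))
 go -[1+ B ] refl = trans (cong₂ Z._+_ (low -[1+ B ] refl) (cong₂ Z._+_ (ZP.*-zeroʳ (φ (+ suc B))) (trans (cong (φ -[1+ B ] Z.*_) (ind-yes (-[1+ B ] ZP.≟ -[1+ B ]) refl)) (ZP.*-identityʳ (φ -[1+ B ]))))) (trans (ZP.+-identityˡ (+ 0 Z.+ φ -[1+ B ])) (ZP.+-identityˡ (φ -[1+ B ])))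

module Laurent = Moments (\ _ -> ⊤) (\ _ _ _ -> tt)

module _ where
 open Laurent

 bound : Elt -> ℕ
 bound [] = 0
 bound ((c , n) ∷ p) = Z.∣ n ∣ N.⊔ bound p

 expand : ∀ p B φ -> bound p N.≤ B -> ⟪ p , φ ⟫ ≡ Zsum B (\ m -> φ m Z.* ⟪ p , δ m ⟫)
 expand [] B φ l = sym (trans (Zsum-cong B (\ m -> ZP.*-zeroʳ (φ m))) (Zsum-zero B))
 expand ((c , n) ∷ p) B φ l = sym (trans (Zsum-cong B (\ m -> lem (φ m) c (δ m n) ⟪ p , δ m ⟫))
  (trans (Zsum-+ B (\ m -> c Z.* (φ m Z.* δ m n)) _) (cong₂ Z._+_ (trans (Zsum-* B c (\ m -> φ m Z.* δ m n)) (cong (c Z.*_) (Zsum-δ B n φ (NP.≤-trans (NP.m≤m⊔n _ _) l))))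
   (sym (expand p B φ (NP.≤-trans (NP.m≤n⊔m Z.∣ n ∣ _) l))))))
  where
  lem : ∀ f c d r -> f Z.* (c Z.* d Z.+ r) ≡ c Z.* (f Z.* d) Z.+ f Z.* r
  lem = solve-∀

 coef-supp : ∀ p -> Supp (bound p) (\ m -> ⟪ p , δ m ⟫)
 coef-supp [] m l = refl
 coef-supp ((c , n) ∷ p) m l = trans (cong₂ Z._+_ (trans (cong (c Z.*_) (ind-no (n ZP.≟ m) \ { refl -> NP.<-irrefl refl (NP.≤-<-trans (NP.m≤m⊔n Z.∣ n ∣ _) l) })) (ZP.*-zeroʳ c))
  (coef-supp p m (NP.≤-<-trans (NP.m≤n⊔m Z.∣ n ∣ _) l))) refl

 -- A test functional only depends on the coefficients.
 expand' : ∀ p B φ -> Supp B (\ m -> ⟪ p , δ m ⟫) -> ⟪ p , φ ⟫ ≡ Zsum B (\ m -> φ m Z.* ⟪ p , δ m ⟫)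
 expand' p B φ h = trans (expand p (bound p) φ NP.≤-refl)
  (Zsum-agree {f = \ m -> φ m Z.* ⟪ p , δ m ⟫} (\ m l -> trans (cong (φ m Z.*_) (coef-supp p m l)) (ZP.*-zeroʳ (φ m)))
             (\ m l -> trans (cong (φ m Z.*_) (h m l)) (ZP.*-zeroʳ (φ m))))

-- The Jacobi triple product

tri : ℕ -> ℕ
tri zero = 0
tri (suc n) = suc n N.+ tri n

-- The triangular exponent m(m + 1)/2 as a natural number; the symmetry m ↦ -1 - m is why both
-- clauses give `tri n`.
T : ℤ -> ℕ
T (+ n) = tri n
T -[1+ n ] = tri n

T-suc : ∀ m -> + T (m Z.+ + 1) ≡ + T m Z.+ (m Z.+ + 1)
T-suc (+ n) = trans (cong (\ k -> + tri k) (NP.+-comm n 1)) (trans (lem (+ n) (+ tri n)) refl)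
 where
 lem : ∀ n t -> (+ 1 Z.+ n) Z.+ t ≡ t Z.+ (n Z.+ + 1)
 lem = solve-∀
T-suc -[1+ zero ] = refl
T-suc -[1+ suc n ] = lem (+ n) (+ tri n)
 where
 lem : ∀ n t -> t ≡ ((+ 1 Z.+ n) Z.+ t) Z.+ Z.- (+ 1 Z.+ n)
 lem = solve-∀

T-reflect : ∀ m -> T (Z.- + 1 Z.- m) ≡ T m
T-reflect (+ zero) = refl
T-reflect (+ suc n) = refl
T-reflect -[1+ n ] = refl

module L = Laurent.PSL
open PSℤ

coef : ℤ -> L.Ser -> Ser
coef m = Laurent.moment (δ m)

zL : ℤ -> L.Ser
zL k = L.constˢ ((+ 1 , k) ∷ [])

moment-z : ∀ φ k F -> Laurent.moment φ (zL k L.* F) ~ Laurent.moment (\ n -> φ (k Z.+ n)) F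
moment-z φ k F = mk \ n -> trans (Laurent.test (L.const-* ((+ 1 , k) ∷ []) F n) φ tt)
 (trans (Laurent.⟪⟫-mul ((+ 1 , k) ∷ []) (F n) φ) (trans (ZP.+-identityʳ _) (ZP.*-identityˡ _)))

δ-shift : ∀ m k n -> δ m (k Z.+ n) ≡ δ (m Z.- k) n
δ-shift m k n = ind-iff (k Z.+ n ZP.≟ m) (n ZP.≟ m Z.- k)
 (\ { refl -> l1 k n }) (\ { refl -> l2 k m })
 where
 l1 : ∀ k n -> n ≡ k Z.+ n Z.- k
 l1 = solve-∀
 l2 : ∀ k m -> k Z.+ (m Z.- k) ≡ m
 l2 = solve-∀

coef-z : ∀ m k F -> coef m (zL k L.* F) ~ coef (m Z.- k) F
coef-z m k F = tr (moment-z (δ m) k F) (Laurent.moment-ext F (δ-shift m k))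

moment-q : ∀ φ F -> Laurent.moment φ (L.q L.* F) ~ q * Laurent.moment φ F
moment-q φ F = mk \ { zero -> trans (Laurent.test (L.q*-zero F) φ tt) (sym (q*-zero (Laurent.moment φ F)))
                ; (suc n) -> trans (Laurent.test (L.q*-suc F n) φ tt) (sym (q*-suc (Laurent.moment φ F) n)) }

moment-q^ : ∀ φ k F -> Laurent.moment φ (L.q L.^ k L.* F) ~ q ^ k * Laurent.moment φ F
moment-q^ φ zero F = tr (Laurent.moment-cong φ tt (L.*-identityˡ F)) (sy (*-identityˡ (Laurent.moment φ F)))
moment-q^ φ (suc k) F = tr (Laurent.moment-cong φ tt (L.*-assoc L.q (L.q L.^ k) F))
 (tr (moment-q φ (L.q L.^ k L.* F)) (tr (*ˡ (moment-q^ φ k F)) (sy (*-assoc q (q ^ k) (Laurent.moment φ F)))))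

factor : ℤ -> ℕ -> L.Ser
factor k j = L.1# L.+ L.q L.^ j L.* zL k

coef-factor : ∀ m k j F -> coef m (F L.* factor k j) ~ coef m F + q ^ j * coef (m Z.- k) F
coef-factor m k j F = tr (Laurent.moment-cong (δ m) tt (L.tr (L.distribˡ F L.1# (L.q L.^ j L.* zL k)) (L.+-cong (L.*-identityʳ F)
  (L.tr (L.*-comm F _) (L.*-assoc (L.q L.^ j) (zL k) F)))))
 (tr (Laurent.moment-+ (δ m) F (L.q L.^ j L.* (zL k L.* F)))
 (+ˡ (tr (moment-q^ (δ m) j (zL k L.* F)) (*ˡ (coef-z m k F)))))

factor-unital : ∀ k -> L.Unital (factor k)
factor-unital k j i l = A.tr (A.reflexive (L.+-at L.1# (L.q L.^ j L.* zL k) i)) (A.tr (A.+ˡ {L.1# i} (L.q^-low j (zL k) i l)) (A.+-identityʳ (L.1# i)))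
 where module A = RingTheory Laurent.groupRing

oneMinus : ℕ -> Ser
oneMinus j = 1# - q ^ j

oneMinus-unital : Unital oneMinus
oneMinus-unital j i l = trans (+-at 1# (- q ^ j) i) (trans (cong (\ x -> 1# i Z.+ x) (neg-at (q ^ j) i)) (trans (cong (\ x -> 1# i Z.- x) (trans (sym (at (*-identityʳ (q ^ j)) i)) (q^-low j 1# i l))) (ZP.+-identityʳ _)))

qfac : ℕ -> Ser
qfac k = prod k oneMinus

π : Ser
π = prod∞ oneMinus

-- The unpaired factor 1 + z⁻¹ of the bottom row: `pre` times `half` is the product of (1 + z qⁿ)(1
-- + z⁻¹ qⁿ⁻¹) over n ≥ 1.
pre : L.Ser
pre = L.1# L.+ zL (Z.- + 1)

q^-+ : ∀ m n -> q ^ (m N.+ n) ~ q ^ m * q ^ n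
q^-+ zero n = sy (*-identityˡ _)
q^-+ (suc m) n = tr (*ˡ (q^-+ m n)) (sy (*-assoc q (q ^ m) (q ^ n)))

private
 U : ℕ -> ℕ -> L.Ser
 U a b = pre L.* (L.prod a (factor (+ 1)) L.* L.prod b (factor (Z.- + 1)))

 U-a : ∀ a b -> U (suc a) b L.~ U a b L.* factor (+ 1) (suc a)
 U-a a b = L.solve (v0 :* (v1 :* v3 :* v2)) (v0 :* (v1 :* v2) :* v3) refl
  (pre ∷ L.prod a (factor (+ 1)) ∷ L.prod b (factor (Z.- + 1)) ∷ factor (+ 1) (suc a) ∷ [])

 U-b : ∀ a b -> U a (suc b) L.~ U a b L.* factor (Z.- + 1) (suc b)
 U-b a b = L.solve (v0 :* (v1 :* (v2 :* v3))) (v0 :* (v1 :* v2) :* v3) refl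
  (pre ∷ L.prod a (factor (+ 1)) ∷ L.prod b (factor (Z.- + 1)) ∷ factor (Z.- + 1) (suc b) ∷ [])

 coef-a : ∀ a b m -> coef m (U (suc a) b) ~ coef m (U a b) + q ^ suc a * coef (m Z.- + 1) (U a b)
 coef-a a b m = tr (Laurent.moment-cong (δ m) tt (U-a a b)) (coef-factor m (+ 1) (suc a) (U a b))

 coef-b : ∀ a b m -> coef m (U a (suc b)) ~ coef m (U a b) + q ^ suc b * coef (m Z.+ + 1) (U a b)
 coef-b a b m = tr (Laurent.moment-cong (δ m) tt (U-b a b)) (coef-factor m (Z.- + 1) (suc b) (U a b))

 0+*0 : ∀ {x y c} -> x ~ 0# -> y ~ 0# -> x + c * y ~ 0#
 0+*0 {c = c} h k = tr (+-cong h (tr (*ˡ k) (zeroʳ c))) (+-identityʳ 0#)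

 coef-00 : ∀ m -> coef m (U 0 0) ~ constˢ (δ m (+ 0)) + constˢ (δ m (Z.- + 1))
 coef-00 m = tr (Laurent.moment-cong (δ m) tt (L.tr (L.*ˡ {pre} (L.*-identityˡ L.1#)) (L.*-identityʳ pre)))
  (mk \ n -> trans (cong (\ p -> Laurent.⟪ p , δ m ⟫) (L.+-at L.1# (zL (Z.- + 1)) n)) (trans (go n) (sym (+-at (constˢ (δ m (+ 0))) (constˢ (δ m (Z.- + 1))) n))))
  where
  lem : ∀ a b -> + 1 Z.* a Z.+ (+ 1 Z.* b Z.+ + 0) ≡ a Z.+ b
  lem = solve-∀
  go : ∀ n -> Laurent.⟪ L.1# n ++ zL (Z.- + 1) n , δ m ⟫ ≡ constˢ (δ m (+ 0)) n Z.+ constˢ (δ m (Z.- + 1)) n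
  go zero = lem (δ m (+ 0)) (δ m (Z.- + 1))
  go (suc n) = refl

 out⁺ : ∀ a b k m -> m ≡ + suc (a N.+ k) -> coef m (U a b) ~ 0#
 out⁺ zero zero k m refl = tr (coef-00 m) (tr (+-cong (mk \ { zero -> refl ; (suc n) -> refl }) (mk \ { zero -> refl ; (suc n) -> refl })) (+-identityʳ 0#))
 out⁺ zero (suc b) k m refl = tr (coef-b 0 b m) (0+*0 {c = q ^ suc b} (out⁺ 0 b k m refl) (out⁺ 0 b (suc k) _ (cong +_ (NP.+-comm (suc k) 1))))
 out⁺ (suc a) b k m refl = tr (coef-a a b m) (0+*0 {c = q ^ suc a} (out⁺ a b (suc k) m (cong (\ n -> + suc n) (sym (NP.+-suc a k)))) (out⁺ a b k _ refl))

 out⁻ : ∀ a b k m -> m ≡ -[1+ suc (b N.+ k) ] -> coef m (U a b) ~ 0#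
 out⁻ zero zero k m refl = tr (coef-00 m) (tr (+-cong (mk \ { zero -> refl ; (suc n) -> refl }) (mk \ { zero -> refl ; (suc n) -> refl })) (+-identityʳ 0#))
 out⁻ zero (suc b) k m refl = tr (coef-b 0 b m) (0+*0 {c = q ^ suc b} (out⁻ 0 b (suc k) m (cong (\ n -> -[1+ suc n ]) (sym (NP.+-suc b k)))) (out⁻ 0 b k _ refl))
 out⁻ (suc a) b k m refl = tr (coef-a a b m) (0+*0 {c = q ^ suc a} (out⁻ a b k m refl) (out⁻ a b (suc k) _ (cong -[1+_] (trans (cong (\ n -> 2+ n) (NP.+-identityʳ (b N.+ k))) (cong suc (sym (NP.+-suc b k)))))))

 q^-eq : ∀ a b c d -> + a Z.+ + b ≡ + c Z.+ + d -> q ^ a * q ^ b ~ q ^ c * q ^ d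
 q^-eq a b c d h = tr (sy (q^-+ a b)) (tr (reflexive (cong (q ^_) (ZP.+-injective h))) (q^-+ c d))

 -- The q-binomial theorem cleared of denominators: the a + b + 1 factors of `U a b` have as
 -- coefficients `q ^ T m` times the Gaussian binomials of i + j over i.
 Gauss : ℕ -> ℕ -> Set
 Gauss a b = ∀ i j m -> i N.+ j ≡ suc (a N.+ b) -> m ≡ + i Z.- + suc b ->
           coef m (U a b) * (qfac i * qfac j) ~ q ^ T m * qfac (i N.+ j)

 -- The two terms of Pascal's rule for Gaussian binomials
 grow : ∀ {c Ai Aj P G} w -> c * (Ai * Aj) ~ P * G -> c * (Ai * (Aj * w)) ~ P * (G * w)
 grow {c} {Ai} {Aj} {P} {G} w h = tr (solve (v0 :* (v1 :* (v2 :* v3))) (v0 :* (v1 :* v2) :* v3) refl (c ∷ Ai ∷ Aj ∷ w ∷ []))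
  (tr (*ʳ h) (*-assoc P G w))

 growˡ : ∀ {c Ai Aj P G} w -> c * (Ai * Aj) ~ P * G -> c * ((Ai * w) * Aj) ~ P * (G * w)
 growˡ {c} {Ai} {Aj} {P} {G} w h = tr (solve (v0 :* ((v1 :* v3) :* v2)) (v0 :* (v1 :* v2) :* v3) refl (c ∷ Ai ∷ Aj ∷ w ∷ []))
  (tr (*ʳ h) (*-assoc P G w))

 -- Pascal's rule: (1 - y) + y (1 - z) = 1 - y z, after the last hypothesis has turned the power of
 -- q in front of the second term into y.
 combine : ∀ {c c1 c2 x y z P P2 S G} -> c ~ c1 + x * c2 -> c1 * S ~ P * (G * (1# - y)) -> c2 * S ~ P2 * (G * (1# - z)) ->
         x * P2 ~ P * y -> c * S ~ P * (G * (1# - y * z))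
 combine {c} {c1} {c2} {x} {y} {z} {P} {P2} {S} {G} h h1 h2 hp = begin
  c * S ≈⟨ *ʳ h ⟩
  (c1 + x * c2) * S ≈⟨ solve ((v0 :+ v1 :* v2) :* v3) (v0 :* v3 :+ v1 :* (v2 :* v3)) refl (c1 ∷ x ∷ c2 ∷ S ∷ []) ⟩
  c1 * S + x * (c2 * S) ≈⟨ +-cong h1 (*ˡ h2) ⟩
  P * (G * (1# - y)) + x * (P2 * (G * (1# - z)))
   ≈⟨ solve (v0 :* (v1 :* (v2 :- v3)) :+ v4 :* (v5 :* (v1 :* (v2 :- v6)))) (v0 :* (v1 :* (v2 :- v3)) :+ (v4 :* v5) :* (v1 :* (v2 :- v6))) refl (P ∷ G ∷ 1# ∷ y ∷ x ∷ P2 ∷ z ∷ []) ⟩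
  P * (G * (1# - y)) + (x * P2) * (G * (1# - z)) ≈⟨ +ˡ (*ʳ hp) ⟩
  P * (G * (1# - y)) + (P * y) * (G * (1# - z)) ≈⟨ +-cong (*ˡ (*ˡ (+ʳ ι-1))) (*ˡ (*ˡ (+ʳ ι-1))) ⟨
  P * (G * (ι (+ 1) - y)) + (P * y) * (G * (ι (+ 1) - z))
   ≈⟨ solve (v0 :* (v1 :* (# 1 :- v3)) :+ (v0 :* v3) :* (v1 :* (# 1 :- v2))) (v0 :* (v1 :* (# 1 :- v3 :* v2))) refl (P ∷ G ∷ z ∷ y ∷ []) ⟩
  P * (G * (ι (+ 1) - y * z)) ≈⟨ *ˡ (*ˡ (+ʳ ι-1)) ⟩
  P * (G * (1# - y * z)) ∎

 drop2 : ∀ {c c1 c2 x} -> c ~ c1 + x * c2 -> c2 ~ 0# -> c ~ c1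
 drop2 {c1 = c1} {x = x} h h0 = tr h (tr (+ˡ (tr (*ˡ h0) (zeroʳ x))) (+-identityʳ c1))

 drop1 : ∀ {c c1 c2 x} -> c ~ c1 + x * c2 -> c1 ~ 0# -> c ~ x * c2
 drop1 {c2 = c2} {x = x} h h0 = tr h (tr (+ʳ h0) (+-identityˡ (x * c2)))

 absorb : ∀ {c c2 x P P2 S G} -> c ~ x * c2 -> c2 * S ~ P2 * G -> x * P2 ~ P -> c * S ~ P * G
 absorb {c} {c2} {x} {P} {P2} {S} {G} h h2 hp = tr (*ʳ h) (tr (*-assoc x c2 S) (tr (*ˡ h2) (tr (sy (*-assoc x P2 G)) (*ʳ hp))))

 oneMinus-prod : ∀ i j -> 1# - q ^ j * q ^ i ~ oneMinus (i N.+ j)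
 oneMinus-prod i j = +ˡ (-‿cong (tr (sy (q^-+ j i)) (reflexive (cong (q ^_) (NP.+-comm j i)))))

 finish : ∀ {P} i j k -> suc k ≡ i N.+ j -> P * (qfac k * (1# - q ^ j * q ^ i)) ~ P * qfac (i N.+ j)
 finish {P} i j k e = *ˡ {P} (tr (*ˡ {qfac k} (tr (oneMinus-prod i j) (reflexive (cong oneMinus (sym e))))) (reflexive (cong qfac e)))

 -- At i = 0 or j = 0 one of the two terms has an exponent outside the support of `U a b`, and
 -- Pascal's rule degenerates to a single term.
 gauss-a : ∀ a b -> Gauss a b -> Gauss (suc a) b
 gauss-a a b ih zero (suc j) m e em =
  tr (*ʳ (drop2 {x = q ^ suc a} (coef-a a b m) (out⁻ a b 0 _ (trans (cong (Z._- + 1) em) (trans (lem (+ b)) (cong (\ n -> -[1+ suc n ]) (sym (NP.+-identityʳ b))))))))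
   (grow {coef m (U a b)} {qfac 0} {qfac j} {q ^ T m} {qfac j} (oneMinus (suc j)) (ih 0 j m (NP.suc-injective e) em))
  where
  lem : ∀ b -> (+ 0 Z.- (+ 1 Z.+ b)) Z.- + 1 ≡ Z.- (+ 1 Z.+ (+ 1 Z.+ b))
  lem = solve-∀
 gauss-a a b ih (suc i) zero m e em =
  absorb {x = q ^ suc a} {P = q ^ T m} {P2 = q ^ T (m Z.- + 1)} (drop1 {x = q ^ suc a} (coef-a a b m) (out⁺ a b 0 m (trans em (trans (cong (Z._- + suc b) (cong +_ e')) (trans (lem (+ a) (+ b)) (cong (\ n -> + suc n) (sym (NP.+-identityʳ a))))))))
   (tr (growˡ {coef (m Z.- + 1) (U a b)} {qfac i} {qfac 0} {q ^ T (m Z.- + 1)} {qfac (i N.+ 0)} (oneMinus (suc i)) (ih i 0 (m Z.- + 1) (NP.suc-injective e) (trans (cong (Z._- + 1) em) (lem2 (+ i) (+ b)))))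
     (*ˡ (*ˡ {qfac (i N.+ 0)} (reflexive (cong (oneMinus ∘ suc) (sym (NP.+-identityʳ i)))))))
   (tr (q^-eq (suc a) (T (m Z.- + 1)) (T m) 0 expo) (*-identityʳ _))
  where
  e' : suc i ≡ suc (suc (a N.+ b))
  e' = trans (sym (NP.+-identityʳ (suc i))) e
  lem : ∀ a b -> (+ 1 Z.+ (+ 1 Z.+ (a Z.+ b))) Z.- (+ 1 Z.+ b) ≡ + 1 Z.+ a
  lem = solve-∀
  lem2 : ∀ i b -> ((+ 1 Z.+ i) Z.- (+ 1 Z.+ b)) Z.- + 1 ≡ i Z.- (+ 1 Z.+ b)
  lem2 = solve-∀
  expo : + suc a Z.+ + T (m Z.- + 1) ≡ + T m Z.+ + 0
  expo = exponent (+ suc a) (+ 0) m (trans em (trans (cong (Z._- + suc b) (cong +_ e')) (lem3 (+ a) (+ b))))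
   where
   lem3 : ∀ a b -> (+ 1 Z.+ (+ 1 Z.+ (a Z.+ b))) Z.- (+ 1 Z.+ b) ≡ (+ 1 Z.+ a) Z.- + 0
   lem3 = solve-∀
   exponent : ∀ x y m -> m ≡ x Z.- y -> x Z.+ + T (m Z.- + 1) ≡ + T m Z.+ y
   exponent x y m refl = sym (trans (cong (\ z -> + T z Z.+ y) (r1 (x Z.- y))) (trans (cong (Z._+ y) (T-suc (x Z.- y Z.- + 1))) (r2 x y (+ T (x Z.- y Z.- + 1)))))
     where
     r1 : ∀ z -> z ≡ z Z.- + 1 Z.+ + 1
     r1 = solve-∀
     r2 : ∀ x y t -> t Z.+ (x Z.- y Z.- + 1 Z.+ + 1) Z.+ y ≡ x Z.+ t
     r2 = solve-∀
 gauss-a a b ih (suc i) (suc j) m e em = tr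
  (combine {x = q ^ suc a} {y = q ^ suc j} {z = q ^ suc i} {P = q ^ T m} {P2 = q ^ T (m Z.- + 1)} {S = qfac (suc i) * qfac (suc j)} {G = qfac (suc i N.+ j)} (coef-a a b m)
   (grow {coef m (U a b)} {qfac (suc i)} {qfac j} {q ^ T m} {qfac (suc i N.+ j)} (oneMinus (suc j)) (ih (suc i) j m e1 em))
   (tr (growˡ {coef (m Z.- + 1) (U a b)} {qfac i} {qfac (suc j)} {q ^ T (m Z.- + 1)} {qfac (i N.+ suc j)} (oneMinus (suc i)) (ih i (suc j) (m Z.- + 1) (NP.suc-injective e) (trans (cong (Z._- + 1) em) (lem2 (+ i) (+ b)))))
     (*ˡ (*ʳ {oneMinus (suc i)} (reflexive (cong qfac (NP.+-suc i j))))))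
   (q^-eq (suc a) (T (m Z.- + 1)) (T m) (suc j) expo))
  (finish {q ^ T m} (suc i) (suc j) (suc i N.+ j) (cong suc (sym (NP.+-suc i j))))
  where
  e1 : suc i N.+ j ≡ suc (a N.+ b)
  e1 = trans (sym (NP.+-suc i j)) (NP.suc-injective e)
  lem2 : ∀ i b -> ((+ 1 Z.+ i) Z.- (+ 1 Z.+ b)) Z.- + 1 ≡ i Z.- (+ 1 Z.+ b)
  lem2 = solve-∀
  expo : + suc a Z.+ + T (m Z.- + 1) ≡ + T m Z.+ + suc j
  expo = sym (trans (cong (\ z -> + T z Z.+ + suc j) (r1 m)) (trans (cong (Z._+ + suc j) (T-suc (m Z.- + 1))) (trans (r2 m (+ T (m Z.- + 1)) (+ suc j)) (cong (Z._+ + T (m Z.- + 1)) (trans (cong (Z._+ + suc j) em) (trans (r3 (+ suc i) (+ suc j) (+ b)) (trans (cong (\ n -> + n Z.- (+ 1 Z.+ + b)) e) (r4 (+ a) (+ b)))))))))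
   where
   r1 : ∀ z -> z ≡ z Z.- + 1 Z.+ + 1
   r1 = solve-∀
   r2 : ∀ m t j -> t Z.+ (m Z.- + 1 Z.+ + 1) Z.+ j ≡ (m Z.+ j) Z.+ t
   r2 = solve-∀
   r3 : ∀ i j b -> (i Z.- (+ 1 Z.+ b)) Z.+ j ≡ (i Z.+ j) Z.- (+ 1 Z.+ b)
   r3 = solve-∀
   r4 : ∀ a b -> (+ 1 Z.+ ((+ 1 Z.+ a) Z.+ b)) Z.- (+ 1 Z.+ b) ≡ + 1 Z.+ a
   r4 = solve-∀

 gauss-b : ∀ a b -> Gauss a b -> Gauss a (suc b)
 gauss-b a b ih i j m e em = go i j e em where
  e1 : ∀ {n} -> suc n ≡ suc (a N.+ suc b) -> n ≡ suc (a N.+ b)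
  e1 h = trans (NP.suc-injective h) (NP.+-suc a b)
  r1 : ∀ i b -> (+ 1 Z.+ i) Z.- (+ 1 Z.+ (+ 1 Z.+ b)) ≡ i Z.- (+ 1 Z.+ b)
  r1 = solve-∀
  r2 : ∀ i b -> i Z.- (+ 1 Z.+ (+ 1 Z.+ b)) Z.+ + 1 ≡ i Z.- (+ 1 Z.+ b)
  r2 = solve-∀
  expo : ∀ i -> m ≡ + i Z.- + 2+ b -> + suc b Z.+ + T (m Z.+ + 1) ≡ + T m Z.+ + i
  expo i refl = trans (cong (\ z -> + suc b Z.+ z) (T-suc m)) (lem (+ b) (+ i) (+ T m))
   where
   lem : ∀ b i t -> (+ 1 Z.+ b) Z.+ (t Z.+ (i Z.- (+ 1 Z.+ (+ 1 Z.+ b)) Z.+ + 1)) ≡ t Z.+ i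
   lem = solve-∀
  go : ∀ i j -> i N.+ j ≡ suc (a N.+ suc b) -> m ≡ + i Z.- + 2+ b -> coef m (U a (suc b)) * (qfac i * qfac j) ~ q ^ T m * qfac (i N.+ j)
  go zero (suc j) e em = absorb {x = q ^ suc b} {P = q ^ T m} {P2 = q ^ T (m Z.+ + 1)}
   (drop1 {x = q ^ suc b} (coef-b a b m) (out⁻ a b 0 m (trans em (cong (\ n -> -[1+ suc n ]) (sym (NP.+-identityʳ b))))))
   (grow {coef (m Z.+ + 1) (U a b)} {qfac 0} {qfac j} {q ^ T (m Z.+ + 1)} {qfac j} (oneMinus (suc j)) (ih 0 j (m Z.+ + 1) (e1 e) (trans (cong (Z._+ + 1) em) (r2 (+ 0) (+ b)))))
   (tr (q^-eq (suc b) (T (m Z.+ + 1)) (T m) 0 (expo 0 em)) (*-identityʳ _))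
  go (suc i) zero e em = tr (*ʳ (drop2 {x = q ^ suc b} (coef-b a b m)
     (out⁺ a b 0 _ (trans (cong (Z._+ + 1) em) (trans (cong (\ n -> + suc n Z.- + 2+ b Z.+ + 1) (trans (sym (NP.+-identityʳ i)) (e1 e)))
        (trans (lem (+ a) (+ b)) (cong (\ n -> + suc n) (sym (NP.+-identityʳ a)))))))))
   (tr (growˡ {coef m (U a b)} {qfac i} {qfac 0} {q ^ T m} {qfac (i N.+ 0)} (oneMinus (suc i)) (ih i 0 m (e1 e) (trans em (r1 (+ i) (+ b)))))
     (*ˡ (*ˡ {qfac (i N.+ 0)} (reflexive (cong (oneMinus ∘ suc) (sym (NP.+-identityʳ i)))))))
   where
   lem : ∀ a b -> (+ 1 Z.+ (+ 1 Z.+ (a Z.+ b))) Z.- (+ 1 Z.+ (+ 1 Z.+ b)) Z.+ + 1 ≡ + 1 Z.+ a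
   lem = solve-∀
  go (suc i) (suc j) e em = tr
   (combine {x = q ^ suc b} {y = q ^ suc i} {z = q ^ suc j} {P = q ^ T m} {P2 = q ^ T (m Z.+ + 1)} {S = qfac (suc i) * qfac (suc j)} {G = qfac (suc i N.+ j)} (coef-b a b m)
     (tr (growˡ {coef m (U a b)} {qfac i} {qfac (suc j)} {q ^ T m} {qfac (i N.+ suc j)} (oneMinus (suc i)) (ih i (suc j) m (e1 e) (trans em (r1 (+ i) (+ b)))))
       (*ˡ (*ʳ {oneMinus (suc i)} (reflexive (cong qfac (NP.+-suc i j))))))
     (grow {coef (m Z.+ + 1) (U a b)} {qfac (suc i)} {qfac j} {q ^ T (m Z.+ + 1)} {qfac (suc i N.+ j)} (oneMinus (suc j))
       (ih (suc i) j (m Z.+ + 1) (trans (sym (NP.+-suc i j)) (e1 e)) (trans (cong (Z._+ + 1) em) (r2 (+ suc i) (+ b)))))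
     (q^-eq (suc b) (T (m Z.+ + 1)) (T m) (suc i) (expo (suc i) em)))
   (tr (*ˡ {q ^ T m} (*ˡ {qfac (suc i N.+ j)} (+ˡ (-‿cong (*-comm (q ^ suc i) (q ^ suc j))))))
     (finish {q ^ T m} (suc i) (suc j) (suc i N.+ j) (cong suc (sym (NP.+-suc i j)))))

 gauss-00 : Gauss 0 0
 gauss-00 zero (suc zero) m e refl = *-cong (tr (coef-00 m) (mk \ n -> trans (+-at (constˢ (+ 0)) (constˢ (+ 1)) n) (f n))) (*-identityˡ (qfac 1))
  where
  f : ∀ n -> constˢ (+ 0) n Z.+ constˢ (+ 1) n ≡ 1# n
  f zero = refl
  f (suc n) = refl
 gauss-00 (suc zero) zero m e refl = *-cong (tr (coef-00 m) (mk \ n -> trans (+-at (constˢ (+ 1)) (constˢ (+ 0)) n) (f n))) (*-identityʳ (qfac 1))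
  where
  f : ∀ n -> constˢ (+ 1) n Z.+ constˢ (+ 0) n ≡ 1# n
  f zero = refl
  f (suc n) = refl

 gauss : ∀ a b -> Gauss a b
 gauss zero zero = gauss-00
 gauss zero (suc b) = gauss-b 0 b (gauss 0 b)
 gauss (suc a) b = gauss-a a b (gauss a b)

-- ∏ (1 + z q^n) (1 + z⁻¹ q^n) over n ≥ 1
half : L.Ser
half = L.prod∞ (factor (+ 1)) L.* L.prod∞ (factor (Z.- + 1))

regular-1 : ∀ {f} -> f 0 ≡ + 1 -> Regular f
regular-1 {f} h = regular-head f \ a e -> trans (sym (trans (cong (Z._* a) h) (ZP.*-identityˡ a))) e

regular-nz : ∀ {f} -> ¬ f 0 ≡ + 0 -> Regular f
regular-nz {f} h = regular-head f \ a e -> case ZP.i*j≡0⇒i≡0∨j≡0 (f 0) e of \ { (inj₁ z) -> ⊥-elim (h z) ; (inj₂ z) -> z }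

regular-π : Regular π
regular-π = regular-1 refl

private
 limit : ∀ a b i j m n -> i N.+ j ≡ suc (a N.+ b) -> m ≡ + i Z.- + suc b -> n N.≤ a -> n N.≤ b -> n N.≤ i -> n N.≤ j ->
       (coef m (pre L.* half) * (π * π)) n ≡ (q ^ T m * π) n
 limit a b i j m n e em la lb li lj = trans (sym (*-cong[] n U≈ (*-cong[] n (qfac≈ i li) (qfac≈ j lj)) n NP.≤-refl))
  (trans (at (gauss a b i j m e em) n) (*-cong[] {q ^ T m} n (\ _ _ -> refl) (qfac≈ (i N.+ j) (NP.≤-trans li (NP.m≤m+n i j))) n NP.≤-refl))
  where
  qfac≈ : ∀ i -> n N.≤ i -> qfac i ≈[ n ] π
  qfac≈ i l k k≤ = prod-approx oneMinus oneMinus-unital i k (NP.≤-trans k≤ l)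
  U≈ : coef m (U a b) ≈[ n ] coef m (pre L.* half)
  U≈ k k≤ = Laurent.test (L.*-cong[] {pre} {pre} n (\ _ _ -> Laurent.mk∼ (\ _ _ -> refl))
   (L.*-cong[] {L.prod a (factor (+ 1))} {L.prod∞ (factor (+ 1))} {L.prod b (factor (Z.- + 1))} {L.prod∞ (factor (Z.- + 1))} n
     (\ k' l -> L.prod-approx (factor (+ 1)) (factor-unital (+ 1)) a k' (NP.≤-trans l la))
     (\ k' l -> L.prod-approx (factor (Z.- + 1)) (factor-unital (Z.- + 1)) b k' (NP.≤-trans l lb))) k k≤) (δ m) tt

-- In degree n it suffices to take both a and b at least n in `gauss`; the three finite products
-- then agree with `π` up to that degree, and one factor `π` is cancelled.
jacobi : ∀ m -> coef m (pre L.* half) * π ~ q ^ T m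
jacobi m = regular-cancel {π} regular-π (tr (solve (v0 :* (v1 :* v0)) (v1 :* (v0 :* v0)) refl (π ∷ coef m (pre L.* half) ∷ []))
 (tr (mk (go m)) (*-comm (q ^ T m) π)))
 where
 go : ∀ m n -> (coef m (pre L.* half) * (π * π)) n ≡ (q ^ T m * π) n
 go (+ k) n = limit (k N.+ n) n (k N.+ suc n) n (+ k) n (cong (N._+ n) (NP.+-suc k n)) (lem (+ k) (+ n)) (NP.m≤n+m n k) NP.≤-refl (NP.≤-trans (NP.n≤1+n n) (NP.m≤n+m (suc n) k)) NP.≤-refl
  where
  lem : ∀ k n -> k ≡ (k Z.+ (+ 1 Z.+ n)) Z.- (+ 1 Z.+ n)
  lem = solve-∀
 go -[1+ k ] n = limit n (n N.+ k) n (n N.+ suc k) -[1+ k ] n (trans (cong (n N.+_) (NP.+-suc n k)) (NP.+-suc n (n N.+ k))) (lem (+ k) (+ n)) NP.≤-refl (NP.m≤m+n n k) NP.≤-refl (NP.m≤m+n n (suc k))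
  where
  lem : ∀ k n -> Z.- (+ 1 Z.+ k) ≡ n Z.- (+ 1 Z.+ (n Z.+ k))
  lem = solve-∀

-- Powers of the theta function: quasi-periodicity and moments

lift : Ser -> L.Ser
lift f n = (f n , + 0) ∷ []

moment-lift : ∀ φ f F -> Laurent.moment φ (lift f L.* F) ~ f * Laurent.moment φ F
moment-lift φ f F = mk \ n -> trans (Laurent.moment-* φ (lift f) F n) (go f n)
 where
 term0 : ∀ c p -> Laurent.⟪ (c , + 0) ∷ [] , p , (\ a b -> φ (a Z.+ b)) ⟫2 ≡ c Z.* Laurent.⟪ p , φ ⟫
 term0 c p = trans (ZP.+-identityʳ _) (cong (c Z.*_) (Laurent.⟪⟫-cong p (\ b -> cong φ (ZP.+-identityˡ b))))
 go : ∀ f n -> Laurent.moment2 (\ a b -> φ (a Z.+ b)) (lift f) F n ≡ (f * Laurent.moment φ F) n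
 go f zero = term0 (f 0) (F 0)
 go f (suc n) = cong₂ Z._+_ (term0 (f 0) (F (suc n))) (go (f ∘ suc) n)

moment-lift^ : ∀ φ f k F -> Laurent.moment φ (lift f L.^ k L.* F) ~ f ^ k * Laurent.moment φ F
moment-lift^ φ f zero F = tr (Laurent.moment-cong φ tt (L.*-identityˡ F)) (sy (*-identityˡ (Laurent.moment φ F)))
moment-lift^ φ f (suc k) F = tr (Laurent.moment-cong φ tt (L.*-assoc (lift f) (lift f L.^ k) F))
 (tr (moment-lift φ f (lift f L.^ k L.* F)) (tr (*ˡ (moment-lift^ φ f k F)) (sy (*-assoc f (f ^ k) (Laurent.moment φ F)))))

-- The sum of z^m q^(m(m + 1)/2) over all integers m; the factor `π` clears the denominator of the
-- triple product.
ϑ : L.Ser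
ϑ = lift π L.* (pre L.* half)

coef-ϑ : ∀ m -> coef m ϑ ~ q ^ T m
coef-ϑ m = tr (moment-lift (δ m) π (pre L.* half)) (tr (*-comm π _) (jacobi m))

-- Admits negative degrees, with coefficient zero, so that the shift N ↦ N + m + k of `quasi` holds
-- without side conditions.
extend : Ser -> ℤ -> ℤ
extend f (+ n) = f n
extend f -[1+ n ] = + 0

extend-q^ : ∀ k f n -> (q ^ k * f) n ≡ extend f (+ n Z.- + k)
extend-q^ k f n with NP.≤-total k n
... | inj₁ l = trans (cong (q ^ k * f) (sym e)) (trans (q^-shift k f (n ∸ k)) (cong (extend f) (trans (lem (+ k) (+ (n ∸ k))) (cong (\ j -> + j Z.- + k) e))))
 where
 e : k N.+ (n ∸ k) ≡ n
 e = NP.m+[n∸m]≡n l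
 lem : ∀ k r -> r ≡ (k Z.+ r) Z.- k
 lem = solve-∀
... | inj₂ l with k ∸ n in eq
... | zero = trans (cong (\ j -> (q ^ k * f) j) (trans (sym (NP.+-identityʳ n)) (trans (cong (n N.+_) (sym eq)) (trans (NP.m+[n∸m]≡n l) (sym (NP.+-identityʳ k))))))
               (trans (q^-shift k f 0) (cong (extend f) (sym (trans (cong (\ j -> + n Z.- + j) (trans (sym (NP.m+[n∸m]≡n l)) (cong (n N.+_) eq))) (lem (+ n))))))
 where
 lem : ∀ n -> n Z.- (n Z.+ + 0) ≡ + 0
 lem = solve-∀
... | suc r = trans (q^-low k f n (subst (n N.<_) (sym e) (NP.m<m+n n (s≤s z≤n)))) (cong (extend f) (sym (trans (cong (\ j -> + n Z.- + j) e) (lem (+ n) (+ r)))))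
 where
 e : k ≡ n N.+ suc r
 e = trans (sym (NP.m+[n∸m]≡n l)) (cong (n N.+_) eq)
 lem : ∀ n r -> n Z.- (n Z.+ (+ 1 Z.+ r)) ≡ Z.- (+ 1 Z.+ r)
 lem = solve-∀

extend-below : ∀ f n t -> n N.< t -> extend f (+ n Z.- + t) ≡ + 0
extend-below f n t l = trans (sym (extend-q^ t f n)) (q^-low t f n l)

n≤tri : ∀ n -> n N.≤ tri n
n≤tri zero = z≤n
n≤tri (suc n) = NP.m≤m+n (suc n) (tri n)

T-large : ∀ a {B} -> suc B N.< Z.∣ a ∣ -> B N.< T a
T-large (+ n) l = NP.≤-trans (NP.≤-trans (NP.n≤1+n _) l) (n≤tri n)
T-large -[1+ n ] (s≤s l) = NP.≤-trans l (n≤tri n)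

extend-T : ∀ f N a -> suc Z.∣ N ∣ N.< Z.∣ a ∣ -> extend f (N Z.- + T a) ≡ + 0
extend-T f (+ n) a l = extend-below f n (T a) (T-large a l)
extend-T f -[1+ n ] a l with T a
... | zero = refl
... | suc t = refl

q^-supp : ∀ n -> Supp (suc n) (\ a -> (q ^ T a) n)
q^-supp n a l = trans (sym (at (*-identityʳ (q ^ T a)) n)) (q^-low (T a) 1# n (T-large a l))

private
 moment2-coef : ∀ Φ F Y B n -> (∀ i -> i N.≤ n -> Supp B (\ a -> Laurent.⟪ F i , δ a ⟫)) ->
              Laurent.moment2 Φ F Y n ≡ Zsum B (\ a -> (coef a F * Laurent.moment (Φ a) Y) n)
 moment2-coef Φ F Y B zero h = trans (expand' (F 0) B (\ a -> Laurent.⟪ Y 0 , Φ a ⟫) (h 0 z≤n))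
  (Zsum-cong B (\ a -> ZP.*-comm Laurent.⟪ Y 0 , Φ a ⟫ Laurent.⟪ F 0 , δ a ⟫))
 moment2-coef Φ F Y B (suc n) h = trans (cong₂ Z._+_
   (trans (expand' (F 0) B (\ a -> Laurent.⟪ Y (suc n) , Φ a ⟫) (h 0 z≤n)) (Zsum-cong B (\ a -> ZP.*-comm Laurent.⟪ Y (suc n) , Φ a ⟫ Laurent.⟪ F 0 , δ a ⟫)))
   (moment2-coef Φ (F ∘ suc) Y B n (\ i l -> h (suc i) (s≤s l))))
  (sym (Zsum-+ B (\ a -> coef a F 0 Z.* Laurent.moment (Φ a) Y (suc n)) (\ a -> conv (coef a F ∘ suc) (Laurent.moment (Φ a) Y) n)))

coef-ϑ* : ∀ m Y N B -> suc Z.∣ N ∣ N.≤ B -> extend (coef m (ϑ L.* Y)) N ≡ Zsum B (\ a -> extend (coef (m Z.- a) Y) (N Z.- + T a))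
coef-ϑ* m Y (+ n) B l = trans (Laurent.moment-* (δ m) ϑ Y n) (trans
 (moment2-coef (\ a b -> δ m (a Z.+ b)) ϑ Y B n (\ i i≤n a l' -> trans (at (coef-ϑ a) i) (q^-supp i a (NP.≤-<-trans (NP.≤-trans (s≤s i≤n) l) l'))))
 (Zsum-cong B (\ a -> trans (at (*-cong (coef-ϑ a) (Laurent.moment-ext Y (δ-shift m a))) n) (extend-q^ (T a) (coef (m Z.- a) Y) n))))
coef-ϑ* m Y -[1+ n ] B l = sym (trans (Zsum-cong B (\ a -> neg (T a) a)) (Zsum-zero B))
 where
 neg : ∀ t a -> extend (coef (m Z.- a) Y) (-[1+ n ] Z.- + t) ≡ + 0
 neg zero a = refl
 neg (suc t) a = refl

extend-≡ : ∀ {m m' N N'} Y -> m ≡ m' -> N ≡ N' -> extend (coef m Y) N ≡ extend (coef m' Y) N'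
extend-≡ Y refl refl = refl

-- Coefficient form of the fact that ϑ(qz) is a monomial times ϑ(z). In one factor the summation
-- index a is replaced by a + 1, and the induction treats the remaining k.
quasi : ∀ k m N -> extend (coef (m Z.+ + k) (ϑ L.^ k)) (N Z.+ m Z.+ + k) ≡ extend (coef m (ϑ L.^ k)) N
quasi zero m N with m ZP.≟ + 0
... | yes refl = cong (extend (coef (+ 0) L.1#)) (lem N)
 where
 lem : ∀ N -> N Z.+ + 0 Z.+ + 0 ≡ N
 lem = solve-∀
... | no m≢0 = trans (z (m Z.+ + 0) (\ e -> m≢0 (trans (sym (ZP.+-identityʳ m)) e)) (N Z.+ m Z.+ + 0)) (sym (z m m≢0 N))
 where
 z : ∀ m -> ¬ m ≡ + 0 -> ∀ N -> extend (coef m L.1#) N ≡ + 0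
 z m h (+ zero) = cong (\ x -> + 1 Z.* x Z.+ + 0) (ind-no (+ 0 ZP.≟ m) (h ∘ sym))
 z m h (+ suc n) = refl
 z m h -[1+ n ] = refl
quasi (suc k) m N = trans (coef-ϑ* (m Z.+ + suc k) Y N' B (s≤s (NP.m≤n+m Z.∣ N' ∣ Z.∣ N ∣)))
 (trans (sym (Zsum-suc {B} {f} supp)) (trans (Zsum-cong (suc B) step) (sym (coef-ϑ* m Y N (suc B) (NP.m≤n⇒m≤1+n (s≤s (NP.m≤m+n Z.∣ N ∣ Z.∣ N' ∣)))))))
 where
 Y = ϑ L.^ k
 N' = N Z.+ m Z.+ + suc k
 B = suc (Z.∣ N ∣ N.+ Z.∣ N' ∣)
 f : ℤ -> ℤ
 f a = extend (coef (m Z.+ + suc k Z.- a) Y) (N' Z.- + T a)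
 supp : Supp B f
 supp a l = extend-T (coef (m Z.+ + suc k Z.- a) Y) N' a (NP.≤-<-trans (s≤s (NP.m≤n+m Z.∣ N' ∣ Z.∣ N ∣)) l)
 l1 : ∀ m k a -> m Z.+ (+ 1 Z.+ k) Z.- (+ 1 Z.+ a) ≡ m Z.- a Z.+ k
 l1 = solve-∀
 l2 : ∀ N m k a t -> N Z.+ m Z.+ (+ 1 Z.+ k) Z.- (t Z.+ (a Z.+ + 1)) ≡ (N Z.- t) Z.+ (m Z.- a) Z.+ k
 l2 = solve-∀
 step : ∀ a -> f (+ 1 Z.+ a) ≡ extend (coef (m Z.- a) Y) (N Z.- + T a)
 step a = trans (extend-≡ Y (l1 m (+ k) a) (trans (cong (\ z -> N' Z.- z) (trans (cong (\ z -> + T z) (ZP.+-comm (+ 1) a)) (T-suc a))) (l2 N m (+ k) a (+ T a))))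
  (quasi k (m Z.- a) (N Z.- + T a))

-- Coefficient form of ϑ(z⁻¹) = z ϑ(z), which is `T-reflect`, taken once for each of the k factors.
symm : ∀ k m N -> extend (coef (Z.- + k Z.- m) (ϑ L.^ k)) N ≡ extend (coef m (ϑ L.^ k)) N
symm zero m (+ zero) = cong (\ x -> + 1 Z.* x Z.+ + 0) (ind-iff (+ 0 ZP.≟ + 0 Z.- m) (+ 0 ZP.≟ m)
 (\ e -> sym (trans (lem m) (cong Z.-_ (sym e)))) (\ { refl -> refl }))
 where
 lem : ∀ m -> m ≡ Z.- (+ 0 Z.- m)
 lem = solve-∀
symm zero m (+ suc n) = refl
symm zero m -[1+ n ] = refl
symm (suc k) m N = trans (coef-ϑ* (Z.- + suc k Z.- m) Y N B NP.≤-refl)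
 (trans (sym (Zsum-reflect B f)) (trans (sym (Zsum-suc {B} {\ a -> f (Z.- a)} supp)) (trans (Zsum-cong (suc B) step) (sym (coef-ϑ* m Y N (suc B) (NP.n≤1+n B))))))
 where
 Y = ϑ L.^ k
 B = suc Z.∣ N ∣
 f : ℤ -> ℤ
 f a = extend (coef (Z.- + suc k Z.- m Z.- a) Y) (N Z.- + T a)
 supp : Supp B (\ a -> f (Z.- a))
 supp a l = extend-T (coef (Z.- + suc k Z.- m Z.- Z.- a) Y) N (Z.- a) (subst (B N.<_) (sym (ZP.∣-i∣≡∣i∣ a)) l)
 l1 : ∀ m k a -> Z.- (+ 1 Z.+ k) Z.- m Z.- Z.- (+ 1 Z.+ a) ≡ Z.- k Z.- (m Z.- a)
 l1 = solve-∀
 l3 : ∀ a -> Z.- (+ 1 Z.+ a) ≡ Z.- + 1 Z.- a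
 l3 = solve-∀
 step : ∀ a -> f (Z.- (+ 1 Z.+ a)) ≡ extend (coef (m Z.- a) Y) (N Z.- + T a)
 step a = trans (extend-≡ Y (l1 m (+ k) a) (cong (\ t -> N Z.- + t) (trans (cong T (l3 a)) (T-reflect a)))) (symm k (m Z.- a) (N Z.- + T a))

-- The sign (-1)^m; on (-1)^m p(m) multiplication by 1 + z⁻¹ acts as the
-- backward difference of p.

private
 sg : ℕ -> ℤ
 sg zero = + 1
 sg (suc n) = Z.- sg n

σ : ℤ -> ℤ
σ (+ n) = sg n
σ -[1+ n ] = sg (suc n)

σ-suc : ∀ m -> σ (+ 1 Z.+ m) ≡ Z.- σ m
σ-suc (+ n) = refl
σ-suc -[1+ zero ] = refl
σ-suc -[1+ suc n ] = sym (trans (ZP.neg-involutive (Z.- sg n)) refl)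

σ-pred : ∀ m -> σ (-[1+ 0 ] Z.+ m) ≡ Z.- σ m
σ-pred m = trans (sym (ZP.neg-involutive _)) (cong Z.-_ (trans (sym (σ-suc (-[1+ 0 ] Z.+ m))) (cong σ (lem m))))
 where
 lem : ∀ m -> + 1 Z.+ (-[1+ 0 ] Z.+ m) ≡ m
 lem = solve-∀

σ-+ : ∀ a b -> σ (a Z.+ b) ≡ σ a Z.* σ b
σ-+ (+ zero) b = trans (cong σ (ZP.+-identityˡ b)) (sym (ZP.*-identityˡ (σ b)))
σ-+ (+ suc n) b = trans (cong σ (ZP.+-assoc (+ 1) (+ n) b)) (trans (σ-suc (+ n Z.+ b)) (trans (cong Z.-_ (σ-+ (+ n) b)) (ZP.neg-distribˡ-* (sg n) (σ b))))
σ-+ -[1+ zero ] b = trans (σ-pred b) (lem (σ b))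
 where
 lem : ∀ x -> Z.- x ≡ -[1+ 0 ] Z.* x
 lem = solve-∀
σ-+ -[1+ suc n ] b = trans (cong σ (ZP.+-assoc -[1+ 0 ] -[1+ n ] b)) (trans (σ-pred (-[1+ n ] Z.+ b)) (trans (cong Z.-_ (σ-+ -[1+ n ] b)) (ZP.neg-distribˡ-* (sg (suc n)) (σ b))))

signed : List ℤ -> ℤ -> ℤ
signed p m = σ m Z.* ℤR.horner p m

private
 ∇-step : List ℤ -> List ℤ -> List ℤ
 ∇-step p d = addP 1 (0 ,, d) (addP 1 p (negP 1 d))

-- Uses ∇(m p) = m ∇p + (p - ∇p), where p - ∇p is p shifted by one.
∇ : List ℤ -> List ℤ
∇ [] = []
∇ (c ∷ p) = ∇-step p (∇ p)

∇-horner : ∀ p m -> ℤR.horner (∇ p) m ≡ ℤR.horner p m Z.- ℤR.horner p (-[1+ 0 ] Z.+ m)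
∇-horner [] m = trans ℤR.ι-0 (sym (ZP.+-inverseʳ (ℤR.ι (+ 0))))
∇-horner (c ∷ p) m = trans (ℤR.horner-add (0 ,, ∇ p) (addP 1 p (negP 1 (∇ p))) m)
 (trans (cong₂ Z._+_ (cong₂ Z._+_ ℤR.ι-0 (cong (m Z.*_) (∇-horner p m))) (trans (ℤR.horner-add p (negP 1 (∇ p)) m) (cong (\ z -> ℤR.horner p m Z.+ z) (trans (ℤR.horner-neg (∇ p) m) (cong Z.-_ (∇-horner p m))))))
  (lem (ℤR.ι c) m (ℤR.horner p m) (ℤR.horner p (-[1+ 0 ] Z.+ m))))
 where
 lem : ∀ c m h k -> + 0 Z.+ m Z.* (h Z.- k) Z.+ (h Z.+ Z.- (h Z.- k)) ≡ c Z.+ m Z.* h Z.- (c Z.+ (-[1+ 0 ] Z.+ m) Z.* k)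
 lem = solve-∀

moment-pre : ∀ φ F -> Laurent.moment φ (pre L.* F) ~ Laurent.moment (\ n -> φ n Z.+ φ (-[1+ 0 ] Z.+ n)) F
moment-pre φ F = tr (Laurent.moment-cong φ tt (L.tr (L.distribʳ F L.1# (zL (Z.- + 1))) (L.+ʳ (L.*-identityˡ F))))
 (tr (Laurent.moment-+ φ F (zL (Z.- + 1) L.* F)) (tr (+ˡ (moment-z φ (Z.- + 1) F)) (sy (Laurent.moment-φ+ φ (\ n -> φ (-[1+ 0 ] Z.+ n)) F))))

∇^ : ℕ -> List ℤ -> List ℤ
∇^ zero p = p
∇^ (suc k) p = ∇^ k (∇ p)

moment-∇ : ∀ k p F -> Laurent.moment (signed p) (pre L.^ k L.* F) ~ Laurent.moment (signed (∇^ k p)) F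
moment-∇ zero p F = Laurent.moment-cong (signed p) tt (L.*-identityˡ F)
moment-∇ (suc k) p F = tr (Laurent.moment-cong (signed p) tt (L.*-assoc pre (pre L.^ k) F)) (tr (moment-pre (signed p) (pre L.^ k L.* F))
 (tr (Laurent.moment-ext (pre L.^ k L.* F) pt) (moment-∇ k (∇ p) F)))
 where
 lem : ∀ s h k -> s Z.* h Z.+ (Z.- s) Z.* k ≡ s Z.* (h Z.- k)
 lem = solve-∀
 pt : ∀ n -> signed p n Z.+ signed p (-[1+ 0 ] Z.+ n) ≡ signed (∇ p) n
 pt n = trans (cong (\ s -> signed p n Z.+ s Z.* ℤR.horner p (-[1+ 0 ] Z.+ n)) (σ-pred n)) (trans (lem (σ n) _ _) (cong (σ n Z.*_) (sym (∇-horner p n))))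

private
 σ-factor : ∀ k j -> σ k ≡ Z.- + 1 -> Laurent.moment σ (factor k j) ~ oneMinus j
 σ-factor k j h = tr (Laurent.moment-+ σ L.1# (L.q L.^ j L.* zL k)) (+-cong (mk \ { zero -> refl ; (suc n) -> refl })
  (tr (moment-q^ σ j (zL k)) (tr (*ˡ {q ^ j} (mk \ { zero -> trans (ZP.+-identityʳ _) (trans (ZP.*-identityˡ (σ k)) h) ; (suc n) -> refl }))
   (tr (*ˡ {q ^ j} neg1) (tr (sy (-‿distribʳ-* (q ^ j) 1#)) (-‿cong (*-identityʳ (q ^ j))))))))
  where
  neg1 : constˢ (Z.- + 1) ~ - 1#
  neg1 = mk \ { zero -> sym (neg-at 1# 0) ; (suc n) -> sym (neg-at 1# (suc n)) }

 σ-1 : Laurent.moment σ L.1# ~ 1#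
 σ-1 = mk \ { zero -> refl ; (suc n) -> refl }

 σ-prod : ∀ k -> σ k ≡ Z.- + 1 -> Laurent.moment σ (L.prod∞ (factor k)) ~ π
 σ-prod k h = mk \ n -> at (go n) n
  where
  go : ∀ n -> Laurent.moment σ (L.prod n (factor k)) ~ qfac n
  go zero = σ-1
  go (suc n) = tr (Laurent.moment-mult σ σ-+ (L.prod n (factor k)) (factor k (suc n))) (*-cong (go n) (σ-factor k (suc n) h))

 σ-half^ : ∀ k -> Laurent.moment σ (half L.^ k) ~ (π * π) ^ k
 σ-half^ zero = σ-1
 σ-half^ (suc k) = tr (Laurent.moment-mult σ σ-+ half (half L.^ k)) (*-cong
  (tr (Laurent.moment-mult σ σ-+ (L.prod∞ (factor (+ 1))) (L.prod∞ (factor (Z.- + 1)))) (*-cong (σ-prod (+ 1) refl) (σ-prod (Z.- + 1) refl))) (σ-half^ k))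

L-^-* : ∀ a b k -> (a L.* b) L.^ k L.~ a L.^ k L.* b L.^ k
L-^-* a b zero = L.sy (L.*-identityˡ L.1#)
L-^-* a b (suc k) = L.tr (L.*ˡ {a L.* b} (L-^-* a b k)) (L.solve (v0 :* v1 :* (v2 :* v3)) (v0 :* v2 :* (v1 :* v3)) refl (a ∷ b ∷ a L.^ k ∷ b L.^ k ∷ []))

ϑ^ : ∀ k -> ϑ L.^ k L.~ lift π L.^ k L.* (pre L.* half) L.^ k
ϑ^ = L-^-* (lift π) (pre L.* half)

-- Each factor 1 + z⁻¹ costs one difference. After k of them the weight is `c` times the bare sign,
-- so `half ^ k` is evaluated at z = -1, where `half` is `π * π`.
moment-ϑ^ : ∀ k p c -> (∀ m -> ℤR.horner (∇^ k p) m ≡ c) -> Laurent.moment (signed p) (ϑ L.^ k) ~ π ^ k * (ι c * (π * π) ^ k)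
moment-ϑ^ k p c h = tr (Laurent.moment-cong (signed p) tt (L.tr (ϑ^ k) (L.*ˡ (L-^-* pre half k))))
 (tr (moment-lift^ (signed p) π k (pre L.^ k L.* half L.^ k)) (*ˡ (tr (moment-∇ k p (half L.^ k))
 (tr (Laurent.moment-ext (half L.^ k) (\ n -> trans (cong (σ n Z.*_) (h n)) (ZP.*-comm (σ n) c))) (tr (Laurent.moment-φ* c σ (half L.^ k)) (*ˡ (σ-half^ k)))))))

-- Generating functions of the rows of Frobenius symbols

sumℤ-cong : ∀ n {f g} -> (∀ i -> i N.≤ n -> f i ≡ g i) -> sumℤ n f ≡ sumℤ n g
sumℤ-cong zero h = h 0 z≤n
sumℤ-cong (suc n) h = cong₂ Z._+_ (sumℤ-cong n (\ i l -> h i (NP.m≤n⇒m≤1+n l))) (h (suc n) NP.≤-refl)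

sumℤ-suc : ∀ n f -> sumℤ (suc n) f ≡ f 0 Z.+ sumℤ n (f ∘ suc)
sumℤ-suc zero f = refl
sumℤ-suc (suc n) f = trans (cong (Z._+ f (2+ n)) (sumℤ-suc n f)) (ZP.+-assoc (f 0) (sumℤ n (f ∘ suc)) (f (2+ n)))

conv-sum : ∀ f g n -> conv f g n ≡ (f ⊛ g) n
conv-sum f g zero = refl
conv-sum f g (suc n) = sym (trans (sumℤ-suc n (\ i -> f i Z.* g (suc n ∸ i))) (cong (\ z -> f 0 Z.* g (suc n) Z.+ z) (sym (conv-sum (f ∘ suc) g n))))

sumℕ-sumℤ : ∀ n f -> + sumℕ n f ≡ sumℤ n (\ i -> + f i)
sumℕ-sumℤ zero f = refl
sumℕ-sumℤ (suc n) f = cong (Z._+ + f (suc n)) (sumℕ-sumℤ n f)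

∑ : ℕ -> (ℕ -> Ser) -> Ser
∑ zero F = F 0
∑ (suc n) F = ∑ n F + F (suc n)

∑-cong : ∀ n {F G} -> (∀ i -> i N.≤ n -> F i ~ G i) -> ∑ n F ~ ∑ n G
∑-cong zero h = h 0 z≤n
∑-cong (suc n) h = +-cong (∑-cong n (\ i l -> h i (NP.m≤n⇒m≤1+n l))) (h (suc n) NP.≤-refl)

∑-suc : ∀ n F -> ∑ (suc n) F ~ F 0 + ∑ n (F ∘ suc)
∑-suc zero F = ≈-refl
∑-suc (suc n) F = tr (+ʳ (∑-suc n F)) (+-assoc (F 0) (∑ n (F ∘ suc)) (F (2+ n)))

∑-+ : ∀ n F G -> ∑ n (\ i -> F i + G i) ~ ∑ n F + ∑ n G
∑-+ zero F G = ≈-refl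
∑-+ (suc n) F G = tr (+ʳ (∑-+ n F G)) (+-swap (∑ n F) (∑ n G) (F (suc n)) (G (suc n)))

∑-*ˡ : ∀ n f G -> ∑ n (\ i -> f * G i) ~ f * ∑ n G
∑-*ˡ zero f G = ≈-refl
∑-*ˡ (suc n) f G = tr (+ʳ (∑-*ˡ n f G)) (sy (distribˡ f (∑ n G) (G (suc n))))

∑-at : ∀ n F k -> ∑ n F k ≡ sumℤ n (\ i -> F i k)
∑-at zero F k = refl
∑-at (suc n) F k = trans (+-at (∑ n F) (F (suc n)) k) (cong (Z._+ F (suc n) k) (∑-at n F k))

sumℤ-tail : ∀ k n f -> (∀ i -> n N.< i -> f i ≡ + 0) -> sumℤ (k N.+ n) f ≡ sumℤ n f
sumℤ-tail zero n f h = refl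
sumℤ-tail (suc k) n f h = trans (cong₂ Z._+_ (sumℤ-tail k n f h) (h (suc (k N.+ n)) (s≤s (NP.m≤n+m n k)))) (ZP.+-identityʳ _)

module Rows (k : ℕ) where

 row : List (Colored k) -> ℕ -> Ser
 row xs d s = + subCount xs d s

 row-suc : ∀ x xs d -> row (x ∷ xs) (suc d) ~ row xs (suc d) + q ^ value x * row xs d
 row-suc x xs d = mk \ s -> trans (go s) (sym (trans (+-at (row xs (suc d)) (q ^ value x * row xs d) s) refl))
  where
  go : ∀ s -> row (x ∷ xs) (suc d) s ≡ row xs (suc d) s Z.+ (q ^ value x * row xs d) s
  go s with value x NP.≤? s
  ... | yes l = cong (\ z -> row xs (suc d) s Z.+ z) (sym (trans (cong (q ^ value x * row xs d) (sym (NP.m+[n∸m]≡n l))) (q^-shift (value x) (row xs d) (s ∸ value x))))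
  ... | no ¬l = sym (trans (cong (\ z -> row xs (suc d) s Z.+ z) (q^-low (value x) (row xs d) s (NP.≰⇒> ¬l))) (ZP.+-identityʳ _))

 row-long : ∀ xs d -> length xs N.< d -> row xs d ~ 0#
 row-long [] (suc d) l = mk \ _ -> refl
 row-long (x ∷ xs) (suc d) (s≤s l) = tr (row-suc x xs d) (tr (+-cong (row-long xs (suc d) (NP.m≤n⇒m≤1+n l)) (tr (*ˡ (row-long xs d l)) (zeroʳ _))) (+-identityʳ 0#))

 -- The product of the factors 1 + z^ζ q^(value x + o)
 gen : ℤ -> ℕ -> List (Colored k) -> L.Ser
 gen ζ o [] = L.1#
 gen ζ o (x ∷ xs) = gen ζ o xs L.* factor ζ (o N.+ value x)

 -- One factor per candidate: choosing its second term puts `x` into the row. A choice of d entries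
 -- contributes their value sum, the offset d·o and the exponent d·ζ of z.
 coef-gen : ∀ ζ o xs m F -> coef m (gen ζ o xs L.* F) ~ ∑ (length xs) (\ d -> row xs d * (q ^ (d N.* o) * coef (m Z.- + d Z.* ζ) F))
 coef-gen ζ o [] m F = tr (Laurent.moment-cong (δ m) tt (L.*-identityˡ F)) (sy (tr (*-cong row0 (tr (*-identityˡ _) (reflexive (cong (\ j -> coef j F) (ZP.+-identityʳ m))))) (*-identityˡ (coef m F))))
  where
  row0 : row [] 0 ~ 1#
  row0 = mk \ { zero -> refl ; (suc s) -> refl }
 coef-gen ζ o (x ∷ xs) m F = begin
  coef m (gen ζ o xs L.* factor ζ (o N.+ value x) L.* F)
   ≈⟨ Laurent.moment-cong (δ m) tt (L.solve (v0 :* v1 :* v2) (v0 :* v2 :* v1) refl (gen ζ o xs ∷ factor ζ (o N.+ value x) ∷ F ∷ [])) ⟩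
  coef m (gen ζ o xs L.* F L.* factor ζ (o N.+ value x))
   ≈⟨ coef-factor m ζ (o N.+ value x) (gen ζ o xs L.* F) ⟩
  coef m (gen ζ o xs L.* F) + q ^ (o N.+ value x) * coef (m Z.- ζ) (gen ζ o xs L.* F)
   ≈⟨ +-cong (coef-gen ζ o xs m F) (*ˡ (coef-gen ζ o xs (m Z.- ζ) F)) ⟩
  ∑ len (A m) + q ^ (o N.+ value x) * ∑ len (A (m Z.- ζ))
   ≈⟨ +-cong head (sy (∑-*ˡ len (q ^ (o N.+ value x)) (A (m Z.- ζ)))) ⟩
  (A m 0 + ∑ len (A m ∘ suc)) + ∑ len (\ d -> q ^ (o N.+ value x) * A (m Z.- ζ) d)
   ≈⟨ tr (+-assoc (A m 0) (∑ len (A m ∘ suc)) (∑ len (\ d -> q ^ (o N.+ value x) * A (m Z.- ζ) d))) (+ˡ (sy (∑-+ len (A m ∘ suc) (\ d -> q ^ (o N.+ value x) * A (m Z.- ζ) d)))) ⟩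
  A m 0 + ∑ len (\ d -> A m (suc d) + q ^ (o N.+ value x) * A (m Z.- ζ) d)
   ≈⟨ +ˡ (∑-cong len (\ d _ -> step d)) ⟩
  B 0 + ∑ len (B ∘ suc) ≈⟨ ∑-suc len B ⟨
  ∑ (suc len) B ∎
  where
  len = length xs
  A : ℤ -> ℕ -> Ser
  A m d = row xs d * (q ^ (d N.* o) * coef (m Z.- + d Z.* ζ) F)
  B : ℕ -> Ser
  B d = row (x ∷ xs) d * (q ^ (d N.* o) * coef (m Z.- + d Z.* ζ) F)
  head : ∑ len (A m) ~ A m 0 + ∑ len (A m ∘ suc)
  head = tr (sy (tr (+ˡ (tr (*ʳ (row-long xs (suc len) NP.≤-refl)) (zeroˡ _))) (+-identityʳ _))) (∑-suc len (A m))
  q^+ : ∀ i j -> q ^ (i N.+ j) ~ q ^ i * q ^ j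
  q^+ zero j = sy (*-identityˡ (q ^ j))
  q^+ (suc i) j = tr (*ˡ {q} (q^+ i j)) (sy (*-assoc q (q ^ i) (q ^ j)))
  idx : ∀ m d ζ -> m Z.- ζ Z.- d Z.* ζ ≡ m Z.- (+ 1 Z.+ d) Z.* ζ
  idx = solve-∀
  step : ∀ d -> A m (suc d) + q ^ (o N.+ value x) * A (m Z.- ζ) d ~ B (suc d)
  step d = begin
   A m (suc d) + q ^ (o N.+ value x) * A (m Z.- ζ) d
     ≈⟨ +-cong (*ˡ {row xs (suc d)} (*ʳ (q^+ o (d N.* o)))) (*-cong (q^+ o (value x)) (*ˡ {row xs d} (*ˡ {q ^ (d N.* o)} (reflexive (cong (\ j -> coef j F) (idx m (+ d) ζ)))))) ⟩
   row xs (suc d) * ((q ^ o * q ^ (d N.* o)) * c) + (q ^ o * q ^ value x) * (row xs d * (q ^ (d N.* o) * c))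
     ≈⟨ solve (v0 :* ((v1 :* v2) :* v3) :+ (v1 :* v4) :* (v5 :* (v2 :* v3))) ((v0 :+ v4 :* v5) :* ((v1 :* v2) :* v3)) refl (row xs (suc d) ∷ q ^ o ∷ q ^ (d N.* o) ∷ c ∷ q ^ value x ∷ row xs d ∷ []) ⟩
   (row xs (suc d) + q ^ value x * row xs d) * ((q ^ o * q ^ (d N.* o)) * c)
     ≈⟨ *-cong (row-suc x xs d) (*ʳ (q^+ o (d N.* o))) ⟨
   B (suc d) ∎
   where
   c = coef (m Z.- + suc d Z.* ζ) F

 private
  coef-1 : ∀ j -> coef j L.1# ~ constˢ (δ j (+ 0))
  coef-1 j = mk \ { zero -> trans (ZP.+-identityʳ _) (ZP.*-identityˡ (δ j (+ 0))) ; (suc n) -> refl }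

  pick-d : ∀ n d (F : ℕ -> Ser) -> d N.≤ n -> ∑ n (\ i -> F i * constˢ (δ (Z.- + d Z.+ + i) (+ 0))) ~ F d
  pick-d n d F l = mk \ s -> trans (∑-at n (\ i -> F i * constˢ (δ (Z.- + d Z.+ + i) (+ 0))) s) (go n l s)
   where
   val : ∀ i s -> (F i * constˢ (δ (Z.- + d Z.+ + i) (+ 0))) s ≡ δ (Z.- + d Z.+ + i) (+ 0) Z.* F i s
   val i s = trans (at (*-comm (F i) (constˢ (δ (Z.- + d Z.+ + i) (+ 0)))) s) (const-* (δ (Z.- + d Z.+ + i) (+ 0)) (F i) s)
   off : ∀ i s -> ¬ i ≡ d -> (F i * constˢ (δ (Z.- + d Z.+ + i) (+ 0))) s ≡ + 0
   off i s h = trans (val i s) (cong (Z._* F i s) (ind-no (+ 0 ZP.≟ Z.- + d Z.+ + i) (\ e -> h (ZP.+-injective (trans (lem (+ d) (+ i)) (trans (cong (\ z -> + d Z.+ z) (sym e)) (ZP.+-identityʳ (+ d))))))))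
     where
     lem : ∀ d i -> i ≡ d Z.+ (Z.- d Z.+ i)
     lem = solve-∀
   on : ∀ s -> (F d * constˢ (δ (Z.- + d Z.+ + d) (+ 0))) s ≡ F d s
   on s = trans (val d s) (trans (cong (Z._* F d s) (ind-yes (+ 0 ZP.≟ Z.- + d Z.+ + d) (sym (ZP.+-inverseˡ (+ d))))) (ZP.*-identityˡ (F d s)))
   zeros : ∀ n s -> n N.< d -> sumℤ n (\ i -> (F i * constˢ (δ (Z.- + d Z.+ + i) (+ 0))) s) ≡ + 0
   zeros zero s l = off 0 s (\ e -> NP.<⇒≢ l e)
   zeros (suc n) s l = cong₂ Z._+_ (zeros n s (NP.<-trans (NP.n<1+n n) l)) (off (suc n) s (NP.<⇒≢ l))
   go : ∀ n -> d N.≤ n -> ∀ s -> sumℤ n (\ i -> (F i * constˢ (δ (Z.- + d Z.+ + i) (+ 0))) s) ≡ F d s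
   go zero z≤n s = on s
   go (suc n) l s with d NP.≟ suc n
   ... | yes e = trans (cong₂ Z._+_ (zeros n s (subst (n N.<_) (sym e) (NP.n<1+n n))) (trans (cong (\ i -> (F i * constˢ (δ (Z.- + d Z.+ + i) (+ 0))) s) (sym e)) (on s))) (ZP.+-identityˡ (F d s))
   ... | no h = trans (cong₂ Z._+_ (go n (NP.≤-pred (NP.≤∧≢⇒< l h)) s) (off (suc n) s (h ∘ sym))) (ZP.+-identityʳ (F d s))

 -- Entries of the top row carry z q^(1 + value), those of the bottom row z⁻¹ q^value. The constant
 -- term in z forces rows of equal length d, and the extra q per column yields the summand d of n.
 constant-term : ∀ xs -> coef (+ 0) (gen (+ 1) 1 xs L.* gen (Z.- + 1) 0 xs) ~ ∑ (length xs) (\ d -> row xs d * (q ^ d * row xs d))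
 constant-term xs = tr (coef-gen (+ 1) 1 xs (+ 0) (gen (Z.- + 1) 0 xs)) (∑-cong len (\ d l -> *ˡ {row xs d} (*-cong (reflexive (cong (q ^_) (NP.*-identityʳ d))) (inner d l))))
  where
  len = length xs
  idx : ∀ d i -> + 0 Z.- d Z.* + 1 Z.- i Z.* Z.- + 1 ≡ Z.- d Z.+ i
  idx = solve-∀
  inner : ∀ d -> d N.≤ len -> coef (+ 0 Z.- + d Z.* + 1) (gen (Z.- + 1) 0 xs) ~ row xs d
  inner d l = tr (Laurent.moment-cong _ tt (L.sy (L.*-identityʳ (gen (Z.- + 1) 0 xs)))) (tr (coef-gen (Z.- + 1) 0 xs (+ 0 Z.- + d Z.* + 1) L.1#)
   (tr (∑-cong len (\ i _ -> *ˡ {row xs i} (tr (*-cong (reflexive (cong (q ^_) (NP.*-zeroʳ i))) (tr (reflexive (cong (\ j -> coef j L.1#) (idx (+ d) (+ i)))) (coef-1 (Z.- + d Z.+ + i)))) (*-identityˡ (constˢ (δ (Z.- + d Z.+ + i) (+ 0)))))))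
     (pick-d len d (row xs) l)))

 level : ℕ -> List (Colored k)
 level ℓ = List.map (\ c -> (ℓ , c)) (List.allFin k)

 candidates-suc : ∀ n -> candidates k (suc n) ≡ candidates k n ++ level (suc n)
 candidates-suc n = trans (cong (List.concatMap level) (sym (upTo-∷ʳ (suc n)))) (trans (concatMap-++ level (List.upTo (suc n)) (suc n ∷ [])) (cong (candidates k n ++_) (++-identityʳ (level (suc n)))))

 private
  count-level : ∀ {s} cs ℓ -> s N.< ℓ -> ∀ d -> subCount (List.map (\ (c : Fin k) -> (ℓ , c)) cs) d s ≡ subCount {k} [] d s
  count-level [] ℓ l d = refl
  count-level (c ∷ cs) ℓ l zero = count-level cs ℓ l zero
  count-level {s} (c ∷ cs) ℓ l (suc d) with ℓ NP.≤? s
  ... | yes l' = ⊥-elim (NP.<-irrefl refl (NP.<-≤-trans l l'))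
  ... | no _ = count-level cs ℓ l (suc d)

  count-++ : ∀ xs {s} cs ℓ -> s N.< ℓ -> ∀ d -> subCount (xs ++ List.map (\ (c : Fin k) -> (ℓ , c)) cs) d s ≡ subCount xs d s
  count-++ [] cs ℓ l d = count-level cs ℓ l d
  count-++ (x ∷ xs) cs ℓ l zero = count-++ xs cs ℓ l zero
  count-++ (x ∷ xs) {s} cs ℓ l (suc d) with value x NP.≤? s
  ... | yes _ = cong₂ N._+_ (count-++ xs cs ℓ l (suc d)) (count-++ xs cs ℓ (NP.≤-<-trans (NP.m∸n≤m s (value x)) l) d)
  ... | no _ = count-++ xs cs ℓ l (suc d)

 -- No entry of a row exceeds its sum. The statement bounds the candidates by that sum, the
 -- generating function needs one bound for all rows.
 rows-stable : ∀ j d s -> subCount (candidates k (j N.+ s)) d s ≡ rows k d s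
 rows-stable zero d s = refl
 rows-stable (suc j) d s = trans (cong (\ xs -> subCount xs d s) (candidates-suc (j N.+ s)))
  (trans (count-++ (candidates k (j N.+ s)) (List.allFin k) (suc (j N.+ s)) (s≤s (NP.m≤n+m s j)) d) (rows-stable j d s))

 private
  gen-++ : ∀ ζ o xs ys -> gen ζ o (xs ++ ys) L.~ gen ζ o xs L.* gen ζ o ys
  gen-++ ζ o [] ys = L.sy (L.*-identityˡ (gen ζ o ys))
  gen-++ ζ o (x ∷ xs) ys = L.tr (L.*ʳ {factor ζ (o N.+ value x)} (gen-++ ζ o xs ys))
   (L.solve (v0 :* v1 :* v2) (v0 :* v2 :* v1) refl (gen ζ o xs ∷ gen ζ o ys ∷ factor ζ (o N.+ value x) ∷ []))

  gen-map : ∀ ζ o ℓ cs -> gen ζ o (List.map (\ c -> (ℓ , c)) cs) L.~ factor ζ (o N.+ ℓ) L.^ length cs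
  gen-map ζ o ℓ [] = L.≈-refl
  gen-map ζ o ℓ (c ∷ cs) = L.tr (L.*-comm (gen ζ o (List.map (\ c -> (ℓ , c)) cs)) (factor ζ (o N.+ ℓ))) (L.*ˡ {factor ζ (o N.+ ℓ)} (gen-map ζ o ℓ cs))

  gen-level : ∀ ζ o ℓ -> gen ζ o (level ℓ) L.~ factor ζ (o N.+ ℓ) L.^ k
  gen-level ζ o ℓ = L.tr (gen-map ζ o ℓ (List.allFin k)) (L.reflexive (cong (factor ζ (o N.+ ℓ) L.^_) (length-tabulate {n = k} (\ i -> i))))

  gen-suc : ∀ ζ o n -> gen ζ o (candidates k (suc n)) L.~ gen ζ o (candidates k n) L.* factor ζ (o N.+ suc n) L.^ k
  gen-suc ζ o n = L.tr (L.reflexive (cong (gen ζ o) (candidates-suc n))) (L.tr (gen-++ ζ o (candidates k n) (level (suc n))) (L.*ˡ {gen ζ o (candidates k n)} (gen-level ζ o (suc n))))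

  gen-0 : ∀ ζ o -> gen ζ o (candidates k 0) L.~ factor ζ (o N.+ 0) L.^ k
  gen-0 ζ o = L.tr (L.reflexive (cong (gen ζ o) (++-identityʳ (level 0)))) (gen-level ζ o 0)

  gen⁺ : ∀ n -> gen (+ 1) 1 (candidates k n) L.~ L.prod (suc n) (factor (+ 1)) L.^ k
  gen⁺ zero = L.tr (gen-0 (+ 1) 1) (L.^-cong k (L.sy (L.*-identityˡ (factor (+ 1) 1))))
  gen⁺ (suc n) = L.tr (gen-suc (+ 1) 1 n) (L.tr (L.*ʳ {factor (+ 1) (2+ n) L.^ k} (gen⁺ n)) (L.sy (L-^-* (L.prod (suc n) (factor (+ 1))) (factor (+ 1) (2+ n)) k)))

  gen⁻ : ∀ n -> gen (Z.- + 1) 0 (candidates k n) L.~ (pre L.* L.prod n (factor (Z.- + 1))) L.^ k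
  gen⁻ zero = L.tr (gen-0 (Z.- + 1) 0) (L.^-cong k (L.tr (L.+ˡ {L.1#} (L.*-identityˡ (zL (Z.- + 1)))) (L.sy (L.*-identityʳ pre))))
  gen⁻ (suc n) = L.tr (gen-suc (Z.- + 1) 0 n) (L.tr (L.*ʳ {factor (Z.- + 1) (suc n) L.^ k} (gen⁻ n))
   (L.tr (L.sy (L-^-* (pre L.* L.prod n (factor (Z.- + 1))) (factor (Z.- + 1) (suc n)) k)) (L.^-cong k (L.*-assoc pre (L.prod n (factor (Z.- + 1))) (factor (Z.- + 1) (suc n))))))

  ^-cong[] : ∀ j {F G} n -> F L.≈[ n ] G -> (F L.^ j) L.≈[ n ] (G L.^ j)
  ^-cong[] zero n h i l = Laurent.mk∼ \ _ _ -> refl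
  ^-cong[] (suc j) {F} {G} n h = L.*-cong[] {F} {G} n h (^-cong[] j n h)

 frobenius : ∀ n -> CΦ k n ≡ coef (+ 0) ((pre L.* half) L.^ k) n
 frobenius n = sym (trans approx (trans (at (constant-term xs) n) count))
  where
  xs = candidates k n
  len = length xs
  approx : coef (+ 0) ((pre L.* half) L.^ k) n ≡ coef (+ 0) (gen (+ 1) 1 xs L.* gen (Z.- + 1) 0 xs) n
  approx = sym (trans (at (Laurent.moment-cong (δ (+ 0)) tt (L.tr (L.*-cong (gen⁺ n) (gen⁻ n)) (L.tr (L.sy (L-^-* (L.prod (suc n) (factor (+ 1))) (pre L.* L.prod n (factor (Z.- + 1))) k))
     (L.^-cong k (L.solve (v0 :* (v1 :* v2)) (v1 :* (v0 :* v2)) refl (L.prod (suc n) (factor (+ 1)) ∷ pre ∷ L.prod n (factor (Z.- + 1)) ∷ [])))))) n)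
   (Laurent.test (^-cong[] k n (L.*-cong[] {pre} {pre} n (\ _ _ -> Laurent.mk∼ (\ _ _ -> refl))
     (L.*-cong[] {L.prod (suc n) (factor (+ 1))} {L.prod∞ (factor (+ 1))} {L.prod n (factor (Z.- + 1))} {L.prod∞ (factor (Z.- + 1))} n
       (\ i l -> L.prod-approx (factor (+ 1)) (factor-unital (+ 1)) (suc n) i (NP.m≤n⇒m≤1+n l))
       (L.prod-approx (factor (Z.- + 1)) (factor-unital (Z.- + 1)) n))) n NP.≤-refl) (δ (+ 0)) tt))
  S : ℕ -> ℤ
  S d = (row xs d * (q ^ d * row xs d)) n
  S-form : ∀ d -> (row xs d * (q ^ d * row xs d)) ~ q ^ d * (row xs d * row xs d)
  S-form d = solve (v0 :* (v1 :* v0)) (v1 :* (v0 :* v0)) refl (row xs d ∷ q ^ d ∷ [])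
  S-len : ∀ d -> len N.< d -> S d ≡ + 0
  S-len d l = at (tr (*ʳ {q ^ d * row xs d} (row-long xs d l)) (zeroˡ (q ^ d * row xs d))) n
  S-n : ∀ d -> n N.< d -> S d ≡ + 0
  S-n d l = trans (at (S-form d) n) (q^-low d (row xs d * row xs d) n l)
  rows-eq : ∀ d a -> a N.≤ n -> row xs d a ≡ + rows k d a
  rows-eq d a l = cong +_ (trans (cong (\ j -> subCount (candidates k j) d a) (sym (NP.m∸n+n≡m l))) (rows-stable (n ∸ a) d a))
  S-rows : ∀ d -> d N.≤ n -> S d ≡ + sumℕ (n ∸ d) (\ a -> rows k d a N.* rows k d (n ∸ d ∸ a))
  S-rows d l = trans (at (S-form d) n) (trans (cong (q ^ d * (row xs d * row xs d)) (sym (NP.m+[n∸m]≡n l))) (trans (q^-shift d (row xs d * row xs d) (n ∸ d))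
   (trans (conv-sum (row xs d) (row xs d) (n ∸ d)) (trans (sumℤ-cong (n ∸ d) (\ a l' -> trans (cong₂ Z._*_ (rows-eq d a (NP.≤-trans l' (NP.m∸n≤m n d)))
     (rows-eq d (n ∸ d ∸ a) (NP.≤-trans (NP.m∸n≤m (n ∸ d) a) (NP.m∸n≤m n d)))) (sym (ZP.pos-* (rows k d a) (rows k d (n ∸ d ∸ a))))))
     (sym (sumℕ-sumℤ (n ∸ d) (\ a -> rows k d a N.* rows k d (n ∸ d ∸ a))))))))
  count : ∑ len (\ d -> row xs d * (q ^ d * row xs d)) n ≡ CΦ k n
  -- `S` vanishes beyond `len` and beyond `n`, so the two ranges of summation are compared through
  -- `n + len`.
  count = trans (∑-at len (\ d -> row xs d * (q ^ d * row xs d)) n) (trans (sym (sumℤ-tail n len S S-len)) (trans (cong (\ j -> sumℤ j S) (NP.+-comm n len))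
   (trans (sumℤ-tail len n S S-n) (trans (sumℤ-cong n S-rows) (sym (sumℕ-sumℤ n (\ d -> sumℕ (n ∸ d) (\ a -> rows k d a N.* rows k d (n ∸ d ∸ a)))))))))

-- The quintuple product identity, as a rearrangement of a double sum

T-double : ∀ j -> + 2 Z.* + T j ≡ j Z.* j Z.+ j
T-double (+ n) = go n where
 r1 : ∀ n t -> + 2 Z.* ((+ 1 Z.+ n) Z.+ t) ≡ + 2 Z.* (+ 1 Z.+ n) Z.+ + 2 Z.* t
 r1 = solve-∀
 r2 : ∀ n -> + 2 Z.* (+ 1 Z.+ n) Z.+ (n Z.* n Z.+ n) ≡ (+ 1 Z.+ n) Z.* (+ 1 Z.+ n) Z.+ (+ 1 Z.+ n)
 r2 = solve-∀
 go : ∀ n -> + 2 Z.* + tri n ≡ + n Z.* + n Z.+ + n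
 go zero = refl
 go (suc n) = trans (r1 (+ n) (+ tri n)) (trans (cong (\ z -> + 2 Z.* (+ 1 Z.+ + n) Z.+ z) (go n)) (r2 (+ n)))
T-double -[1+ n ] = trans (T-double (+ n)) (lem (+ n))
 where
 lem : ∀ n -> n Z.* n Z.+ n ≡ (Z.- (+ 1 Z.+ n)) Z.* (Z.- (+ 1 Z.+ n)) Z.+ (Z.- (+ 1 Z.+ n))
 lem = solve-∀

-- The pentagonal exponent j(3j + 1)/2, written as T j + j² in order to stay in ℕ.
G : ℤ -> ℕ
G j = T j N.+ Z.∣ j ∣ N.* Z.∣ j ∣

G-double : ∀ j -> + 2 Z.* + G j ≡ + 3 Z.* (j Z.* j) Z.+ j
G-double j = trans (ZP.*-distribˡ-+ (+ 2) (+ T j) (+ (Z.∣ j ∣ N.* Z.∣ j ∣))) (trans (cong₂ (\ x y -> x Z.+ + 2 Z.* y) (T-double j) (sq j)) (lem j))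
 where
 sq : ∀ j -> + (Z.∣ j ∣ N.* Z.∣ j ∣) ≡ j Z.* j
 sq (+ n) = ZP.pos-* n n
 sq -[1+ n ] = refl
 lem : ∀ j -> (j Z.* j Z.+ j) Z.+ + 2 Z.* (j Z.* j) ≡ + 3 Z.* (j Z.* j) Z.+ j
 lem = solve-∀

q^-zero : ∀ t n -> n N.< t -> (q ^ t) n ≡ + 0
q^-zero t n l = trans (sym (at (*-identityʳ (q ^ t)) n)) (q^-low t 1# n l)

private
 halve : ∀ {a b : ℤ} -> + 2 Z.* a ≡ + 2 Z.* b -> a ≡ b
 halve {a} {b} = ZP.*-cancelˡ-≡ (+ 2) a b

 GT-double : ∀ j l -> + 2 Z.* + (G j N.+ T l) ≡ (+ 3 Z.* (j Z.* j) Z.+ j) Z.+ (l Z.* l Z.+ l)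
 GT-double j l = trans (ZP.*-distribˡ-+ (+ 2) (+ G j) (+ T l)) (cong₂ Z._+_ (G-double j) (T-double l))

 GT-≡ : ∀ j l j' l' -> (+ 3 Z.* (j Z.* j) Z.+ j) Z.+ (l Z.* l Z.+ l) ≡ (+ 3 Z.* (j' Z.* j') Z.+ j') Z.+ (l' Z.* l' Z.+ l') -> G j N.+ T l ≡ G j' N.+ T l'
 GT-≡ j l j' l' e = ZP.+-injective (halve (trans (GT-double j l) (trans e (sym (GT-double j' l')))))

 σ-twice : ∀ x -> σ (x Z.+ x) ≡ + 1
 σ-twice x = trans (σ-+ x x) (go x)
  where
  neg² : ∀ x -> Z.- x Z.* Z.- x ≡ x Z.* x
  neg² = solve-∀
  nat : ∀ n -> σ (+ n) Z.* σ (+ n) ≡ + 1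
  nat zero = refl
  nat (suc n) = trans (neg² (σ (+ n))) (nat n)
  go : ∀ x -> σ x Z.* σ x ≡ + 1
  go (+ n) = nat n
  go -[1+ n ] = nat (suc n)

 σ-even : ∀ {y} x -> y ≡ x Z.+ x -> σ y ≡ + 1
 σ-even x refl = σ-twice x

 σ-odd : ∀ {y} x -> y ≡ + 1 Z.+ (x Z.+ x) -> σ y ≡ Z.- + 1
 σ-odd x refl = trans (σ-suc (x Z.+ x)) (cong Z.-_ (σ-twice x))

Zsum-swap : ∀ B C (f : ℤ -> ℤ -> ℤ) -> Zsum B (\ j -> Zsum C (f j)) ≡ Zsum C (\ c -> Zsum B (\ j -> f j c))
Zsum-swap zero C f = refl
Zsum-swap (suc B) C f = sym (trans (Zsum-+ C (\ c -> Zsum B (\ j -> f j c)) (\ c -> f (+ suc B) c Z.+ f -[1+ B ] c))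
 (cong₂ Z._+_ (sym (Zsum-swap B C f)) (Zsum-+ C (f (+ suc B)) (f -[1+ B ]))))

private
 Zsum-parity' : ∀ B f -> Zsum B (\ m -> f (m Z.+ m)) Z.+ Zsum B (\ m -> f (+ 1 Z.+ (m Z.+ m))) ≡ Zsum (B N.+ B) f Z.+ f (+ suc (B N.+ B))
 Zsum-parity' zero f = refl
 Zsum-parity' (suc B) f = trans (r1 (Zsum B (\ m -> f (m Z.+ m))) (f (+ suc B Z.+ + suc B)) (f (-[1+ B ] Z.+ -[1+ B ])) (Zsum B (\ m -> f (+ 1 Z.+ (m Z.+ m)))) (f (+ 1 Z.+ (+ suc B Z.+ + suc B))) (f (+ 1 Z.+ (-[1+ B ] Z.+ -[1+ B ]))))
  (trans (cong₂ (\ x y -> x Z.+ y) (Zsum-parity' B f) refl)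
  (trans (cong₂ (\ x y -> (Zsum (B N.+ B) f Z.+ f (+ suc (B N.+ B))) Z.+ ((x Z.+ f -[1+ suc (B N.+ B) ]) Z.+ (y Z.+ f -[1+ B N.+ B ])))
     (cong f (cong (\ k -> + suc k) (NP.+-suc B B))) (cong f (cong (\ k -> + 2+ k) (NP.+-suc B B))))
  (trans (r2 (Zsum (B N.+ B) f) (f (+ suc (B N.+ B))) (f (+ suc (suc (B N.+ B)))) (f -[1+ suc (B N.+ B) ]) (f (+ suc (suc (suc (B N.+ B))))) (f -[1+ B N.+ B ]))
   (cong (\ k -> Zsum (suc k) f Z.+ f (+ 2+ k)) (sym (NP.+-suc B B))))))
  where
  r1 : ∀ s a b t c d -> (s Z.+ (a Z.+ b)) Z.+ (t Z.+ (c Z.+ d)) ≡ (s Z.+ t) Z.+ ((a Z.+ b) Z.+ (c Z.+ d))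
  r1 = solve-∀
  r2 : ∀ s p a b c d -> (s Z.+ p) Z.+ ((a Z.+ b) Z.+ (c Z.+ d)) ≡ (s Z.+ (p Z.+ d) Z.+ (a Z.+ b)) Z.+ c
  r2 = solve-∀

Zsum-parity : ∀ {B f} -> Supp B f -> Zsum B f ≡ Zsum B (\ m -> f (m Z.+ m)) Z.+ Zsum B (\ m -> f (+ 1 Z.+ (m Z.+ m)))
Zsum-parity {B} {f} h = sym (trans (Zsum-parity' B f) (trans (cong₂ Z._+_ (Zsum-extend B {B} {f} h) (h (+ suc (B N.+ B)) (s≤s (NP.m≤m+n B B)))) (ZP.+-identityʳ _)))

Supp-mono : ∀ {B B' f} -> B N.≤ B' -> Supp B f -> Supp B' f
Supp-mono l h m l' = h m (NP.≤-<-trans l l')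

Supp-cong : ∀ {B f g} -> (∀ m -> f m ≡ g m) -> Supp B f -> Supp B g
Supp-cong e h m l = trans (sym (e m)) (h m l)

-- The identity multiplied by its theta denominator, in degree n, and paired with an arbitrary
-- function of the exponent of z. Indices beyond n + 1 contribute nothing.
module Quintuple (n B : ℕ) (B≡ : B ≡ suc n) where

 h : ℤ -> ℤ -> ℤ
 h j l = σ (j Z.+ l) Z.* (q ^ (G j N.+ T l)) n

 private
  h-j : ∀ j l -> B N.< Z.∣ j ∣ -> h j l ≡ + 0
  h-j j l b = trans (cong (σ (j Z.+ l) Z.*_) (q^-zero (G j N.+ T l) n (NP.<-≤-trans (T-large j (subst (N._< Z.∣ j ∣) B≡ b)) (NP.≤-trans (NP.m≤m+n (T j) _) (NP.m≤m+n (G j) (T l)))))) (ZP.*-zeroʳ (σ (j Z.+ l)))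

  h-l : ∀ j l -> B N.< Z.∣ l ∣ -> h j l ≡ + 0
  h-l j l b = trans (cong (σ (j Z.+ l) Z.*_) (q^-zero (G j N.+ T l) n (NP.<-≤-trans (T-large l (subst (N._< Z.∣ l ∣) B≡ b)) (NP.m≤n+m (T l) (G j))))) (ZP.*-zeroʳ (σ (j Z.+ l)))

  *0 : ∀ {a} b -> a ≡ + 0 -> a Z.* b ≡ + 0
  *0 b refl = refl

  C : ℕ
  C = B N.+ suc (3 N.* B)

  -- Coefficients at a fixed exponent of z: `K1` and `K2` belong to the two families on the left of
  -- the identity, `K0` to the right.
  K1 K2 K0 : ℤ -> ℤ
  K1 c = Zsum B (\ j -> h j (Z.- (+ 3 Z.* j Z.+ + 1) Z.+ c))
  K2 c = Zsum B (\ j -> h j (+ 3 Z.* j Z.+ c))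
  K0 m = Zsum B (\ j -> h j m)

  -- Change of the inner variable by a shift depending on the outer one
  regroup : ∀ (s ψ : ℤ -> ℤ) (e : ℤ -> ℤ -> ℤ) -> (∀ j c -> e j (s j Z.+ c) ≡ c) -> (∀ j -> Z.∣ j ∣ N.≤ B -> Z.∣ s j ∣ N.≤ suc (3 N.* B)) ->
           Zsum B (\ j -> Zsum B (\ l -> h j l Z.* ψ (e j l))) ≡ Zsum C (\ c -> ψ c Z.* Zsum B (\ j -> h j (s j Z.+ c)))
  regroup s ψ e es bnd = trans (Zsum-cong B inner) (trans (Zsum-swap B C (\ j c -> ψ c Z.* h j (s j Z.+ c))) (Zsum-cong C (\ c -> Zsum-* B (ψ c) (\ j -> h j (s j Z.+ c)))))
   where
   inner : ∀ j -> Zsum B (\ l -> h j l Z.* ψ (e j l)) ≡ Zsum C (\ c -> ψ c Z.* h j (s j Z.+ c))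
   inner j with Z.∣ j ∣ NP.≤? B
   ... | no ¬l = trans (trans (Zsum-cong B (\ l -> *0 (ψ (e j l)) (h-j j l (NP.≰⇒> ¬l)))) (Zsum-zero B))
                (sym (trans (Zsum-cong C (\ c -> trans (cong (ψ c Z.*_) (h-j j (s j Z.+ c) (NP.≰⇒> ¬l))) (ZP.*-zeroʳ (ψ c)))) (Zsum-zero C)))
   ... | yes l = trans (sym (Zsum-shift {B} {f} (s j) supp)) (trans (Zsum-agree {B N.+ Z.∣ s j ∣} {C} {\ c -> f (s j Z.+ c)} (Supp-shift (s j) supp) (Supp-mono (NP.+-monoʳ-≤ B (bnd j l)) (Supp-shift (s j) supp)))
                (Zsum-cong C (\ c -> trans (ZP.*-comm (h j (s j Z.+ c)) _) (cong (\ z -> ψ z Z.* h j (s j Z.+ c)) (es j c)))))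
     where
     f : ℤ -> ℤ
     f l = h j l Z.* ψ (e j l)
     supp : Supp B f
     supp l b = *0 (ψ (e j l)) (h-l j l b)

  ∣3j∣ : ∀ j -> Z.∣ j ∣ N.≤ B -> Z.∣ + 3 Z.* j ∣ N.≤ 3 N.* B
  ∣3j∣ j l = subst (N._≤ 3 N.* B) (sym (ZP.abs-* (+ 3) j)) (NP.*-monoʳ-≤ 3 l)

  bnd1 : ∀ j -> Z.∣ j ∣ N.≤ B -> Z.∣ Z.- (+ 3 Z.* j Z.+ + 1) ∣ N.≤ suc (3 N.* B)
  bnd1 j l = subst (N._≤ suc (3 N.* B)) (sym (ZP.∣-i∣≡∣i∣ (+ 3 Z.* j Z.+ + 1)))
   (NP.≤-trans (ZP.∣i+j∣≤∣i∣+∣j∣ (+ 3 Z.* j) (+ 1)) (subst (N._≤ suc (3 N.* B)) (NP.+-comm 1 _) (s≤s (∣3j∣ j l))))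

  f1 f2 : ℤ -> ℤ -> ℤ
  f1 m i = (q ^ (G i N.+ T m)) n
  f2 m i = σ (i Z.+ m) Z.* f1 m i

  -- The shift j ↦ γ + j in `K1` produces the terms of `K2` with the opposite sign and the same
  -- power of q.
  K-even : ∀ γ -> K1 (γ Z.+ γ) Z.+ K2 (γ Z.+ γ) ≡ + 0
  K-even γ = trans (cong₂ Z._+_ (sym (Zsum-shift {B} {\ j -> h j (Z.- (+ 3 Z.* j Z.+ + 1) Z.+ (γ Z.+ γ))} γ (\ j -> h-j j _)))
     (sym (Zsum-mono {B} {B N.+ Z.∣ γ ∣} {\ j -> h j (+ 3 Z.* j Z.+ (γ Z.+ γ))} (NP.m≤m+n B _) (\ j -> h-j j _))))
   (trans (sym (Zsum-+ (B N.+ Z.∣ γ ∣) (\ j -> h (γ Z.+ j) (Z.- (+ 3 Z.* (γ Z.+ j) Z.+ + 1) Z.+ (γ Z.+ γ))) (\ j -> h j (+ 3 Z.* j Z.+ (γ Z.+ γ))))) (trans (Zsum-cong (B N.+ Z.∣ γ ∣) pt) (Zsum-zero (B N.+ Z.∣ γ ∣))))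
   where
   e1 : ∀ γ j -> (γ Z.+ j) Z.+ (Z.- (+ 3 Z.* (γ Z.+ j) Z.+ + 1) Z.+ (γ Z.+ γ)) ≡ + 1 Z.+ ((Z.- j Z.- + 1) Z.+ (Z.- j Z.- + 1))
   e1 = solve-∀
   e2 : ∀ γ j -> j Z.+ (+ 3 Z.* j Z.+ (γ Z.+ γ)) ≡ (j Z.+ j Z.+ γ) Z.+ (j Z.+ j Z.+ γ)
   e2 = solve-∀
   e3 : ∀ γ j -> (+ 3 Z.* ((γ Z.+ j) Z.* (γ Z.+ j)) Z.+ (γ Z.+ j)) Z.+ ((Z.- (+ 3 Z.* (γ Z.+ j) Z.+ + 1) Z.+ (γ Z.+ γ)) Z.* (Z.- (+ 3 Z.* (γ Z.+ j) Z.+ + 1) Z.+ (γ Z.+ γ)) Z.+ (Z.- (+ 3 Z.* (γ Z.+ j) Z.+ + 1) Z.+ (γ Z.+ γ)))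
          ≡ (+ 3 Z.* (j Z.* j) Z.+ j) Z.+ ((+ 3 Z.* j Z.+ (γ Z.+ γ)) Z.* (+ 3 Z.* j Z.+ (γ Z.+ γ)) Z.+ (+ 3 Z.* j Z.+ (γ Z.+ γ)))
   e3 = solve-∀
   lem : ∀ x -> Z.- + 1 Z.* x Z.+ + 1 Z.* x ≡ + 0
   lem = solve-∀
   pt : ∀ j -> h (γ Z.+ j) (Z.- (+ 3 Z.* (γ Z.+ j) Z.+ + 1) Z.+ (γ Z.+ γ)) Z.+ h j (+ 3 Z.* j Z.+ (γ Z.+ γ)) ≡ + 0
   pt j = trans (cong₂ Z._+_
       (cong₂ (\ s t -> s Z.* (q ^ t) n) (σ-odd (Z.- j Z.- + 1) (e1 γ j)) (GT-≡ (γ Z.+ j) (Z.- (+ 3 Z.* (γ Z.+ j) Z.+ + 1) Z.+ (γ Z.+ γ)) j (+ 3 Z.* j Z.+ (γ Z.+ γ)) (e3 γ j)))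
       (cong (Z._* (q ^ (G j N.+ T (+ 3 Z.* j Z.+ (γ Z.+ γ)))) n) (σ-even (j Z.+ j Z.+ γ) (e2 γ j))))
     (lem ((q ^ (G j N.+ T (+ 3 Z.* j Z.+ (γ Z.+ γ)))) n))

  -- The index i of `K0` is split by the parity of i - m: after a reflection the even differences
  -- are the terms of `K1`, and after a reflection and a shift the odd ones are those of `K2`.
  K-odd : ∀ m -> K1 (+ 1 Z.+ (m Z.+ m)) Z.+ K2 (+ 1 Z.+ (m Z.+ m)) ≡ K0 m
  K-odd m = sym (trans (sym (Zsum-shift {B} {\ i -> h i m} m (\ i -> h-j i m)))
   (trans (Zsum-parity {B'} {\ i -> h (m Z.+ i) m} (Supp-shift {B} {\ i -> h i m} m (\ i -> h-j i m)))
     (cong₂ Z._+_ (sym first) (sym second))))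
   where
   B' = B N.+ Z.∣ m ∣
   a1 : ∀ j m -> Z.- j Z.+ (Z.- (+ 3 Z.* (Z.- j) Z.+ + 1) Z.+ (+ 1 Z.+ (m Z.+ m))) ≡ (j Z.+ m) Z.+ (j Z.+ m)
   a1 = solve-∀
   a2 : ∀ j m -> (m Z.+ (j Z.+ j)) Z.+ m ≡ (j Z.+ m) Z.+ (j Z.+ m)
   a2 = solve-∀
   a3 : ∀ j m -> (+ 3 Z.* (Z.- j Z.* Z.- j) Z.+ Z.- j) Z.+ ((Z.- (+ 3 Z.* (Z.- j) Z.+ + 1) Z.+ (+ 1 Z.+ (m Z.+ m))) Z.* (Z.- (+ 3 Z.* (Z.- j) Z.+ + 1) Z.+ (+ 1 Z.+ (m Z.+ m))) Z.+ (Z.- (+ 3 Z.* (Z.- j) Z.+ + 1) Z.+ (+ 1 Z.+ (m Z.+ m))))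
          ≡ (+ 3 Z.* ((m Z.+ (j Z.+ j)) Z.* (m Z.+ (j Z.+ j))) Z.+ (m Z.+ (j Z.+ j))) Z.+ (m Z.* m Z.+ m)
   a3 = solve-∀
   pt1 : ∀ j -> h (Z.- j) (Z.- (+ 3 Z.* (Z.- j) Z.+ + 1) Z.+ (+ 1 Z.+ (m Z.+ m))) ≡ h (m Z.+ (j Z.+ j)) m
   pt1 j = cong₂ (\ s t -> s Z.* (q ^ t) n) (trans (σ-even (j Z.+ m) (a1 j m)) (sym (σ-even (j Z.+ m) (a2 j m))))
     (GT-≡ (Z.- j) (Z.- (+ 3 Z.* (Z.- j) Z.+ + 1) Z.+ (+ 1 Z.+ (m Z.+ m))) (m Z.+ (j Z.+ j)) m (a3 j m))
   neg-supp : ∀ {f} -> Supp B f -> Supp B (\ j -> f (Z.- j))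
   neg-supp hf j b = hf (Z.- j) (subst (B N.<_) (sym (ZP.∣-i∣≡∣i∣ j)) b)
   first : K1 (+ 1 Z.+ (m Z.+ m)) ≡ Zsum B' (\ j -> h (m Z.+ (j Z.+ j)) m)
   first = trans (sym (Zsum-reflect B (\ j -> h j (Z.- (+ 3 Z.* j Z.+ + 1) Z.+ (+ 1 Z.+ (m Z.+ m))))))
     (trans (Zsum-cong B pt1) (sym (Zsum-mono {B} {B'} {\ j -> h (m Z.+ (j Z.+ j)) m} (NP.m≤m+n B _)
       (Supp-cong pt1 (neg-supp {\ j -> h j (Z.- (+ 3 Z.* j Z.+ + 1) Z.+ (+ 1 Z.+ (m Z.+ m)))} (\ j -> h-j j _))))))
   g : ℤ -> ℤ
   g j = h (Z.- j) (+ 3 Z.* (Z.- j) Z.+ (+ 1 Z.+ (m Z.+ m)))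
   g-supp : Supp B g
   g-supp = neg-supp {\ j -> h j (+ 3 Z.* j Z.+ (+ 1 Z.+ (m Z.+ m)))} (\ j -> h-j j _)
   b1 : ∀ j m -> Z.- ((+ 1 Z.+ m) Z.+ j) Z.+ (+ 3 Z.* (Z.- ((+ 1 Z.+ m) Z.+ j)) Z.+ (+ 1 Z.+ (m Z.+ m))) ≡ + 1 Z.+ ((Z.- (m Z.+ (j Z.+ j)) Z.- + 2) Z.+ (Z.- (m Z.+ (j Z.+ j)) Z.- + 2))
   b1 = solve-∀
   b₂ : ∀ j m -> (m Z.+ (+ 1 Z.+ (j Z.+ j))) Z.+ m ≡ + 1 Z.+ ((j Z.+ m) Z.+ (j Z.+ m))
   b₂ = solve-∀
   b3 : ∀ j m -> (+ 3 Z.* (Z.- ((+ 1 Z.+ m) Z.+ j) Z.* Z.- ((+ 1 Z.+ m) Z.+ j)) Z.+ Z.- ((+ 1 Z.+ m) Z.+ j)) Z.+ ((+ 3 Z.* (Z.- ((+ 1 Z.+ m) Z.+ j)) Z.+ (+ 1 Z.+ (m Z.+ m))) Z.* (+ 3 Z.* (Z.- ((+ 1 Z.+ m) Z.+ j)) Z.+ (+ 1 Z.+ (m Z.+ m))) Z.+ (+ 3 Z.* (Z.- ((+ 1 Z.+ m) Z.+ j)) Z.+ (+ 1 Z.+ (m Z.+ m))))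
          ≡ (+ 3 Z.* ((m Z.+ (+ 1 Z.+ (j Z.+ j))) Z.* (m Z.+ (+ 1 Z.+ (j Z.+ j)))) Z.+ (m Z.+ (+ 1 Z.+ (j Z.+ j)))) Z.+ (m Z.* m Z.+ m)
   b3 = solve-∀
   pt2 : ∀ j -> g ((+ 1 Z.+ m) Z.+ j) ≡ h (m Z.+ (+ 1 Z.+ (j Z.+ j))) m
   pt2 j = cong₂ (\ s t -> s Z.* (q ^ t) n) (trans (σ-odd (Z.- (m Z.+ (j Z.+ j)) Z.- + 2) (b1 j m)) (sym (σ-odd (j Z.+ m) (b₂ j m))))
     (GT-≡ (Z.- ((+ 1 Z.+ m) Z.+ j)) (+ 3 Z.* (Z.- ((+ 1 Z.+ m) Z.+ j)) Z.+ (+ 1 Z.+ (m Z.+ m))) (m Z.+ (+ 1 Z.+ (j Z.+ j))) m (b3 j m))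
   odd-supp : Supp B' (\ j -> h (m Z.+ (+ 1 Z.+ (j Z.+ j))) m)
   odd-supp j b = h-j (m Z.+ (+ 1 Z.+ (j Z.+ j))) m (NP.≰⇒> \ l -> NP.<-irrefl refl (NP.<-≤-trans b (big l)))
     where
     e : ∀ j m -> j Z.+ j ≡ (m Z.+ (+ 1 Z.+ (j Z.+ j))) Z.- (+ 1 Z.+ m)
     e = solve-∀
     dbl : ∀ j -> Z.∣ j Z.+ j ∣ ≡ Z.∣ j ∣ N.+ Z.∣ j ∣
     dbl (+ n) = refl
     dbl -[1+ n ] = cong suc (sym (NP.+-suc n n))
     b2 : Z.∣ m Z.+ (+ 1 Z.+ (j Z.+ j)) ∣ N.≤ B -> Z.∣ j ∣ N.+ Z.∣ j ∣ N.≤ B N.+ suc Z.∣ m ∣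
     b2 l = subst (N._≤ B N.+ suc Z.∣ m ∣) (trans (cong Z.∣_∣ (sym (e j m))) (dbl j))
       (NP.≤-trans (ZP.∣i-j∣≤∣i∣+∣j∣ (m Z.+ (+ 1 Z.+ (j Z.+ j))) (+ 1 Z.+ m)) (NP.+-mono-≤ l (ZP.∣i+j∣≤∣i∣+∣j∣ (+ 1) m)))
     big : Z.∣ m Z.+ (+ 1 Z.+ (j Z.+ j)) ∣ N.≤ B -> Z.∣ j ∣ N.≤ B'
     big l = NP.≮⇒≥ \ b' -> NP.<-irrefl refl (NP.<-≤-trans (NP.+-mono-< b' b') (NP.≤-trans (b2 l)
       (NP.≤-trans (NP.≤-reflexive (NP.+-suc B Z.∣ m ∣)) (NP.+-monoˡ-≤ B' {1} {B'} (subst (\ b -> 1 N.≤ b N.+ Z.∣ m ∣) (sym B≡) (s≤s z≤n))))))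
   second : K2 (+ 1 Z.+ (m Z.+ m)) ≡ Zsum B' (\ j -> h (m Z.+ (+ 1 Z.+ (j Z.+ j))) m)
   second = trans (sym (Zsum-reflect B (\ j -> h j (+ 3 Z.* j Z.+ (+ 1 Z.+ (m Z.+ m))))))
     (trans (sym (Zsum-shift {B} {g} (+ 1 Z.+ m) g-supp)) (trans (Zsum-cong (B N.+ Z.∣ + 1 Z.+ m ∣) pt2)
       (Zsum-agree {B N.+ Z.∣ + 1 Z.+ m ∣} {B'} {\ j -> h (m Z.+ (+ 1 Z.+ (j Z.+ j))) m} (Supp-cong pt2 (Supp-shift {B} {g} (+ 1 Z.+ m) g-supp)) odd-supp)))

  K-supp : Supp C (\ c -> K1 c Z.+ K2 c)
  K-supp c b = cong₂ Z._+_ (Zsum-supp0 B _ (\ j l -> vanish (Z.- (+ 3 Z.* j Z.+ + 1)) j (bnd1 j l))) (Zsum-supp0 B _ (\ j l -> vanish (+ 3 Z.* j) j (NP.m≤n⇒m≤1+n (∣3j∣ j l))))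
   where
   vanish : ∀ s j -> Z.∣ s ∣ N.≤ suc (3 N.* B) -> h j (s Z.+ c) ≡ + 0
   vanish s j l = Supp-shift {B} {h j} s (h-l j) c (NP.≤-<-trans (NP.+-monoʳ-≤ B l) b)

 quintuple : ∀ (ψ : ℤ -> ℤ) -> Zsum B (\ j -> Zsum B (\ l -> h j l Z.* (ψ (+ 3 Z.* j Z.+ + 1 Z.+ l) Z.+ ψ (Z.- (+ 3 Z.* j) Z.+ l)))) ≡ Zsum B (\ j -> Zsum B (\ m -> h j m Z.* ψ (+ 1 Z.+ (m Z.+ m))))
 quintuple ψ = trans (Zsum-cong B (\ j -> trans (Zsum-cong B (\ l -> ZP.*-distribˡ-+ (h j l) (ψ (+ 3 Z.* j Z.+ + 1 Z.+ l)) (ψ (Z.- (+ 3 Z.* j) Z.+ l)))) (Zsum-+ B (\ l -> h j l Z.* ψ (+ 3 Z.* j Z.+ + 1 Z.+ l)) (\ l -> h j l Z.* ψ (Z.- (+ 3 Z.* j) Z.+ l)))))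
  (trans (Zsum-+ B (\ j -> Zsum B (\ l -> h j l Z.* ψ (+ 3 Z.* j Z.+ + 1 Z.+ l))) (\ j -> Zsum B (\ l -> h j l Z.* ψ (Z.- (+ 3 Z.* j) Z.+ l)))) (trans (cong₂ Z._+_
   (regroup (\ j -> Z.- (+ 3 Z.* j Z.+ + 1)) ψ (\ j l -> + 3 Z.* j Z.+ + 1 Z.+ l) c1 bnd1)
   (regroup (\ j -> + 3 Z.* j) ψ (\ j l -> Z.- (+ 3 Z.* j) Z.+ l) c2 (\ j l -> NP.m≤n⇒m≤1+n (∣3j∣ j l))))
  (trans (sym (Zsum-+ C (\ c -> ψ c Z.* K1 c) (\ c -> ψ c Z.* K2 c))) (trans (Zsum-cong C (\ c -> sym (ZP.*-distribˡ-+ (ψ c) (K1 c) (K2 c))))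
  (trans (Zsum-parity {C} {\ c -> ψ c Z.* (K1 c Z.+ K2 c)} (\ c b -> trans (cong (ψ c Z.*_) (K-supp c b)) (ZP.*-zeroʳ (ψ c))))
  (trans (cong₂ Z._+_ (trans (Zsum-cong C (\ m -> trans (cong (ψ (m Z.+ m) Z.*_) (K-even m)) (ZP.*-zeroʳ (ψ (m Z.+ m))))) (Zsum-zero C))
     (trans (Zsum-cong C (\ m -> cong (ψ (+ 1 Z.+ (m Z.+ m)) Z.*_) (K-odd m))) (Zsum-mono {B} {C} {\ m -> ψ (+ 1 Z.+ (m Z.+ m)) Z.* K0 m} (NP.m≤m+n B _) K0-supp)))
  (trans (ZP.+-identityˡ (Zsum B (\ m -> ψ (+ 1 Z.+ (m Z.+ m)) Z.* K0 m))) (trans (Zsum-cong B (\ m -> sym (Zsum-* B (ψ (+ 1 Z.+ (m Z.+ m))) (\ j -> h j m))))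
  (trans (Zsum-swap B B (\ m j -> ψ (+ 1 Z.+ (m Z.+ m)) Z.* h j m)) (Zsum-cong B (\ j -> Zsum-cong B (\ m -> ZP.*-comm (ψ (+ 1 Z.+ (m Z.+ m))) (h j m)))))))))))))
  where
  c1 : ∀ j c -> + 3 Z.* j Z.+ + 1 Z.+ (Z.- (+ 3 Z.* j Z.+ + 1) Z.+ c) ≡ c
  c1 = solve-∀
  c2 : ∀ j c -> Z.- (+ 3 Z.* j) Z.+ (+ 3 Z.* j Z.+ c) ≡ c
  c2 = solve-∀
  K0-supp : Supp B (\ m -> ψ (+ 1 Z.+ (m Z.+ m)) Z.* K0 m)
  K0-supp m b = trans (cong (ψ (+ 1 Z.+ (m Z.+ m)) Z.*_) (trans (Zsum-cong B (\ j -> h-l j m b)) (Zsum-zero B))) (ZP.*-zeroʳ (ψ (+ 1 Z.+ (m Z.+ m))))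

-- The derivation q d/dq

D : Ser -> Ser
D f n = + n Z.* f n

D-cong : ∀ {f g} -> f ~ g -> D f ~ D g
D-cong h = mk \ n -> cong (+ n Z.*_) (at h n)

D-+ : ∀ f g -> D (f + g) ~ D f + D g
D-+ f g = mk \ n -> trans (cong (+ n Z.*_) (+-at f g n)) (trans (ZP.*-distribˡ-+ (+ n) (f n) (g n)) (sym (+-at (D f) (D g) n)))

D-neg : ∀ f -> D (- f) ~ - D f
D-neg f = mk \ n -> trans (cong (+ n Z.*_) (neg-at f n)) (trans (sym (ZP.neg-distribʳ-* (+ n) (f n))) (sym (neg-at (D f) n)))

D-* : ∀ f g -> D (f * g) ~ D f * g + f * D g
D-* f g = mk \ n -> trans (go f n) (sym (+-at (D f * g) (f * D g) n))
 where
 r1 : ∀ n a b -> + 0 ≡ + 0 Z.* b Z.+ a Z.* (+ 0 Z.* b)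
 r1 = solve-∀
 r2 : ∀ n a b c x y -> n Z.* c ≡ x Z.+ y -> (+ 1 Z.+ n) Z.* (a Z.* b Z.+ c) ≡ (+ 0 Z.* a Z.* b Z.+ (x Z.+ c)) Z.+ (a Z.* ((+ 1 Z.+ n) Z.* b) Z.+ y)
 r2 n a b c x y h = trans (l n a b c) (trans (cong (\ z -> (+ 1 Z.+ n) Z.* (a Z.* b) Z.+ c Z.+ z) h) (l' n a b c x y))
  where
  l : ∀ n a b c -> (+ 1 Z.+ n) Z.* (a Z.* b Z.+ c) ≡ (+ 1 Z.+ n) Z.* (a Z.* b) Z.+ c Z.+ n Z.* c
  l = solve-∀
  l' : ∀ n a b c x y -> (+ 1 Z.+ n) Z.* (a Z.* b) Z.+ c Z.+ (x Z.+ y) ≡ (+ 0 Z.* a Z.* b Z.+ (x Z.+ c)) Z.+ (a Z.* ((+ 1 Z.+ n) Z.* b) Z.+ y)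
  l' = solve-∀
 tail : ∀ f n -> (D f ∘ suc) n ≡ (D (f ∘ suc) + f ∘ suc) n
 tail f n = trans (l (+ n) (f (suc n))) (sym (+-at (D (f ∘ suc)) (f ∘ suc) n))
  where
  l : ∀ n x -> (+ 1 Z.+ n) Z.* x ≡ n Z.* x Z.+ x
  l = solve-∀
 go : ∀ f n -> + n Z.* (f * g) n ≡ (D f * g) n Z.+ (f * D g) n
 go f zero = r1 (+ 0) (f 0) (g 0)
 go f (suc n) = trans (r2 (+ n) (f 0) (g (suc n)) (conv (f ∘ suc) g n) ((D (f ∘ suc) * g) n) (((f ∘ suc) * D g) n) (go (f ∘ suc) n))
  (cong (\ z -> (+ 0 Z.* f 0 Z.* g (suc n) Z.+ z) Z.+ (f * D g) (suc n)) (sym (trans (at (*ʳ {g} (mk (tail f))) n) (trans (at (distribʳ g (D (f ∘ suc)) (f ∘ suc)) n) (+-at (D (f ∘ suc) * g) ((f ∘ suc) * g) n)))))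

record Derivation (𝒟 : Ser -> Ser) : Set where
 field
  𝒟-cong : ∀ {f g} -> f ~ g -> 𝒟 f ~ 𝒟 g
  𝒟-+ : ∀ f g -> 𝒟 (f + g) ~ 𝒟 f + 𝒟 g
  𝒟-* : ∀ f g -> 𝒟 (f * g) ~ 𝒟 f * g + f * 𝒟 g

D-derivation : Derivation D
D-derivation = record { 𝒟-cong = D-cong ; 𝒟-+ = D-+ ; 𝒟-* = D-* }

scaled : ℤ -> (Ser -> Ser) -> Ser -> Ser
scaled c 𝒟 f = ι c * 𝒟 f

scaled-derivation : ∀ c {𝒟} -> Derivation 𝒟 -> Derivation (scaled c 𝒟)
scaled-derivation c {𝒟} d = record
 { 𝒟-cong = \ h -> *ˡ {ι c} (𝒟-cong h)
 ; 𝒟-+ = \ f g -> tr (*ˡ {ι c} (𝒟-+ f g)) (distribˡ (ι c) (𝒟 f) (𝒟 g))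
 ; 𝒟-* = \ f g -> tr (*ˡ {ι c} (𝒟-* f g)) (solve (v0 :* (v1 :* v2 :+ v3 :* v4)) (v0 :* v1 :* v2 :+ v3 :* (v0 :* v4)) refl (ι c ∷ 𝒟 f ∷ g ∷ f ∷ 𝒟 g ∷ [])) }
 where open Derivation d

-- Symbolic differentiation: s and d express the variables and their
-- derivatives in a possibly larger set of variables.
substE : ∀ {n m} -> Vec (Expr m) n -> Expr n -> Expr m
substE s (K c) = K c
substE s (X i) = Vec.lookup s i
substE s (a :+ b) = substE s a :+ substE s b
substE s (a :* b) = substE s a :* substE s b
substE s (:- a) = :- substE s a
substE s (a :^ k) = substE s a :^ k

∂ : ∀ {n m} -> Vec (Expr m) n -> Vec (Expr m) n -> Expr n -> Expr m
∂ s d (K c) = # 0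
∂ s d (X i) = Vec.lookup d i
∂ s d (a :+ b) = ∂ s d a :+ ∂ s d b
∂ s d (a :* b) = ∂ s d a :* substE s b :+ substE s a :* ∂ s d b
∂ s d (:- a) = :- ∂ s d a
∂ s d (a :^ zero) = # 0
∂ s d (a :^ suc k) = K (+ suc k) :* substE s a :^ k :* ∂ s d a

module Differentiate {𝒟 : Ser -> Ser} (der : Derivation 𝒟) where
 open Derivation der public

 𝒟-0 : 𝒟 0# ~ 0#
 𝒟-0 = begin
  𝒟 0# ≈⟨ solve v0 (v0 :+ v0 :- v0) refl (𝒟 0# ∷ []) ⟩
  𝒟 0# + 𝒟 0# - 𝒟 0# ≈⟨ +ʳ (tr (sy (𝒟-+ 0# 0#)) (𝒟-cong (+-identityʳ 0#))) ⟩
  𝒟 0# - 𝒟 0# ≈⟨ -‿inverseʳ (𝒟 0#) ⟩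
  0# ∎

 𝒟-neg : ∀ f -> 𝒟 (- f) ~ - 𝒟 f
 𝒟-neg f = begin
  𝒟 (- f) ≈⟨ solve v0 (v1 :+ v0 :- v1) refl (𝒟 (- f) ∷ 𝒟 f ∷ []) ⟩
  𝒟 f + 𝒟 (- f) - 𝒟 f ≈⟨ +ʳ (tr (sy (𝒟-+ f (- f))) (tr (𝒟-cong (-‿inverseʳ f)) 𝒟-0)) ⟩
  0# - 𝒟 f ≈⟨ +-identityˡ (- 𝒟 f) ⟩
  - 𝒟 f ∎

 𝒟-1 : 𝒟 1# ~ 0#
 𝒟-1 = begin
  𝒟 1# ≈⟨ solve v0 (v0 :+ v0 :- v0) refl (𝒟 1# ∷ []) ⟩
  𝒟 1# + 𝒟 1# - 𝒟 1# ≈⟨ +ʳ (tr (+-cong (sy (*-identityʳ (𝒟 1#))) (sy (*-identityˡ (𝒟 1#)))) (tr (sy (𝒟-* 1# 1#)) (𝒟-cong (*-identityˡ 1#)))) ⟩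
  𝒟 1# - 𝒟 1# ≈⟨ -‿inverseʳ (𝒟 1#) ⟩
  0# ∎

 𝒟-ι : ∀ c -> 𝒟 (ι c) ~ 0#
 𝒟-ι (+ n) = go n
  where
  go : ∀ n -> 𝒟 (ι (+ n)) ~ 0#
  go zero = tr (𝒟-cong ι-0) 𝒟-0
  go (suc n) = tr (𝒟-cong (tr (ι-+ (+ 1) (+ n)) (+ʳ ι-1))) (tr (𝒟-+ 1# (ι (+ n))) (tr (+-cong 𝒟-1 (go n)) (+-identityʳ 0#)))
 𝒟-ι -[1+ n ] = tr (𝒟-cong (ι-neg (+ suc n))) (tr (𝒟-neg (ι (+ suc n))) (tr (-‿cong (𝒟-ι (+ suc n))) -0#≈0#))

 𝒟-^ : ∀ f k -> 𝒟 (f ^ suc k) ~ ι (+ suc k) * f ^ k * 𝒟 f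
 𝒟-^ f zero = tr (𝒟-cong (*-identityʳ f)) (sy (tr (*ʳ (tr (*-identityʳ (ι (+ 1))) ι-1)) (*-identityˡ (𝒟 f))))
 𝒟-^ f (suc k) = tr (𝒟-* f (f ^ suc k)) (tr (+ˡ (*ˡ {f} (𝒟-^ f k)))
  (tr (solve (v0 :* (v1 :* v2) :+ v1 :* (v3 :* v2 :* v0)) ((# 1 :+ v3) :* (v1 :* v2) :* v0) refl (𝒟 f ∷ f ∷ f ^ k ∷ ι (+ suc k) ∷ []))
   (*ʳ {𝒟 f} (*ʳ {f * f ^ k} (sy (ι-+ (+ 1) (+ suc k)))))))

 substE-⟦⟧ : ∀ {n m} (s : Vec (Expr m) n) (e : Expr n) ρ ρ' -> (∀ i -> Vec.lookup ρ i ~ ⟦ Vec.lookup s i ⟧ ρ') -> ⟦ e ⟧ ρ ~ ⟦ substE s e ⟧ ρ'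
 substE-⟦⟧ s (K c) ρ ρ' h = ≈-refl
 substE-⟦⟧ s (X i) ρ ρ' h = h i
 substE-⟦⟧ s (a :+ b) ρ ρ' h = +-cong (substE-⟦⟧ s a ρ ρ' h) (substE-⟦⟧ s b ρ ρ' h)
 substE-⟦⟧ s (a :* b) ρ ρ' h = *-cong (substE-⟦⟧ s a ρ ρ' h) (substE-⟦⟧ s b ρ ρ' h)
 substE-⟦⟧ s (:- a) ρ ρ' h = -‿cong (substE-⟦⟧ s a ρ ρ' h)
 substE-⟦⟧ s (a :^ k) ρ ρ' h = ^-cong k (substE-⟦⟧ s a ρ ρ' h)

 differentiate : ∀ {n m} (s d : Vec (Expr m) n) (e : Expr n) ρ ρ' -> (∀ i -> Vec.lookup ρ i ~ ⟦ Vec.lookup s i ⟧ ρ') ->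
               (∀ i -> 𝒟 (Vec.lookup ρ i) ~ ⟦ Vec.lookup d i ⟧ ρ') -> 𝒟 (⟦ e ⟧ ρ) ~ ⟦ ∂ s d e ⟧ ρ'
 differentiate s d (K c) ρ ρ' h k = tr (𝒟-ι c) (sy ι-0)
 differentiate s d (X i) ρ ρ' h k = k i
 differentiate s d (a :+ b) ρ ρ' h k = tr (𝒟-+ (⟦ a ⟧ ρ) (⟦ b ⟧ ρ)) (+-cong (differentiate s d a ρ ρ' h k) (differentiate s d b ρ ρ' h k))
 differentiate s d (a :* b) ρ ρ' h k = tr (𝒟-* (⟦ a ⟧ ρ) (⟦ b ⟧ ρ))
  (+-cong (*-cong (differentiate s d a ρ ρ' h k) (substE-⟦⟧ s b ρ ρ' h)) (*-cong (substE-⟦⟧ s a ρ ρ' h) (differentiate s d b ρ ρ' h k)))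
 differentiate s d (:- a) ρ ρ' h k = tr (𝒟-neg (⟦ a ⟧ ρ)) (-‿cong (differentiate s d a ρ ρ' h k))
 differentiate s d (a :^ zero) ρ ρ' h k = tr 𝒟-1 (sy ι-0)
 differentiate s d (a :^ suc j) ρ ρ' h k = tr (𝒟-^ (⟦ a ⟧ ρ) j)
  (*-cong (*ˡ {ι (+ suc j)} (^-cong j (substE-⟦⟧ s a ρ ρ' h))) (differentiate s d a ρ ρ' h k))

-- Sums of α(j) q^(x j) over ℤ

Growing : (ℤ -> ℕ) -> Set
Growing x = ∀ j {B} -> suc B N.< Z.∣ j ∣ -> B N.< x j

family : (ℤ -> ℤ) -> (ℤ -> ℕ) -> Ser
family α x n = Zsum (suc n) (\ j -> α j Z.* (q ^ x j) n)

private
 ZS : ℕ -> (ℤ -> Ser) -> Ser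
 ZS zero F = F (+ 0)
 ZS (suc B) F = ZS B F + (F (+ suc B) + F -[1+ B ])

 ZS-at : ∀ B F n -> ZS B F n ≡ Zsum B (\ j -> F j n)
 ZS-at zero F n = refl
 ZS-at (suc B) F n = trans (+-at (ZS B F) (F (+ suc B) + F -[1+ B ]) n) (cong₂ Z._+_ (ZS-at B F n) (+-at (F (+ suc B)) (F -[1+ B ]) n))

 ZS-* : ∀ B F Y -> ZS B F * Y ~ ZS B (\ j -> F j * Y)
 ZS-* zero F Y = ≈-refl
 ZS-* (suc B) F Y = tr (distribʳ Y (ZS B F) (F (+ suc B) + F -[1+ B ])) (+-cong (ZS-* B F Y) (distribʳ Y (F (+ suc B)) (F -[1+ B ])))

family-* : ∀ α x -> Growing x -> ∀ Y n -> (family α x * Y) n ≡ Zsum (suc n) (\ j -> α j Z.* (q ^ x j * Y) n)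
family-* α x gr Y n = trans (*-cong[] {family α x} {F} {Y} {Y} n fam (\ _ _ -> refl) n NP.≤-refl)
 (trans (at (ZS-* (suc n) (\ j -> constˢ (α j) * q ^ x j) Y) n) (trans (ZS-at (suc n) (\ j -> constˢ (α j) * q ^ x j * Y) n)
  (Zsum-cong (suc n) (\ j -> trans (at (*-assoc (constˢ (α j)) (q ^ x j) Y) n) (const-* (α j) (q ^ x j * Y) n)))))
 where
 F : Ser
 F = ZS (suc n) (\ j -> constˢ (α j) * q ^ x j)
 fam : family α x ≈[ n ] F
 fam i l = trans (sym (Zsum-mono {suc i} {suc n} {\ j -> α j Z.* (q ^ x j) i} (s≤s l) (\ j b -> trans (cong (α j Z.*_) (q^-zero (x j) i (gr j b))) (ZP.*-zeroʳ (α j)))))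
  (sym (trans (ZS-at (suc n) (\ j -> constˢ (α j) * q ^ x j) i) (Zsum-cong (suc n) (\ j -> const-* (α j) (q ^ x j) i))))

family-cong : ∀ {α β} x -> (∀ j -> α j ≡ β j) -> family α x ~ family β x
family-cong x h = mk \ n -> Zsum-cong (suc n) (\ j -> cong (Z._* (q ^ x j) n) (h j))

family-D : ∀ α x c -> (ι c * D (family α x)) + family α x ~ family (\ j -> α j Z.* (c Z.* + x j Z.+ + 1)) x
family-D α x c = mk \ n -> trans (+-at (ι c * D (family α x)) (family α x) n) (trans (cong (Z._+ family α x n) (trans (ι-*ˢ c (D (family α x)) n) (cong (Z._* D (family α x) n) (ι-ℤ c))))
 (trans (cong (Z._+ family α x n) (trans (sym (ZP.*-assoc c (+ n) (family α x n))) (sym (Zsum-* (suc n) (c Z.* + n) (\ j -> α j Z.* (q ^ x j) n)))))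
 (trans (sym (Zsum-+ (suc n) (\ j -> c Z.* + n Z.* (α j Z.* (q ^ x j) n)) (\ j -> α j Z.* (q ^ x j) n))) (Zsum-cong (suc n) (\ j -> pt n j)))))
 where
 weight : ∀ t n -> + n Z.* (q ^ t) n ≡ + t Z.* (q ^ t) n
 weight t n with n NP.≟ t
 ... | yes refl = refl
 ... | no h = trans (cong (+ n Z.*_) z) (trans (ZP.*-zeroʳ (+ n)) (sym (trans (cong (+ t Z.*_) z) (ZP.*-zeroʳ (+ t)))))
  where
  z : (q ^ t) n ≡ + 0
  z with NP.<-cmp n t
  ... | Relation.Binary.Definitions.tri< l _ _ = q^-zero t n l
  ... | Relation.Binary.Definitions.tri≈ _ e _ = ⊥-elim (h e)
  ... | Relation.Binary.Definitions.tri> _ _ l = trans (sym (at (*-identityʳ (q ^ t)) n)) (trans (cong (q ^ t * 1#) (sym (NP.m+[n∸m]≡n (NP.<⇒≤ l)))) (trans (q^-shift t 1# (n ∸ t)) (one-pos (n ∸ t) (NP.m<n⇒0<n∸m l))))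
   where
   one-pos : ∀ k -> 0 N.< k -> 1# k ≡ + 0
   one-pos (suc k) _ = refl
 l1 : ∀ c n a w -> c Z.* n Z.* (a Z.* w) ≡ a Z.* c Z.* (n Z.* w)
 l1 = solve-∀
 l2 : ∀ c t a w -> a Z.* c Z.* (t Z.* w) Z.+ a Z.* w ≡ a Z.* (c Z.* t Z.+ + 1) Z.* w
 l2 = solve-∀
 pt : ∀ n j -> c Z.* + n Z.* (α j Z.* (q ^ x j) n) Z.+ α j Z.* (q ^ x j) n ≡ α j Z.* (c Z.* + x j Z.+ + 1) Z.* (q ^ x j) n
 pt n j = trans (cong (Z._+ α j Z.* (q ^ x j) n) (trans (l1 c (+ n) (α j) ((q ^ x j) n)) (cong (α j Z.* c Z.*_) (weight (x j) n)))) (l2 c (+ x j) (α j) ((q ^ x j) n))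

T-growing : Growing T
T-growing j l = T-large j l

G-growing : Growing G
G-growing j l = NP.<-≤-trans (T-large j l) (NP.m≤m+n (T j) _)

-- Ramanujan's differential equations from the moments of the quintuple product

coefficient-ι : ∀ c f n -> (ι c * f) n ≡ c Z.* f n
coefficient-ι c f n = trans (ι-*ˢ c f n) (cong (Z._* f n) (ι-ℤ c))

ι-head : ∀ c -> ι c 0 ≡ c
ι-head c = trans (ι-at-0 c) (ι-ℤ c)

regular-ι : ∀ c -> ¬ c ≡ + 0 -> Regular (ι c)
regular-ι c h = regular-nz {ι c} (\ e -> h (trans (sym (ι-head c)) e))

private
 -- With a = 6j + 1 and b = 2l + 1 the doubled exponents of `quintuple` are b + a, b - a and 2b,
 -- while a² = 24 G j + 1 and b² = 8 T l + 1 turn squares into derivatives.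
 a b : ℤ -> ℤ
 a j = + 3 Z.* j Z.+ + 1 Z.+ + 3 Z.* j
 b l = + 1 Z.+ (l Z.+ l)

 a² : ℕ -> ℤ -> ℤ
 a² zero j = ℤR.ι (+ 1)
 a² (suc i) j = a² i j Z.* (a j Z.* a j)

 b² : ℕ -> ℤ -> ℤ
 b² zero l = b l
 b² (suc i) l = b² i l Z.* (b l Z.* b l)

 ε γ : ℕ -> Ser
 ε i = family (\ j -> σ j Z.* a² i j) G
 γ i = family (\ l -> σ l Z.* b² i l) T

 ε-suc : ∀ i -> ι (+ 24) * D (ε i) + ε i ~ ε (suc i)
 ε-suc i = tr (family-D (\ j -> σ j Z.* a² i j) G (+ 24)) (family-cong G (\ j -> trans (cong (σ j Z.* a² i j Z.*_) (sq j)) (ZP.*-assoc (σ j) (a² i j) (a j Z.* a j))))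
  where
  l1 : ∀ j -> + 24 Z.* j Z.+ + 1 ≡ + 12 Z.* (+ 2 Z.* j) Z.+ + 1
  l1 = solve-∀
  l2 : ∀ j -> + 12 Z.* (+ 3 Z.* (j Z.* j) Z.+ j) Z.+ + 1 ≡ (+ 3 Z.* j Z.+ + 1 Z.+ + 3 Z.* j) Z.* (+ 3 Z.* j Z.+ + 1 Z.+ + 3 Z.* j)
  l2 = solve-∀
  sq : ∀ j -> + 24 Z.* + G j Z.+ + 1 ≡ a j Z.* a j
  sq j = trans (l1 (+ G j)) (trans (cong (\ z -> + 12 Z.* z Z.+ + 1) (G-double j)) (l2 j))

 γ-suc : ∀ i -> ι (+ 8) * D (γ i) + γ i ~ γ (suc i)
 γ-suc i = tr (family-D (\ l -> σ l Z.* b² i l) T (+ 8)) (family-cong T (\ l -> trans (cong (σ l Z.* b² i l Z.*_) (sq l)) (ZP.*-assoc (σ l) (b² i l) (b l Z.* b l))))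
  where
  l1 : ∀ t -> + 8 Z.* t Z.+ + 1 ≡ + 4 Z.* (+ 2 Z.* t) Z.+ + 1
  l1 = solve-∀
  l2 : ∀ l -> + 4 Z.* (l Z.* l Z.+ l) Z.+ + 1 ≡ (+ 1 Z.+ (l Z.+ l)) Z.* (+ 1 Z.+ (l Z.+ l))
  l2 = solve-∀
  sq : ∀ l -> + 8 Z.* + T l Z.+ + 1 ≡ b l Z.* b l
  sq l = trans (l1 (+ T l)) (trans (cong (\ z -> + 4 Z.* z Z.+ + 1) (T-double l)) (l2 l))

 -- In degree n the products `ε i * γ k` are double sums over the box of `Quintuple`, so each
 -- polynomial choice of ψ becomes a linear relation between such products.
 module Double (n B : ℕ) (B≡ : B ≡ suc n) where
  open Quintuple n B B≡

  DS : (ℤ -> ℤ -> ℤ) -> ℤ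
  DS Φ = Zsum B (\ j -> Zsum B (\ l -> h j l Z.* Φ j l))

  DS-cong : ∀ {Φ Ψ : ℤ -> ℤ -> ℤ} -> (∀ j l -> Φ j l ≡ Ψ j l) -> DS Φ ≡ DS Ψ
  DS-cong e = Zsum-cong B (\ j -> Zsum-cong B (\ l -> cong (h j l Z.*_) (e j l)))

  DS-+ : ∀ (Φ Ψ : ℤ -> ℤ -> ℤ) -> DS (\ j l -> Φ j l Z.+ Ψ j l) ≡ DS Φ Z.+ DS Ψ
  DS-+ Φ Ψ = trans (Zsum-cong B (\ j -> trans (Zsum-cong B (\ l -> ZP.*-distribˡ-+ (h j l) (Φ j l) (Ψ j l))) (Zsum-+ B (\ l -> h j l Z.* Φ j l) (\ l -> h j l Z.* Ψ j l))))
   (Zsum-+ B (\ j -> Zsum B (\ l -> h j l Z.* Φ j l)) (\ j -> Zsum B (\ l -> h j l Z.* Ψ j l)))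

  DS-* : ∀ c (Φ : ℤ -> ℤ -> ℤ) -> DS (\ j l -> c Z.* Φ j l) ≡ c Z.* DS Φ
  DS-* c Φ = trans (Zsum-cong B (\ j -> trans (Zsum-cong B (\ l -> lem (h j l) c (Φ j l))) (Zsum-* B c (\ l -> h j l Z.* Φ j l)))) (Zsum-* B c (\ j -> Zsum B (\ l -> h j l Z.* Φ j l)))
   where
   lem : ∀ h c x -> h Z.* (c Z.* x) ≡ c Z.* (h Z.* x)
   lem = solve-∀

  product : ∀ i k -> (ε i * γ k) n ≡ DS (\ j l -> a² i j Z.* b² k l)
  product i k = trans (family-* (\ j -> σ j Z.* a² i j) G G-growing (γ k) n) (trans (cong (\ B -> Zsum B (\ j -> σ j Z.* a² i j Z.* (q ^ G j * γ k) n)) (sym B≡)) (Zsum-cong B inner))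
   where
   lem : ∀ s a t c x -> s Z.* a Z.* (t Z.* c Z.* x) ≡ s Z.* t Z.* x Z.* (a Z.* c)
   lem = solve-∀
   inner : ∀ j -> σ j Z.* a² i j Z.* (q ^ G j * γ k) n ≡ Zsum B (\ l -> h j l Z.* (a² i j Z.* b² k l))
   inner j = trans (cong (σ j Z.* a² i j Z.*_) (trans (at (*-comm (q ^ G j) (γ k)) n) (trans (family-* (\ l -> σ l Z.* b² k l) T T-growing (q ^ G j) n) (cong (\ B -> Zsum B (\ l -> σ l Z.* b² k l Z.* (q ^ T l * q ^ G j) n)) (sym B≡)))))
     (trans (sym (Zsum-* B (σ j Z.* a² i j) (\ l -> σ l Z.* b² k l Z.* (q ^ T l * q ^ G j) n)))
     (Zsum-cong B (\ l -> trans (lem (σ j) (a² i j) (σ l) (b² k l) ((q ^ T l * q ^ G j) n))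
       (cong₂ (\ s x -> s Z.* x Z.* (a² i j Z.* b² k l)) (sym (σ-+ j l)) (at (tr (*-comm (q ^ T l) (q ^ G j)) (sy (q^-+ (G j) (T l)))) n)))))

  comb : List (ℤ × ℕ × ℕ) -> Ser
  comb [] = 0#
  comb ((c , i , k) ∷ w) = ι c * (ε i * γ k) + comb w

  combℤ : List (ℤ × ℕ × ℕ) -> ℤ -> ℤ -> ℤ
  combℤ [] j l = ℤR.ι (+ 0)
  combℤ ((c , i , k) ∷ w) j l = ℤR.ι c Z.* (a² i j Z.* b² k l) Z.+ combℤ w j l

  comb-at : ∀ w -> comb w n ≡ DS (combℤ w)
  comb-at [] = sym (trans (DS-cong (\ j l -> ℤR.ι-0)) (trans (DS-* (+ 0) (\ _ _ -> + 0)) refl))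
  comb-at ((c , i , k) ∷ w) = trans (+-at (ι c * (ε i * γ k)) (comb w) n) (trans (cong₂ Z._+_ (trans (ι-*ˢ c (ε i * γ k) n) (trans (cong (ℤR.ι c Z.*_) (product i k)) (sym (DS-* (ℤR.ι c) (\ j l -> a² i j Z.* b² k l))))) (comb-at w))
   (sym (DS-+ (\ j l -> ℤR.ι c Z.* (a² i j Z.* b² k l)) (combℤ w))))

  identity : ∀ (ψ : ℤ -> ℤ) w w' -> (∀ j l -> ψ (+ 3 Z.* j Z.+ + 1 Z.+ l) Z.+ ψ (Z.- (+ 3 Z.* j) Z.+ l) ≡ combℤ w j l) ->
            (∀ j m -> ψ (+ 1 Z.+ (m Z.+ m)) ≡ combℤ w' j m) -> comb w n ≡ comb w' n
  identity ψ w w' e e' = trans (comb-at w) (trans (DS-cong (\ j l -> sym (e j l))) (trans (quintuple ψ) (trans (DS-cong e') (sym (comb-at w')))))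

 aE bE cE dE : Expr 3
 aE = v0 :+ v1 :+ v0
 bE = v1 :+ (v2 :+ v2)
 cE = (v0 :+ v1 :+ v2) :+ (v0 :+ v1 :+ v2)
 dE = (:- v0 :+ v2) :+ (:- v0 :+ v2)
 a²E b²E : ℕ -> Expr 3
 a²E zero = # 1
 a²E (suc i) = a²E i :* (aE :* aE)
 b²E zero = bE
 b²E (suc i) = b²E i :* (bE :* bE)

 termE : ℤ -> ℕ -> ℕ -> Expr 3 -> Expr 3
 termE c i k e = K c :* (a²E i :* b²E k) :+ e

 -- ψ(c) = (2c)³: the sum (b + a)³ + (b - a)³ = 2b³ + 6a²b is compared with (2b)³. The relation is
 -- of first order and identifies `ε 0`.
 cubic : ι (+ 2) * (ε 0 * γ 1) + (ι (+ 6) * (ε 1 * γ 0) + 0#) ~ ι (+ 8) * (ε 0 * γ 1) + 0#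
 cubic = mk \ n -> Double.identity n (suc n) refl (\ c -> (c Z.+ c) ℤR.^ 3) ((+ 2 , 0 , 1) ∷ (+ 6 , 1 , 0) ∷ []) ((+ 8 , 0 , 1) ∷ [])
  (\ j l -> ℤR.solve (cE :^ 3 :+ dE :^ 3) (termE (+ 2) 0 1 (termE (+ 6) 1 0 (# 0))) refl (+ 3 Z.* j ∷ 1 ,, l ∷ []))
  (\ j l -> ℤR.solve ((bE :+ bE) :^ 3) (termE (+ 8) 0 1 (# 0)) refl (+ 3 Z.* j ∷ 1 ,, l ∷ []))

 -- ψ(c) = (2c)⁹ leads to weight 8, which is the weight of both `S` and `Q * Q`.
 nonic : ι (+ 2) * (ε 0 * γ 4) + (ι (+ 72) * (ε 1 * γ 3) + (ι (+ 252) * (ε 2 * γ 2) + (ι (+ 168) * (ε 3 * γ 1) + (ι (+ 18) * (ε 4 * γ 0) + 0#)))) ~ ι (+ 512) * (ε 0 * γ 4) + 0#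
 nonic = mk \ n -> Double.identity n (suc n) refl (\ c -> (c Z.+ c) ℤR.^ 9) ((+ 2 , 0 , 4) ∷ (+ 72 , 1 , 3) ∷ (+ 252 , 2 , 2) ∷ (+ 168 , 3 , 1) ∷ (+ 18 , 4 , 0) ∷ []) ((+ 512 , 0 , 4) ∷ [])
  (\ j l -> ℤR.solve (cE :^ 9 :+ dE :^ 9) (termE (+ 2) 0 4 (termE (+ 72) 1 3 (termE (+ 252) 2 2 (termE (+ 168) 3 1 (termE (+ 18) 4 0 (# 0)))))) refl (+ 3 Z.* j ∷ 1 ,, l ∷ []))
  (\ j l -> ℤR.solve ((bE :+ bE) :^ 9) (termE (+ 512) 0 4 (# 0)) refl (+ 3 Z.* j ∷ 1 ,, l ∷ []))

moment-ϑ-family : ∀ (φ : ℤ -> ℤ) -> Laurent.moment φ ϑ ~ family φ T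
moment-ϑ-family φ = mk \ n -> trans (expand' (ϑ n) (suc n) φ (\ m l -> trans (at (coef-ϑ m) n) (q^-supp n m l)))
 (Zsum-cong (suc n) (\ m -> cong (φ m Z.*_) (at (coef-ϑ m) n)))

constant-horner : ∀ p c -> isZero 1 (norm {1} (hE p v0 :- K c)) ≡ true -> ∀ m -> ℤR.horner p m ≡ c
constant-horner p c h m = trans (sym (ℤR.⟦hornerE⟧ p v0 (m ∷ []))) (trans (ℤR.solve (hE p v0) (K c) h (m ∷ [])) (ι-ℤ c))

private
 -- Jacobi's cube identity as a first moment of the triple product: one backward difference of 2m +
 -- 1 is the constant 2.
 γ-π : γ 0 ~ ι (+ 2) * π ^ 3
 γ-π = tr (family-cong T (\ l -> cong (σ l Z.*_) (lem l))) (tr (sy (moment-ϑ-family (signed p1))) (tr (Laurent.moment-cong (signed p1) tt (L.sy (L.*-identityʳ ϑ)))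
  (tr (moment-ϑ^ 1 p1 (+ 2) (constant-horner (∇ p1) (+ 2) refl)) (solve (v0 :^ 1 :* (# 2 :* (v0 :* v0) :^ 1)) (# 2 :* v0 :^ 3) refl (π ∷ [])))))
  where
  p1 : List ℤ
  p1 = 1 ,, 2 ,, []
  lem : ∀ l -> b l ≡ ℤR.horner p1 l
  lem l = trans (cong (Z._+ (l Z.+ l)) (sym (ι-ℤ (+ 1)))) (ℤR.solve (# 1 :+ (v0 :+ v0)) (hE (1 ,, 2 ,, []) v0) refl (l ∷ []))

-- The difference e satisfies g D e = e D g. Once its lower coefficients vanish, degree n of this
-- equation reads n eₙ = 0, because g starts with 1.
wronskian-unique : ∀ f g -> f 0 ≡ + 1 -> g 0 ≡ + 1 -> D f * g ~ f * D g -> f ~ g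
wronskian-unique f g f0 g0 h = from-diff (mk (strong _ step))
 where
 e = f - g
 eq : g * D e ~ e * D g
 eq = by1 h (tr (*ˡ {g} (tr (D-+ f (- g)) (+ˡ (D-neg g))))
  (solve (v1 :* (v2 :- v3)) ((v0 :- v1) :* v3 :+ # 1 :* (v2 :* v1 :- v0 :* v3)) refl (f ∷ g ∷ D f ∷ D g ∷ [])))
 step : ∀ n -> (∀ i -> i N.< n -> e i ≡ + 0) -> e n ≡ + 0
 step zero ih = trans (+-at f (- g) 0) (trans (cong₂ Z._+_ f0 (trans (neg-at g 0) (cong Z.-_ g0))) refl)
 step (suc n) ih = case ZP.i*j≡0⇒i≡0∨j≡0 (+ suc n) zero-product of \ { (inj₂ z) -> z }
  where
  zero-product : + suc n Z.* e (suc n) ≡ + 0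
  zero-product = trans (sym (trans (*-leading g (D e) (suc n) (\ i l -> trans (cong (+ i Z.*_) (ih i l)) (ZP.*-zeroʳ (+ i)))) (trans (cong (Z._* D e (suc n)) g0) (ZP.*-identityˡ _))))
   (trans (at eq (suc n)) (trans (at (*-comm e (D g)) (suc n)) (*-leading (D g) e (suc n) ih)))

private
 γ' : D (γ 0) ~ ι (+ 6) * π ^ 2 * D π
 γ' = tr (D-cong γ-π) (tr (D-* (ι (+ 2)) (π ^ 3)) (tr (+-cong (*ʳ {π ^ 3} (𝒟-ι (+ 2))) (*ˡ {ι (+ 2)} (𝒟-^ π 2)))
  (tr (+ʳ (zeroˡ (π ^ 3))) (tr (+-identityˡ _) (solve (# 2 :* (# 3 :* v0 :^ 2 :* v1)) (# 6 :* v0 :^ 2 :* v1) refl (π ∷ D π ∷ []))))))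
  where open Differentiate D-derivation

 -- Euler's pentagonal number theorem. With γ₀ = 2π³ the relation `cubic` says that `ε 0` and `π`
 -- have the same logarithmic derivative.
 ε≈π : ε 0 ~ π
 ε≈π = wronskian-unique (ε 0) π (trans (at (family-cong {\ j -> σ j Z.* a² 0 j} {σ} G (\ j -> trans (cong (σ j Z.*_) (ι-ℤ (+ 1))) (ZP.*-identityʳ (σ j)))) 0) refl) refl
  (from-diff (regular-* {ι (+ 288)} {π ^ 2} (regular-ι (+ 288) (\ ())) (regular-1 {π ^ 2} refl) (D (ε 0) * π - ε 0 * D π)
   (tr (by1 {c = ι (+ 1)} cubic' (solve (# 288 :* v0 :^ 2 :* (v1 :* v0 :- v2 :* v3))
     (# 0 :+ # 1 :* (# 2 :* (v2 :* xE) :+ (# 6 :* (yE :* zE) :+ # 0) :- (# 8 :* (v2 :* xE) :+ # 0))) refl ρ)) ι-0)))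
  where
  ρ = π ∷ D (ε 0) ∷ ε 0 ∷ D π ∷ []
  xE yE zE : Expr 4
  xE = # 8 :* (# 6 :* v0 :^ 2 :* v3) :+ # 2 :* v0 :^ 3
  yE = # 24 :* v1 :+ v2
  zE = # 2 :* v0 :^ 3
  x≈ : γ 1 ~ ⟦ xE ⟧ ρ
  x≈ = tr (sy (γ-suc 0)) (+-cong (*ˡ {ι (+ 8)} γ') γ-π)
  cubic' : ⟦ # 2 :* (v2 :* xE) :+ (# 6 :* (yE :* zE) :+ # 0) ⟧ ρ ~ ⟦ # 8 :* (v2 :* xE) :+ # 0 ⟧ ρ
  cubic' = tr (+-cong (*ˡ {ι (+ 2)} (*ˡ {ε 0} (sy x≈))) (+-cong (*ˡ {ι (+ 6)} (*-cong (ε-suc 0) (sy γ-π))) ι-0))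
   (tr cubic (+-cong (*ˡ {ι (+ 8)} (*ˡ {ε 0} x≈)) (sy ι-0)))

λ̂ : Ser
λ̂ = D π * inv π

Dπ : D π ~ λ̂ * π
Dπ = sy (tr (*-assoc (D π) (inv π) π) (tr (*ˡ {D π} (tr (*-comm (inv π) π) (inv-inverse π refl))) (*-identityʳ (D π))))

-- The Eisenstein series of weights 2, 4 and 6, each obtained from the
-- derivative of the previous one
P Q R : Ser
P = ι (+ 1) + ι (+ 24) * λ̂
Q = P * P - ι (+ 12) * D P
R = P * Q - ι (+ 3) * D Q

private
 -- The next term in the pattern of `P`, `Q`, `R`, of weight 8; Ramanujan's third equation amounts
 -- to `S≈Q²`.
 S : Ser
 S = P * R - ι (+ 2) * D R

 24D : Ser -> Ser
 24D = scaled (+ 24) D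

 module D24 = Differentiate (scaled-derivation (+ 24) D-derivation)

 24Dπ : 24D π ~ (P - ι (+ 1)) * π
 24Dπ = tr (*ˡ {ι (+ 24)} Dπ) (solve (# 24 :* (v0 :* v1)) ((# 1 :+ # 24 :* v0 :- # 1) :* v1) refl (λ̂ ∷ π ∷ []))

 24DP : 24D P ~ ι (+ 2) * (P * P - Q)
 24DP = solve (# 24 :* v1) (# 2 :* (v0 :* v0 :- (v0 :* v0 :- # 12 :* v1))) refl (P ∷ D P ∷ [])

 24DQ : 24D Q ~ ι (+ 8) * (P * Q - R)
 24DQ = solve (# 24 :* v2) (# 8 :* (v0 :* v1 :- (v0 :* v1 :- # 3 :* v2))) refl (P ∷ Q ∷ D Q ∷ [])

 24DR : 24D R ~ ι (+ 12) * (P * R - S)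
 24DR = solve (# 24 :* v2) (# 12 :* (v0 :* v1 :- (v0 :* v1 :- # 2 :* v2))) refl (P ∷ R ∷ D R ∷ [])

 ρ3 : Vec Ser 3
 ρ3 = P ∷ Q ∷ R ∷ []
 ρ4 : Vec Ser 4
 ρ4 = P ∷ Q ∷ R ∷ S ∷ []

 incl deriv : Vec (Expr 4) 3
 incl = v0 ∷ v1 ∷ v2 ∷ []
 deriv = (# 2 :* (v0 :* v0 :- v1)) ∷ (# 8 :* (v0 :* v1 :- v2)) ∷ (# 12 :* (v0 :* v2 :- v3)) ∷ []

 24D-⟦⟧ : ∀ (e : Expr 3) -> 24D (⟦ e ⟧ ρ3) ~ ⟦ ∂ incl deriv e ⟧ ρ4
 24D-⟦⟧ e = D24.differentiate incl deriv e ρ3 ρ4 (\ { zero -> ≈-refl ; (suc zero) -> ≈-refl ; (2+ zero) -> ≈-refl })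
  (\ { zero -> 24DP ; (suc zero) -> 24DQ ; (2+ zero) -> 24DR })

 -- Since 24D π = (P - 1) π, the summand `ε i` is absorbed and the polynomial factor changes by 24D
 -- + P. Differentiating `R` introduces `S`, hence the fourth variable.
 ε-step : ∀ i (e : Expr 3) (e' : Expr 4) -> isZero 4 (norm (∂ incl deriv e :+ v0 :* substE incl e :- e')) ≡ true -> ε i ~ π * ⟦ e ⟧ ρ3 -> ε (suc i) ~ π * ⟦ e' ⟧ ρ4
 ε-step i e e' h hi = begin
  ε (suc i) ≈⟨ ε-suc i ⟨
  24D (ε i) + ε i ≈⟨ +-cong (*ˡ {ι (+ 24)} (D-cong hi)) hi ⟩
  24D (π * E) + π * E ≈⟨ +ʳ (D24.𝒟-* π E) ⟩
  24D π * E + π * 24D E + π * E ≈⟨ +ʳ (+-cong (*ʳ {E} 24Dπ) (*ˡ {π} (24D-⟦⟧ e))) ⟩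
  (P - ι (+ 1)) * π * E + π * ⟦ ∂ incl deriv e ⟧ ρ4 + π * E
   ≈⟨ solve ((v0 :- # 1) :* v1 :* v2 :+ v1 :* v3 :+ v1 :* v2) (v1 :* (v3 :+ v0 :* v2)) refl (P ∷ π ∷ E ∷ ⟦ ∂ incl deriv e ⟧ ρ4 ∷ []) ⟩
  π * (⟦ ∂ incl deriv e ⟧ ρ4 + P * E)
   ≈⟨ *ˡ {π} (+ˡ (*ˡ {P} (D24.substE-⟦⟧ incl e ρ3 ρ4 (\ { zero -> ≈-refl ; (suc zero) -> ≈-refl ; (2+ zero) -> ≈-refl })))) ⟩
  π * ⟦ ∂ incl deriv e :+ v0 :* substE incl e ⟧ ρ4
   ≈⟨ *ˡ {π} (solve (∂ incl deriv e :+ v0 :* substE incl e) e' h ρ4) ⟩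
  π * ⟦ e' ⟧ ρ4 ∎
  where E = ⟦ e ⟧ ρ3

 -- As for `ε`, but the operator of γ is 8D + 1; a factor 3 makes it 24D + 3, and these factors
 -- accumulate in `c`.
 γ-step : ∀ i c (e : Expr 3) (e' : Expr 4) -> isZero 4 (norm (∂ incl deriv e :+ # 3 :* v0 :* substE incl e :- e')) ≡ true ->
        ι c * γ i ~ γ 0 * ⟦ e ⟧ ρ3 -> ι (+ 3 Z.* c) * γ (suc i) ~ γ 0 * ⟦ e' ⟧ ρ4
 γ-step i c e e' h hi = begin
  ι (+ 3 Z.* c) * γ (suc i) ≈⟨ *-cong (ι-* (+ 3) c) (sy (γ-suc i)) ⟩
  ι (+ 3) * ι c * (ι (+ 8) * D (γ i) + γ i) ≈⟨ solve (# 3 :* v0 :* (# 8 :* v1 :+ v2)) (# 24 :* (v3 :* v2 :+ v0 :* v1) :+ # 3 :* (v0 :* v2) :- # 24 :* v3 :* v2) refl (ι c ∷ D (γ i) ∷ γ i ∷ D (ι c) ∷ []) ⟩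
  ι (+ 24) * (D (ι c) * γ i + ι c * D (γ i)) + ι (+ 3) * (ι c * γ i) - ι (+ 24) * D (ι c) * γ i
   ≈⟨ +-cong (+-cong (*ˡ {ι (+ 24)} (tr (sy (D-* (ι c) (γ i))) (D-cong hi))) (*ˡ {ι (+ 3)} hi))
        (-‿cong (*ʳ {γ i} (tr (D24.𝒟-ι c) (sy ι-0)))) ⟩
  24D (γ 0 * E) + ι (+ 3) * (γ 0 * E) - ι (+ 0) * γ i ≈⟨ +ʳ (+ʳ (D24.𝒟-* (γ 0) E)) ⟩
  24D (γ 0) * E + γ 0 * 24D E + ι (+ 3) * (γ 0 * E) - ι (+ 0) * γ i
   ≈⟨ +ʳ (+ʳ (+-cong (*ʳ {E} 24Dγ) (*ˡ {γ 0} (24D-⟦⟧ e)))) ⟩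
  ι (+ 3) * (P - ι (+ 1)) * γ 0 * E + γ 0 * ⟦ ∂ incl deriv e ⟧ ρ4 + ι (+ 3) * (γ 0 * E) - ι (+ 0) * γ i
   ≈⟨ solve (# 3 :* (v0 :- # 1) :* v1 :* v2 :+ v1 :* v3 :+ # 3 :* (v1 :* v2) :- # 0 :* v4) (v1 :* (v3 :+ # 3 :* v0 :* v2)) refl (P ∷ γ 0 ∷ E ∷ ⟦ ∂ incl deriv e ⟧ ρ4 ∷ γ i ∷ []) ⟩
  γ 0 * (⟦ ∂ incl deriv e ⟧ ρ4 + ι (+ 3) * P * E)
   ≈⟨ *ˡ {γ 0} (+ˡ (*ˡ {ι (+ 3) * P} (D24.substE-⟦⟧ incl e ρ3 ρ4 (\ { zero -> ≈-refl ; (suc zero) -> ≈-refl ; (2+ zero) -> ≈-refl })))) ⟩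
  γ 0 * ⟦ ∂ incl deriv e :+ # 3 :* v0 :* substE incl e ⟧ ρ4
   ≈⟨ *ˡ {γ 0} (solve (∂ incl deriv e :+ # 3 :* v0 :* substE incl e) e' h ρ4) ⟩
  γ 0 * ⟦ e' ⟧ ρ4 ∎
  where
  E = ⟦ e ⟧ ρ3
  24Dγ : 24D (γ 0) ~ ι (+ 3) * (P - ι (+ 1)) * γ 0
  24Dγ = tr (*ˡ {ι (+ 24)} γ') (tr (solve (# 24 :* (# 6 :* v0 :^ 2 :* v1)) (# 6 :* v0 :^ 2 :* (# 24 :* v1)) refl (π ∷ D π ∷ []))
   (tr (*ˡ {ι (+ 6) * π ^ 2} 24Dπ) (tr (solve (# 6 :* v0 :^ 2 :* ((v1 :- # 1) :* v0)) (# 3 :* (v1 :- # 1) :* (# 2 :* v0 :^ 3)) refl (π ∷ P ∷ []))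
     (*ˡ {ι (+ 3) * (P - ι (+ 1))} (sy γ-π)))))

 e2 e3 g2 g3 : ∀ {n} -> Expr (3 N.+ n)
 e2 = # 3 :* v0 :^ 2 :- # 2 :* v1
 e3 = # 15 :* v0 :^ 3 :- # 30 :* v0 :* v1 :+ # 16 :* v2
 g2 = # 15 :* v0 :^ 2 :- # 6 :* v1
 g3 = # 105 :* v0 :^ 3 :- # 126 :* v0 :* v1 :+ # 48 :* v2
 e4 g4 : Expr 4
 e4 = ∂ incl deriv e3 :+ v0 :* substE incl e3
 g4 = ∂ incl deriv g3 :+ # 3 :* v0 :* substE incl g3

 ε0 : ε 0 ~ π * ⟦ # 1 ⟧ ρ3
 ε0 = tr ε≈π (sy (tr (*ˡ {π} ι-1) (*-identityʳ π)))
 ε1 : ε 1 ~ π * P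
 ε1 = ε-step 0 (# 1) v0 refl ε0
 ε2 : ε 2 ~ π * ⟦ e2 ⟧ ρ4
 ε2 = ε-step 1 v0 e2 refl ε1
 ε3 : ε 3 ~ π * ⟦ e3 ⟧ ρ4
 ε3 = ε-step 2 e2 e3 refl ε2
 ε4 : ε 4 ~ π * ⟦ e4 ⟧ ρ4
 ε4 = ε-step 3 e3 e4 refl ε3
 γ1 : ι (+ 3) * γ 1 ~ γ 0 * ⟦ # 3 :* v0 ⟧ ρ4
 γ1 = γ-step 0 (+ 1) (# 1) (# 3 :* v0) refl (*-comm (ι (+ 1)) (γ 0))
 γ2 : ι (+ 9) * γ 2 ~ γ 0 * ⟦ g2 ⟧ ρ4
 γ2 = γ-step 1 (+ 3) (# 3 :* v0) g2 refl γ1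
 γ3 : ι (+ 27) * γ 3 ~ γ 0 * ⟦ g3 ⟧ ρ4
 γ3 = γ-step 2 (+ 9) g2 g3 refl γ2
 γ4 : ι (+ 81) * γ 4 ~ γ 0 * ⟦ g4 ⟧ ρ4
 γ4 = γ-step 3 (+ 27) g3 g4 refl γ3

 -- With the moments up to order 4 inserted, 81 times `nonic` becomes 13824 π γ₀ (S - Q²) = 0; the
 -- factor 81 is the one that accompanies `γ 4`.
 S≈Q² : S ~ Q * Q
 S≈Q² = from-diff (regular-* {ι (+ 13824)} {π * γ 0} (regular-ι (+ 13824) (\ ())) (regular-* {π} {γ 0} regular-π γ-regular) (S - Q * Q)
  (tr (solve (# 13824 :* (v0 :* v1) :* (v5 :- v3 :* v3))
   (# 2 :* (v0 :* # 1 :* (v1 :* g4')) :+ # 72 :* # 3 :* (v0 :* v2 :* (v1 :* g3')) :+ # 252 :* # 9 :* (v0 :* e2' :* (v1 :* g2')) :+ # 168 :* # 27 :* (v0 :* e3' :* (v1 :* (# 3 :* v2))) :+ # 18 :* # 81 :* (v0 :* e4' :* v1)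
      :- # 512 :* (v0 :* # 1 :* (v1 :* g4'))) refl (π ∷ γ 0 ∷ P ∷ Q ∷ R ∷ S ∷ []))
  (tr (+-cong (+-cong (+-cong (+-cong (+-cong
     (*ˡ {ι (+ 2)} (*-cong (sy ε0) (sy γ4)))
     (*ˡ {ι (+ 72) * ι (+ 3)} (*-cong (sy ε1) (sy γ3))))
     (*ˡ {ι (+ 252) * ι (+ 9)} (*-cong (sy ε2) (sy γ2))))
     (*ˡ {ι (+ 168) * ι (+ 27)} (*-cong (sy ε3) (sy γ1))))
     (*ˡ {ι (+ 18) * ι (+ 81)} (*ʳ {γ 0} (sy ε4))))
     (-‿cong (*ˡ {ι (+ 512)} (*-cong (sy ε0) (sy γ4)))))
  (tr (solve (# 2 :* (v0 :* (# 81 :* v4)) :+ # 72 :* # 3 :* (v1 :* (# 27 :* v3)) :+ # 252 :* # 9 :* (v2 :* (# 9 :* v5)) :+ # 168 :* # 27 :* (v6 :* (# 3 :* v7)) :+ # 18 :* # 81 :* v8 :- # 512 :* (v0 :* (# 81 :* v4)))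
     (# 81 :* (# 2 :* (v0 :* v4) :+ (# 72 :* (v1 :* v3) :+ (# 252 :* (v2 :* v5) :+ (# 168 :* (v6 :* v7) :+ (# 18 :* v8 :+ # 0)))) :- (# 512 :* (v0 :* v4) :+ # 0))) refl
     (ε 0 ∷ ε 1 ∷ ε 2 ∷ γ 3 ∷ γ 4 ∷ γ 2 ∷ ε 3 ∷ γ 1 ∷ (ε 4 * γ 0) ∷ []))
   (tr (*ˡ {ι (+ 81)} (x-x nonic')) (zeroʳ (ι (+ 81))))))))
  where
  v8 : Expr 9
  v8 = X (8+ zero)
  up : Vec (Expr 6) 4
  up = v2 ∷ v3 ∷ v4 ∷ v5 ∷ []
  g4' = substE up g4
  g3' = substE up g3
  g2' = substE up g2
  e2' = substE up e2
  e3' = substE up e3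
  e4' = substE up e4
  γ-regular : Regular (γ 0)
  γ-regular = regular-nz {γ 0} (\ e -> two (trans (sym e) (trans (at γ-π 0) (coefficient-ι (+ 2) (π ^ 3) 0))))
   where
   two : ¬ + 0 ≡ + 2
   two ()
  nonic' : _ ~ _
  nonic' = tr (+ˡ (+ˡ (+ˡ (+ˡ (+ˡ ι-0))))) (tr nonic (+ˡ (sy ι-0)))

12DP : ι (+ 12) * D P ~ P * P - Q
12DP = solve (# 12 :* v1) (v0 :* v0 :- (v0 :* v0 :- # 12 :* v1)) refl (P ∷ D P ∷ [])

3DQ : ι (+ 3) * D Q ~ P * Q - R
3DQ = solve (# 3 :* v2) (v0 :* v1 :- (v0 :* v1 :- # 3 :* v2)) refl (P ∷ Q ∷ D Q ∷ [])

2DR : ι (+ 2) * D R ~ P * R - Q * Q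
2DR = by1 {c = - ι (+ 1)} S≈Q² (solve (# 2 :* v3) (v0 :* v2 :- v1 :* v1 :+ (:- # 1) :* ((v0 :* v2 :- # 2 :* v3) :- v1 :* v1)) refl (P ∷ Q ∷ R ∷ D R ∷ []))

jacobi-cube : family (\ l -> σ l Z.* (+ 1 Z.+ (l Z.+ l))) T ~ ι (+ 2) * π ^ 3
jacobi-cube = γ-π

pentagonal : family σ G ~ π
pentagonal = tr (family-cong {σ} {\ j -> σ j Z.* a² 0 j} G (\ j -> sym (trans (cong (σ j Z.*_) (ι-ℤ (+ 1))) (ZP.*-identityʳ (σ j))))) ε≈π

-- Truncated evaluation: lists of leading coefficients

data Agrees (f : Ser) : List ℤ -> Set where
 [] : Agrees f []
 _∷_ : ∀ {c cs} -> f 0 ≡ c -> Agrees (f ∘ suc) cs -> Agrees f (c ∷ cs)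

addT mulT : List ℤ -> List ℤ -> List ℤ
addT [] _ = []
addT (_ ∷ _) [] = []
addT (c ∷ cs) (d ∷ ds) = (c Z.+ d) ∷ addT cs ds

private
 rowT : ℤ -> List ℤ -> List ℤ -> List ℤ
 rowT c [] _ = []
 rowT c (_ ∷ _) [] = []
 rowT c (d ∷ ds) (r ∷ rs) = (c Z.* d Z.+ r) ∷ rowT c ds rs

mulT [] _ = []
mulT (_ ∷ _) [] = []
mulT (c ∷ cs) (d ∷ ds) = (c Z.* d) ∷ rowT c ds (mulT cs (d ∷ ds))

zerosT : ℕ -> List ℤ
zerosT zero = []
zerosT (suc n) = 0 ,, zerosT n

constT : ℕ -> ℤ -> List ℤ
constT zero c = []
constT (suc n) c = c ∷ zerosT n

derivT : ℕ -> List ℤ -> List ℤ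
derivT k [] = []
derivT k (c ∷ cs) = (+ k Z.* c) ∷ derivT (suc k) cs

evalT : ∀ {n} -> ℕ -> Expr n -> Vec (List ℤ) n -> List ℤ
powT : ℕ -> List ℤ -> ℕ -> List ℤ
evalT N (K c) ρ = constT N c
evalT N (X i) ρ = Vec.lookup ρ i
evalT N (a :+ b) ρ = addT (evalT N a ρ) (evalT N b ρ)
evalT N (a :* b) ρ = mulT (evalT N a ρ) (evalT N b ρ)
evalT N (:- a) ρ = List.map Z.-_ (evalT N a ρ)
evalT N (a :^ k) ρ = powT N (evalT N a ρ) k
powT N cs zero = constT N (+ 1)
powT N cs (suc k) = mulT cs (powT N cs k)

agrees-ext : ∀ {f g} cs -> (∀ n -> f n ≡ g n) -> Agrees f cs -> Agrees g cs
agrees-ext [] h a = []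
agrees-ext (c ∷ cs) h (e ∷ a) = trans (sym (h 0)) e ∷ agrees-ext cs (h ∘ suc) a

agrees-cong : ∀ {f g} cs -> f ~ g -> Agrees f cs -> Agrees g cs
agrees-cong cs h = agrees-ext cs (at h)

agrees-+ : ∀ {f g} cs ds -> Agrees f cs -> Agrees g ds -> Agrees (f + g) (addT cs ds)
agrees-+ {f} {g} cs ds a b = agrees-ext (addT cs ds) (\ n -> sym (+-at f g n)) (go f g cs ds a b)
 where
 go : ∀ f g cs ds -> Agrees f cs -> Agrees g ds -> Agrees (\ n -> f n Z.+ g n) (addT cs ds)
 go f g [] ds a b = []
 go f g (c ∷ cs) [] a b = []
 go f g (c ∷ cs) (d ∷ ds) (e ∷ a) (k ∷ b) = cong₂ Z._+_ e k ∷ go (f ∘ suc) (g ∘ suc) cs ds a b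

agrees-* : ∀ {f g} cs ds -> Agrees f cs -> Agrees g ds -> Agrees (f * g) (mulT cs ds)
agrees-* [] ds a b = []
agrees-* (c ∷ cs) [] a b = []
agrees-* {f} {g} (c ∷ cs) (d ∷ ds) (e ∷ a) (k ∷ b) = cong₂ Z._*_ e k ∷ go (g ∘ suc) ((f ∘ suc) * g) ds (mulT cs (d ∷ ds)) b (agrees-* cs (d ∷ ds) a (k ∷ b))
 where
 go : ∀ g r ds rs -> Agrees g ds -> Agrees r rs -> Agrees (\ n -> f 0 Z.* g n Z.+ r n) (rowT c ds rs)
 go g r [] rs a b = []
 go g r (d ∷ ds) [] a b = []
 go g r (d ∷ ds) (x ∷ rs) (k ∷ a) (l ∷ b) = cong₂ Z._+_ (cong₂ Z._*_ e k) l ∷ go (g ∘ suc) (r ∘ suc) ds rs a b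

agrees-neg : ∀ {f} cs -> Agrees f cs -> Agrees (- f) (List.map Z.-_ cs)
agrees-neg {f} cs a = agrees-ext (List.map Z.-_ cs) (\ n -> sym (neg-at f n)) (go f cs a)
 where
 go : ∀ f cs -> Agrees f cs -> Agrees (\ n -> Z.- f n) (List.map Z.-_ cs)
 go f [] a = []
 go f (c ∷ cs) (e ∷ a) = cong Z.-_ e ∷ go (f ∘ suc) cs a

agrees-zeros : ∀ N f -> (∀ n -> f n ≡ + 0) -> Agrees f (zerosT N)
agrees-zeros zero f h = []
agrees-zeros (suc N) f h = h 0 ∷ agrees-zeros N (f ∘ suc) (h ∘ suc)

agrees-const : ∀ N c -> Agrees (constˢ c) (constT N c)
agrees-const zero c = []
agrees-const (suc N) c = refl ∷ agrees-zeros N (constˢ c ∘ suc) (\ _ -> refl)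

agrees-ι : ∀ N c -> Agrees (ι c) (constT N c)
agrees-ι N c = agrees-cong (constT N c) (sy (tr (ι-const c) (const-cong (ι-ℤ c)))) (agrees-const N c)

agrees-D : ∀ {f} cs -> Agrees f cs -> Agrees (D f) (derivT 0 cs)
agrees-D {f} cs a = go 0 f cs a
 where
 go : ∀ k f cs -> Agrees f cs -> Agrees (\ n -> + (k N.+ n) Z.* f n) (derivT k cs)
 go k f [] a = []
 go k f (c ∷ cs) (e ∷ a) = cong₂ (\ j x -> + j Z.* x) (NP.+-identityʳ k) e ∷
  agrees-ext (derivT (suc k) cs) (\ n -> cong (\ j -> + j Z.* f (suc n)) (sym (NP.+-suc k n))) (go (suc k) (f ∘ suc) cs a)

agrees-⟦⟧ : ∀ {n} N (e : Expr n) ρ ρT -> (∀ i -> Agrees (Vec.lookup ρ i) (Vec.lookup ρT i)) -> Agrees (⟦ e ⟧ ρ) (evalT N e ρT)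
agrees-⟦⟧ N (K c) ρ ρT h = agrees-ι N c
agrees-⟦⟧ N (X i) ρ ρT h = h i
agrees-⟦⟧ N (a :+ b) ρ ρT h = agrees-+ (evalT N a ρT) (evalT N b ρT) (agrees-⟦⟧ N a ρ ρT h) (agrees-⟦⟧ N b ρ ρT h)
agrees-⟦⟧ N (a :* b) ρ ρT h = agrees-* (evalT N a ρT) (evalT N b ρT) (agrees-⟦⟧ N a ρ ρT h) (agrees-⟦⟧ N b ρ ρT h)
agrees-⟦⟧ N (:- a) ρ ρT h = agrees-neg (evalT N a ρT) (agrees-⟦⟧ N a ρ ρT h)
agrees-⟦⟧ N (a :^ k) ρ ρT h = go k
 where
 go : ∀ k -> Agrees (⟦ a ⟧ ρ ^ k) (powT N (evalT N a ρT) k)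
 go zero = agrees-const N (+ 1)
 go (suc k) = agrees-* (evalT N a ρT) (powT N (evalT N a ρT) k) (agrees-⟦⟧ N a ρ ρT h) (go k)

-- The comparison is Boolean so that it is evaluated in one run.
sameT : List ℤ -> List ℤ -> Bool
sameT [] [] = true
sameT [] (_ ∷ _) = false
sameT (_ ∷ _) [] = false
sameT (c ∷ cs) (d ∷ ds) = isZero 0 (c Z.- d) ∧ sameT cs ds

sameT-≡ : ∀ cs ds -> sameT cs ds ≡ true -> cs ≡ ds
sameT-≡ [] [] h = refl
sameT-≡ (c ∷ cs) (d ∷ ds) h with c Z.- d in eq
... | + zero = cong₂ _∷_ (ZP.i-j≡0⇒i≡j c d eq) (sameT-≡ cs ds h)

data AgreeAll : ∀ {n} -> Vec Ser n -> Vec (List ℤ) n -> Set where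
 [] : AgreeAll [] []
 _∷_ : ∀ {n f cs} {ρ : Vec Ser n} {ρT} -> Agrees f cs -> AgreeAll ρ ρT -> AgreeAll (f ∷ ρ) (cs ∷ ρT)

agrees-lookup : ∀ {n} {ρ : Vec Ser n} {ρT} -> AgreeAll ρ ρT -> ∀ i -> Agrees (Vec.lookup ρ i) (Vec.lookup ρT i)
agrees-lookup (a ∷ _) zero = a
agrees-lookup (_ ∷ as) (suc i) = agrees-lookup as i

agrees-eval : ∀ {n} (e : Expr n) ρ ρT N cs -> AgreeAll ρ ρT -> sameT (evalT N e ρT) cs ≡ true -> Agrees (⟦ e ⟧ ρ) cs
agrees-eval e ρ ρT N cs h s = subst (Agrees (⟦ e ⟧ ρ)) (sameT-≡ (evalT N e ρT) cs s) (agrees-⟦⟧ N e ρ ρT (agrees-lookup h))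

agrees-≈[] : ∀ f g xs N -> length xs ≡ suc N -> f ≈[ N ] g -> Agrees g xs -> Agrees f xs
agrees-≈[] f g (x ∷ []) N refl h (k ∷ b) = trans (h 0 z≤n) k ∷ []
agrees-≈[] f g (x ∷ y ∷ xs) (suc N) l h (k ∷ b) = trans (h 0 z≤n) k ∷ agrees-≈[] (f ∘ suc) (g ∘ suc) (y ∷ xs) N (NP.suc-injective l) (\ i i≤ -> h (suc i) (s≤s i≤)) b

-- The list of an inverse is recognised by multiplication.
agrees-inv : ∀ {f} c cs d ds -> f 0 ≡ + 1 -> Agrees f (c ∷ cs) -> sameT (mulT (c ∷ cs) (d ∷ ds)) (constT (suc (length ds)) (+ 1)) ≡ true -> Agrees (inv f) (d ∷ ds)
agrees-inv {f} c cs d ds f0 a e = agrees-≈[] (inv f) g (d ∷ ds) (length ds) refl inv≈g (list-agrees (d ∷ ds))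
 where
 list : List ℤ -> Ser
 list [] n = + 0
 list (x ∷ xs) zero = x
 list (x ∷ xs) (suc n) = list xs n
 list-agrees : ∀ xs -> Agrees (list xs) xs
 list-agrees [] = []
 list-agrees (x ∷ xs) = refl ∷ list-agrees xs
 to-≈[] : ∀ f g xs N -> length xs ≡ suc N -> Agrees f xs -> Agrees g xs -> f ≈[ N ] g
 to-≈[] f g (x ∷ xs) N l (j ∷ a) (k ∷ b) zero i≤ = trans j (sym k)
 to-≈[] f g (x ∷ xs) (suc N) l (j ∷ a) (k ∷ b) (suc i) (s≤s i≤) = to-≈[] (f ∘ suc) (g ∘ suc) xs N (NP.suc-injective l) a b i i≤
 N = length ds
 g = list (d ∷ ds)
 len : ∀ N c -> length (constT (suc N) c) ≡ suc N
 len N c = cong suc (zl N)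
  where
  zl : ∀ N -> length (zerosT N) ≡ N
  zl zero = refl
  zl (suc N) = cong suc (zl N)
 fg : (f * g) ≈[ N ] (f * inv f)
 fg = to-≈[] (f * g) (f * inv f) (constT (suc N) (+ 1)) N (len N (+ 1)) (subst (Agrees (f * g)) (sameT-≡ (mulT (c ∷ cs) (d ∷ ds)) (constT (suc N) (+ 1)) e) (agrees-* {f} {g} (c ∷ cs) (d ∷ ds) a (list-agrees (d ∷ ds))))
  (agrees-cong (constT (suc N) (+ 1)) (sy (inv-inverse f f0)) (agrees-const (suc N) (+ 1)))
 diff : ∀ n -> n N.≤ N -> (f * (inv f - g)) n ≡ + 0
 diff n l = trans (at (distribˡ f (inv f) (- g)) n) (trans (+-at (f * inv f) (f * - g) n) (trans (cong₂ Z._+_ (sym (fg n l)) (trans (at (sy (-‿distribʳ-* f g)) n) (neg-at (f * g) n))) (ZP.+-inverseʳ ((f * g) n))))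
 inv≈g : inv f ≈[ N ] g
 inv≈g n l = ZP.i-j≡0⇒i≡j (inv f n) (g n) (trans (sym (trans (+-at (inv f) (- g) n) (cong (\ z -> inv f n Z.+ z) (neg-at g n)))) (strong (\ n -> n N.≤ N -> (inv f - g) n ≡ + 0)
  (\ n ih l -> trans (sym (trans (*-leading f (inv f - g) n (\ i i< -> ih i i< (NP.≤-trans (NP.<⇒≤ i<) l))) (trans (cong (Z._* (inv f - g) n) f0) (ZP.*-identityˡ ((inv f - g) n))))) (diff n l)) n l))

vanishing : ∀ {f} N -> Agrees f (zerosT N) -> ∀ n -> n N.< N -> f n ≡ + 0
vanishing (suc N) (e ∷ a) zero l = e
vanishing (suc N) (e ∷ a) (suc n) (s≤s l) = vanishing N a n l

agrees-head : ∀ {f c cs} -> Agrees f (c ∷ cs) -> f 0 ≡ c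
agrees-head (e ∷ _) = e

-- Level 13.  The hauptmodul t = q (q¹³;q¹³)² / (q;q)², its logarithmic
-- derivative E, and the form e = E / (P2 P3) of weight 2.

module V13 = Dissection ℤring 12
open V13 using (V; H)

D-V : ∀ f -> D (V f) ~ ι (+ 13) * V (D f)
D-V f = mk \ n -> trans (V13.V-elim (\ n -> D (V f) n ≡ + 13 Z.* V (D f) n)
  (\ n -> trans (cong₂ Z._*_ (ZP.pos-* n 13) (V13.V-multiple f n)) (trans (lem (+ n) (f n)) (cong (+ 13 Z.*_) (sym (V13.V-multiple (D f) n)))))
  (\ r n l -> trans (cong (+ (suc r N.+ n N.* 13) Z.*_) (V13.V-other f r n l)) (trans (ZP.*-zeroʳ (+ (suc r N.+ n N.* 13))) (cong (+ 13 Z.*_) (sym (V13.V-other (D f) r n l))))) n)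
 (sym (coefficient-ι (+ 13) (V (D f)) n))
 where
 lem : ∀ n x -> n Z.* + 13 Z.* x ≡ + 13 Z.* (n Z.* x)
 lem = solve-∀

module DD = Differentiate D-derivation

π⁻¹ : Ser
π⁻¹ = inv π

π*π⁻¹ : π * π⁻¹ ~ ι (+ 1)
π*π⁻¹ = tr (inv-inverse π refl) (sy ι-1)

Dπ⁻¹ : D π⁻¹ ~ - (λ̂ * π⁻¹)
Dπ⁻¹ = regular-cancel {π} regular-π (by2 {c = ι (+ 1)} {c' = - π⁻¹} product Dπ
 (solve (v0 :* v3) (v0 :* (:- (v1 :* v2)) :+ # 1 :* (v4 :* v2 :+ v0 :* v3 :- # 0) :+ (:- v2) :* (v4 :- v1 :* v0)) refl (π ∷ λ̂ ∷ π⁻¹ ∷ D π⁻¹ ∷ D π ∷ [])))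
 where
 product : D π * π⁻¹ + π * D π⁻¹ ~ ι (+ 0)
 product = tr (sy (D-* π π⁻¹)) (tr (D-cong π*π⁻¹) (tr (DD.𝒟-ι (+ 1)) (sy ι-0)))

t E : Ser
t = q * (V π ^ 2 * π⁻¹ ^ 2)
E = ι (+ 1) + ι (+ 2) * (ι (+ 13) * V λ̂ - λ̂)

Dq : D q ~ q
Dq = mk \ { zero -> refl ; (suc zero) -> refl ; (2+ n) -> ZP.*-zeroʳ (+ 2+ n) }

DVπ : D (V π) ~ ι (+ 13) * V λ̂ * V π
DVπ = tr (D-V π) (tr (*ˡ {ι (+ 13)} (tr (V13.V-cong Dπ) (V13.V-* λ̂ π))) (sy (*-assoc (ι (+ 13)) (V λ̂) (V π))))

Dt : D t ~ t * E
Dt = tr (DD.differentiate s d (v0 :* (v1 :^ 2 :* v2 :^ 2)) (q ∷ V π ∷ π⁻¹ ∷ []) (q ∷ V π ∷ π⁻¹ ∷ V λ̂ ∷ λ̂ ∷ [])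
  (\ { zero -> ≈-refl ; (suc zero) -> ≈-refl ; (2+ zero) -> ≈-refl }) (\ { zero -> Dq ; (suc zero) -> DVπ ; (2+ zero) -> Dπ⁻¹ }))
 (solve (∂ s d (v0 :* (v1 :^ 2 :* v2 :^ 2))) (v0 :* (v1 :^ 2 :* v2 :^ 2) :* (# 1 :+ # 2 :* (# 13 :* v3 :- v4))) refl (q ∷ V π ∷ π⁻¹ ∷ V λ̂ ∷ λ̂ ∷ []))
 where
 s d : Vec (Expr 5) 3
 s = v0 ∷ v1 ∷ v2 ∷ []
 d = v0 ∷ # 13 :* v3 :* v1 ∷ :- (v4 :* v2) ∷ []

-- Thus `E` is (13 P(q¹³) - P(q))/12, the Eisenstein series of weight 2 on Γ₀(13).
13VP : ι (+ 13) * V P ~ ι (+ 12) * E + P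
13VP = tr (*ˡ {ι (+ 13)} (V13.V-⟦⟧ (# 1 :+ # 24 :* v0) (λ̂ ∷ [])))
 (solve (# 13 :* (# 1 :+ # 24 :* v1)) (# 12 :* (# 1 :+ # 2 :* (# 13 :* v1 :- v0)) :+ (# 1 :+ # 24 :* v0)) refl (λ̂ ∷ V λ̂ ∷ []))

144DE : ι (+ 144) * D E ~ (ι (+ 12) * E + P) ^ 2 - ι (+ 169) * V Q - P * P + Q
144DE = by3 {c = ι (+ 169)} {c' = ι (+ 12) * E + P + ι (+ 13) * V P} {c″ = - ι (+ 1)} V12DP 13VP 12DP′
 (tr (*ˡ {ι (+ 144)} DE) (solve (# 144 :* (# 2 :* (# 13 :* (# 13 :* v5) :- v6)))
  (((# 12 :* v0 :+ v1) :^ 2 :- # 169 :* v3 :- v1 :* v1 :+ v2) :+ # 169 :* (# 288 :* v5 :- (v4 :* v4 :- v3)) :+ (# 12 :* v0 :+ v1 :+ # 13 :* v4) :* (# 13 :* v4 :- (# 12 :* v0 :+ v1))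
   :+ (:- # 1) :* (# 288 :* v6 :- (v1 :* v1 :- v2))) refl (E ∷ P ∷ Q ∷ V Q ∷ V P ∷ V (D λ̂) ∷ D λ̂ ∷ [])))
 where
 DE : D E ~ ι (+ 2) * (ι (+ 13) * (ι (+ 13) * V (D λ̂)) - D λ̂)
 DE = tr (DD.differentiate (v0 ∷ v1 ∷ []) (v2 ∷ v3 ∷ []) (# 1 :+ # 2 :* (# 13 :* v0 :- v1)) (V λ̂ ∷ λ̂ ∷ []) (V λ̂ ∷ λ̂ ∷ D (V λ̂) ∷ D λ̂ ∷ [])
   (\ { zero -> ≈-refl ; (suc zero) -> ≈-refl }) (\ { zero -> ≈-refl ; (suc zero) -> ≈-refl }))
  (tr (solve (∂ {2} {4} (v0 ∷ v1 ∷ []) (v2 ∷ v3 ∷ []) (# 1 :+ # 2 :* (# 13 :* v0 :- v1))) (# 2 :* (# 13 :* v2 :- v3)) refl (V λ̂ ∷ λ̂ ∷ D (V λ̂) ∷ D λ̂ ∷ []))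
   (*ˡ {ι (+ 2)} (+ʳ (*ˡ {ι (+ 13)} (D-V λ̂)))))
 DP : D P ~ ι (+ 24) * D λ̂
 DP = tr (D-+ (ι (+ 1)) (ι (+ 24) * λ̂)) (tr (+-cong (DD.𝒟-ι (+ 1)) (tr (D-* (ι (+ 24)) λ̂) (+ʳ (tr (*ʳ {λ̂} (DD.𝒟-ι (+ 24))) (zeroˡ λ̂)))))
  (tr (+-identityˡ _) (+-identityˡ _)))
 12DP′ : ι (+ 288) * D λ̂ ~ P * P - Q
 12DP′ = tr (solve (# 288 :* v0) (# 12 :* (# 24 :* v0)) refl (D λ̂ ∷ [])) (tr (*ˡ {ι (+ 12)} (sy DP)) 12DP)
 V12DP : ι (+ 288) * V (D λ̂) ~ V P * V P - V Q
 V12DP = tr (sy (V13.V-⟦⟧ (# 288 :* v0) (D λ̂ ∷ []))) (tr (V13.V-cong 12DP′) (V13.V-⟦⟧ (v0 :* v0 :- v1) (P ∷ Q ∷ [])))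

3DVQ : ι (+ 3) * D (V Q) ~ (ι (+ 12) * E + P) * V Q - ι (+ 13) * V R
3DVQ = by2 {c = ι (+ 13)} {c' = V Q} (tr (sy (V13.V-⟦⟧ (# 3 :* v0) (D Q ∷ []))) (tr (V13.V-cong 3DQ) (V13.V-⟦⟧ (v0 :* v1 :- v2) (P ∷ Q ∷ R ∷ [])))) 13VP
 (tr (*ˡ {ι (+ 3)} (D-V Q)) (solve (# 3 :* (# 13 :* v5))
  ((# 12 :* v0 :+ v1) :* v2 :- # 13 :* v3 :+ # 13 :* (# 3 :* v5 :- (v4 :* v2 :- v3)) :+ v2 :* (# 13 :* v4 :- (# 12 :* v0 :+ v1))) refl (E ∷ P ∷ V Q ∷ V R ∷ V P ∷ V (D Q) ∷ [])))

2DVR : ι (+ 2) * D (V R) ~ (ι (+ 12) * E + P) * V R - ι (+ 13) * (V Q * V Q)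
2DVR = by2 {c = ι (+ 13)} {c' = V R} (tr (sy (V13.V-⟦⟧ (# 2 :* v0) (D R ∷ []))) (tr (V13.V-cong 2DR) (V13.V-⟦⟧ (v0 :* v2 :- v1 :* v1) (P ∷ Q ∷ R ∷ [])))) 13VP
 (tr (*ˡ {ι (+ 2)} (D-V R)) (solve (# 2 :* (# 13 :* v5))
  ((# 12 :* v0 :+ v1) :* v3 :- # 13 :* (v2 :* v2) :+ # 13 :* (# 2 :* v5 :- (v4 :* v3 :- v2 :* v2)) :+ v3 :* (# 13 :* v4 :- (# 12 :* v0 :+ v1))) refl (E ∷ P ∷ V Q ∷ V R ∷ V P ∷ V (D R) ∷ [])))

-- `p2` and `p3` belong to the elliptic points of orders 2 and 3. In terms of t, j is P3 Q4³/t and j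
-- - 1728 is P2 Q6²/t. The starred lists are the reversals in 13t up to constants, and `mᴸ` governs
-- the derivative of `e`.
p2 p3 q4 q4* q6 q6* mᴸ p23 : List ℤ
p2 = 1 ,, 6 ,, 13 ,, []
p3 = 1 ,, 5 ,, 13 ,, []
q4 = 1 ,, 247 ,, 3380 ,, 15379 ,, 28561 ,, []
q4* = 1 ,, 7 ,, 20 ,, 19 ,, 1 ,, []
q6 = 1 ,, Z.- + 494 ∷ Z.- + 20618 ∷ Z.- + 237276 ∷ Z.- + 1313806 ∷ Z.- + 3712930 ∷ Z.- + 4826809 ∷ []
q6* = 1 ,, 10 ,, 46 ,, 108 ,, 122 ,, 38 ,, Z.- + 1 ∷ []
mᴸ = 1 ,, 39 ,, 336 ,, 1209 ,, 1859 ,, []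
p23 = mulP 1 p2 p3

P2E P3E P23E Q4E Q4*E Q6E Q6*E mE : ∀ {n} -> Expr n -> Expr n
P2E = hE p2
P3E = hE p3
P23E x = P2E x :* P3E x
Q4E = hE q4
Q4*E = hE q4*
Q6E = hE q6
Q6*E = hE q6*
mE = hE mᴸ

P23 u e : Ser
P23 = ⟦ P23E v0 ⟧ (t ∷ [])
u = inv P23
e = E * u

-- Leading coefficients

module _ where
 -- Sixteen terms: the errors below are computed in degrees up to 13, and the trace `T6` uses degree
 -- 15. An entry `n ,-` stands for -(n + 1).
 πT iπT λT tT PT QT RT ET uT eT VπT VλT VQT VRT : List ℤ
 πT = 1 ,, 0 ,- 0 ,- 0 ,, 0 ,, 1 ,, 0 ,, 1 ,, 0 ,, 0 ,, 0 ,, 0 ,, 0 ,- 0 ,, 0 ,, 0 ,- []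
 iπT = 1 ,, 1 ,, 2 ,, 3 ,, 5 ,, 7 ,, 11 ,, 15 ,, 22 ,, 30 ,, 42 ,, 56 ,, 77 ,, 101 ,, 135 ,, 176 ,, []
 λT = 0 ,, 0 ,- 2 ,- 3 ,- 6 ,- 5 ,- 11 ,- 7 ,- 14 ,- 12 ,- 17 ,- 11 ,- 27 ,- 13 ,- 23 ,- 23 ,- []
 tT = 0 ,, 1 ,, 2 ,, 5 ,, 10 ,, 20 ,, 36 ,, 65 ,, 110 ,, 185 ,, 300 ,, 481 ,, 752 ,, 1165 ,, 1768 ,, 2661 ,, []
 PT = 1 ,, 23 ,- 71 ,- 95 ,- 167 ,- 143 ,- 287 ,- 191 ,- 359 ,- 311 ,- 431 ,- 287 ,- 671 ,- 335 ,- 575 ,- 575 ,- []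
 QT = 1 ,, 240 ,, 2160 ,, 6720 ,, 17520 ,, 30240 ,, 60480 ,, 82560 ,, 140400 ,, 181680 ,, 272160 ,, 319680 ,, 490560 ,, 527520 ,, 743040 ,, 846720 ,, []
 RT = 1 ,, 503 ,- 16631 ,- 122975 ,- 532727 ,- 1575503 ,- 4058207 ,- 8471231 ,- 17047799 ,- 29883671 ,- 51991631 ,- 81170207 ,- 129985631 ,- 187132175 ,- 279550655 ,- 384422975 ,- []
 ET = 1 ,, 2 ,, 6 ,, 8 ,, 14 ,, 12 ,, 24 ,, 16 ,, 30 ,, 26 ,, 36 ,, 24 ,, 56 ,, 2 ,, 48 ,, 48 ,, []
 uT = 1 ,, 10 ,- 43 ,, 36 ,- 225 ,- 684 ,, 207 ,- 1887 ,- 2371 ,, 1490 ,, 520 ,- 12395 ,- 3395 ,, 66976 ,, 108498 ,- 58865 ,- []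
 eT = 1 ,, 8 ,- 27 ,, 8 ,- 115 ,- 212 ,, 2 ,, 257 ,- 97 ,, 399 ,- 1901 ,, 2021 ,- 2514 ,- 9624 ,, 11108 ,- 1738 ,, []
 VπT = 1 ,, 0 ,, 0 ,, 0 ,, 0 ,, 0 ,, 0 ,, 0 ,, 0 ,, 0 ,, 0 ,, 0 ,, 0 ,, 0 ,- 0 ,, 0 ,, []
 VλT = 0 ,, 0 ,, 0 ,, 0 ,, 0 ,, 0 ,, 0 ,, 0 ,, 0 ,, 0 ,, 0 ,, 0 ,, 0 ,, 0 ,- 0 ,, 0 ,, []
 VQT = 1 ,, 0 ,, 0 ,, 0 ,, 0 ,, 0 ,, 0 ,, 0 ,, 0 ,, 0 ,, 0 ,, 0 ,, 0 ,, 240 ,, 0 ,, 0 ,, []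
 VRT = 1 ,, 0 ,, 0 ,, 0 ,, 0 ,, 0 ,, 0 ,, 0 ,, 0 ,, 0 ,, 0 ,, 0 ,, 0 ,, 503 ,- 0 ,, 0 ,, []

 prodE : ℕ -> Expr 1
 prodE zero = # 1
 prodE (suc N) = prodE N :* (# 1 :- v0 :^ suc N)

 prodE-⟦⟧ : ∀ N -> ⟦ prodE N ⟧ (q ∷ []) ~ qfac N
 prodE-⟦⟧ zero = ι-1
 prodE-⟦⟧ (suc N) = *-cong (prodE-⟦⟧ N) (+ʳ ι-1)

 -- Among the first sixteen coefficients of `V f` only those of degrees 0 and 13 come from `f`.
 agrees-V : ∀ f c cs d -> Agrees f (c ∷ d ∷ []) -> cs ≡ c ∷ zerosT 12 ++ d ∷ zerosT 2 -> Agrees (V f) cs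
 agrees-V f c cs d (e0 ∷ e1 ∷ []) refl = e0 ∷ refl ∷ refl ∷ refl ∷ refl ∷ refl ∷ refl ∷ refl ∷ refl ∷ refl ∷ refl ∷ refl ∷ refl ∷ e1 ∷ refl ∷ refl ∷ []

 first-two : ∀ {f c d cs} -> Agrees f (c ∷ d ∷ cs) -> Agrees f (c ∷ d ∷ [])
 first-two (e ∷ k ∷ _) = e ∷ k ∷ []

 qT : List ℤ
 qT = 0 ,, 1 ,, zerosT 14

opaque
 agrees-q : Agrees q qT
 agrees-q = refl ∷ refl ∷ agrees-zeros 14 (\ n -> q (2+ n)) (\ _ -> refl)

 agrees-π : Agrees π πT
 agrees-π = agrees-≈[] π (qfac 15) πT 15 refl (\ i l -> sym (prod-approx oneMinus oneMinus-unital 15 i l))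
  (agrees-cong πT (prodE-⟦⟧ 15) (agrees-eval (prodE 15) (q ∷ []) (qT ∷ []) 16 πT (agrees-q ∷ []) refl))

 agrees-π⁻¹ : Agrees π⁻¹ iπT
 agrees-π⁻¹ = agrees-inv {π} (+ 1) (List.drop 1 πT) (+ 1) (List.drop 1 iπT) refl agrees-π refl

 agrees-λ : Agrees λ̂ λT
 agrees-λ = agrees-eval (v0 :* v1) (D π ∷ π⁻¹ ∷ []) (derivT 0 πT ∷ iπT ∷ []) 16 λT (agrees-D {π} πT agrees-π ∷ agrees-π⁻¹ ∷ []) refl

 agrees-Vπ : Agrees (V π) VπT
 agrees-Vπ = agrees-V π (+ 1) VπT (Z.- + 1) (first-two agrees-π) refl

 agrees-Vλ : Agrees (V λ̂) VλT
 agrees-Vλ = agrees-V λ̂ (+ 0) VλT (Z.- + 1) (first-two agrees-λ) refl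

 agrees-t : Agrees t tT
 agrees-t = agrees-eval (v0 :* (v1 :^ 2 :* v2 :^ 2)) (q ∷ V π ∷ π⁻¹ ∷ []) (qT ∷ VπT ∷ iπT ∷ []) 16 tT
  (agrees-q ∷ agrees-Vπ ∷ agrees-π⁻¹ ∷ []) refl

 agrees-E : Agrees E ET
 agrees-E = agrees-eval (# 1 :+ # 2 :* (# 13 :* v0 :- v1)) (V λ̂ ∷ λ̂ ∷ []) (VλT ∷ λT ∷ []) 16 ET (agrees-Vλ ∷ agrees-λ ∷ []) refl

 agrees-P : Agrees P PT
 agrees-P = agrees-eval (# 1 :+ # 24 :* v0) (λ̂ ∷ []) (λT ∷ []) 16 PT (agrees-λ ∷ []) refl

 agrees-Q : Agrees Q QT
 agrees-Q = agrees-eval (v0 :* v0 :- # 12 :* v1) (P ∷ D P ∷ []) (PT ∷ derivT 0 PT ∷ []) 16 QT (agrees-P ∷ agrees-D {P} PT agrees-P ∷ []) refl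

 agrees-R : Agrees R RT
 agrees-R = agrees-eval (v0 :* v1 :- # 3 :* v2) (P ∷ Q ∷ D Q ∷ []) (PT ∷ QT ∷ derivT 0 QT ∷ []) 16 RT (agrees-P ∷ agrees-Q ∷ agrees-D {Q} QT agrees-Q ∷ []) refl

 agrees-VQ : Agrees (V Q) VQT
 agrees-VQ = agrees-V Q (+ 1) VQT (+ 240) (first-two agrees-Q) refl

 agrees-VR : Agrees (V R) VRT
 agrees-VR = agrees-V R (+ 1) VRT (Z.- + 504) (first-two agrees-R) refl

 P23-head : P23 0 ≡ + 1
 P23-head = agrees-head (agrees-eval (P23E v0) (t ∷ []) ((0 ,, []) ∷ []) 1 (1 ,, []) ((agrees-head agrees-t ∷ []) ∷ []) refl)

 agrees-u : Agrees u uT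
 agrees-u = agrees-inv {P23} (+ 1) (List.drop 1 (evalT 16 (P23E v0) (tT ∷ []))) (+ 1) (List.drop 1 uT) P23-head (agrees-eval (P23E v0) (t ∷ []) (tT ∷ []) 16 _ (agrees-t ∷ []) refl) refl

 agrees-e : Agrees e eT
 agrees-e = agrees-eval (v0 :* v1) (E ∷ u ∷ []) (ET ∷ uT ∷ []) 16 eT (agrees-E ∷ agrees-u ∷ []) refl

private
 DEᵉ : Expr 2
 DEᵉ = ∂ {1} {2} (v0 ∷ []) (v1 ∷ []) (P23E v0)

regular-P23 : Regular P23
regular-P23 = regular-1 {P23} P23-head

P23*u : P23 * u ~ ι (+ 1)
P23*u = tr (inv-inverse P23 P23-head) (sy ι-1)

P23*e : P23 * e ~ E
P23*e = tr (solve (v0 :* (v1 :* v2)) (v1 :* (v0 :* v2)) refl (P23 ∷ E ∷ u ∷ [])) (tr (*ˡ {E} P23*u) (tr (*ˡ {E} ι-1) (*-identityʳ E)))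

-- The four forms of weights 4 and 6 in terms of t and e; their failures to
-- represent Q, R, V Q, V R satisfy a homogeneous linear system of differential
-- equations and vanish to sufficiently high order.

private
 x2E x3E x4E x5E : ∀ {n} -> Expr n -> Expr n -> Expr n
 x2E t e = P23E t :* Q4E t :* e :^ 2
 x3E t e = P2E t :* P23E t :* Q6E t :* e :^ 3
 x4E t e = P23E t :* Q4*E t :* e :^ 2
 x5E t e = P2E t :* P23E t :* Q6*E t :* e :^ 3

 -- 13² times the third error minus the first
 wE : ∀ {n} -> Expr n -> Expr n -> Expr n -> Expr n -> Expr n
 wE t e VQ Q = # 169 :* (VQ :- x4E t e) :- (Q :- x2E t e)

 deE : ∀ {n} (t e P u Q VQ : Expr n) -> Expr n
 deE t e P u Q VQ = # 24 :* P :* e :- # 24 :* mE t :* e :^ 2 :- u :* wE t e VQ Q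

 Dt' : D t ~ t * (P23 * e)
 Dt' = tr Dt (*ˡ {t} (sy P23*e))

 -- This is 24 times the final equation `6De` up to the term `u * w`, a combination of the errors.
 -- Keeping that term is what closes the differential system for the errors.
 144De : ι (+ 144) * D e ~ ⟦ deE v0 v1 v2 v3 v4 v5 ⟧ (t ∷ e ∷ P ∷ u ∷ Q ∷ V Q ∷ [])
 144De = regular-cancel {P23} regular-P23 (by3 {c = - ι (+ 144)} {c' = ι (+ 1)} {c″ = ⟦ wE v0 v1 v3 v2 ⟧ (t ∷ e ∷ Q ∷ V Q ∷ [])} DE 144DE′ P23*u
  (solve (P23E v0 :* (# 144 :* v6))
   (P23E v0 :* deE v0 v1 v2 v3 v4 v5 :+ (:- # 144) :* (v7 :- (dP :* v1 :+ P23E v0 :* v6)) :+ # 1 :* (# 144 :* v7 :- ((# 12 :* (P23E v0 :* v1) :+ v2) :^ 2 :- # 169 :* v5 :- v2 :* v2 :+ v4))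
     :+ wE v0 v1 v5 v4 :* (P23E v0 :* v3 :- # 1)) refl
   (t ∷ e ∷ P ∷ u ∷ Q ∷ V Q ∷ D e ∷ D E ∷ [])))
  where
  dP : Expr 8
  dP = substE (v0 ∷ v0 :* (P23E v0 :* v1) ∷ []) DEᵉ
  DP23 : D P23 ~ ⟦ dP ⟧ (t ∷ e ∷ P ∷ u ∷ Q ∷ V Q ∷ D e ∷ D E ∷ [])
  DP23 = tr (DD.differentiate (v0 ∷ []) (v1 ∷ []) (P23E v0) (t ∷ []) (t ∷ D t ∷ []) (\ { zero -> ≈-refl }) (\ { zero -> ≈-refl }))
   (DD.substE-⟦⟧ (v0 ∷ v0 :* (P23E v0 :* v1) ∷ []) DEᵉ (t ∷ D t ∷ []) (t ∷ e ∷ P ∷ u ∷ Q ∷ V Q ∷ D e ∷ D E ∷ []) (\ { zero -> ≈-refl ; (suc zero) -> Dt' }))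
  DE : D E ~ ⟦ dP :* v1 :+ P23E v0 :* v6 ⟧ (t ∷ e ∷ P ∷ u ∷ Q ∷ V Q ∷ D e ∷ D E ∷ [])
  DE = tr (D-cong (sy P23*e)) (tr (D-* P23 e) (+ʳ (*ʳ {e} DP23)))
  144DE′ : ι (+ 144) * D E ~ (ι (+ 12) * (P23 * e) + P) ^ 2 - ι (+ 169) * V Q - P * P + Q
  144DE′ = tr 144DE (+ʳ (+ʳ (+ʳ (^-cong 2 (+ʳ (*ˡ {ι (+ 12)} (sy P23*e)))))))

 base : Vec Ser 8
 base = t ∷ e ∷ P ∷ u ∷ Q ∷ R ∷ V Q ∷ V R ∷ []

 a2E a3E a4E a5E w : Expr 8
 a2E = v4 :- x2E v0 v1
 a3E = v5 :- x3E v0 v1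
 a4E = v6 :- x4E v0 v1
 a5E = v7 :- x5E v0 v1
 w = # 169 :* a4E :- a2E

 a2 a3 a4 a5 : Ser
 a2 = ⟦ a2E ⟧ base
 a3 = ⟦ a3E ⟧ base
 a4 = ⟦ a4E ⟧ base
 a5 = ⟦ a5E ⟧ base

 -- f is the part of the error not involving t and e, x the other part
 module Error (f : Ser) (xE : Expr 2) where
  env : Vec Ser 10
  env = t ∷ e ∷ P ∷ u ∷ Q ∷ R ∷ V Q ∷ V R ∷ D e ∷ D f ∷ []

  v8 v9 : Expr 10
  v8 = X (8+ zero)
  v9 = X (8+ (suc zero))

  dx : Expr 10
  dx = ∂ (v0 ∷ v1 ∷ []) (v0 :* (P23E v0 :* v1) ∷ v8 ∷ []) xE

  D-error : D (f - ⟦ xE ⟧ (t ∷ e ∷ [])) ~ ⟦ v9 :- dx ⟧ env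
  D-error = tr (D-+ f (- ⟦ xE ⟧ (t ∷ e ∷ []))) (+ˡ (tr (D-neg (⟦ xE ⟧ (t ∷ e ∷ [])))
   (-‿cong (DD.differentiate (v0 ∷ v1 ∷ []) (v0 :* (P23E v0 :* v1) ∷ v8 ∷ []) xE (t ∷ e ∷ []) env (\ { zero -> ≈-refl ; (suc zero) -> ≈-refl }) (\ { zero -> Dt' ; (suc zero) -> ≈-refl })))))

  up : Expr 8 -> Expr 10
  up = substE (v0 ∷ v1 ∷ v2 ∷ v3 ∷ v4 ∷ v5 ∷ v6 ∷ v7 ∷ [])

 -- Ramanujan's equation for `Q` against the derivative of its proposed expression in t and e: the
 -- parts free of errors cancel. The other three equations arise in the same way.
 Da2 : ι (+ 144) * D a2 ~ ⟦ # 48 :* (v2 :* a2E :- a3E) :+ # 2 :* (Q4E v0 :* v1) :* w ⟧ base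
 Da2 = by3 {c = ι (+ 48)} {c' = ⟦ K (Z.- + 2) :* P23E v0 :* Q4E v0 :* v1 ⟧ base} {c″ = ⟦ # 2 :* Q4E v0 :* v1 :* w ⟧ base} 3DQ 144De P23*u
  (tr (*ˡ {ι (+ 144)} D-error) (solve (# 144 :* (v9 :- dx))
   (up (# 48 :* (v2 :* a2E :- a3E) :+ # 2 :* (Q4E v0 :* v1) :* w) :+ # 48 :* (# 3 :* v9 :- (v2 :* v4 :- v5))
     :+ up (K (Z.- + 2) :* P23E v0 :* Q4E v0 :* v1) :* (# 144 :* v8 :- deE v0 v1 v2 v3 v4 v6) :+ up (# 2 :* Q4E v0 :* v1 :* w) :* (P23E v0 :* v3 :- # 1)) refl env))
  where
  open Error Q (x2E v0 v1)

 Da3 : ι (+ 144) * D a3 ~ ⟦ # 72 :* (v2 :* a3E :- (v4 :+ x2E v0 v1) :* a2E) :+ # 3 :* (P2E v0 :* Q6E v0 :* v1 :^ 2) :* w ⟧ base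
 Da3 = by3 {c = ι (+ 72)} {c' = ⟦ K (Z.- + 3) :* P2E v0 :* P23E v0 :* Q6E v0 :* v1 :^ 2 ⟧ base} {c″ = ⟦ # 3 :* P2E v0 :* Q6E v0 :* v1 :^ 2 :* w ⟧ base} 2DR 144De P23*u
  (tr (*ˡ {ι (+ 144)} D-error) (solve (# 144 :* (v9 :- dx))
   (up (# 72 :* (v2 :* a3E :- (v4 :+ x2E v0 v1) :* a2E) :+ # 3 :* (P2E v0 :* Q6E v0 :* v1 :^ 2) :* w) :+ # 72 :* (# 2 :* v9 :- (v2 :* v5 :- v4 :* v4))
     :+ up (K (Z.- + 3) :* P2E v0 :* P23E v0 :* Q6E v0 :* v1 :^ 2) :* (# 144 :* v8 :- deE v0 v1 v2 v3 v4 v6) :+ up (# 3 :* P2E v0 :* Q6E v0 :* v1 :^ 2 :* w) :* (P23E v0 :* v3 :- # 1)) refl env))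
  where
  open Error R (x3E v0 v1)

 Da4 : ι (+ 144) * D a4 ~ ⟦ # 48 :* ((# 12 :* (P23E v0 :* v1) :+ v2) :* a4E :- # 13 :* a5E) :+ # 2 :* (Q4*E v0 :* v1) :* w ⟧ base
 Da4 = by3 {c = ι (+ 48)} {c' = ⟦ K (Z.- + 2) :* P23E v0 :* Q4*E v0 :* v1 ⟧ base} {c″ = ⟦ # 2 :* Q4*E v0 :* v1 :* w ⟧ base} 3DVQ′ 144De P23*u
  (tr (*ˡ {ι (+ 144)} D-error) (solve (# 144 :* (v9 :- dx))
   (up (# 48 :* ((# 12 :* (P23E v0 :* v1) :+ v2) :* a4E :- # 13 :* a5E) :+ # 2 :* (Q4*E v0 :* v1) :* w) :+ # 48 :* (# 3 :* v9 :- ((# 12 :* (P23E v0 :* v1) :+ v2) :* v6 :- # 13 :* v7))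
     :+ up (K (Z.- + 2) :* P23E v0 :* Q4*E v0 :* v1) :* (# 144 :* v8 :- deE v0 v1 v2 v3 v4 v6) :+ up (# 2 :* Q4*E v0 :* v1 :* w) :* (P23E v0 :* v3 :- # 1)) refl env))
  where
  open Error (V Q) (x4E v0 v1)
  3DVQ′ = tr 3DVQ (+ʳ (*ʳ {V Q} (+ʳ (*ˡ {ι (+ 12)} (sy P23*e)))))

 Da5 : ι (+ 144) * D a5 ~ ⟦ # 72 :* ((# 12 :* (P23E v0 :* v1) :+ v2) :* a5E :- # 13 :* (v6 :+ x4E v0 v1) :* a4E) :+ # 3 :* (P2E v0 :* Q6*E v0 :* v1 :^ 2) :* w ⟧ base
 Da5 = by3 {c = ι (+ 72)} {c' = ⟦ K (Z.- + 3) :* P2E v0 :* P23E v0 :* Q6*E v0 :* v1 :^ 2 ⟧ base} {c″ = ⟦ # 3 :* P2E v0 :* Q6*E v0 :* v1 :^ 2 :* w ⟧ base} 2DVR′ 144De P23*u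
  (tr (*ˡ {ι (+ 144)} D-error) (solve (# 144 :* (v9 :- dx))
   (up (# 72 :* ((# 12 :* (P23E v0 :* v1) :+ v2) :* a5E :- # 13 :* (v6 :+ x4E v0 v1) :* a4E) :+ # 3 :* (P2E v0 :* Q6*E v0 :* v1 :^ 2) :* w) :+ # 72 :* (# 2 :* v9 :- ((# 12 :* (P23E v0 :* v1) :+ v2) :* v7 :- # 13 :* (v6 :* v6)))
     :+ up (K (Z.- + 3) :* P2E v0 :* P23E v0 :* Q6*E v0 :* v1 :^ 2) :* (# 144 :* v8 :- deE v0 v1 v2 v3 v4 v6) :+ up (# 3 :* P2E v0 :* Q6*E v0 :* v1 :^ 2 :* w) :* (P23E v0 :* v3 :- # 1)) refl env))
  where
  open Error (V R) (x5E v0 v1)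
  2DVR′ = tr 2DVR (+ʳ (*ʳ {V R} (+ʳ (*ˡ {ι (+ 12)} (sy P23*e)))))

 -- The values at q = 0 of the coefficients of the system
 headT : Vec (List ℤ) 8
 headT = (0 ,, []) ∷ (1 ,, []) ∷ (1 ,, []) ∷ (1 ,, []) ∷ (1 ,, []) ∷ (1 ,, []) ∷ (1 ,, []) ∷ (1 ,, []) ∷ []

 heads : AgreeAll base headT
 heads = (agrees-head agrees-t ∷ []) ∷ (agrees-head agrees-e ∷ []) ∷ (agrees-head agrees-P ∷ []) ∷ (agrees-head agrees-u ∷ [])
  ∷ (agrees-head agrees-Q ∷ []) ∷ (agrees-head agrees-R ∷ []) ∷ (agrees-head agrees-VQ ∷ []) ∷ (agrees-head agrees-VR ∷ []) ∷ []

 head : ∀ (c : Expr 8) k -> sameT (evalT 1 c headT) (k ∷ []) ≡ true -> ⟦ c ⟧ base 0 ≡ k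
 head c k h = agrees-head (agrees-eval c base headT 1 (k ∷ []) heads h)

 Low : ℕ -> Ser -> Set
 Low n f = ∀ i -> i N.< n -> f i ≡ + 0

 leading : ∀ n (c : Expr 8) k f -> sameT (evalT 1 c headT) (k ∷ []) ≡ true -> Low n f -> (⟦ c ⟧ base * f) n ≡ ℤR.ι k Z.* f n
 leading n c k f h low = trans (*-leading (⟦ c ⟧ base) f n low) (cong (Z._* f n) (trans (head c k h) (sym (ι-ℤ k))))

 equation : ∀ n (a x y z : Ser) (c1 c2 c3 : Expr 8) k1 k2 k3 -> sameT (evalT 1 c1 headT) (k1 ∷ []) ≡ true -> sameT (evalT 1 c2 headT) (k2 ∷ []) ≡ true -> sameT (evalT 1 c3 headT) (k3 ∷ []) ≡ true ->
     Low n x -> Low n y -> Low n z -> ι (+ 144) * D a ~ ⟦ c1 ⟧ base * x + ⟦ c2 ⟧ base * y + ⟦ c3 ⟧ base * z ->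
     ℤR.ι (+ 144) Z.* (+ n Z.* a n) ≡ ℤR.ι k1 Z.* x n Z.+ ℤR.ι k2 Z.* y n Z.+ ℤR.ι k3 Z.* z n
 equation n a x y z c1 c2 c3 k1 k2 k3 h1 h2 h3 l1 l2 l3 eq = trans (sym (ι-*ˢ (+ 144) (D a) n)) (trans (at eq n)
  (trans (+-at (⟦ c1 ⟧ base * x + ⟦ c2 ⟧ base * y) (⟦ c3 ⟧ base * z) n) (cong₂ Z._+_
   (trans (+-at (⟦ c1 ⟧ base * x) (⟦ c2 ⟧ base * y) n) (cong₂ Z._+_ (leading n c1 k1 x h1 l1) (leading n c2 k2 y h2 l2))) (leading n c3 k3 z h3 l3))))

 -- The determinant K² (K - 144) (K - 1872), K = 144 n, of the system for the
 -- n-th coefficients vanishes for n = 0, 1, 13 only.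
 module Cramer (k : ℕ) (a b c d : ℤ)
  (r1 : ℤR.ι (+ 144) Z.* (+ (14 N.+ k) Z.* a) ≡ ℤR.ι (+ 46) Z.* a Z.+ ℤR.ι (Z.- + 48) Z.* b Z.+ ℤR.ι (+ 338) Z.* c)
  (r2 : ℤR.ι (+ 144) Z.* (+ (14 N.+ k) Z.* b) ≡ ℤR.ι (Z.- + 147) Z.* a Z.+ ℤR.ι (+ 72) Z.* b Z.+ ℤR.ι (+ 507) Z.* c)
  (r3 : ℤR.ι (+ 144) Z.* (+ (14 N.+ k) Z.* c) ≡ ℤR.ι (Z.- + 2) Z.* a Z.+ ℤR.ι (+ 962) Z.* c Z.+ ℤR.ι (Z.- + 624) Z.* d)
  (r4 : ℤR.ι (+ 144) Z.* (+ (14 N.+ k) Z.* d) ≡ ℤR.ι (Z.- + 3) Z.* a Z.+ ℤR.ι (Z.- + 1365) Z.* c Z.+ ℤR.ι (+ 936) Z.* d) where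

  N : ℤ
  N = + (14 N.+ k)
  ρ : Vec ℤ 5
  ρ = N ∷ a ∷ b ∷ c ∷ d ∷ []
  kE detE d1 d2 d3 d4 : Expr 5
  kE = # 144 :* v0
  detE = kE :* kE :* (kE :- # 144) :* (kE :- # 1872)
  d1 = # 144 :* (v0 :* v1) :- (# 46 :* v1 :+ K (Z.- + 48) :* v2 :+ # 338 :* v3)
  d2 = # 144 :* (v0 :* v2) :- (K (Z.- + 147) :* v1 :+ # 72 :* v2 :+ # 507 :* v3)
  d3 = # 144 :* (v0 :* v3) :- (K (Z.- + 2) :* v1 :+ # 962 :* v3 :+ K (Z.- + 624) :* v4)
  d4 = # 144 :* (v0 :* v4) :- (K (Z.- + 3) :* v1 :+ K (Z.- + 1365) :* v3 :+ # 936 :* v4)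
  AE : List ℤ -> Expr 5
  AE p = hE p kE
  A : List ℤ -> ℤ
  A p = ℤR.⟦ AE p ⟧ ρ
  ⟦det⟧ : ℤ
  ⟦det⟧ = ℤR.⟦ detE ⟧ ρ

  positive : ∀ j m -> + 144 Z.* N Z.- + j ≡ + 144 Z.* + suc m -> ∀ x -> (ℤR.ι (+ 144) Z.* N Z.- ℤR.ι (+ j)) Z.* x ≡ + 0 -> x ≡ + 0
  positive j m e x h = case ZP.i*j≡0⇒i≡0∨j≡0 (+ 144 Z.* + suc m) (trans (cong (Z._* x) (sym (trans (cong₂ (\ u v -> u Z.* N Z.- v) (ι-ℤ (+ 144)) (ι-ℤ (+ j))) e))) h) of \ { (inj₂ z) -> z }

  vanish : ∀ x -> ⟦det⟧ Z.* x ≡ ℤR.ι (+ 0) -> x ≡ + 0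
  vanish x h = positive 1872 k (l1 (+ k)) x (positive 144 (12 N.+ k) (l2 (+ k)) _ (positive 0 (13 N.+ k) (l3 (+ k)) _ (positive 0 (13 N.+ k) (l3 (+ k)) _
   (trans (ℤR.solve ((kE :- # 0) :* ((kE :- # 0) :* ((kE :- # 144) :* ((kE :- # 1872) :* v1)))) (detE :* v1) refl (N ∷ x ∷ b ∷ c ∷ d ∷ [])) (trans h (ι-ℤ (+ 0)))))))
   where
   l1 : ∀ k -> + 144 Z.* (+ 14 Z.+ k) Z.- + 1872 ≡ + 144 Z.* (+ 1 Z.+ k)
   l1 = solve-∀
   l2 : ∀ k -> + 144 Z.* (+ 14 Z.+ k) Z.- + 144 ≡ + 144 Z.* (+ 13 Z.+ k)
   l2 = solve-∀
   l3 : ∀ k -> + 144 Z.* (+ 14 Z.+ k) Z.- + 0 ≡ + 144 Z.* (+ 14 Z.+ k)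
   l3 = solve-∀

  -- The multipliers of the four equations are a row of the adjugate matrix, as polynomials in K =
  -- 144 n.
  a-det : ⟦det⟧ Z.* a ≡ ℤR.ι (+ 0)
  a-det = ℤR.by2 {c = A (Z.- + 3504384 ∷ 185328 ,, Z.- + 1970 ∷ 1 ,, [])} {c' = A (Z.- + 2336256 ∷ 91104 ,, Z.- + 48 ∷ [])} r1 r2 (ℤR.by2 {c = A (45556992 ,, Z.- + 365040 ∷ 338 ,, [])} {c' = A (30371328 ,, Z.- + 210912 ∷ [])} r3 r4
   (ℤR.solve (detE :* v1) (# 0 :+ AE (Z.- + 3504384 ∷ 185328 ,, Z.- + 1970 ∷ 1 ,, []) :* d1 :+ AE (Z.- + 2336256 ∷ 91104 ,, Z.- + 48 ∷ []) :* d2 :+ AE (45556992 ,, Z.- + 365040 ∷ 338 ,, []) :* d3 :+ AE (30371328 ,, Z.- + 210912 ∷ []) :* d4) refl ρ))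
  b-det : ⟦det⟧ Z.* b ≡ ℤR.ι (+ 0)
  b-det = ℤR.by2 {c = A (Z.- + 5256576 ∷ 277992 ,, Z.- + 147 ∷ [])} {c' = A (Z.- + 3504384 ∷ 136656 ,, Z.- + 1944 ∷ 1 ,, [])} r1 r2 (ℤR.by2 {c = A (68335488 ,, Z.- + 547560 ∷ 507 ,, [])} {c' = A (45556992 ,, Z.- + 316368 ∷ [])} r3 r4
   (ℤR.solve (detE :* v2) (# 0 :+ AE (Z.- + 5256576 ∷ 277992 ,, Z.- + 147 ∷ []) :* d1 :+ AE (Z.- + 3504384 ∷ 136656 ,, Z.- + 1944 ∷ 1 ,, []) :* d2 :+ AE (68335488 ,, Z.- + 547560 ∷ 507 ,, []) :* d3 :+ AE (45556992 ,, Z.- + 316368 ∷ []) :* d4) refl ρ))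
  c-det : ⟦det⟧ Z.* c ≡ ℤR.ι (+ 0)
  c-det = ℤR.by2 {c = A (Z.- + 269568 ∷ 3888 ,, Z.- + 2 ∷ [])} {c' = A (Z.- + 179712 ∷ 96 ,, [])} r1 r2 (ℤR.by2 {c = A (3504384 ,, 106704 ,, Z.- + 1054 ∷ 1 ,, [])} {c' = A (2336256 ,, 73632 ,, Z.- + 624 ∷ [])} r3 r4
   (ℤR.solve (detE :* v3) (# 0 :+ AE (Z.- + 269568 ∷ 3888 ,, Z.- + 2 ∷ []) :* d1 :+ AE (Z.- + 179712 ∷ 96 ,, []) :* d2 :+ AE (3504384 ,, 106704 ,, Z.- + 1054 ∷ 1 ,, []) :* d3 :+ AE (2336256 ,, 73632 ,, Z.- + 624 ∷ []) :* d4) refl ρ))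
  d-det : ⟦det⟧ Z.* d ≡ ℤR.ι (+ 0)
  d-det = ℤR.by2 {c = A (Z.- + 404352 ∷ 5832 ,, Z.- + 3 ∷ [])} {c' = A (Z.- + 269568 ∷ 144 ,, [])} r1 r2 (ℤR.by2 {c = A (5256576 ,, 160056 ,, Z.- + 1365 ∷ [])} {c' = A (3504384 ,, 110448 ,, Z.- + 1080 ∷ 1 ,, [])} r3 r4
   (ℤR.solve (detE :* v4) (# 0 :+ AE (Z.- + 404352 ∷ 5832 ,, Z.- + 3 ∷ []) :* d1 :+ AE (Z.- + 269568 ∷ 144 ,, []) :* d2 :+ AE (5256576 ,, 160056 ,, Z.- + 1365 ∷ []) :* d3 :+ AE (3504384 ,, 110448 ,, Z.- + 1080 ∷ 1 ,, []) :* d4) refl ρ))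

  solution : (a ≡ + 0) × (b ≡ + 0) × (c ≡ + 0) × (d ≡ + 0)
  solution = vanish a a-det , vanish b b-det , vanish c c-det , vanish d d-det

 initial : ∀ (c : Expr 8) -> sameT (evalT 16 c (tT ∷ eT ∷ PT ∷ uT ∷ QT ∷ RT ∷ VQT ∷ VRT ∷ [])) (zerosT 16) ≡ true -> ∀ n -> n N.< 16 -> ⟦ c ⟧ base n ≡ + 0
 initial c h n l = vanishing 16 (agrees-eval c base (tT ∷ eT ∷ PT ∷ uT ∷ QT ∷ RT ∷ VQT ∷ VRT ∷ []) 16 (zerosT 16)
  (agrees-t ∷ agrees-e ∷ agrees-P ∷ agrees-u ∷ agrees-Q ∷ agrees-R ∷ agrees-VQ ∷ agrees-VR ∷ []) h) n l

 c22 c23 c24 c32 c33 c34 c42 c44 c45 c52 c54 c55 : Expr 8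
 c22 = # 48 :* v2 :- # 2 :* Q4E v0 :* v1
 c23 = K (Z.- + 48)
 c24 = # 338 :* Q4E v0 :* v1
 c32 = :- (# 72 :* (v4 :+ x2E v0 v1)) :- # 3 :* P2E v0 :* Q6E v0 :* v1 :^ 2
 c33 = # 72 :* v2
 c34 = # 507 :* P2E v0 :* Q6E v0 :* v1 :^ 2
 c42 = :- (# 2 :* Q4*E v0 :* v1)
 c44 = # 48 :* (# 12 :* (P23E v0 :* v1) :+ v2) :+ # 338 :* Q4*E v0 :* v1
 c45 = K (Z.- + 624)
 c52 = :- (# 3 :* P2E v0 :* Q6*E v0 :* v1 :^ 2)
 c54 = :- (# 936 :* (v6 :+ x4E v0 v1)) :+ # 507 :* P2E v0 :* Q6*E v0 :* v1 :^ 2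
 c55 = # 72 :* (# 12 :* (P23E v0 :* v1) :+ v2)

 errors : ∀ n -> (a2 n ≡ + 0) × (a3 n ≡ + 0) × (a4 n ≡ + 0) × (a5 n ≡ + 0)
 errors = strong _ step
  where
  step : ∀ n -> (∀ i -> i N.< n -> (a2 i ≡ + 0) × (a3 i ≡ + 0) × (a4 i ≡ + 0) × (a5 i ≡ + 0)) -> (a2 n ≡ + 0) × (a3 n ≡ + 0) × (a4 n ≡ + 0) × (a5 n ≡ + 0)
  step n ih with n NP.<? 14
  -- The degrees 0, 1 and 13, where the determinant vanishes, lie in this range and are settled by
  -- computation.
  ... | yes l = initial a2E refl n l' , initial a3E refl n l' , initial a4E refl n l' , initial a5E refl n l'
   where l' = NP.<-≤-trans l (NP.m≤m+n 14 2)
  ... | no ¬l = subst (\ n -> (a2 n ≡ + 0) × (a3 n ≡ + 0) × (a4 n ≡ + 0) × (a5 n ≡ + 0)) n≡ (Cramer.solution (n ∸ 14) (a2 n') (a3 n') (a4 n') (a5 n')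
     (equation n' a2 a2 a3 a4 c22 c23 c24 (+ 46) (Z.- + 48) (+ 338) refl refl refl (low (\ z -> proj₁ z)) (low (\ z -> proj₁ (proj₂ z))) (low (\ z -> proj₁ (proj₂ (proj₂ z))))
       (tr Da2 (solve (# 48 :* (v2 :* a2E :- a3E) :+ # 2 :* (Q4E v0 :* v1) :* w) (c22 :* a2E :+ c23 :* a3E :+ c24 :* a4E) refl base)))
     (equation n' a3 a2 a3 a4 c32 c33 c34 (Z.- + 147) (+ 72) (+ 507) refl refl refl (low (\ z -> proj₁ z)) (low (\ z -> proj₁ (proj₂ z))) (low (\ z -> proj₁ (proj₂ (proj₂ z))))
       (tr Da3 (solve (# 72 :* (v2 :* a3E :- (v4 :+ x2E v0 v1) :* a2E) :+ # 3 :* (P2E v0 :* Q6E v0 :* v1 :^ 2) :* w) (c32 :* a2E :+ c33 :* a3E :+ c34 :* a4E) refl base)))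
     (equation n' a4 a2 a4 a5 c42 c44 c45 (Z.- + 2) (+ 962) (Z.- + 624) refl refl refl (low (\ z -> proj₁ z)) (low (\ z -> proj₁ (proj₂ (proj₂ z)))) (low (\ z -> proj₂ (proj₂ (proj₂ z))))
       (tr Da4 (solve (# 48 :* ((# 12 :* (P23E v0 :* v1) :+ v2) :* a4E :- # 13 :* a5E) :+ # 2 :* (Q4*E v0 :* v1) :* w) (c42 :* a2E :+ c44 :* a4E :+ c45 :* a5E) refl base)))
     (equation n' a5 a2 a4 a5 c52 c54 c55 (Z.- + 3) (Z.- + 1365) (+ 936) refl refl refl (low (\ z -> proj₁ z)) (low (\ z -> proj₁ (proj₂ (proj₂ z)))) (low (\ z -> proj₂ (proj₂ (proj₂ z))))
       (tr Da5 (solve (# 72 :* ((# 12 :* (P23E v0 :* v1) :+ v2) :* a5E :- # 13 :* (v6 :+ x4E v0 v1) :* a4E) :+ # 3 :* (P2E v0 :* Q6*E v0 :* v1 :^ 2) :* w) (c52 :* a2E :+ c54 :* a4E :+ c55 :* a5E) refl base))))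
   where
   n' = 14 N.+ (n ∸ 14)
   n≡ : n' ≡ n
   n≡ = NP.m+[n∸m]≡n (NP.≮⇒≥ ¬l)
   low : ∀ {f : Ser} -> (∀ {i} -> (a2 i ≡ + 0) × (a3 i ≡ + 0) × (a4 i ≡ + 0) × (a5 i ≡ + 0) -> f i ≡ + 0) -> Low n' f
   low g i l = g (ih i (subst (i N.<_) n≡ l))

opaque
 Q≈ : Q ~ P23 * ⟦ Q4E v0 ⟧ (t ∷ []) * e ^ 2
 Q≈ = from-diff (mk \ n -> proj₁ (errors n))

 R≈ : R ~ ⟦ P2E v0 ⟧ (t ∷ []) * P23 * ⟦ Q6E v0 ⟧ (t ∷ []) * e ^ 3
 R≈ = from-diff (mk \ n -> proj₁ (proj₂ (errors n)))

 VQ≈ : V Q ~ P23 * ⟦ Q4*E v0 ⟧ (t ∷ []) * e ^ 2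
 VQ≈ = from-diff (mk \ n -> proj₁ (proj₂ (proj₂ (errors n))))

 VR≈ : V R ~ ⟦ P2E v0 ⟧ (t ∷ []) * P23 * ⟦ Q6*E v0 ⟧ (t ∷ []) * e ^ 3
 VR≈ = from-diff (mk \ n -> proj₂ (proj₂ (proj₂ (errors n))))

 -- The vanishing of the errors simplifies the derivative of e.
 6De : ι (+ 6) * D e ~ P * e - ⟦ mE v0 ⟧ (t ∷ []) * e ^ 2
 6De = regular-cancel {ι (+ 24)} (regular-ι (+ 24) (\ ())) (by3 {c = ι (+ 1)} {c' = - (ι (+ 169) * u)} {c″ = u} 144De VQ≈ Q≈
  (solve (# 24 :* (# 6 :* v6)) (# 24 :* (v2 :* v1 :- mE v0 :* v1 :^ 2) :+ # 1 :* (# 144 :* v6 :- deE v0 v1 v2 v3 v4 v5)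
   :+ (:- (# 169 :* v3)) :* (v5 :- x4E v0 v1) :+ v3 :* (v4 :- x2E v0 v1)) refl (t ∷ e ∷ P ∷ u ∷ Q ∷ V Q ∷ D e ∷ [])))

-- The discriminant

private
 -- `P` starts with 1, so once the lower coefficients of the difference d vanish, degree n reads n
 -- dₙ = dₙ. Only n = 1 needs an initial value.
 P-unique : ∀ f g -> D f ~ P * f -> D g ~ P * g -> f 1 ≡ g 1 -> f ~ g
 P-unique f g hf hg h1 = from-diff (mk (strong _ step))
  where
  d = f - g
  eq : D d ~ P * d
  eq = tr (D-+ f (- g)) (tr (+-cong hf (tr (D-neg g) (-‿cong hg))) (solve (v0 :* v1 :- v0 :* v2) (v0 :* (v1 :- v2)) refl (P ∷ f ∷ g ∷ [])))
  lem2 : ∀ n x -> n Z.* x ≡ (+ 1 Z.+ n) Z.* x Z.- x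
  lem2 = solve-∀
  step : ∀ n -> (∀ i -> i N.< n -> d i ≡ + 0) -> d n ≡ + 0
  lead : ∀ n -> (∀ i -> i N.< n -> d i ≡ + 0) -> + n Z.* d n ≡ d n
  lead n ih = trans (at eq n) (trans (*-leading P d n ih) (trans (cong (Z._* d n) (agrees-head agrees-P)) (ZP.*-identityˡ (d n))))
  step zero ih = sym (lead 0 ih)
  step (suc zero) ih = trans (+-at f (- g) 1) (trans (cong₂ Z._+_ h1 (neg-at g 1)) (ZP.+-inverseʳ (g 1)))
  step (2+ n) ih = case ZP.i*j≡0⇒i≡0∨j≡0 (+ suc n) (trans (lem2 (+ suc n) (d (2+ n))) (trans (cong (Z._- d (2+ n)) (lead (2+ n) ih)) (ZP.+-inverseʳ (d (2+ n))))) of \ { (inj₂ z) -> z }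

 agrees-take2 : ∀ {f c d cs} -> Agrees f (c ∷ d ∷ cs) -> Agrees f (c ∷ d ∷ [])
 agrees-take2 (x ∷ y ∷ _) = x ∷ y ∷ []

 agrees-second : ∀ {f c d cs} -> Agrees f (c ∷ d ∷ cs) -> f 1 ≡ d
 agrees-second (_ ∷ y ∷ _) = y

Δ : Ser
Δ = q * π ^ 24

opaque
 -- Both sides solve D f = P f: the left by Ramanujan's equations, the right because P = 1 + 24 `λ̂`
 -- is the logarithmic derivative of q π²⁴.
 Q³-R² : Q ^ 3 - R ^ 2 ~ ι (+ 1728) * Δ
 Q³-R² = P-unique (Q ^ 3 - R ^ 2) (ι (+ 1728) * Δ) dl dr
   (trans (agrees-second (agrees-eval (v0 :^ 3 :- v1 :^ 2) (Q ∷ R ∷ []) ((1 ,, 240 ,, []) ∷ (1 ,, Z.- + 504 ∷ []) ∷ []) 2 (0 ,, 1728 ,, []) (agrees-take2 agrees-Q ∷ agrees-take2 agrees-R ∷ []) refl))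
     (sym (agrees-second (agrees-eval (# 1728 :* (v0 :* v1 :^ 24)) (q ∷ π ∷ []) ((0 ,, 1 ,, []) ∷ (1 ,, Z.- + 1 ∷ []) ∷ []) 2 (0 ,, 1728 ,, []) (agrees-take2 agrees-q ∷ agrees-take2 agrees-π ∷ []) refl))))
  where
  s2 : Vec (Expr 5) 2
  s2 = v1 ∷ v2 ∷ []
  d2 : Vec (Expr 5) 2
  d2 = v3 ∷ v4 ∷ []
  dl : D (Q ^ 3 - R ^ 2) ~ P * (Q ^ 3 - R ^ 2)
  dl = tr (DD.differentiate s2 d2 (v0 :^ 3 :- v1 :^ 2) (Q ∷ R ∷ []) (P ∷ Q ∷ R ∷ D Q ∷ D R ∷ []) (\ { zero -> ≈-refl ; (suc zero) -> ≈-refl }) (\ { zero -> ≈-refl ; (suc zero) -> ≈-refl }))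
   (by2 {c = Q ^ 2} {c' = - R} 3DQ 2DR (solve (∂ s2 d2 (v0 :^ 3 :- v1 :^ 2))
     (v0 :* (v1 :^ 3 :- v2 :^ 2) :+ v1 :^ 2 :* (# 3 :* v3 :- (v0 :* v1 :- v2)) :+ (:- v2) :* (# 2 :* v4 :- (v0 :* v2 :- v1 :* v1))) refl (P ∷ Q ∷ R ∷ D Q ∷ D R ∷ [])))
  s3 d3 : Vec (Expr 3) 2
  s3 = v0 ∷ v1 ∷ []
  d3 = v0 ∷ v2 :* v1 ∷ []
  dr : D (ι (+ 1728) * Δ) ~ P * (ι (+ 1728) * Δ)
  dr = tr (DD.differentiate s3 d3 (# 1728 :* (v0 :* v1 :^ 24)) (q ∷ π ∷ []) (q ∷ π ∷ λ̂ ∷ []) (\ { zero -> ≈-refl ; (suc zero) -> ≈-refl }) (\ { zero -> Dq ; (suc zero) -> Dπ }))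
   (solve (∂ s3 d3 (# 1728 :* (v0 :* v1 :^ 24))) ((# 1 :+ # 24 :* v2) :* (# 1728 :* (v0 :* v1 :^ 24))) refl (q ∷ π ∷ λ̂ ∷ []))

 Δ≈ : Δ ~ ⟦ v0 :* P2E v0 :* P23E v0 :^ 2 :* v1 :^ 6 ⟧ (t ∷ e ∷ [])
 Δ≈ = regular-cancel {ι (+ 1728)} (regular-ι (+ 1728) (\ ())) (tr (sy Q³-R²) (tr (+-cong (^-cong 3 Q≈) (-‿cong (^-cong 2 R≈)))
  (solve ((P23E v0 :* Q4E v0 :* v1 :^ 2) :^ 3 :- (P2E v0 :* P23E v0 :* Q6E v0 :* v1 :^ 3) :^ 2) (# 1728 :* (v0 :* P2E v0 :* P23E v0 :^ 2 :* v1 :^ 6)) refl (t ∷ e ∷ []))))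

 VΔ≈ : V Δ ~ ⟦ v0 :^ 13 :* P2E v0 :* P23E v0 :^ 2 :* v1 :^ 6 ⟧ (t ∷ e ∷ [])
 VΔ≈ = regular-cancel {ι (+ 1728)} (regular-ι (+ 1728) (\ ())) (tr (sy (V13.V-⟦⟧ (# 1728 :* v0) (Δ ∷ []))) (tr (V13.V-cong (sy Q³-R²)) (tr (V13.V-⟦⟧ (v0 :^ 3 :- v1 :^ 2) (Q ∷ R ∷ [])) (tr (+-cong (^-cong 3 VQ≈) (-‿cong (^-cong 2 VR≈)))
  (solve ((P23E v0 :* Q4*E v0 :* v1 :^ 2) :^ 3 :- (P2E v0 :* P23E v0 :* Q6*E v0 :* v1 :^ 3) :^ 2) (# 1728 :* (v0 :^ 13 :* P2E v0 :* P23E v0 :^ 2 :* v1 :^ 6)) refl (t ∷ e ∷ []))))))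

-- v = q / t, and the orthogonality [q^j] t^i v^j E = δ(i, j): the constant
-- term of t^k dt/t is the residue δ(k, 0).

v : Ser
v = π ^ 2 * V π⁻¹ ^ 2

Vπ*Vπ⁻¹ : V π * V π⁻¹ ~ ι (+ 1)
Vπ*Vπ⁻¹ = tr (sy (V13.V-* π π⁻¹)) (tr (V13.V-cong π*π⁻¹) (V13.V-ι (+ 1)))

t*v : t * v ~ q
t*v = by2 {c = q * (V π * V π⁻¹) ^ 2 * (π * π⁻¹ + ι (+ 1))} {c' = q * (V π * V π⁻¹ + ι (+ 1))} π*π⁻¹ Vπ*Vπ⁻¹
 (solve (v0 :* (v1 :^ 2 :* v2 :^ 2) :* (v3 :^ 2 :* v4 :^ 2)) (v0 :+ v0 :* (v1 :* v4) :^ 2 :* (v3 :* v2 :+ # 1) :* (v3 :* v2 :- # 1) :+ v0 :* (v1 :* v4 :+ # 1) :* (v1 :* v4 :- # 1)) refl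
  (q ∷ V π ∷ π⁻¹ ∷ π ∷ V π⁻¹ ∷ []))

v-head : v 0 ≡ + 1
v-head = trans (cong (\ z -> + 1 Z.* (z Z.* (z Z.* + 1))) (trans (V13.V-0 π⁻¹) refl)) refl

regular-t : Regular t
regular-t = regular-* {q} {V π ^ 2 * π⁻¹ ^ 2} regular-q (regular-1 {V π ^ 2 * π⁻¹ ^ 2} (trans (cong (\ z -> (z Z.* (z Z.* + 1)) Z.* + 1) (trans (V13.V-0 π) refl)) refl))

vE : v * E ~ v - D v
vE = regular-cancel {t} regular-t (by2 {c = ι (+ 1)} {c' = - v} Dtv Dt''
 (solve (v0 :* (v1 :* v2)) (v0 :* (v1 :- v3) :+ # 1 :* (v4 :* v1 :+ v0 :* v3 :- v0 :* v1) :+ (:- v1) :* (v4 :- v0 :* v2)) refl (t ∷ v ∷ E ∷ D v ∷ D t ∷ [])))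
 where
 Dt'' = Dt
 Dtv : D t * v + t * D v ~ t * v
 Dtv = tr (sy (D-* t v)) (tr (D-cong t*v) (tr Dq (sy t*v)))

-- t^(-k) dt/t is exact for k ≥ 1: k v^k E = k v^k - D (v^k), and the right side has no coefficient
-- in degree k.
residue : ∀ k -> (v ^ suc k * E) (suc k) ≡ + 0
residue k = case ZP.i*j≡0⇒i≡0∨j≡0 (+ suc k) zero-product of \ { (inj₂ z) -> z }
 where
 eq : ι (+ suc k) * (v ^ suc k * E) ~ ι (+ suc k) * v ^ suc k - D (v ^ suc k)
 eq = by2 {c = ι (+ suc k) * v ^ k} {c' = ι (+ 1)} vE (DD.𝒟-^ v k)
  (solve (v0 :* (v1 :* v2 :* v3)) (v0 :* (v1 :* v2) :- v5 :+ v0 :* v2 :* (v1 :* v3 :- (v1 :- v4)) :+ # 1 :* (v5 :- v0 :* v2 :* v4)) refl (ι (+ suc k) ∷ v ∷ v ^ k ∷ E ∷ D v ∷ D (v ^ suc k) ∷ []))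
 zero-product : + suc k Z.* (v ^ suc k * E) (suc k) ≡ + 0
 zero-product = trans (sym (coefficient-ι (+ suc k) (v ^ suc k * E) (suc k))) (trans (at eq (suc k)) (trans (+-at (ι (+ suc k) * v ^ suc k) (- D (v ^ suc k)) (suc k))
  (trans (cong₂ Z._+_ (coefficient-ι (+ suc k) (v ^ suc k) (suc k)) (neg-at (D (v ^ suc k)) (suc k))) (ZP.+-inverseʳ (+ suc k Z.* (v ^ suc k) (suc k))))))

E-head : E 0 ≡ + 1
E-head = agrees-head agrees-E

nth : List ℤ -> ℕ -> ℤ
nth [] _ = + 0
nth (c ∷ cs) zero = c
nth (c ∷ cs) (suc n) = nth cs n

private
 t-v : ∀ j Z -> t * Z * (v ^ suc j * E) ~ q * (Z * (v ^ j * E))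
 t-v j Z = tr (solve (v0 :* v1 :* (v2 :* v3 :* v4)) (v0 :* v2 :* (v1 :* (v3 :* v4))) refl (t ∷ Z ∷ v ∷ v ^ j ∷ E ∷ [])) (*ʳ {Z * (v ^ j * E)} t*v)

 t-0 : ∀ Z Y -> (t * Z * Y) 0 ≡ + 0
 t-0 Z Y = trans (at (tr (*-assoc t Z Y) (*-assoc q (V π ^ 2 * π⁻¹ ^ 2) (Z * Y))) 0) (q*-zero (V π ^ 2 * π⁻¹ ^ 2 * (Z * Y)))

orthogonal : ∀ p j -> (horner p t * (v ^ j * E)) j ≡ nth p j
orthogonal [] j = trans (at (*ʳ {v ^ j * E} ι-0) j) (at (zeroˡ (v ^ j * E)) j)
orthogonal (c ∷ p) zero = trans (at (distribʳ (v ^ 0 * E) (ι c) (t * horner p t)) 0) (trans (+-at (ι c * (v ^ 0 * E)) (t * horner p t * (v ^ 0 * E)) 0)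
 (trans (cong₂ Z._+_ (trans (coefficient-ι c (v ^ 0 * E) 0) (cong (c Z.*_) (trans (at (*-identityˡ E) 0) E-head))) (t-0 (horner p t) (v ^ 0 * E))) (trans (ZP.+-identityʳ _) (ZP.*-identityʳ c))))
orthogonal (c ∷ p) (suc j) = trans (at (distribʳ (v ^ suc j * E) (ι c) (t * horner p t)) (suc j)) (trans (+-at (ι c * (v ^ suc j * E)) (t * horner p t * (v ^ suc j * E)) (suc j))
 (trans (cong₂ Z._+_ (trans (coefficient-ι c (v ^ suc j * E) (suc j)) (trans (cong (c Z.*_) (residue j)) (ZP.*-zeroʳ c)))
  (trans (at (t-v j (horner p t)) (suc j)) (trans (q*-suc _ j) (orthogonal p j)))) (ZP.+-identityˡ _)))

-- The homogenisation of a polynomial, of degree one less than its length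

hom : List ℤ -> Ser -> Ser -> Ser
hom [] a b = 0#
hom (c ∷ cs) a b = ι c * b ^ length cs + a * hom cs a b

-- `hom` reads the degree off the length of the list, so the summands are padded to the exact length
-- of the product and leading zeros are kept.
mulH : List ℤ -> List ℤ -> List ℤ
mulH [] r = []
mulH (c ∷ []) r = scaleP 0 c r
mulH (c ∷ c' ∷ p) r = addP 1 (scaleP 0 c r ++ zerosT (suc (length p))) (0 ,, mulH (c' ∷ p) r)

private
 length-scale : ∀ c r -> length (scaleP 0 c r) ≡ length r
 length-scale c [] = refl
 length-scale c (x ∷ r) = cong suc (length-scale c r)

 length-zeros : ∀ n -> length (zerosT n) ≡ n
 length-zeros zero = refl
 length-zeros (suc n) = cong suc (length-zeros n)

 length-add : ∀ p r -> length p ≡ length r -> length (addP 1 p r) ≡ length r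
 length-add [] [] h = refl
 length-add (a ∷ p) (b ∷ r) h = cong suc (length-add p r (NP.suc-injective h))

 length-pad : ∀ c r n -> length (scaleP 0 c r ++ zerosT n) ≡ n N.+ length r
 length-pad c [] n = trans (length-zeros n) (sym (NP.+-identityʳ n))
 length-pad c (x ∷ r) n = trans (cong suc (length-pad c r n)) (sym (NP.+-suc n (length r)))

length-mulH : ∀ c p r -> length (mulH (c ∷ p) r) ≡ length p N.+ length r
length-mulH c [] r = length-scale c r
length-mulH c (c' ∷ p) r = trans (length-add (scaleP 0 c r ++ zerosT (suc (length p))) (0 ,, mulH (c' ∷ p) r)
 (trans (length-pad c r (suc (length p))) (cong suc (sym (length-mulH c' p r))))) (cong suc (length-mulH c' p r))

module _ (a b : Ser) where
 private
  hom-add : ∀ p r -> length p ≡ length r -> hom (addP 1 p r) a b ~ hom p a b + hom r a b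
  hom-add [] [] h = sy (+-identityʳ 0#)
  hom-add (x ∷ p) (y ∷ r) h = tr (+-cong (*-cong (ι-+ x y) (reflexive (cong (b ^_) (length-add p r (NP.suc-injective h))))) (*ˡ {a} (hom-add p r (NP.suc-injective h))))
   (tr (solve ((v0 :+ v1) :* v2 :+ v3 :* (v4 :+ v5)) (v0 :* v2 :+ v3 :* v4 :+ (v1 :* v2 :+ v3 :* v5)) refl (ι x ∷ ι y ∷ b ^ length r ∷ a ∷ hom p a b ∷ hom r a b ∷ []))
     (+ʳ (+ʳ (*ˡ {ι x} (reflexive (cong (b ^_) (sym (NP.suc-injective h))))))))

  hom-zeros : ∀ n -> hom (zerosT n) a b ~ 0#
  hom-zeros zero = ≈-refl
  hom-zeros (suc n) = tr (+-cong (tr (*ʳ ι-0) (zeroˡ _)) (tr (*ˡ {a} (hom-zeros n)) (zeroʳ a))) (+-identityʳ 0#)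

  ^-+ : ∀ m n -> b ^ (m N.+ n) ~ b ^ m * b ^ n
  ^-+ zero n = sy (*-identityˡ (b ^ n))
  ^-+ (suc m) n = tr (*ˡ {b} (^-+ m n)) (sy (*-assoc b (b ^ m) (b ^ n)))

  hom-scale : ∀ c r n -> hom (scaleP 0 c r ++ zerosT n) a b ~ ι c * b ^ n * hom r a b
  hom-scale c [] n = tr (hom-zeros n) (sy (zeroʳ _))
  hom-scale c (x ∷ r) n = tr (+-cong (*-cong (ι-* c x) (tr (reflexive (cong (b ^_) (length-pad c r n))) (^-+ n (length r)))) (*ˡ {a} (hom-scale c r n)))
   (solve (v0 :* v1 :* (v2 :* v3) :+ v4 :* (v0 :* v2 :* v5)) (v0 :* v2 :* (v1 :* v3 :+ v4 :* v5)) refl (ι c ∷ ι x ∷ b ^ n ∷ b ^ length r ∷ a ∷ hom r a b ∷ []))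

 hom-mulH : ∀ p r -> hom (mulH p r) a b ~ hom p a b * hom r a b
 hom-mulH [] r = sy (zeroˡ (hom r a b))
 hom-mulH (c ∷ []) r = tr (reflexive (cong (\ l -> hom l a b) (sym (++-identityʳ (scaleP 0 c r))))) (tr (hom-scale c r 0) (sy (*ʳ {hom r a b} (tr (+ˡ (zeroʳ a)) (+-identityʳ _)))))
 hom-mulH (c ∷ c' ∷ p) r = tr (hom-add (scaleP 0 c r ++ zerosT (suc (length p))) (0 ,, mulH (c' ∷ p) r) (trans (length-pad c r (suc (length p))) (cong suc (sym (length-mulH c' p r)))))
  (tr (+-cong (hom-scale c r (suc (length p))) (tr (+-cong (tr (*ʳ ι-0) (zeroˡ _)) (*ˡ {a} (hom-mulH (c' ∷ p) r))) (+-identityˡ _)))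
   (solve (v0 :* v1 :* v2 :+ v3 :* (v4 :* v2)) ((v0 :* v1 :+ v3 :* v4) :* v2) refl (ι c ∷ b ^ suc (length p) ∷ hom r a b ∷ a ∷ hom (c' ∷ p) a b ∷ [])))

hom-horner : ∀ p x -> hom p x 1# ~ horner p x
hom-horner [] x = sy ι-0
hom-horner (c ∷ p) x = +-cong (tr (*ˡ {ι c} (one^ (length p))) (*-identityʳ (ι c))) (*ˡ {x} (hom-horner p x))
 where
 one^ : ∀ n -> 1# ^ n ~ 1#
 one^ zero = ≈-refl
 one^ (suc n) = tr (*-identityˡ (1# ^ n)) (one^ n)

hom-cong : ∀ p {a a' b b'} -> a ~ a' -> b ~ b' -> hom p a b ~ hom p a' b'
hom-cong [] h k = ≈-refl
hom-cong (c ∷ p) h k = +-cong (*ˡ {ι c} (^-cong (length p) k)) (*-cong h (hom-cong p h k))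

-- For a list p of formal degree d, `hom p 1# 13t` is (13t)ᵈ p(1/(13t)), the numerator of the image
-- of p under the Fricke involution.
13t : Ser
13t = ι (+ 13) * t

ι^ : ∀ c n -> ι c ^ n ~ ι (c Z.^ n)
ι^ c zero = sy ι-1
ι^ c (suc n) = tr (*ˡ {ι c} (ι^ c n)) (sy (ι-* c (c Z.^ n)))

private
 13t^ : ∀ i Y j -> (13t ^ i * Y) j ≡ (+ 13) Z.^ i Z.* (t ^ i * Y) j
 13t^ i Y j = trans (at (tr (*ʳ {Y} (pw i)) (*-assoc (ι ((+ 13) Z.^ i)) (t ^ i) Y)) j) (coefficient-ι ((+ 13) Z.^ i) (t ^ i * Y) j)
  where
  pw : ∀ i -> 13t ^ i ~ ι ((+ 13) Z.^ i) * t ^ i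
  pw zero = sy (tr (*ʳ ι-1) (*-identityˡ 1#))
  pw (suc i) = tr (*ˡ {13t} (pw i)) (tr (solve (v0 :* v1 :* (v2 :* v3)) (v0 :* v2 :* (v1 :* v3)) refl (ι (+ 13) ∷ t ∷ ι ((+ 13) Z.^ i) ∷ t ^ i ∷ [])) (*ʳ {t ^ suc i} (sy (ι-* (+ 13) ((+ 13) Z.^ i)))))

 power-below : ∀ i j -> i N.< j -> (t ^ i * (v ^ j * E)) j ≡ + 0
 power-below zero (suc j) l = trans (at (*-identityˡ (v ^ suc j * E)) (suc j)) (residue j)
 power-below (suc i) (suc j) (s≤s l) = trans (at (t-v j (t ^ i)) (suc j)) (trans (q*-suc _ j) (power-below i j l))

 power-at : ∀ j -> (t ^ j * (v ^ j * E)) j ≡ + 1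
 power-at zero = trans (at (tr (*-identityˡ (1# * E)) (*-identityˡ E)) 0) E-head
 power-at (suc j) = trans (at (t-v j (t ^ j)) (suc j)) (trans (q*-suc _ j) (power-at j))

 power-above : ∀ i j -> j N.< i -> (t ^ i * (v ^ j * E)) j ≡ + 0
 power-above (suc i) zero l = t-0 (t ^ i) (v ^ 0 * E)
 power-above (suc i) (suc j) (s≤s l) = trans (at (t-v j (t ^ i)) (suc j)) (trans (q*-suc _ j) (power-above i j l))

 split-hom : ∀ c p j -> (hom (c ∷ p) 1# 13t * (v ^ j * E)) j ≡ c Z.* ((+ 13) Z.^ length p Z.* (t ^ length p * (v ^ j * E)) j) Z.+ (hom p 1# 13t * (v ^ j * E)) j
 split-hom c p j = trans (at (tr (*ʳ {v ^ j * E} (+ˡ (*-identityˡ (hom p 1# 13t)))) (distribʳ (v ^ j * E) (ι c * 13t ^ length p) (hom p 1# 13t))) j)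
  (trans (+-at (ι c * 13t ^ length p * (v ^ j * E)) (hom p 1# 13t * (v ^ j * E)) j) (cong (Z._+ (hom p 1# 13t * (v ^ j * E)) j)
   (trans (at (*-assoc (ι c) (13t ^ length p) (v ^ j * E)) j) (trans (coefficient-ι c (13t ^ length p * (v ^ j * E)) j) (cong (c Z.*_) (13t^ (length p) (v ^ j * E) j))))))

 orthogonal-short : ∀ p j -> length p N.≤ j -> (hom p 1# 13t * (v ^ j * E)) j ≡ + 0
 orthogonal-short [] j l = at (zeroˡ (v ^ j * E)) j
 orthogonal-short (c ∷ p) j l = trans (split-hom c p j) (cong₂ Z._+_ (trans (cong (\ z -> c Z.* ((+ 13) Z.^ length p Z.* z)) (power-below (length p) j l)) (trans (cong (c Z.*_) (ZP.*-zeroʳ ((+ 13) Z.^ length p))) (ZP.*-zeroʳ c))) (orthogonal-short p j (NP.<⇒≤ l)))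

-- Reversal moves the coefficient at k to the place j, with the factor 13^j; this is the residue
-- taken at the other cusp.
orthogonal-hom : ∀ p k j -> length p ≡ suc (k N.+ j) -> (hom p 1# 13t * (v ^ j * E)) j ≡ (+ 13) Z.^ j Z.* nth p k
orthogonal-hom (c ∷ p) zero j l = trans (split-hom c p j) (trans (cong₂ Z._+_
  (trans (cong (\ n -> c Z.* ((+ 13) Z.^ n Z.* (t ^ n * (v ^ j * E)) j)) (NP.suc-injective l)) (cong (\ z -> c Z.* ((+ 13) Z.^ j Z.* z)) (power-at j))) (orthogonal-short p j (NP.≤-reflexive (NP.suc-injective l))))
 (lem c ((+ 13) Z.^ j)))
 where
 lem : ∀ c x -> c Z.* (x Z.* + 1) Z.+ + 0 ≡ x Z.* c
 lem = solve-∀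
orthogonal-hom (c ∷ p) (suc k) j l = trans (split-hom c p j) (trans (cong₂ Z._+_ (trans (cong (\ z -> c Z.* ((+ 13) Z.^ length p Z.* z)) (power-above (length p) j (subst (j N.<_) (sym (NP.suc-injective l)) (s≤s (NP.m≤n+m j k)))))
 (trans (cong (c Z.*_) (ZP.*-zeroʳ ((+ 13) Z.^ length p))) (ZP.*-zeroʳ c))) (orthogonal-hom p k j (NP.suc-injective l))) (ZP.+-identityˡ _))

homE : ∀ {n} -> List ℤ -> Expr n -> Expr n -> Expr n
homE [] a b = # 0
homE (c ∷ cs) a b = K c :* b :^ length cs :+ a :* homE cs a b

⟦homE⟧ : ∀ {n} p (a b : Expr n) ρ -> ⟦ homE p a b ⟧ ρ ~ hom p (⟦ a ⟧ ρ) (⟦ b ⟧ ρ)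
⟦homE⟧ [] a b ρ = ι-0
⟦homE⟧ (c ∷ cs) a b ρ = +ˡ (*ˡ {⟦ a ⟧ ρ} (⟦homE⟧ cs a b ρ))

hom-1-13t : ∀ p -> hom p 1# 13t ~ ⟦ homE p (# 1) (# 13 :* v0) ⟧ (t ∷ [])
hom-1-13t p = tr (hom-cong p (sy ι-1) ≈-refl) (sy (⟦homE⟧ p (# 1) (# 13 :* v0) (t ∷ [])))

-- The j-invariant is N(t) / t, with Fricke transform N(1/(13 t)) 13 t.

opaque
 nᴸ : List ℤ
 nᴸ = mulH p3 (mulH q4 (mulH q4 q4))

 length-nᴸ : ∀ r -> length (mulH nᴸ r) ≡ 14 N.+ length r
 length-nᴸ r = length-mulH (+ 1) (List.drop 1 (mulH p3 (mulH q4 (mulH q4 q4)))) r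

P2 P3 Q4 Q4* Q6 Q6* : Ser
P2 = horner p2 t
P3 = horner p3 t
Q4 = horner q4 t
Q4* = horner q4* t
Q6 = horner q6 t
Q6* = horner q6* t

opaque
 unfolding nᴸ

 hom3 : ∀ a b -> hom nᴸ a b ~ hom p3 a b * (hom q4 a b * (hom q4 a b * hom q4 a b))
 hom3 a b = tr (hom-mulH a b p3 (mulH q4 (mulH q4 q4))) (*ˡ {hom p3 a b} (tr (hom-mulH a b q4 (mulH q4 q4)) (*ˡ {hom q4 a b} (hom-mulH a b q4 q4))))

horner-n : horner nᴸ t ~ P3 * (Q4 * (Q4 * Q4))
horner-n = tr (sy (hom-horner nᴸ t)) (tr (hom3 t 1#) (*-cong (hom-horner p3 t) (*-cong (hom-horner q4 t) (*-cong (hom-horner q4 t) (hom-horner q4 t)))))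

hom-n : hom nᴸ 1# 13t ~ ι ((+ 13) Z.^ 13) * (P3 * Q4* ^ 3)
hom-n = tr (hom3 1# 13t) (tr (*-cong h3 (*-cong h4 (*-cong h4 h4))) (solve (# 13 :* v0 :* (# 28561 :* v1 :* (# 28561 :* v1 :* (# 28561 :* v1)))) (# 302875106592253 :* (v0 :* v1 :^ 3)) refl (P3 ∷ Q4* ∷ [])))
 where
 h3 : hom p3 1# 13t ~ ι (+ 13) * P3
 h3 = tr (hom-1-13t p3) (solve (homE p3 (# 1) (# 13 :* v0)) (# 13 :* P3E v0) refl (t ∷ []))
 h4 : hom q4 1# 13t ~ ι (+ 28561) * Q4*
 h4 = tr (hom-1-13t q4) (solve (homE q4 (# 1) (# 13 :* v0)) (# 28561 :* Q4*E v0) refl (t ∷ []))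

-- q times the j-invariant N(t)/t, since q/t = v; its constant term is 1.
Ĵ : Ser
Ĵ = horner nᴸ t * v

tv^ : ∀ n -> t ^ n * v ^ n ~ q ^ n
tv^ zero = *-identityˡ 1#
tv^ (suc n) = tr (solve (v0 :* v1 :* (v2 :* v3)) (v0 :* v2 :* (v1 :* v3)) refl (t ∷ t ^ n ∷ v ∷ v ^ n ∷ [])) (*-cong t*v (tv^ n))

private
 ĴΔ : Ĵ * Δ ~ q * Q ^ 3
 ĴΔ = tr (*-cong (*ʳ {v} horner-n) Δ≈) (tr (solve (v1 :* (v2 :* (v2 :* v2)) :* v3 :* (v4 :* v0 :* (v0 :* v1) :^ 2 :* v5 :^ 6)) (v4 :* v3 :* (v0 :* v1 :* v2 :* v5 :^ 2) :^ 3) refl (P2 ∷ P3 ∷ Q4 ∷ v ∷ t ∷ e ∷ []))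
  (*-cong t*v (^-cong 3 (sy Q≈))))

private
 V-q-unique : ∀ f -> (∀ n -> n N.< 13 -> f n ≡ + 0) -> (∀ n -> f (13 N.+ n) ≡ 1# n) -> V q ~ f
 V-q-unique f low high = mk (V13.V-elim (\ n -> V q n ≡ f n) (\ { zero -> sym (low 0 (s≤s z≤n)) ; (suc n) -> trans (V13.V-multiple q (suc n)) (sym (trans (high (n N.* 13)) (unit n))) })
  (\ r n l -> trans (V13.V-other q r n l) (sym (other r n l))))
  where
  unit : ∀ n -> 1# (n N.* 13) ≡ q (suc n)
  unit zero = refl
  unit (suc n) = refl
  other : ∀ r n -> suc r N.< 13 -> f (suc r N.+ n N.* 13) ≡ + 0
  other r zero l = trans (cong f (NP.+-identityʳ (suc r))) (low (suc r) l)
  other r (suc n) l = trans (cong f (idx r (n N.* 13))) (high (suc (r N.+ n N.* 13)))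
   where
   idx : ∀ r m -> suc r N.+ (13 N.+ m) ≡ 13 N.+ suc (r N.+ m)
   idx r m = trans (sym (NP.+-assoc (suc r) 13 m)) (trans (cong (N._+ m) (NP.+-comm (suc r) 13)) (NP.+-assoc 13 (suc r) m))

 V-q-power : ∀ k -> k ≡ 13 -> V q ~ q ^ k * 1#
 V-q-power k e = V-q-unique (q ^ k * 1#) (\ n l -> q^-low k 1# n (subst (n N.<_) (sym e) l))
  (\ n -> trans (cong (\ j -> (q ^ k * 1#) (j N.+ n)) (sym e)) (q^-shift k 1# n))

V-q : V q ~ q ^ 13
V-q = tr (V-q-power 13 refl) (*-identityʳ (q ^ 13))

VΔ : V Δ ~ q ^ 13 * V π ^ 24
VΔ = tr (V13.V-* q (π ^ 24)) (*-cong V-q (V13.V-^ π 24))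

V-head : ∀ f -> V f 0 ≡ f 0
V-head f = V13.V-0 f

regular-Vπ^ : ∀ n -> Regular (V π ^ n)
regular-Vπ^ zero g h = tr (sy (*-identityˡ g)) h
regular-Vπ^ (suc n) = regular-* {V π} {V π ^ n} (regular-1 {V π} (V-head π)) (regular-Vπ^ n)

regular-VΔ : Regular (V Δ)
regular-VΔ g h = regular-* {q ^ 13} {V π ^ 24} (regular-q^ 13) (regular-Vπ^ 24) g (tr (*ʳ {g} (sy VΔ)) h)

opaque
 -- Multiplied by `V Δ`, both sides become q¹³ (V Q)³, by `ĴΔ` on the left and by `VQ≈` and `VΔ≈` on
 -- the right. In effect j(q¹³) is the Fricke image of j as a function of t.
 VĴ : V Ĵ ~ v ^ 13 * (P3 * Q4* ^ 3)
 VĴ = regular-cancel {V Δ} regular-VΔ (tr (*-comm (V Δ) (V Ĵ)) (tr (sy (V13.V-* Ĵ Δ)) (tr (V13.V-cong ĴΔ) (tr (V13.V-* q (Q ^ 3)) (tr (*-cong V-q (V13.V-^ Q 3))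
  (tr (*-cong (sy (tv^ 13)) (^-cong 3 VQ≈)) (tr (solve (v0 :* v1 :* (v2 :* v3 :* v4 :* v5 :^ 2) :^ 3) (v0 :* v2 :* (v2 :* v3) :^ 2 :* v5 :^ 6 :* (v1 :* (v3 :* v4 :^ 3))) refl (t ^ 13 ∷ v ^ 13 ∷ P2 ∷ P3 ∷ Q4* ∷ e ∷ []))
   (*ʳ (sy VΔ≈)))))))))

 13VĴ : ι ((+ 13) Z.^ 13) * V Ĵ ~ v ^ 13 * hom nᴸ 1# 13t
 13VĴ = tr (*ˡ {ι ((+ 13) Z.^ 13)} VĴ) (tr (solve (v0 :* (v1 :* v2)) (v1 :* (v0 :* v2)) refl (ι ((+ 13) Z.^ 13) ∷ v ^ 13 ∷ P3 * Q4* ^ 3 ∷ [])) (*ˡ {v ^ 13} (sy hom-n)))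

private
 head-horner : ∀ c p -> horner (c ∷ p) t 0 ≡ c
 head-horner c p = trans (+-at (ι c) (t * horner p t) 0) (trans (cong₂ Z._+_ (ι-head c) (cong (Z._* horner p t 0) (agrees-head agrees-t))) (ZP.+-identityʳ c))

 nᴸ-head : horner nᴸ t 0 ≡ + 1
 nᴸ-head = trans (at horner-n 0) (cong₂ Z._*_ (head-horner (+ 1) (List.drop 1 p3)) (cong₂ Z._*_ h4 (cong₂ Z._*_ h4 h4)))
  where
  h4 = head-horner (+ 1) (List.drop 1 q4)

-- The trace of h(t) t^(-p) E from level 13 to level 1, pole order M: it
-- pairs to zero with all powers of the j-invariant, by the residue theorem
-- on both cusps.
module Trace (h : List ℤ) (p r M' off : ℕ) (len : length h ≡ suc (r N.+ p)) (13M : off N.+ r ≡ (p N.+ M') N.* 13) where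

 M : ℕ
 M = p N.+ M'

 opaque
  -- `upper` is q^M times the expansion at infinity. `lower` is the expansion at the other cusp, in
  -- a 13th root of q and cleared of its pole, from which `H 0` keeps the integral powers. The minus
  -- sign is that of dt/t under t ↦ 1/(13t), and 13^r clears (13t)^(-r).
  upper lower trace : Ser
  upper = q ^ M' * (v ^ p * (horner h t * E))
  lower = q ^ off * (v ^ r * (hom h 1# 13t * E))
  trace = ι ((+ 13) Z.^ r) * upper - H 0 lower

  g : ℕ -> List ℤ
  g zero = h
  g (suc n) = mulH nᴸ (g n)

  length-g : ∀ n -> length (g n) ≡ suc ((n N.+ p) N.+ (r N.+ n N.* 13))
  length-g zero = trans len (cong suc (trans (NP.+-comm r p) (cong (p N.+_) (sym (NP.+-identityʳ r)))))
  length-g (suc n) = trans (length-nᴸ (g n)) (trans (cong (14 N.+_) (length-g n)) (cong (2 N.+_) (idx (n N.+ p) r (n N.* 13))))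
   where
   idx : ∀ a r m -> 12 N.+ (1 N.+ (a N.+ (r N.+ m))) ≡ a N.+ (r N.+ (13 N.+ m))
   idx a r m = trans (sym (NP.+-assoc 13 a (r N.+ m))) (trans (cong (N._+ (r N.+ m)) (NP.+-comm 13 a)) (trans (NP.+-assoc a 13 (r N.+ m))
     (cong (a N.+_) (trans (sym (NP.+-assoc 13 r m)) (trans (cong (N._+ m) (NP.+-comm 13 r)) (NP.+-assoc r 13 m))))))

  horner-g : ∀ n -> horner (g n) t ~ horner nᴸ t ^ n * horner h t
  horner-g zero = sy (*-identityˡ (horner h t))
  horner-g (suc n) = tr (sy (hom-horner (g (suc n)) t)) (tr (hom-mulH t 1# nᴸ (g n)) (tr (*-cong (hom-horner nᴸ t) (tr (hom-horner (g n) t) (horner-g n))) (sy (*-assoc (horner nᴸ t) (horner nᴸ t ^ n) (horner h t)))))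

  hom-g : ∀ n -> hom (g n) 1# 13t ~ hom nᴸ 1# 13t ^ n * hom h 1# 13t
  hom-g zero = sy (*-identityˡ (hom h 1# 13t))
  hom-g (suc n) = tr (hom-mulH 1# 13t nᴸ (g n)) (tr (*ˡ {hom nᴸ 1# 13t} (hom-g n)) (sy (*-assoc (hom nᴸ 1# 13t) (hom nᴸ 1# 13t ^ n) (hom h 1# 13t))))

  ^-+ : ∀ (x : Ser) m n -> x ^ (m N.+ n) ~ x ^ m * x ^ n
  ^-+ x zero n = sy (*-identityˡ (x ^ n))
  ^-+ x (suc m) n = tr (*ˡ {x} (^-+ x m n)) (sy (*-assoc x (x ^ m) (x ^ n)))

  ^-* : ∀ (x y : Ser) n -> (x * y) ^ n ~ x ^ n * y ^ n
  ^-* x y zero = sy (*-identityˡ 1#)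
  ^-* x y (suc n) = tr (*ˡ {x * y} (^-* x y n)) (solve (v0 :* v1 :* (v2 :* v3)) (v0 :* v2 :* (v1 :* v3)) refl (x ∷ y ∷ x ^ n ∷ y ^ n ∷ []))

  upper-coefficient : ∀ n -> (Ĵ ^ n * upper) (M N.+ n) ≡ nth (g n) (n N.+ p)
  upper-coefficient n = trans (at form (M N.+ n)) (trans (cong (q ^ M' * (horner (g n) t * (v ^ (n N.+ p) * E))) idx) (trans (q^-shift M' _ (n N.+ p)) (orthogonal (g n) (n N.+ p))))
   where
   idx : M N.+ n ≡ M' N.+ (n N.+ p)
   idx = trans (cong (N._+ n) (NP.+-comm p M')) (trans (NP.+-assoc M' p n) (cong (M' N.+_) (NP.+-comm p n)))
   form : Ĵ ^ n * upper ~ q ^ M' * (horner (g n) t * (v ^ (n N.+ p) * E))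
   form = tr (*ʳ {upper} (^-* (horner nᴸ t) v n)) (tr (solve (v0 :* v1 :* (v2 :* (v3 :* (v4 :* v5)))) (v2 :* (v0 :* v4 :* (v1 :* v3 :* v5))) refl (horner nᴸ t ^ n ∷ v ^ n ∷ q ^ M' ∷ v ^ p ∷ horner h t ∷ E ∷ []))
     (*ˡ {q ^ M'} (*-cong (sy (horner-g n)) (*ʳ {E} (sy (^-+ v n p))))))

  lower-coefficient : ∀ n -> ((+ 13) Z.^ 13) Z.^ n Z.* (Ĵ ^ n * H 0 lower) (M N.+ n) ≡ (+ 13) Z.^ (r N.+ n N.* 13) Z.* nth (g n) (n N.+ p)
  lower-coefficient n = trans (cong (\ z -> ((+ 13) Z.^ 13) Z.^ n Z.* z) (trans (sym (at (V13.H-V* 0 (Ĵ ^ n) lower (s≤s z≤n)) (M N.+ n))) (at (*ʳ {lower} (V13.V-^ Ĵ n)) ((M N.+ n) N.* 13))))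
   (trans (sym (coefficient-ι (((+ 13) Z.^ 13) Z.^ n) (V Ĵ ^ n * lower) ((M N.+ n) N.* 13))) (trans (at form ((M N.+ n) N.* 13)) (trans (cong (q ^ off * (hom (g n) 1# 13t * (v ^ (r N.+ n N.* 13) * E))) idx)
     (trans (q^-shift off _ (r N.+ n N.* 13)) (orthogonal-hom (g n) (n N.+ p) (r N.+ n N.* 13) (length-g n))))))
   where
   idx : (M N.+ n) N.* 13 ≡ off N.+ (r N.+ n N.* 13)
   idx = trans (NP.*-distribʳ-+ 13 M n) (trans (cong (N._+ n N.* 13) (sym 13M)) (NP.+-assoc off r (n N.* 13)))
   v-power : ∀ n -> (v ^ 13) ^ n ~ v ^ (n N.* 13)
   v-power zero = ≈-refl
   v-power (suc n) = tr (*ˡ {v ^ 13} (v-power n)) (sy (^-+ v 13 (n N.* 13)))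
   form : ι (((+ 13) Z.^ 13) Z.^ n) * (V Ĵ ^ n * lower) ~ q ^ off * (hom (g n) 1# 13t * (v ^ (r N.+ n N.* 13) * E))
   form = tr (sy (*-assoc (ι (((+ 13) Z.^ 13) Z.^ n)) (V Ĵ ^ n) lower)) (tr (*ʳ {lower} (tr (*ʳ {V Ĵ ^ n} (sy (ι^ ((+ 13) Z.^ 13) n))) (tr (sy (^-* (ι ((+ 13) Z.^ 13)) (V Ĵ) n)) (tr (^-cong n 13VĴ) (tr (^-* (v ^ 13) (hom nᴸ 1# 13t) n) (*ʳ {hom nᴸ 1# 13t ^ n} (v-power n)))))))
     (tr (solve (v0 :* v1 :* (v2 :* (v3 :* (v4 :* v5)))) (v2 :* (v1 :* v4 :* (v3 :* v0 :* v5))) refl (v ^ (n N.* 13) ∷ hom nᴸ 1# 13t ^ n ∷ q ^ off ∷ v ^ r ∷ hom h 1# 13t ∷ E ∷ []))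
       (*ˡ {q ^ off} (*-cong (sy (hom-g n)) (*ʳ {E} (sy (^-+ v r (n N.* 13))))))))

  -- The residues at t = 0 and t = ∞ of jⁿ h(t) t^(-p) dt/t cancel: up to the same power of 13 both
  -- are the coefficient of t^(n + p) in Nⁿ h.
  pairing : ∀ n -> (Ĵ ^ n * trace) (M N.+ n) ≡ + 0
  pairing n = case ZP.i*j≡0⇒i≡0∨j≡0 (((+ 13) Z.^ 13) Z.^ n) scaled-pairing of \ { (inj₁ z) -> ⊥-elim (nonzero n z) ; (inj₂ z) -> z }
   where
   nonzero : ∀ n -> ¬ ((+ 13) Z.^ 13) Z.^ n ≡ + 0
   nonzero (suc n) e = case ZP.i*j≡0⇒i≡0∨j≡0 ((+ 13) Z.^ 13) e of \ { (inj₁ ()) ; (inj₂ z) -> nonzero n z }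
   unfold-trace : (Ĵ ^ n * trace) (M N.+ n) ≡ (+ 13) Z.^ r Z.* (Ĵ ^ n * upper) (M N.+ n) Z.- (Ĵ ^ n * H 0 lower) (M N.+ n)
   unfold-trace = trans (at (solve (v0 :* (v1 :* v2 :- v3)) (v1 :* (v0 :* v2) :- v0 :* v3) refl (Ĵ ^ n ∷ ι ((+ 13) Z.^ r) ∷ upper ∷ H 0 lower ∷ [])) (M N.+ n))
     (trans (+-at (ι ((+ 13) Z.^ r) * (Ĵ ^ n * upper)) (- (Ĵ ^ n * H 0 lower)) (M N.+ n)) (cong₂ Z._+_ (coefficient-ι ((+ 13) Z.^ r) (Ĵ ^ n * upper) (M N.+ n)) (neg-at (Ĵ ^ n * H 0 lower) (M N.+ n))))
   powers : ∀ n -> (+ 13) Z.^ (r N.+ n N.* 13) ≡ ((+ 13) Z.^ 13) Z.^ n Z.* (+ 13) Z.^ r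
   powers n = trans (ZP.^-distribˡ-+-* (+ 13) r (n N.* 13)) (trans (ZP.*-comm ((+ 13) Z.^ r) ((+ 13) Z.^ (n N.* 13))) (cong (Z._* (+ 13) Z.^ r) (trans (cong ((+ 13) Z.^_) (NP.*-comm n 13)) (sym (ZP.^-*-assoc (+ 13) 13 n)))))
   r1 : ∀ c x u w -> c Z.* (x Z.* u Z.- w) ≡ c Z.* x Z.* u Z.- c Z.* w
   r1 = solve-∀
   scaled-pairing : ((+ 13) Z.^ 13) Z.^ n Z.* (Ĵ ^ n * trace) (M N.+ n) ≡ + 0
   scaled-pairing = trans (cong (((+ 13) Z.^ 13) Z.^ n Z.*_) unfold-trace) (trans (r1 (((+ 13) Z.^ 13) Z.^ n) ((+ 13) Z.^ r) ((Ĵ ^ n * upper) (M N.+ n)) ((Ĵ ^ n * H 0 lower) (M N.+ n)))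
     (trans (cong₂ Z._-_ (cong₂ Z._*_ (sym (powers n)) (upper-coefficient n)) (lower-coefficient n)) (ZP.+-inverseʳ ((+ 13) Z.^ (r N.+ n N.* 13) Z.* nth (g n) (n N.+ p)))))

  trace-value : ∀ i u l -> upper i ≡ u -> lower (i N.* 13) ≡ l -> trace i ≡ (+ 13) Z.^ r Z.* u Z.- l
  trace-value i u l hu hl = trans (+-at (ι ((+ 13) Z.^ r) * upper) (- H 0 lower) i) (cong₂ Z._+_ (trans (coefficient-ι ((+ 13) Z.^ r) upper i) (cong ((+ 13) Z.^ r Z.*_) hu)) (trans (neg-at (H 0 lower) i) (cong Z.-_ hl)))

  upper-low : ∀ n -> n N.< M' -> upper n ≡ + 0
  upper-low n l = q^-low M' (v ^ p * (horner h t * E)) n l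

  upper-at : ∀ n k {x} -> M' N.+ n ≡ k -> (v ^ p * (horner h t * E)) n ≡ x -> upper k ≡ x
  upper-at n k refl e = trans (q^-shift M' (v ^ p * (horner h t * E)) n) e

  lower-low : ∀ n -> n N.< off -> lower n ≡ + 0
  lower-low n l = q^-low off (v ^ r * (hom h 1# 13t * E)) n l

  lower-at : ∀ n k {x} z -> off N.+ n ≡ k -> hom h 1# 13t ~ z -> (v ^ r * (z * E)) n ≡ x -> lower k ≡ x
  lower-at n k z refl eq e = trans (q^-shift off (v ^ r * (hom h 1# 13t * E)) n) (trans (at (*ˡ {v ^ r} (*ʳ {E} eq)) n) e)

  -- `Ĵ` has constant term 1, so the pairing with its power n - M isolates the coefficient in degree
  -- n once the lower ones vanish. Only the first M coefficients remain to be computed.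
  trace-zero : (∀ i -> i N.< M -> trace i ≡ + 0) ->
   ι ((+ 13) Z.^ r) * (q ^ M' * (v ^ p * (horner h t * E))) - H 0 (q ^ off * (v ^ r * (hom h 1# 13t * E))) ~ 0#
  trace-zero low = mk (strong (\ n -> trace n ≡ + 0) step)
   where
   Ĵ-head : ∀ n -> (Ĵ ^ n) 0 ≡ + 1
   Ĵ-head zero = refl
   Ĵ-head (suc n) = cong₂ Z._*_ (trans (cong₂ Z._*_ nᴸ-head v-head) refl) (Ĵ-head n)
   step : ∀ n -> (∀ i -> i N.< n -> trace i ≡ + 0) -> trace n ≡ + 0
   step n ih with n NP.<? M
   ... | yes l = low n l
   ... | no ¬l = trans (sym (trans (*-leading (Ĵ ^ (n ∸ M)) trace n ih) (trans (cong (Z._* trace n) (Ĵ-head (n ∸ M))) (ZP.*-identityˡ (trace n)))))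
     (trans (cong (Ĵ ^ (n ∸ M) * trace) (sym (NP.m+[n∸m]≡n (NP.≮⇒≥ ¬l)))) (pairing (n ∸ M)))

-- Derivatives of functions of t, and iterated Serre derivatives of η³

τ : Expr 1
τ = v0

agrees-take : ∀ n {f cs} -> Agrees f cs -> Agrees f (List.take n cs)
agrees-take zero a = []
agrees-take (suc n) [] = []
agrees-take (suc n) (x ∷ a) = x ∷ agrees-take n a

agrees-third : ∀ {f a b c} -> Agrees f (a ∷ b ∷ c ∷ []) -> f 2 ≡ c
agrees-third (_ ∷ _ ∷ x ∷ []) = x

agrees-nth : ∀ {f cs} -> Agrees f cs -> ∀ n -> n N.< length cs -> f n ≡ nth cs n
agrees-nth (x ∷ a) zero l = x
agrees-nth (x ∷ a) (suc n) (s≤s l) = agrees-nth a n l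

vT : List ℤ
vT = 1 ,, 1 ,- 0 ,- 2 ,, 1 ,, 2 ,, 1 ,- 0 ,, 1 ,- 1 ,- 1 ,, 0 ,, 0 ,, 4 ,, 0 ,- 3 ,- []

opaque
 agrees-v : Agrees v vT
 agrees-v = agrees-eval (v0 :^ 2 :* v1 :^ 2) (π ∷ V π⁻¹ ∷ []) (πT ∷ (1 ,, 0 ,, 0 ,, 0 ,, 0 ,, 0 ,, 0 ,, 0 ,, 0 ,, 0 ,, 0 ,, 0 ,, 0 ,, 1 ,, 0 ,, 0 ,, []) ∷ []) 16 vT
  (agrees-π ∷ agrees-V π⁻¹ (+ 1) (1 ,, 0 ,, 0 ,, 0 ,, 0 ,, 0 ,, 0 ,, 0 ,, 0 ,, 0 ,, 0 ,, 0 ,, 0 ,, 1 ,, 0 ,, 0 ,, []) (+ 1) (first-two agrees-π⁻¹) refl ∷ []) refl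

-- The derivative with respect to t, on Horner forms: c + t p has derivative p + t p′.
hd : List ℤ -> Ser
hd [] = ι (+ 0)
hd (c ∷ p) = horner p t + t * hd p

hdE : ∀ {n} -> List ℤ -> Expr n -> Expr n
hdE [] x = # 0
hdE (c ∷ p) x = hE p x :+ x :* hdE p x

⟦hdE⟧ : ∀ p -> ⟦ hdE p v0 ⟧ (t ∷ []) ≡ hd p
⟦hdE⟧ [] = refl
⟦hdE⟧ (c ∷ p) = cong₂ (\ x y -> x + t * y) (⟦hornerE⟧ p v0 (t ∷ [])) (⟦hdE⟧ p)

D-ι* : ∀ c f -> D (ι c * f) ~ ι c * D f
D-ι* c f = tr (D-* (ι c) f) (tr (+ʳ (tr (*ʳ {f} (DD.𝒟-ι c)) (zeroˡ f))) (+-identityˡ _))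

D-horner : ∀ p -> D (horner p t) ~ t * E * hd p
D-horner [] = tr (DD.𝒟-ι (+ 0)) (sy (tr (*ˡ {t * E} ι-0) (zeroʳ (t * E))))
D-horner (c ∷ p) = tr (D-+ (ι c) (t * horner p t)) (tr (+-cong (DD.𝒟-ι c) (tr (D-* t (horner p t)) (+-cong (*ʳ {horner p t} Dt) (*ˡ {t} (D-horner p)))))
 (tr (+-identityˡ _) (solve (v0 :* v1 :* v2 :+ v0 :* (v0 :* v1 :* v3)) (v0 :* v1 :* (v2 :+ v0 :* v3)) refl (t ∷ E ∷ horner p t ∷ hd p ∷ []))))

m : Ser
m = horner mᴸ t

D-e^ : ∀ k -> ι (+ 6) * D (e ^ k) ~ ι (+ k) * (e ^ k * (P - m * e))
D-e^ zero = tr (*ˡ {ι (+ 6)} DD.𝒟-1) (tr (zeroʳ (ι (+ 6))) (sy (tr (*ʳ {e ^ 0 * (P - m * e)} ι-0) (zeroˡ (e ^ 0 * (P - m * e))))))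
D-e^ (suc k) = tr (*ˡ {ι (+ 6)} (DD.𝒟-^ e k)) (by1 {c = ι (+ suc k) * e ^ k} 6De
 (solve (# 6 :* (v0 :* v1 :* v2)) (v0 :* (v3 :* v1 :* (v4 :- v5 :* v3)) :+ v0 :* v1 :* (# 6 :* v2 :- (v4 :* v3 :- v5 :* v3 :^ 2))) refl (ι (+ suc k) ∷ e ^ k ∷ D e ∷ e ∷ P ∷ m ∷ [])))

312DVπ³ : ι (+ 312) * D (V π ^ 3) ~ (ι (+ 468) * E + ι (+ 39) * P - ι (+ 507)) * V π ^ 3
312DVπ³ = tr (*ˡ {ι (+ 312)} (tr (DD.𝒟-^ (V π) 2) (*ˡ {ι (+ 3) * V π ^ 2} DVπ)))
 (solve (# 312 :* (# 3 :* v0 :^ 2 :* (# 13 :* v1 :* v0))) ((# 468 :* (# 1 :+ # 2 :* (# 13 :* v1 :- v2)) :+ # 39 :* (# 1 :+ # 24 :* v2) :- # 507) :* v0 :^ 3) refl (V π ∷ V λ̂ ∷ λ̂ ∷ []))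

24Dπ³ : ι (+ 24) * D (π ^ 3) ~ (ι (+ 3) * P - ι (+ 3)) * π ^ 3
24Dπ³ = tr (*ˡ {ι (+ 24)} (tr (DD.𝒟-^ π 2) (*ˡ {ι (+ 3) * π ^ 2} Dπ)))
 (solve (# 24 :* (# 3 :* v0 :^ 2 :* (v1 :* v0))) ((# 3 :* (# 1 :+ # 24 :* v1) :- # 3) :* v0 :^ 3) refl (π ∷ λ̂ ∷ []))

-- `𝓑 f` is 8 q^(-1/8) D (q^(1/8) f) and `𝓐 f` is 104 q^(-13/8) D (q^(13/8) f): differentiation of
-- η(τ)³ and of η(13τ)³ without fractional powers, each with the scale proper to its cusp.
𝓐 𝓑 : Ser -> Ser
𝓐 f = ι (+ 104) * D f + ι (+ 169) * f
𝓑 f = ι (+ 8) * D f + f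

opaque
 -- Iterated Serre derivatives in weight w = 3/2 + 2k: 312 (D - w P/12) on η(13τ)³ and, in the
 -- variable of the other cusp, 24 (D - 13 w P(q¹³)/12) on η(τ)³; note 26 w = 39 + 52 k. They stay
 -- modular, hence are the eta cube times e^k times a polynomial in t.
 Γ∞ Γx : ℕ -> Ser
 Γ∞ zero = V π ^ 3
 Γ∞ (suc k) = ι (+ 3) * 𝓐 (Γ∞ k) - ι (+ (39 N.+ 52 N.* k)) * (P * Γ∞ k)
 Γx zero = π ^ 3
 Γx (suc k) = ι (+ 3) * 𝓑 (Γx k) - ι (+ (39 N.+ 52 N.* k)) * (V P * Γx k)

 Γ∞-zero : Γ∞ 0 ~ V π ^ 3
 Γ∞-zero = ≈-refl

 Γx-zero : Γx 0 ~ π ^ 3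
 Γx-zero = ≈-refl

 Γ∞-suc : ∀ k -> Γ∞ (suc k) ~ ι (+ 3) * 𝓐 (Γ∞ k) - ι (+ (39 N.+ 52 N.* k)) * (P * Γ∞ k)
 Γ∞-suc k = ≈-refl

 Γx-suc : ∀ k -> Γx (suc k) ~ ι (+ 3) * 𝓑 (Γx k) - ι (+ (39 N.+ 52 N.* k)) * (V P * Γx k)
 Γx-suc k = ≈-refl

private
 ι-affine : ∀ a b k -> ι (+ (a N.+ b N.* k)) ~ ι (+ a) + ι (+ b) * ι (+ k)
 ι-affine a b k = tr (ι-+ (+ a) (+ (b N.* k))) (+ˡ (tr (reflexive (cong ι (ZP.pos-* b k))) (ι-* (+ b) (+ k))))

 D-chain : ∀ c w a r -> D (ι c * (w * (a * r))) ~ ι c * (D w * (a * r) + w * (D a * r + a * D r))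
 D-chain c w a r = tr (D-ι* c (w * (a * r))) (*ˡ {ι c} (tr (D-* w (a * r)) (+ˡ (*ˡ {w} (D-* a r)))))

opaque
 -- The quasimodular `P` cancels against κ: 39 P comes from the derivative of w, and 52 k P from
 -- that of e^k. The constant 3·169 likewise cancels 507, and what is left is a polynomial in t.
 step-algebra∞ : ∀ (c w W a A ρ R ρ' κ k P E e m t h p : Ser) ->
  ι (+ 312) * W ~ (ι (+ 468) * E + ι (+ 39) * P - ι (+ 507)) * w -> ι (+ 6) * A ~ k * (a * (P - m * e)) -> R ~ t * E * h -> p * e ~ E -> κ ~ ι (+ 39) + ι (+ 52) * k ->
  ρ' ~ ι (+ 9) * p * ρ - k * (m * ρ) + ι (+ 6) * (t * p) * h ->
  ι (+ 3) * (ι (+ 104) * (c * (W * (a * ρ) + w * (A * ρ + a * R))) + ι (+ 169) * (c * (w * (a * ρ)))) - κ * (P * (c * (w * (a * ρ)))) ~ c * (ι (+ 52) * (w * (e * a * ρ')))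
 step-algebra∞ c w W a A ρ R ρ' κ k P E e m t h p hW hA hR hE hκ hρ =
  tr (+ˡ (-‿cong (sy (*-assoc κ P (c * (w * (a * ρ))))))) (tr (solve (# 3 :* (# 104 :* (v0 :* (v1 :* (v2 :* v3) :+ v4 :* (v5 :* v3 :+ v2 :* v6))) :+ # 169 :* (v0 :* (v4 :* (v2 :* v3)))) :- (v7 :* (v0 :* (v4 :* (v2 :* v3)))))
     (v0 :* ((# 312 :* v1) :* (v2 :* v3) :+ v4 :* (# 52 :* (# 6 :* v5) :* v3 :+ # 312 :* v2 :* v6 :+ # 507 :* (v2 :* v3) :- v7 :* (v2 :* v3)))) refl (c ∷ W ∷ a ∷ ρ ∷ w ∷ A ∷ R ∷ κ * P ∷ []))
  (*ˡ {c} (tr (+-cong (*ʳ {a * ρ} (tr hW (*ʳ {w} (+ʳ (+ʳ (*ˡ {ι (+ 468)} (sy hE)))))))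
     (*ˡ {w} (+-cong (+ʳ (+-cong (*ʳ {ρ} (*ˡ {ι (+ 52)} hA)) (*ˡ {ι (+ 312) * a} (tr hR (*ʳ {h} (*ˡ {t} (sy hE))))))) (-‿cong (*ʳ {a * ρ} (*ʳ {P} hκ))))))
   (tr (solve ((# 468 :* (v5 :* v3) :+ # 39 :* v2 :- # 507) :* w' :* (a' :* v0) :+ w' :* (# 52 :* (v1 :* (a' :* (v2 :- v4 :* v3))) :* v0 :+ # 312 :* a' :* (v6 :* (v5 :* v3) :* v7) :+ # 507 :* (a' :* v0) :- ((# 39 :+ # 52 :* v1) :* v2) :* (a' :* v0)))
       (# 52 :* (w' :* (v3 :* a' :* (# 9 :* v5 :* v0 :- v1 :* (v4 :* v0) :+ # 6 :* (v6 :* v5) :* v7)))) refl (ρ ∷ k ∷ P ∷ e ∷ m ∷ p ∷ t ∷ h ∷ w ∷ a ∷ []))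
     (*ˡ {ι (+ 52)} (*ˡ {w} (*ˡ {e * a} (sy hρ))))))))
  where
  w' a' : Expr 10
  w' = X (8+ zero)
  a' = X (8+ (suc zero))

 step-algebrax : ∀ (c w W a A ρ R ρ' κ k P VP E e m t h p : Ser) ->
  ι (+ 24) * W ~ (ι (+ 3) * P - ι (+ 3)) * w -> ι (+ 6) * A ~ k * (a * (P - m * e)) -> R ~ t * E * h -> p * e ~ E -> κ ~ ι (+ 39) + ι (+ 52) * k -> ι (+ 13) * VP ~ ι (+ 12) * E + P ->
  ρ' ~ - (ι (+ 9) * p * ρ) - k * ((ι (+ 12) * p + m) * ρ) + ι (+ 6) * (t * p) * h ->
  ι (+ 3) * (ι (+ 8) * (c * (W * (a * ρ) + w * (A * ρ + a * R))) + c * (w * (a * ρ))) - κ * (VP * (c * (w * (a * ρ)))) ~ c * (ι (+ 4) * (w * (e * a * ρ')))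
 step-algebrax c w W a A ρ R ρ' κ k P VP E e m t h p hW hA hR hE hκ hV hρ =
  tr (+ˡ (-‿cong (sy (*-assoc κ VP (c * (w * (a * ρ))))))) (tr (solve (# 3 :* (# 8 :* (v0 :* (v1 :* (v2 :* v3) :+ v4 :* (v5 :* v3 :+ v2 :* v6))) :+ v0 :* (v4 :* (v2 :* v3))) :- (v7 :* (v0 :* (v4 :* (v2 :* v3)))))
     (v0 :* ((# 24 :* v1) :* (v2 :* v3) :+ v4 :* (# 4 :* (# 6 :* v5) :* v3 :+ # 24 :* v2 :* v6 :+ # 3 :* (v2 :* v3) :- v7 :* (v2 :* v3)))) refl (c ∷ W ∷ a ∷ ρ ∷ w ∷ A ∷ R ∷ κ * VP ∷ []))
  (*ˡ {c} (tr (+-cong (*ʳ {a * ρ} hW)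
     (*ˡ {w} (+-cong (+ʳ (+-cong (*ʳ {ρ} (*ˡ {ι (+ 4)} hA)) (*ˡ {ι (+ 24) * a} (tr hR (*ʳ {h} (*ˡ {t} (sy hE))))))) (-‿cong (*ʳ {a * ρ} κV)))))
   (tr (solve ((# 3 :* v2 :- # 3) :* w' :* (a' :* v0) :+ w' :* (# 4 :* (v1 :* (a' :* (v2 :- v4 :* v3))) :* v0 :+ # 24 :* a' :* (v6 :* (v5 :* v3) :* v7) :+ # 3 :* (a' :* v0) :- ((# 3 :+ # 4 :* v1) :* (# 12 :* (v5 :* v3) :+ v2)) :* (a' :* v0)))
       (# 4 :* (w' :* (v3 :* a' :* (:- (# 9 :* v5 :* v0) :- v1 :* ((# 12 :* v5 :+ v4) :* v0) :+ # 6 :* (v6 :* v5) :* v7)))) refl (ρ ∷ k ∷ P ∷ e ∷ m ∷ p ∷ t ∷ h ∷ w ∷ a ∷ []))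
     (*ˡ {ι (+ 4)} (*ˡ {w} (*ˡ {e * a} (sy hρ))))))))
  where
  w' a' : Expr 10
  w' = X (8+ zero)
  a' = X (8+ (suc zero))
  κV : κ * VP ~ (ι (+ 3) + ι (+ 4) * k) * (ι (+ 12) * (p * e) + P)
  κV = tr (*ʳ {VP} hκ) (tr (solve ((# 39 :+ # 52 :* v0) :* v1) ((# 3 :+ # 4 :* v0) :* (# 13 :* v1)) refl (k ∷ VP ∷ []))
   (*ˡ {ι (+ 3) + ι (+ 4) * k} (tr hV (+ʳ (*ˡ {ι (+ 12)} (sy hE))))))

 absorbᵒ : ∀ n c (y : Ser) -> ι c * (ι n * y) ~ ι (n Z.* c) * y
 absorbᵒ n c y = tr (sy (*-assoc (ι c) (ι n) y)) (*ʳ {y} (tr (*-comm (ι c) (ι n)) (sy (ι-* n c))))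

 step∞ : ∀ k c r r' -> Γ∞ k ~ ι c * (V π ^ 3 * (e ^ k * horner r t)) ->
  ⟦ hE r' v0 ⟧ (t ∷ []) ~ ⟦ # 9 :* P23E v0 :* hE r v0 :- K (+ k) :* (mE v0 :* hE r v0) :+ # 6 :* (v0 :* P23E v0) :* hdE r v0 ⟧ (t ∷ []) ->
  Γ∞ (suc k) ~ ι (+ 52 Z.* c) * (V π ^ 3 * (e ^ suc k * horner r' t))
 step∞ k c r r' hΓ hr = tr (Γ∞-suc k) (tr (+-cong (*ˡ {ι (+ 3)} (+-cong (*ˡ {ι (+ 104)} (tr (D-cong hΓ) (D-chain c (V π ^ 3) (e ^ k) (horner r t)))) (*ˡ {ι (+ 169)} hΓ))) (-‿cong (*ˡ {ι (+ (39 N.+ 52 N.* k))} (*ˡ {P} hΓ))))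
  (tr (step-algebra∞ (ι c) (V π ^ 3) (D (V π ^ 3)) (e ^ k) (D (e ^ k)) (horner r t) (D (horner r t)) (horner r' t) (ι (+ (39 N.+ 52 N.* k))) (ι (+ k)) P E e m t (hd r) P23
     312DVπ³ (D-e^ k) (D-horner r) P23*e (ι-affine 39 52 k) hr') (absorbᵒ (+ 52) c (V π ^ 3 * (e ^ suc k * horner r' t)))))
  where
  hr' : horner r' t ~ ι (+ 9) * P23 * horner r t - ι (+ k) * (m * horner r t) + ι (+ 6) * (t * P23) * hd r
  hr' = tr (reflexive (sym (⟦hornerE⟧ r' v0 (t ∷ [])))) (tr hr (reflexive (cong₂ (\ x y -> ι (+ 9) * P23 * x - ι (+ k) * (m * x) + ι (+ 6) * (t * P23) * y) (⟦hornerE⟧ r v0 (t ∷ [])) (⟦hdE⟧ r))))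

 stepx : ∀ k c r r' -> Γx k ~ ι c * (π ^ 3 * (e ^ k * horner r t)) ->
  ⟦ hE r' v0 ⟧ (t ∷ []) ~ ⟦ :- (# 9 :* P23E v0 :* hE r v0) :- K (+ k) :* ((# 12 :* P23E v0 :+ mE v0) :* hE r v0) :+ # 6 :* (v0 :* P23E v0) :* hdE r v0 ⟧ (t ∷ []) ->
  Γx (suc k) ~ ι (+ 4 Z.* c) * (π ^ 3 * (e ^ suc k * horner r' t))
 stepx k c r r' hΓ hr = tr (Γx-suc k) (tr (+-cong (*ˡ {ι (+ 3)} (+-cong (*ˡ {ι (+ 8)} (tr (D-cong hΓ) (D-chain c (π ^ 3) (e ^ k) (horner r t)))) hΓ)) (-‿cong (*ˡ {ι (+ (39 N.+ 52 N.* k))} (*ˡ {V P} hΓ))))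
  (tr (step-algebrax (ι c) (π ^ 3) (D (π ^ 3)) (e ^ k) (D (e ^ k)) (horner r t) (D (horner r t)) (horner r' t) (ι (+ (39 N.+ 52 N.* k))) (ι (+ k)) P (V P) E e m t (hd r) P23
     24Dπ³ (D-e^ k) (D-horner r) P23*e (ι-affine 39 52 k) 13VP hr') (absorbᵒ (+ 4) c (π ^ 3 * (e ^ suc k * horner r' t)))))
  where
  hr' : horner r' t ~ - (ι (+ 9) * P23 * horner r t) - ι (+ k) * ((ι (+ 12) * P23 + m) * horner r t) + ι (+ 6) * (t * P23) * hd r
  hr' = tr (reflexive (sym (⟦hornerE⟧ r' v0 (t ∷ [])))) (tr hr (reflexive (cong₂ (\ x y -> - (ι (+ 9) * P23 * x) - ι (+ k) * ((ι (+ 12) * P23 + m) * x) + ι (+ 6) * (t * P23) * y) (⟦hornerE⟧ r v0 (t ∷ [])) (⟦hdE⟧ r))))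

-- The functional whose vanishing on moments characterises the dissection

H-+ : ∀ f g -> H 0 (f + g) ~ H 0 f + H 0 g
H-+ f g = mk \ n -> trans (+-at f g (n N.* 13)) (sym (+-at (H 0 f) (H 0 g) n))

H-scale : ∀ f Y -> f * H 0 Y ~ H 0 (V f * Y)
H-scale f Y = sy (V13.H-V* 0 f Y (s≤s z≤n))

H-ι : ∀ c Y -> ι c * H 0 Y ~ H 0 (ι c * Y)
H-ι c Y = tr (H-scale (ι c) Y) (V13.H-cong 0 (*ʳ {Y} (V13.V-ι c)))

-- Up to the factor 26 π¹³ this is the moment of the array built from the right-hand side, as
-- `array-moment` shows. The argument a belongs to η(13τ)³, the argument b to η(τ)³.
ℒ : Ser -> Ser -> Ser
ℒ a b = q ^ 2 * ((ι (+ 1) + ι (+ 13) * t) * (V π⁻¹ * a)) + H 0 (q ^ 11 * ((q + v) * (π⁻¹ * b)))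

ℒ-cong : ∀ {a a' b b'} -> a ~ a' -> b ~ b' -> ℒ a b ~ ℒ a' b'
ℒ-cong h k = +-cong (*ˡ {q ^ 2} (*ˡ {ι (+ 1) + ι (+ 13) * t} (*ˡ {V π⁻¹} h))) (V13.H-cong 0 (*ˡ {q ^ 11} (*ˡ {q + v} (*ˡ {π⁻¹} k))))

ℒ-+ : ∀ a a' b b' -> ℒ (a + a') (b + b') ~ ℒ a b + ℒ a' b'
ℒ-+ a a' b b' = tr (+-cong (solve (v0 :* (v1 :* (v2 :* (v3 :+ v4)))) (v0 :* (v1 :* (v2 :* v3)) :+ v0 :* (v1 :* (v2 :* v4))) refl (q ^ 2 ∷ ι (+ 1) + ι (+ 13) * t ∷ V π⁻¹ ∷ a ∷ a' ∷ []))
  (tr (V13.H-cong 0 (solve (v0 :* (v1 :* (v2 :* (v3 :+ v4)))) (v0 :* (v1 :* (v2 :* v3)) :+ v0 :* (v1 :* (v2 :* v4))) refl (q ^ 11 ∷ q + v ∷ π⁻¹ ∷ b ∷ b' ∷ []))) (H-+ (q ^ 11 * ((q + v) * (π⁻¹ * b))) (q ^ 11 * ((q + v) * (π⁻¹ * b'))))))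
 (+-swap _ _ _ _)

-- A form f of level 1 acts on the pair through f and `V f`; thus products of `Q` and `R` can adjust
-- the weight without leaving the functional.
ℒ-* : ∀ f a b -> f * ℒ a b ~ ℒ (f * a) (V f * b)
ℒ-* f a b = tr (distribˡ f (q ^ 2 * ((ι (+ 1) + ι (+ 13) * t) * (V π⁻¹ * a))) (H 0 (q ^ 11 * ((q + v) * (π⁻¹ * b))))) (+-cong
 (solve (v3 :* (v0 :* (v1 :* (v2 :* v4)))) (v0 :* (v1 :* (v2 :* (v3 :* v4)))) refl (q ^ 2 ∷ ι (+ 1) + ι (+ 13) * t ∷ V π⁻¹ ∷ f ∷ a ∷ []))
 (tr (H-scale f (q ^ 11 * ((q + v) * (π⁻¹ * b)))) (V13.H-cong 0 (solve (v3 :* (v0 :* (v1 :* (v2 :* v4)))) (v0 :* (v1 :* (v2 :* (v3 :* v4)))) refl (q ^ 11 ∷ q + v ∷ π⁻¹ ∷ V f ∷ b ∷ [])))))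

-- With X = P2 P23² e⁶: X = v π²⁴ and X = v¹³ V(π²⁴), the two discriminants.

X6 : Ser
X6 = P2 * P23 ^ 2 * e ^ 6

opaque
 X6≈ : X6 ~ v * π ^ 24
 X6≈ = regular-cancel {t} regular-t (tr (solve (v0 :* (v1 :* v2 :^ 2 :* v3 :^ 6)) (v0 :* v1 :* v2 :^ 2 :* v3 :^ 6) refl (t ∷ P2 ∷ P23 ∷ e ∷ []))
  (tr (sy Δ≈) (tr (*ʳ {π ^ 24} (sy t*v)) (*-assoc t v (π ^ 24)))))

 regular-t^ : ∀ n -> Regular (t ^ n)
 regular-t^ zero g h = tr (sy (*-identityˡ g)) h
 regular-t^ (suc n) = regular-* {t} {t ^ n} regular-t (regular-t^ n)

 X6≈V : X6 ~ v ^ 13 * V π ^ 24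
 X6≈V = regular-cancel {t ^ 13} (regular-t^ 13) (tr (solve (v0 :* (v1 :* v2 :^ 2 :* v3 :^ 6)) (v0 :* v1 :* v2 :^ 2 :* v3 :^ 6) refl (t ^ 13 ∷ P2 ∷ P23 ∷ e ∷ []))
  (tr (sy VΔ≈) (tr VΔ (tr (*ʳ {V π ^ 24} (sy (tv^ 13))) (*-assoc (t ^ 13) (v ^ 13) (V π ^ 24))))))

 v*Vπ² : v * V π ^ 2 ~ π ^ 2
 v*Vπ² = by1 {c = π ^ 2 * (V π * V π⁻¹ + ι (+ 1))} Vπ*Vπ⁻¹ (solve (v0 :^ 2 :* v1 :^ 2 :* v2 :^ 2) (v0 :^ 2 :+ v0 :^ 2 :* (v2 :* v1 :+ # 1) :* (v2 :* v1 :- # 1)) refl (π ∷ V π⁻¹ ∷ V π ∷ []))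

opaque
 upper-algebra : ∀ (s T w⁻ w c A Y hh Ζ Φ z E : Ser) -> w * w⁻ ~ ι (+ 1) -> T * A ~ hh * Ζ -> w ^ 2 * (Ζ * Y) ~ Φ * (z * E) ->
  s * (T * (w⁻ * (c * (w ^ 3 * (A * Y))))) ~ c * (Φ * (s * (z * (hh * E))))
 upper-algebra s T w⁻ w c A Y hh Ζ Φ z E hw hA hY =
  tr (by1 {c = s * T * c * w ^ 2 * A * Y} hw (solve (v0 :* (v1 :* (v2 :* (v4 :* (v3 :^ 3 :* (v5 :* v6)))))) (v4 :* (v0 :* (v3 :^ 2 :* (v1 :* v5 :* v6))) :+ v0 :* v1 :* v4 :* v3 :^ 2 :* v5 :* v6 :* (v3 :* v2 :- # 1)) refl (s ∷ T ∷ w⁻ ∷ w ∷ c ∷ A ∷ Y ∷ [])))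
   (*ˡ {c} (tr (*ˡ {s} (tr (*ˡ {w ^ 2} (tr (*ʳ {Y} hA) (*-assoc hh Ζ Y))) (tr (solve (v0 :* (v1 :* v2)) (v1 :* (v0 :* v2)) refl (w ^ 2 ∷ hh ∷ Ζ * Y ∷ [])) (*ˡ {hh} hY))))
     (solve (v0 :* (v1 :* (v2 :* (v3 :* v4)))) (v2 :* (v0 :* (v3 :* (v1 :* v4)))) refl (s ∷ hh ∷ Φ ∷ z ∷ E ∷ []))))

 lower-algebra : ∀ (g S v s π⁻ p B Y N c hm Ζ Φ z E : Ser) -> p * π⁻ ~ ι (+ 1) -> S ~ v * s -> N * (s * B) ~ - (c * (hm * Ζ)) -> v * p ^ 2 * (Ζ * Y) ~ Φ * (z * E) ->
  N * (g * (S * (π⁻ * (p ^ 3 * (B * Y))))) ~ - (c * Φ) * (g * (z * (hm * E)))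
 lower-algebra g S v s π⁻ p B Y N c hm Ζ Φ z E hp hS hB hY =
  tr (*ˡ {N} (*ˡ {g} (*ʳ {π⁻ * (p ^ 3 * (B * Y))} hS)))
   (tr (by1 {c = N * g * v * s * p ^ 2 * B * Y} hp (solve (v0 :* (v1 :* (v2 :* v3 :* (v4 :* (v5 :^ 3 :* (v6 :* v7)))))) (v1 :* (v0 :* (v3 :* v6) :* (v2 :* v5 :^ 2 :* v7)) :+ v0 :* v1 :* v2 :* v3 :* v5 :^ 2 :* v6 :* v7 :* (v5 :* v4 :- # 1)) refl (N ∷ g ∷ v ∷ s ∷ π⁻ ∷ p ∷ B ∷ Y ∷ [])))
   (tr (*ˡ {g} (tr (*ʳ {v * p ^ 2 * Y} hB) (tr (solve ((:- (v0 :* (v1 :* v2))) :* (v3 :* v4)) ((:- v0) :* v1 :* (v3 :* (v2 :* v4))) refl (c ∷ hm ∷ Ζ ∷ v * p ^ 2 ∷ Y ∷ [])) (*ˡ {(- c) * hm} hY))))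
     (solve (v0 :* ((:- v1) :* v2 :* (v3 :* (v4 :* v5)))) ((:- (v1 :* v3)) :* (v0 :* (v4 :* (v2 :* v5)))) refl (g ∷ c ∷ hm ∷ Φ ∷ z ∷ E ∷ []))))

 V-const* : ∀ c Φ -> - (ι c * V Φ) ~ V (- (ι c * Φ))
 V-const* c Φ = sy (tr (V13.V-neg (ι c * Φ)) (-‿cong (tr (V13.V-* (ι c) Φ) (*ʳ {V Φ} (V13.V-ι c)))))

 q+v : q + v ~ v * (ι (+ 1) + t)
 q+v = tr (+ʳ (sy t*v)) (solve (v0 :* v1 :+ v1) (v1 :* (# 1 :+ v0)) refl (t ∷ v ∷ []))

 collect : ∀ (N c Φ U L W : Ser) -> L ~ - (c * Φ) * W -> N * (c * (Φ * U)) + L ~ c * (Φ * (N * U - W))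
 collect N c Φ U L W h = tr (+ˡ h) (solve (v0 :* (v1 :* (v2 :* v3)) :+ (:- (v1 :* v2)) :* v4) (v1 :* (v2 :* (v0 :* v3 :- v4))) refl (N ∷ c ∷ Φ ∷ U ∷ W ∷ []))

 -- Rewrites `F * ℒ a b` as Φ times a trace. Both components share the factor `Ζ * Y`; it is traded
 -- for `E` times Φ at infinity and `V Φ` at the other cusp, and `V Φ` then leaves `H 0` as Φ.
 transfer : ∀ p r F a b A B Y Ζ Φ hh hm c N ->
  V π ^ 2 * (Ζ * Y) ~ Φ * (v ^ p * E) -> v * π ^ 2 * (Ζ * Y) ~ V Φ * (v ^ r * E) ->
  a * F ~ ι c * (V π ^ 3 * (A * Y)) -> b * V F ~ π ^ 3 * (B * Y) ->
  (ι (+ 1) + ι (+ 13) * t) * A ~ hh * Ζ -> ι N * ((ι (+ 1) + t) * B) ~ - (ι c * (hm * Ζ)) ->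
  ι N * (F * ℒ a b) ~ ι c * (Φ * (ι N * (q ^ 2 * (v ^ p * (hh * E))) - H 0 (q ^ 11 * (v ^ r * (hm * E)))))
 transfer p r F a b A B Y Ζ Φ hh hm c N κ∞ κx ha hb iA iB =
  tr (*ˡ {ι N} (tr (ℒ-* F a b) (ℒ-cong (tr (*-comm F a) ha) (tr (*-comm (V F) b) hb))))
   (tr (distribˡ (ι N) (q ^ 2 * ((ι (+ 1) + ι (+ 13) * t) * (V π⁻¹ * (ι c * (V π ^ 3 * (A * Y)))))) (H 0 L))
   (tr (+-cong (*ˡ {ι N} (upper-algebra (q ^ 2) (ι (+ 1) + ι (+ 13) * t) (V π⁻¹) (V π) (ι c) A Y hh Ζ Φ (v ^ p) E Vπ*Vπ⁻¹ iA κ∞)) (H-ι N L))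
     (collect (ι N) (ι c) Φ (q ^ 2 * (v ^ p * (hh * E))) (H 0 (ι N * L)) (H 0 W) lower)))
  where
  L W : Ser
  L = q ^ 11 * ((q + v) * (π⁻¹ * (π ^ 3 * (B * Y))))
  W = q ^ 11 * (v ^ r * (hm * E))
  lower : H 0 (ι N * L) ~ - (ι c * Φ) * H 0 W
  lower = tr (V13.H-cong 0 (tr (lower-algebra (q ^ 11) (q + v) v (ι (+ 1) + t) π⁻¹ π B Y (ι N) (ι c) hm Ζ (V Φ) (v ^ r) E π*π⁻¹ q+v iB κx) (*ʳ {W} (V-const* c Φ))))
   (V13.H-V* 0 (- (ι c * Φ)) W (s≤s z≤n))

regular-power : ∀ {f} -> Regular f -> ∀ n -> Regular (f ^ n)
regular-power {f} h zero g k = tr (sy (*-identityˡ g)) k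
regular-power {f} h (suc n) = regular-* {f} {f ^ n} h (regular-power {f} h n)

regular-QR : ∀ a b -> Regular (Q ^ a * R ^ b)
regular-QR a b = regular-* {Q ^ a} {R ^ b} (regular-power {Q} (regular-1 {Q} (agrees-head agrees-Q)) a) (regular-power {R} (regular-1 {R} (agrees-head agrees-R)) b)

V-QR : ∀ a b -> V (Q ^ a * R ^ b) ~ (P23 * Q4* * e ^ 2) ^ a * (P2 * P23 * Q6* * e ^ 3) ^ b
V-QR a b = tr (V13.V-* (Q ^ a) (R ^ b)) (*-cong (tr (V13.V-^ Q a) (^-cong a VQ≈)) (tr (V13.V-^ R b) (^-cong b VR≈)))

power-+ : ∀ (x : Ser) m n k -> m N.+ n ≡ k -> x ^ m * x ^ n ~ x ^ k
power-+ x zero n k e = tr (*-identityˡ (x ^ n)) (reflexive (cong (x ^_) e))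
power-+ x (suc m) n k e = tr (*-assoc x (x ^ m) (x ^ n)) (tr (*ˡ {x} (power-+ x m n (m N.+ n) refl)) (reflexive (cong (x ^_) e)))

opaque
 κ-algebra∞ : ∀ (w p P2 P23 s e f v g E : Ser) -> P2 * s * f ~ v * g -> v * w ~ p -> P23 * e ~ E -> w * (P2 * (P23 * s) * (e * f)) ~ p * g * E
 κ-algebra∞ w p P2 P23 s e f v g E hX hw hE = tr (solve (v0 :* (v1 :* (v2 :* v3) :* (v4 :* v5))) (v0 :* (v1 :* v3 :* v5) :* (v2 :* v4)) refl (w ∷ P2 ∷ P23 ∷ s ∷ e ∷ f ∷ []))
  (tr (*-cong (*ˡ {w} hX) hE) (tr (solve (v0 :* (v1 :* v2) :* v3) (v1 :* v0 :* v2 :* v3) refl (w ∷ v ∷ g ∷ E ∷ [])) (*ʳ {E} (*ʳ {g} hw))))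

 κ-algebrax : ∀ (w p P2 P23 s e f v z g E : Ser) -> P2 * s * f ~ z * g -> v * w ~ p -> P23 * e ~ E -> v * p * (P2 * (P23 * s) * (e * f)) ~ w * g * (v * (v * z) * E)
 κ-algebrax w p P2 P23 s e f v z g E hX hw hE = tr (solve (v0 :* (v1 :* (v2 :* v3) :* (v4 :* v5))) (v0 :* (v1 :* v3 :* v5) :* (v2 :* v4)) refl (v * p ∷ P2 ∷ P23 ∷ s ∷ e ∷ f ∷ []))
  (tr (*-cong (*-cong (*ˡ {v} (sy hw)) hX) hE) (solve (v0 :* (v0 :* v1) :* (v2 :* v3) :* v4) (v1 :* v3 :* (v0 :* (v0 :* v2) :* v4)) refl (v ∷ w ∷ z ∷ g ∷ E ∷ [])))

 κ-square : ∀ (w a b c d Φ y E g z : Ser) -> w * (a * c) ~ Φ * (y * E) -> b * d ~ z * g -> w * (a * b * (c * d)) ~ Φ * g * (z * y * E)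
 κ-square w a b c d Φ y E g z h hX = tr (solve (v0 :* (v1 :* v2 :* (v3 :* v4))) (v0 :* (v1 :* v3) :* (v2 :* v4)) refl (w ∷ a ∷ b ∷ c ∷ d ∷ []))
  (tr (*-cong h hX) (solve (v0 :* (v1 :* v2) :* (v3 :* v4)) (v0 :* v4 :* (v3 :* v1 :* v2)) refl (Φ ∷ y ∷ E ∷ z ∷ g ∷ [])))

 -- Weight 15 on both sides: `X6≈` turns weight 12 into v π²⁴, P23 e = E accounts for weight 2, and
 -- v (V π)² = π² for the rest. At the other cusp `X6≈V` takes the place of `X6≈`.
 κ∞0 : V π ^ 2 * (P2 * P23 ^ 3 * e ^ 7) ~ π ^ 26 * (v ^ 0 * E)
 κ∞0 = tr (κ-algebra∞ (V π ^ 2) (π ^ 2) P2 P23 (P23 ^ 2) e (e ^ 6) v (π ^ 24) E X6≈ v*Vπ² P23*e) (*-cong (power-+ π 2 24 26 refl) (sy (*-identityˡ E)))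

 κx0 : v * π ^ 2 * (P2 * P23 ^ 3 * e ^ 7) ~ V (π ^ 26) * (v ^ 15 * E)
 κx0 = tr (κ-algebrax (V π ^ 2) (π ^ 2) P2 P23 (P23 ^ 2) e (e ^ 6) v (v ^ 13) (V π ^ 24) E X6≈V v*Vπ² P23*e) (*ʳ {v ^ 15 * E} (tr (power-+ (V π) 2 24 26 refl) (sy (V13.V-^ π 26))))

 κ∞1 : V π ^ 2 * (P2 * P23 ^ 3 * (P2 * P23 ^ 2) * (e ^ 7 * e ^ 6)) ~ π ^ 50 * (v ^ 1 * E)
 κ∞1 = tr (κ-square (V π ^ 2) (P2 * P23 ^ 3) (P2 * P23 ^ 2) (e ^ 7) (e ^ 6) (π ^ 26) (v ^ 0) E (π ^ 24) v κ∞0 X6≈) (*ʳ {v ^ 1 * E} (power-+ π 26 24 50 refl))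

 κx1 : v * π ^ 2 * (P2 * P23 ^ 3 * (P2 * P23 ^ 2) * (e ^ 7 * e ^ 6)) ~ V (π ^ 50) * (v ^ 28 * E)
 κx1 = tr (κ-square (v * π ^ 2) (P2 * P23 ^ 3) (P2 * P23 ^ 2) (e ^ 7) (e ^ 6) (V (π ^ 26)) (v ^ 15) E (V π ^ 24) (v ^ 13) κx0 X6≈V)
  (*-cong (tr (*ʳ {V π ^ 24} (V13.V-^ π 26)) (tr (power-+ (V π) 26 24 50 refl) (sy (V13.V-^ π 50)))) (*ʳ {E} (power-+ v 13 15 28 refl)))

hom-star : ∀ h h* -> ⟦ homE h (# 1) (# 13 :* v0) ⟧ (t ∷ []) ~ ⟦ hE h* v0 ⟧ (t ∷ []) -> hom h 1# 13t ~ horner h* t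
hom-star h h* e = tr (hom-1-13t h) (tr e (reflexive (⟦hornerE⟧ h* v0 (t ∷ []))))

agrees-horner : ∀ n h {cs} -> Agrees (⟦ v0 :^ n :* (hE h v1 :* v2) ⟧ (v ∷ t ∷ E ∷ [])) cs -> Agrees (v ^ n * (horner h t * E)) cs
agrees-horner n h {cs} = agrees-cong cs (*ˡ {v ^ n} (*ʳ {E} (reflexive (⟦hornerE⟧ h v1 (v ∷ t ∷ E ∷ [])))))

-- Conversion of these closed terms by unfolding is exponential, hence the
-- explicit rewriting.
to-horner : ∀ r h (f f' : Ser -> Ser) -> (∀ {x y} -> x ~ y -> f x ~ f y) -> (∀ {x y} -> x ~ y -> f' x ~ f' y) ->
 f (⟦ hE r v0 ⟧ (t ∷ [])) ~ f' (⟦ hE h v0 ⟧ (t ∷ [])) -> f (horner r t) ~ f' (horner h t)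
to-horner r h f f' cf cf' eq = tr (cf (reflexive (sym (⟦hornerE⟧ r v0 (t ∷ []))))) (tr eq (cf' (reflexive (⟦hornerE⟧ h v0 (t ∷ [])))))

opaque
 -- A trace with p = 0, r = 15 and M = 2. The factors q² and q¹¹ already kill the degrees concerned
 -- except degree 13 of the lower part, that is, the coefficient 2 = 13 - 11 of v¹⁵ h* E.
 vanish : ∀ h h* -> length h ≡ 16 -> ⟦ homE h (# 1) (# 13 :* v0) ⟧ (t ∷ []) ~ ⟦ hE h* v0 ⟧ (t ∷ []) -> ∀ {x0 x1} -> Agrees (v ^ 15 * (horner h* t * E)) (x0 ∷ x1 ∷ 0 ,, []) ->
  ∀ a b F A B c -> Regular F -> a * F ~ ι c * (V π ^ 3 * (A * e ^ 7)) -> b * V F ~ π ^ 3 * (B * e ^ 7) ->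
  (ι (+ 1) + ι (+ 13) * t) * A ~ horner h t * (P2 * P23 ^ 3) -> ι ((+ 13) Z.^ 15) * ((ι (+ 1) + t) * B) ~ - (ι c * (horner h* t * (P2 * P23 ^ 3))) ->
  ℒ a b ~ 0#
 vanish h h* len star low a b F A B c regF ha hb iA iB = regF (ℒ a b) (regular-ι ((+ 13) Z.^ 15) (\ ()) (F * ℒ a b)
  (tr (transfer 0 15 F a b A B (e ^ 7) (P2 * P23 ^ 3) (π ^ 26) (horner h t) (hom h 1# 13t) c ((+ 13) Z.^ 15) κ∞0 κx0 ha hb iA (tr iB (-‿cong (*ˡ {ι c} (*ʳ {P2 * P23 ^ 3} (sy hm))))))
   (tr (*ˡ {ι c} (*ˡ {π ^ 26} (T.trace-zero small))) (tr (*ˡ {ι c} (zeroʳ (π ^ 26))) (zeroʳ (ι c))))))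
  where
  hm : hom h 1# 13t ~ horner h* t
  hm = hom-star h h* star
  module T = Trace h 0 15 2 11 len refl
  small : ∀ i -> i N.< 2 -> T.trace i ≡ + 0
  small zero _ = T.trace-value 0 (+ 0) (+ 0) (T.upper-low 0 (s≤s z≤n)) (T.lower-low 0 (s≤s z≤n))
  small (suc zero) _ = T.trace-value 1 (+ 0) (+ 0) (T.upper-low 1 (s≤s (s≤s z≤n))) (T.lower-at 2 13 (horner h* t) refl hm (agrees-third low))
  small (2+ i) (s≤s (s≤s ()))

-- The seven moments as explicit polynomials in t

r0 s0 : List ℤ
r0 = 1 ,, []
s0 = 1 ,, []
r1 s1 : List ℤ
r1 = 9 ,, 99 ,, 504 ,, 1287 ,, 1521 ,, []
s1 = 8 ,- 98 ,- 503 ,- 1286 ,- 1520 ,- []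
r2 s2 : List ℤ
r2 = 72 ,, 1926 ,, 24066 ,, 180828 ,, 893700 ,, 2977416 ,, 6564636 ,, 8818758 ,, 5655078 ,, []
s2 = 198 ,, 4014 ,, 38844 ,, 229032 ,, 893700 ,, 2350764 ,, 4067154 ,, 4231422 ,, 2056392 ,, []
r3 s3 : List ℤ
r3 = 504 ,, 26550 ,, 612720 ,, 8444934 ,, 78751314 ,, 528564564 ,, 2635211214 ,, 9880628706 ,, 27768982176 ,, 57289064274 ,, 82758981942 ,, 75641295132 ,, 33449786370 ,, []
s3 = 6929 ,- 203723 ,- 2897621 ,- 26076041 ,- 164313503 ,- 760048361 ,- 2635211213 ,- 6871339331 ,- 13308972065 ,- 18553519997 ,- 17499895919 ,- 9857829149 ,- 2432711735 ,- []
r4 s4 : List ℤ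
r4 = 3024 ,, 309528 ,, 12049344 ,, 266888736 ,, 3944173176 ,, 42194291904 ,, 342475637112 ,, 2169405215856 ,, 10901664438336 ,, 43794564171696 ,, 140674644080568 ,, 358629629514624 ,, 713483508345192 ,, 1074208751898984 ,, 1158418405295424 ,, 803028413206656 ,, 271344667033440 ,, []
s4 = 332640 ,, 12797568 ,, 239996736 ,, 2893156488 ,, 24981040872 ,, 163236062592 ,, 832394343672 ,, 3368812628592 ,, 10901664438336 ,, 28202267806128 ,, 57878382671928 ,, 92700859313088 ,, 112649530079736 ,, 99093919455648 ,, 58159882063296 ,, 19422422969976 ,, 2466769700304 ,, []
r5 s5 : List ℤ
r5 = 15120 ,, 3232440 ,, 205084440 ,, 6875407440 ,, 149137217280 ,, 2314477927440 ,, 27241353774360 ,, 252276251725440 ,, 1883082429263880 ,, 11510668290043800 ,, 58195915705512720 ,, 244642266210546360 ,, 856067228430406200 ,, 2486174406859751400 ,, 5947300066432252320 ,, 11563178793177506040 ,, 17883529974827964720 ,, 21253762621899451800 ,, 18308710063414330560 ,, 10226166466489253280 ,, 2797292172447732960 ,, []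
s5 = 20291039 ,- 964323359 ,- 22444551359 ,- 338713385399 ,- 3705041980079 ,- 31143002408279 ,- 208231506825119 ,- 1131622397296199 ,- 5065486558759799 ,- 18818635862349719 ,- 58195915705512719 ,- 149638687770569399 ,- 318240930545595719 ,- 554250925040791679 ,- 778040305149495959 ,- 859349453112979919 ,- 719856862602059519 ,- 431421620630766479 ,- 167293678107081239 ,- 34278407953260119 ,- 2084420396756879 ,- []
r6 s6 : List ℤ
r6 = 60480 ,, 30872880 ,, 3166596720 ,, 155854812960 ,, 4761047026080 ,, 101946515425200 ,, 1640102733457200 ,, 20713320208988640 ,, 211498463779806240 ,, 1782153021949856640 ,, 12572874920916293760 ,, 75014402942511695520 ,, 381039719646975873120 ,, 1654174816555247990640 ,, 6145372650695008938480 ,, 19514963139100153189920 ,, 52771040380954647853920 ,, 120688156344791165261040 ,, 230961829268332547789040 ,, 364005927665504872675200 ,, 461386607761856806848000 ,, 453474245767854004424640 ,, 325397717537657527002240 ,, 152211122555591282863680 ,, 34982935908631348397760 ,, []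
s6 = 1501536960 ,, 84931640640 ,, 2360374853760 ,, 42762437887680 ,, 565611415488000 ,, 5801028375945600 ,, 47849796681064560 ,, 325048294324943280 ,, 1847660809528890720 ,, 8882550359171667360 ,, 36363151779260407920 ,, 127244216658095999280 ,, 381039719646975873120 ,, 975187238252652041760 ,, 2124815861634853645440 ,, 3915390189223835038080 ,, 6040607624015046020640 ,, 7690710800356019111520 ,, 7916462634775814074800 ,, 6396992656248924428400 ,, 3883732323299144203680 ,, 1652762266313352274080 ,, 436542248113190135280 ,, 55329152785857016560 ,, 1409068188207650880 ,, []
-- For k ≤ 5, `hₖ` is (1 + 13t) `rₖ` times the polynomials of the multiplier, divided by P2 P23³,
-- and `hₖ*` is its reversal in 13t. For k = 6 the numerator carries 13⁶, the divisor gains P2 P23²,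
-- and a multiple of `M0` has been taken off.
h0 h1 h2 h3 h4 h5 h6 h0* h1* h2* h3* h4* h5* h6* : List ℤ
h0 = 1 ,, 13 ,, 196884 ,- 44759480 ,- 2885346463 ,- 91477684167 ,- 1739919840229 ,- 21953823642789 ,- 194602352263201 ,- 1251776314987665 ,- 5930120885376583 ,- 20674362305610831 ,- 52071220248745034 ,- 90559656871083646 ,- 98434409642482224 ,- 51185893014090756 ,- []
h0* = 51185893014090756 ,- 1279647325352268924 ,- 15304582011213136342 ,- 114400470886492841894 ,- 590480461810550972751 ,- 2201812373894128003111 ,- 6042085183169301137793 ,- 12211009009227519171433 ,- 17908408388839933151589 ,- 18450978854789295175789 ,- 12610975577239624346631 ,- 5171003655855504635167 ,- 1042810198376070992360 ,- 59631565361415731904 ,- 51185893014090757 ,, 51185893014090757 ,, []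
h1 = 9 ,, 6831 ,, 1859247 ,, 212935437 ,, 9478938924 ,, 228608070444 ,, 3489290572482 ,, 36618654053826 ,, 277115146153794 ,, 1552435081210962 ,, 6506369381305404 ,, 20323098868379580 ,, 46339891308614709 ,, 73598650901917479 ,, 73598650901917479 ,, 35436387471293601 ,, []
h1* = 35436387471293601 ,, 956782461724927227 ,, 12438172002424053951 ,, 101808741205026515673 ,, 580448026779789184380 ,, 2415769406693027367372 ,, 7493307621904802280258 ,, 17388564459388827423498 ,, 29870961073377055788546 ,, 37002179688100180053786 ,, 31515563815919791810956 ,, 16987778917088496796188 ,, 4960987936818690259197 ,, 563119633306326613491 ,, 26896218090711843159 ,, 460673037126816813 ,, []
h2 = 72 ,, 15713 ,- 10515419 ,- 796513301 ,- 27469789307 ,- 562038271235 ,- 7676799230879 ,- 74615011576559 ,- 535097709564443 ,- 2885558071649291 ,- 11767460558546627 ,- 36031840715586923 ,- 80944992074058839 ,- 127067756258011373 ,- 125809659661397399 ,- 59969271105266093 ,- []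
h2* = 59969271105266093 ,- 1635525575598166199 ,- 21474450807603922205 ,- 177836147586707271479 ,- 1029105402677878136363 ,- 4369175733164453150003 ,- 13928037670259447469227 ,- 33576587725265576929547 ,- 60865757190770635499759 ,- 81408612630513842238239 ,- 77481748434014157155363 ,- 49230268430338649556395 ,- 18557234711184415742261 ,- 3184858953362309041259 ,- 61871932524878627345 ,- 3685384297014534504 ,, []
h3 = 504 ,, 273510 ,, 46748124 ,, 2757972978 ,, 85746479364 ,, 1667112218460 ,, 22143453835464 ,, 211580015724792 ,, 1499815265713596 ,, 8018153067464748 ,, 32472644433719724 ,, 98851478892707268 ,, 220931764529222448 ,, 345202350778618866 ,, 340266741053440968 ,, 161455729898793330 ,, []
h3* = 161455729898793330 ,, 4423467633694732584 ,, 58339197281586588354 ,, 485387086670701718256 ,, 2823297088654612281348 ,, 12056865569729097483132 ,, 38702093389416452829132 ,, 94111183697489095737132 ,, 172592318776375915735032 ,, 234820242314232433164072 ,, 229825576179936217332540 ,, 153671444244271729152468 ,, 64255489206946418318418 ,, 14158843039487860683372 ,, 1076911815252612534390 ,, 25797690079101741528 ,, []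
h4 = 3024 ,, 1211543 ,- 192653207 ,- 10910470391 ,- 333214256735 ,- 6411319218719 ,- 84509929970855 ,- 802614205713527 ,- 5661250398366263 ,- 30139230791196071 ,- 121620414324432815 ,- 369046990418316911 ,- 822415203552774311 ,- 1281501659926129823 ,- 1259823687799858271 ,- 596144233472467679 ,- []
h4* = 596144233472467679 ,- 16377707941398157535 ,- 216573780527515940255 ,- 1806846202205445163463 ,- 10540351093337549323631 ,- 45156808495761633551087 ,- 145476310436022321094247 ,- 355235066863142288830487 ,- 654717064711538514893687 ,- 896185499388216360273287 ,- 883854798255248168213279 ,- 597173393650735841483231 ,- 254193067919124644082551 ,- 58349860908339488397623 ,- 4770304735835659392215 ,- 154786140474610449168 ,, []
h5 = 15120 ,, 6740280 ,, 950731560 ,, 53182553400 ,, 1613300535360 ,, 30868269069600 ,, 405070843465080 ,, 3833056293707160 ,, 26953903831537800 ,, 143119010607136200 ,, 576185470546055760 ,, 1744718799314359440 ,, 3880523734416253080 ,, 6035519428824805920 ,, 5922640047338894880 ,, 2797292172447732960 ,, []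
h5* = 2797292172447732960 ,, 76994320615405633440 ,, 1020002783471392200480 ,, 8525510644512508016760 ,, 49830913627217419965840 ,, 213933631915456681297680 ,, 690808128469620474385800 ,, 1691317492789614779442600 ,, 3126741774099329389662360 ,, 4295573505546022007394840 ,, 4255453019924190413690400 ,, 2891293323150880651648320 ,, 1239051656144091322985400 ,, 287952922575618978604680 ,, 26539019305001203660920 ,, 773930702373052245840 ,, []
h6 = 266983110720 ,, 144638613915120 ,, 39503413765090079 ,- 39214205412371870399 ,- 9286718134332091190399 ,- 1009578381050063908839599 ,- 64426288215690388521743039 ,- 2742042413377832509800863279 ,- 84064012092638445029866554239 ,- 1953340383535627694890786246079 ,- 35651524596055892986090972580639 ,- 524564870870263241039440685694479 ,- 6343883219541125853083636791937279 ,- 63986109182092691168691113125268399 ,- 544199524837919231373980856422045279 ,- 3934510931866501363232544109605063359 ,- 24319804719776767966813244907517185599 ,- 128981560992629858496811424712331616399 ,- 587899853533835562973650774726250399679 ,- 2302255099127274668076511436864218433999 ,- 7727700582021573569793379522238660934719 ,- 22128518012680471125153448808528157863999 ,- 53652055775789670061487143763469068232479 ,- 108912490673113401495610550389679207942639 ,- 182103713217368730480600151648179043020479 ,- 244817927493721557335807868543484302857279 ,- 255064616529905985496431585361806465351359 ,- 193840564064544131746007445629148998789759 ,- 95911910606692980587568789719469400561919 ,- 23278226591593974319391323322957281556159 ,- []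
h6* = 23278226591593974319391323322957281556159 ,- 1246854837887008747638394266353102207304959 ,- 32759055326907958265075258311326180795469439 ,- 560376962516203450135660193039888804376937919 ,- 6992244827148181399068008533470455173906774079 ,- 67613833991616488046333472105907341420203080639 ,- 525699790193399824359626465115857108010406235759 ,- 3366586933932086300277617085723482806959931232159 ,- 18050911953145327853541104032217265163202539943999 ,- 81948395976779511993347264883130919438597833930559 ,- 317385415817356081842609932427301135103344544465999 ,- 1053610833163493329450821699881827237098037538708159 ,- 3005023387236765388734982500466962657265682708288399 ,- 7365863446805166198987916192217272521633449323156799 ,- 15491650432406866655196120312423350687954368751951039 ,- 27855338656672759383757411375784712913729969483476959 ,- 42577419806772847387339066679794433223255278594324399 ,- 54877228393014690268830345084696113491920433420842239 ,- 58990156026416433098672468828591663784817423745227919 ,- 52119687189793390179729669117205256498701537747493279 ,- 37123163229106371493356028466976927286452913486150079 ,- 20769235559692556489109188208084428055440651151861119 ,- 8806998428288080541944752349234909520549896453510319 ,- 2690049144295228578959991242475410477915465946002879 ,- 547999922987284474464174205061121998689362253095599 ,- 65530890848346247529068694952497400449640900547199 ,- 3597249653359770103527870455143055369273113233599 ,- 47109136082766171960386637301820036816836179359 ,- 2242322712196335562205447003334823048137377520 ,, 53807275924193147713783598194363120341706560 ,, []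

opaque
 Γ∞0 : Γ∞ 0 ~ ι (+ 1) * (V π ^ 3 * (e ^ 0 * horner r0 t))
 Γ∞0 = tr Γ∞-zero (solve (v0 :^ 3) (# 1 :* (v0 :^ 3 :* (v1 :^ 0 :* hE r0 v2))) refl (V π ∷ e ∷ t ∷ []))
 Γx0 : Γx 0 ~ ι (+ 1) * (π ^ 3 * (e ^ 0 * horner s0 t))
 Γx0 = tr Γx-zero (solve (v0 :^ 3) (# 1 :* (v0 :^ 3 :* (v1 :^ 0 :* hE s0 v2))) refl (π ∷ e ∷ t ∷ []))
 Γ∞1 : Γ∞ 1 ~ ι (+ 52) * (V π ^ 3 * (e ^ 1 * horner r1 t))
 Γ∞1 = step∞ 0 (+ 1) r0 r1 (Γ∞0)
  (solve (hE r1 τ) (# 9 :* P23E τ :* hE r0 τ :- # 0 :* (mE τ :* hE r0 τ) :+ # 6 :* (τ :* P23E τ) :* hdE r0 τ) refl (t ∷ []))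
 Γx1 : Γx 1 ~ ι (+ 4) * (π ^ 3 * (e ^ 1 * horner s1 t))
 Γx1 = stepx 0 (+ 1) s0 s1 (Γx0)
  (solve (hE s1 τ) (:- (# 9 :* P23E τ :* hE s0 τ) :- # 0 :* ((# 12 :* P23E τ :+ mE τ) :* hE s0 τ) :+ # 6 :* (τ :* P23E τ) :* hdE s0 τ) refl (t ∷ []))
 Γ∞2 : Γ∞ 2 ~ ι (+ 2704) * (V π ^ 3 * (e ^ 2 * horner r2 t))
 Γ∞2 = step∞ 1 (+ 52) r1 r2 (Γ∞1)
  (solve (hE r2 τ) (# 9 :* P23E τ :* hE r1 τ :- # 1 :* (mE τ :* hE r1 τ) :+ # 6 :* (τ :* P23E τ) :* hdE r1 τ) refl (t ∷ []))
 Γx2 : Γx 2 ~ ι (+ 16) * (π ^ 3 * (e ^ 2 * horner s2 t))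
 Γx2 = stepx 1 (+ 4) s1 s2 (Γx1)
  (solve (hE s2 τ) (:- (# 9 :* P23E τ :* hE s1 τ) :- # 1 :* ((# 12 :* P23E τ :+ mE τ) :* hE s1 τ) :+ # 6 :* (τ :* P23E τ) :* hdE s1 τ) refl (t ∷ []))
 Γ∞3 : Γ∞ 3 ~ ι (+ 140608) * (V π ^ 3 * (e ^ 3 * horner r3 t))
 Γ∞3 = step∞ 2 (+ 2704) r2 r3 (Γ∞2)
  (solve (hE r3 τ) (# 9 :* P23E τ :* hE r2 τ :- # 2 :* (mE τ :* hE r2 τ) :+ # 6 :* (τ :* P23E τ) :* hdE r2 τ) refl (t ∷ []))
 Γx3 : Γx 3 ~ ι (+ 64) * (π ^ 3 * (e ^ 3 * horner s3 t))
 Γx3 = stepx 2 (+ 16) s2 s3 (Γx2)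
  (solve (hE s3 τ) (:- (# 9 :* P23E τ :* hE s2 τ) :- # 2 :* ((# 12 :* P23E τ :+ mE τ) :* hE s2 τ) :+ # 6 :* (τ :* P23E τ) :* hdE s2 τ) refl (t ∷ []))
 Γ∞4 : Γ∞ 4 ~ ι (+ 7311616) * (V π ^ 3 * (e ^ 4 * horner r4 t))
 Γ∞4 = step∞ 3 (+ 140608) r3 r4 (Γ∞3)
  (solve (hE r4 τ) (# 9 :* P23E τ :* hE r3 τ :- # 3 :* (mE τ :* hE r3 τ) :+ # 6 :* (τ :* P23E τ) :* hdE r3 τ) refl (t ∷ []))
 Γx4 : Γx 4 ~ ι (+ 256) * (π ^ 3 * (e ^ 4 * horner s4 t))
 Γx4 = stepx 3 (+ 64) s3 s4 (Γx3)
  (solve (hE s4 τ) (:- (# 9 :* P23E τ :* hE s3 τ) :- # 3 :* ((# 12 :* P23E τ :+ mE τ) :* hE s3 τ) :+ # 6 :* (τ :* P23E τ) :* hdE s3 τ) refl (t ∷ []))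
 Γ∞5 : Γ∞ 5 ~ ι (+ 380204032) * (V π ^ 3 * (e ^ 5 * horner r5 t))
 Γ∞5 = step∞ 4 (+ 7311616) r4 r5 (Γ∞4)
  (solve (hE r5 τ) (# 9 :* P23E τ :* hE r4 τ :- # 4 :* (mE τ :* hE r4 τ) :+ # 6 :* (τ :* P23E τ) :* hdE r4 τ) refl (t ∷ []))
 Γx5 : Γx 5 ~ ι (+ 1024) * (π ^ 3 * (e ^ 5 * horner s5 t))
 Γx5 = stepx 4 (+ 256) s4 s5 (Γx4)
  (solve (hE s5 τ) (:- (# 9 :* P23E τ :* hE s4 τ) :- # 4 :* ((# 12 :* P23E τ :+ mE τ) :* hE s4 τ) :+ # 6 :* (τ :* P23E τ) :* hdE s4 τ) refl (t ∷ []))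
 Γ∞6 : Γ∞ 6 ~ ι (+ 19770609664) * (V π ^ 3 * (e ^ 6 * horner r6 t))
 Γ∞6 = step∞ 5 (+ 380204032) r5 r6 (Γ∞5)
  (solve (hE r6 τ) (# 9 :* P23E τ :* hE r5 τ :- # 5 :* (mE τ :* hE r5 τ) :+ # 6 :* (τ :* P23E τ) :* hdE r5 τ) refl (t ∷ []))
 Γx6 : Γx 6 ~ ι (+ 4096) * (π ^ 3 * (e ^ 6 * horner s6 t))
 Γx6 = stepx 5 (+ 1024) s5 s6 (Γx5)
  (solve (hE s6 τ) (:- (# 9 :* P23E τ :* hE s5 τ) :- # 5 :* ((# 12 :* P23E τ :+ mE τ) :* hE s5 τ) :+ # 6 :* (τ :* P23E τ) :* hdE s5 τ) refl (t ∷ []))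

opaque
 -- The multiplier has weight 14 - 2k, so that the product is π²⁶ times a form of weight 2. For k =
 -- 0, ..., 5 it is Q²R, Q³, QR, Q², R and Q.
 Z0 : ℒ (Γ∞ 0) (Γx 0) ~ 0#
 Z0 = vanish h0 h0* refl
  (solve (homE h0 (# 1) (# 13 :* τ)) (hE h0* τ) refl (t ∷ []))
  (agrees-horner 15 h0* (agrees-eval (v0 :^ 15 :* (hE h0* v1 :* v2)) (v ∷ t ∷ E ∷ []) (List.take 3 vT ∷ List.take 3 tT ∷ List.take 3 ET ∷ []) 3 (51185893014090756 ,- 153557679042272271 ,, 0 ,, []) (agrees-take 3 agrees-v ∷ agrees-take 3 agrees-t ∷ agrees-take 3 agrees-E ∷ []) refl))
  (Γ∞ 0) (Γx 0) (Q ^ 2 * R ^ 1) (horner r0 t * ((P23 * Q4) ^ 2 * (P2 * P23 * Q6) ^ 1)) (ι (+ 1) * (horner s0 t * ((P23 * Q4*) ^ 2 * (P2 * P23 * Q6*) ^ 1))) (+ 1)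
  (regular-QR 2 1)
  (tr (*-cong Γ∞0 (*-cong (^-cong 2 Q≈) (^-cong 1 R≈))) (solve (# 1 :* (v0 :^ 3 :* (v1 :^ 0 :* v2)) :* ((v3 :* v4 :* v1 :^ 2) :^ 2 :* (v5 :* v3 :* v6 :* v1 :^ 3) :^ 1)) (# 1 :* (v0 :^ 3 :* (v2 :* ((v3 :* v4) :^ 2 :* (v5 :* v3 :* v6) :^ 1) :* v1 :^ 7))) refl (V π ∷ e ∷ horner r0 t ∷ P23 ∷ Q4 ∷ P2 ∷ Q6 ∷ [])))
  (tr (*-cong Γx0 (V-QR 2 1)) (solve (# 1 :* (v0 :^ 3 :* (v1 :^ 0 :* v2)) :* ((v3 :* v4 :* v1 :^ 2) :^ 2 :* (v5 :* v3 :* v6 :* v1 :^ 3) :^ 1)) (v0 :^ 3 :* (# 1 :* (v2 :* ((v3 :* v4) :^ 2 :* (v5 :* v3 :* v6) :^ 1)) :* v1 :^ 7)) refl (π ∷ e ∷ horner s0 t ∷ P23 ∷ Q4* ∷ P2 ∷ Q6* ∷ [])))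
  (to-horner r0 h0 (\ x -> (ι (+ 1) + ι (+ 13) * t) * (x * ((P23 * Q4) ^ 2 * (P2 * P23 * Q6) ^ 1))) (\ x -> x * (P2 * P23 ^ 3)) (\ e -> *ˡ (*ʳ e)) *ʳ
   (solve ((# 1 :+ # 13 :* τ) :* (hE r0 τ :* ((P23E τ :* Q4E τ) :^ 2 :* (P2E τ :* P23E τ :* Q6E τ) :^ 1))) (hE h0 τ :* (P2E τ :* P23E τ :^ 3)) refl (t ∷ [])))
  (to-horner s0 h0* (\ x -> ι (+ 51185893014090757) * ((ι (+ 1) + t) * (ι (+ 1) * (x * ((P23 * Q4*) ^ 2 * (P2 * P23 * Q6*) ^ 1))))) (\ x -> - (ι (+ 1) * (x * (P2 * P23 ^ 3)))) (\ e -> *ˡ (*ˡ (*ˡ (*ʳ e)))) (\ e -> -‿cong (*ˡ (*ʳ e)))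
   (solve (# 51185893014090757 :* ((# 1 :+ τ) :* (# 1 :* (hE s0 τ :* ((P23E τ :* Q4*E τ) :^ 2 :* (P2E τ :* P23E τ :* Q6*E τ) :^ 1))))) (:- (# 1 :* (hE h0* τ :* (P2E τ :* P23E τ :^ 3)))) refl (t ∷ [])))

 Z1 : ℒ (Γ∞ 1) (Γx 1) ~ 0#
 Z1 = vanish h1 h1* refl
  (solve (homE h1 (# 1) (# 13 :* τ)) (hE h1* τ) refl (t ∷ []))
  (agrees-horner 15 h1* (agrees-eval (v0 :^ 15 :* (hE h1* v1 :* v2)) (v ∷ t ∷ E ∷ []) (List.take 3 vT ∷ List.take 3 tT ∷ List.take 3 ET ∷ []) 3 (35436387471293601 ,, 35436387471293600 ,- 0 ,, []) (agrees-take 3 agrees-v ∷ agrees-take 3 agrees-t ∷ agrees-take 3 agrees-E ∷ []) refl))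
  (Γ∞ 1) (Γx 1) (Q ^ 3 * R ^ 0) (horner r1 t * ((P23 * Q4) ^ 3 * (P2 * P23 * Q6) ^ 0)) (ι (+ 4) * (horner s1 t * ((P23 * Q4*) ^ 3 * (P2 * P23 * Q6*) ^ 0))) (+ 52)
  (regular-QR 3 0)
  (tr (*-cong Γ∞1 (*-cong (^-cong 3 Q≈) (^-cong 0 R≈))) (solve (# 52 :* (v0 :^ 3 :* (v1 :^ 1 :* v2)) :* ((v3 :* v4 :* v1 :^ 2) :^ 3 :* (v5 :* v3 :* v6 :* v1 :^ 3) :^ 0)) (# 52 :* (v0 :^ 3 :* (v2 :* ((v3 :* v4) :^ 3 :* (v5 :* v3 :* v6) :^ 0) :* v1 :^ 7))) refl (V π ∷ e ∷ horner r1 t ∷ P23 ∷ Q4 ∷ P2 ∷ Q6 ∷ [])))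
  (tr (*-cong Γx1 (V-QR 3 0)) (solve (# 4 :* (v0 :^ 3 :* (v1 :^ 1 :* v2)) :* ((v3 :* v4 :* v1 :^ 2) :^ 3 :* (v5 :* v3 :* v6 :* v1 :^ 3) :^ 0)) (v0 :^ 3 :* (# 4 :* (v2 :* ((v3 :* v4) :^ 3 :* (v5 :* v3 :* v6) :^ 0)) :* v1 :^ 7)) refl (π ∷ e ∷ horner s1 t ∷ P23 ∷ Q4* ∷ P2 ∷ Q6* ∷ [])))
  (to-horner r1 h1 (\ x -> (ι (+ 1) + ι (+ 13) * t) * (x * ((P23 * Q4) ^ 3 * (P2 * P23 * Q6) ^ 0))) (\ x -> x * (P2 * P23 ^ 3)) (\ e -> *ˡ (*ʳ e)) *ʳ
   (solve ((# 1 :+ # 13 :* τ) :* (hE r1 τ :* ((P23E τ :* Q4E τ) :^ 3 :* (P2E τ :* P23E τ :* Q6E τ) :^ 0))) (hE h1 τ :* (P2E τ :* P23E τ :^ 3)) refl (t ∷ [])))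
  (to-horner s1 h1* (\ x -> ι (+ 51185893014090757) * ((ι (+ 1) + t) * (ι (+ 4) * (x * ((P23 * Q4*) ^ 3 * (P2 * P23 * Q6*) ^ 0))))) (\ x -> - (ι (+ 52) * (x * (P2 * P23 ^ 3)))) (\ e -> *ˡ (*ˡ (*ˡ (*ʳ e)))) (\ e -> -‿cong (*ˡ (*ʳ e)))
   (solve (# 51185893014090757 :* ((# 1 :+ τ) :* (# 4 :* (hE s1 τ :* ((P23E τ :* Q4*E τ) :^ 3 :* (P2E τ :* P23E τ :* Q6*E τ) :^ 0))))) (:- (# 52 :* (hE h1* τ :* (P2E τ :* P23E τ :^ 3)))) refl (t ∷ [])))

 Z2 : ℒ (Γ∞ 2) (Γx 2) ~ 0#
 Z2 = vanish h2 h2* refl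
  (solve (homE h2 (# 1) (# 13 :* τ)) (hE h2* τ) refl (t ∷ []))
  (agrees-horner 15 h2* (agrees-eval (v0 :^ 15 :* (hE h2* v1 :* v2)) (v ∷ t ∷ E ∷ []) (List.take 3 vT ∷ List.take 3 tT ∷ List.take 3 ET ∷ []) 3 (59969271105266093 ,- 43614015349284432 ,, 0 ,, []) (agrees-take 3 agrees-v ∷ agrees-take 3 agrees-t ∷ agrees-take 3 agrees-E ∷ []) refl))
  (Γ∞ 2) (Γx 2) (Q ^ 1 * R ^ 1) (horner r2 t * ((P23 * Q4) ^ 1 * (P2 * P23 * Q6) ^ 1)) (ι (+ 16) * (horner s2 t * ((P23 * Q4*) ^ 1 * (P2 * P23 * Q6*) ^ 1))) (+ 2704)
  (regular-QR 1 1)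
  (tr (*-cong Γ∞2 (*-cong (^-cong 1 Q≈) (^-cong 1 R≈))) (solve (# 2704 :* (v0 :^ 3 :* (v1 :^ 2 :* v2)) :* ((v3 :* v4 :* v1 :^ 2) :^ 1 :* (v5 :* v3 :* v6 :* v1 :^ 3) :^ 1)) (# 2704 :* (v0 :^ 3 :* (v2 :* ((v3 :* v4) :^ 1 :* (v5 :* v3 :* v6) :^ 1) :* v1 :^ 7))) refl (V π ∷ e ∷ horner r2 t ∷ P23 ∷ Q4 ∷ P2 ∷ Q6 ∷ [])))
  (tr (*-cong Γx2 (V-QR 1 1)) (solve (# 16 :* (v0 :^ 3 :* (v1 :^ 2 :* v2)) :* ((v3 :* v4 :* v1 :^ 2) :^ 1 :* (v5 :* v3 :* v6 :* v1 :^ 3) :^ 1)) (v0 :^ 3 :* (# 16 :* (v2 :* ((v3 :* v4) :^ 1 :* (v5 :* v3 :* v6) :^ 1)) :* v1 :^ 7)) refl (π ∷ e ∷ horner s2 t ∷ P23 ∷ Q4* ∷ P2 ∷ Q6* ∷ [])))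
  (to-horner r2 h2 (\ x -> (ι (+ 1) + ι (+ 13) * t) * (x * ((P23 * Q4) ^ 1 * (P2 * P23 * Q6) ^ 1))) (\ x -> x * (P2 * P23 ^ 3)) (\ e -> *ˡ (*ʳ e)) *ʳ
   (solve ((# 1 :+ # 13 :* τ) :* (hE r2 τ :* ((P23E τ :* Q4E τ) :^ 1 :* (P2E τ :* P23E τ :* Q6E τ) :^ 1))) (hE h2 τ :* (P2E τ :* P23E τ :^ 3)) refl (t ∷ [])))
  (to-horner s2 h2* (\ x -> ι (+ 51185893014090757) * ((ι (+ 1) + t) * (ι (+ 16) * (x * ((P23 * Q4*) ^ 1 * (P2 * P23 * Q6*) ^ 1))))) (\ x -> - (ι (+ 2704) * (x * (P2 * P23 ^ 3)))) (\ e -> *ˡ (*ˡ (*ˡ (*ʳ e)))) (\ e -> -‿cong (*ˡ (*ʳ e)))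
   (solve (# 51185893014090757 :* ((# 1 :+ τ) :* (# 16 :* (hE s2 τ :* ((P23E τ :* Q4*E τ) :^ 1 :* (P2E τ :* P23E τ :* Q6*E τ) :^ 1))))) (:- (# 2704 :* (hE h2* τ :* (P2E τ :* P23E τ :^ 3)))) refl (t ∷ [])))

 Z3 : ℒ (Γ∞ 3) (Γx 3) ~ 0#
 Z3 = vanish h3 h3* refl
  (solve (homE h3 (# 1) (# 13 :* τ)) (hE h3* τ) refl (t ∷ []))
  (agrees-horner 15 h3* (agrees-eval (v0 :^ 15 :* (hE h3* v1 :* v2)) (v ∷ t ∷ E ∷ []) (List.take 3 vT ∷ List.take 3 tT ∷ List.take 3 ET ∷ []) 3 (161455729898793330 ,, 97292803471480655 ,- 0 ,, []) (agrees-take 3 agrees-v ∷ agrees-take 3 agrees-t ∷ agrees-take 3 agrees-E ∷ []) refl))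
  (Γ∞ 3) (Γx 3) (Q ^ 2 * R ^ 0) (horner r3 t * ((P23 * Q4) ^ 2 * (P2 * P23 * Q6) ^ 0)) (ι (+ 64) * (horner s3 t * ((P23 * Q4*) ^ 2 * (P2 * P23 * Q6*) ^ 0))) (+ 140608)
  (regular-QR 2 0)
  (tr (*-cong Γ∞3 (*-cong (^-cong 2 Q≈) (^-cong 0 R≈))) (solve (# 140608 :* (v0 :^ 3 :* (v1 :^ 3 :* v2)) :* ((v3 :* v4 :* v1 :^ 2) :^ 2 :* (v5 :* v3 :* v6 :* v1 :^ 3) :^ 0)) (# 140608 :* (v0 :^ 3 :* (v2 :* ((v3 :* v4) :^ 2 :* (v5 :* v3 :* v6) :^ 0) :* v1 :^ 7))) refl (V π ∷ e ∷ horner r3 t ∷ P23 ∷ Q4 ∷ P2 ∷ Q6 ∷ [])))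
  (tr (*-cong Γx3 (V-QR 2 0)) (solve (# 64 :* (v0 :^ 3 :* (v1 :^ 3 :* v2)) :* ((v3 :* v4 :* v1 :^ 2) :^ 2 :* (v5 :* v3 :* v6 :* v1 :^ 3) :^ 0)) (v0 :^ 3 :* (# 64 :* (v2 :* ((v3 :* v4) :^ 2 :* (v5 :* v3 :* v6) :^ 0)) :* v1 :^ 7)) refl (π ∷ e ∷ horner s3 t ∷ P23 ∷ Q4* ∷ P2 ∷ Q6* ∷ [])))
  (to-horner r3 h3 (\ x -> (ι (+ 1) + ι (+ 13) * t) * (x * ((P23 * Q4) ^ 2 * (P2 * P23 * Q6) ^ 0))) (\ x -> x * (P2 * P23 ^ 3)) (\ e -> *ˡ (*ʳ e)) *ʳ
   (solve ((# 1 :+ # 13 :* τ) :* (hE r3 τ :* ((P23E τ :* Q4E τ) :^ 2 :* (P2E τ :* P23E τ :* Q6E τ) :^ 0))) (hE h3 τ :* (P2E τ :* P23E τ :^ 3)) refl (t ∷ [])))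
  (to-horner s3 h3* (\ x -> ι (+ 51185893014090757) * ((ι (+ 1) + t) * (ι (+ 64) * (x * ((P23 * Q4*) ^ 2 * (P2 * P23 * Q6*) ^ 0))))) (\ x -> - (ι (+ 140608) * (x * (P2 * P23 ^ 3)))) (\ e -> *ˡ (*ˡ (*ˡ (*ʳ e)))) (\ e -> -‿cong (*ˡ (*ʳ e)))
   (solve (# 51185893014090757 :* ((# 1 :+ τ) :* (# 64 :* (hE s3 τ :* ((P23E τ :* Q4*E τ) :^ 2 :* (P2E τ :* P23E τ :* Q6*E τ) :^ 0))))) (:- (# 140608 :* (hE h3* τ :* (P2E τ :* P23E τ :^ 3)))) refl (t ∷ [])))

 Z4 : ℒ (Γ∞ 4) (Γx 4) ~ 0#
 Z4 = vanish h4 h4* refl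
  (solve (homE h4 (# 1) (# 13 :* τ)) (hE h4* τ) refl (t ∷ []))
  (agrees-horner 15 h4* (agrees-eval (v0 :^ 15 :* (hE h4* v1 :* v2)) (v ∷ t ∷ E ∷ []) (List.take 3 vT ∷ List.take 3 tT ∷ List.take 3 ET ∷ []) 3 (596144233472467679 ,- 314330595830937504 ,, 0 ,, []) (agrees-take 3 agrees-v ∷ agrees-take 3 agrees-t ∷ agrees-take 3 agrees-E ∷ []) refl))
  (Γ∞ 4) (Γx 4) (Q ^ 0 * R ^ 1) (horner r4 t * ((P23 * Q4) ^ 0 * (P2 * P23 * Q6) ^ 1)) (ι (+ 256) * (horner s4 t * ((P23 * Q4*) ^ 0 * (P2 * P23 * Q6*) ^ 1))) (+ 7311616)
  (regular-QR 0 1)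
  (tr (*-cong Γ∞4 (*-cong (^-cong 0 Q≈) (^-cong 1 R≈))) (solve (# 7311616 :* (v0 :^ 3 :* (v1 :^ 4 :* v2)) :* ((v3 :* v4 :* v1 :^ 2) :^ 0 :* (v5 :* v3 :* v6 :* v1 :^ 3) :^ 1)) (# 7311616 :* (v0 :^ 3 :* (v2 :* ((v3 :* v4) :^ 0 :* (v5 :* v3 :* v6) :^ 1) :* v1 :^ 7))) refl (V π ∷ e ∷ horner r4 t ∷ P23 ∷ Q4 ∷ P2 ∷ Q6 ∷ [])))
  (tr (*-cong Γx4 (V-QR 0 1)) (solve (# 256 :* (v0 :^ 3 :* (v1 :^ 4 :* v2)) :* ((v3 :* v4 :* v1 :^ 2) :^ 0 :* (v5 :* v3 :* v6 :* v1 :^ 3) :^ 1)) (v0 :^ 3 :* (# 256 :* (v2 :* ((v3 :* v4) :^ 0 :* (v5 :* v3 :* v6) :^ 1)) :* v1 :^ 7)) refl (π ∷ e ∷ horner s4 t ∷ P23 ∷ Q4* ∷ P2 ∷ Q6* ∷ [])))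
  (to-horner r4 h4 (\ x -> (ι (+ 1) + ι (+ 13) * t) * (x * ((P23 * Q4) ^ 0 * (P2 * P23 * Q6) ^ 1))) (\ x -> x * (P2 * P23 ^ 3)) (\ e -> *ˡ (*ʳ e)) *ʳ
   (solve ((# 1 :+ # 13 :* τ) :* (hE r4 τ :* ((P23E τ :* Q4E τ) :^ 0 :* (P2E τ :* P23E τ :* Q6E τ) :^ 1))) (hE h4 τ :* (P2E τ :* P23E τ :^ 3)) refl (t ∷ [])))
  (to-horner s4 h4* (\ x -> ι (+ 51185893014090757) * ((ι (+ 1) + t) * (ι (+ 256) * (x * ((P23 * Q4*) ^ 0 * (P2 * P23 * Q6*) ^ 1))))) (\ x -> - (ι (+ 7311616) * (x * (P2 * P23 ^ 3)))) (\ e -> *ˡ (*ˡ (*ˡ (*ʳ e)))) (\ e -> -‿cong (*ˡ (*ʳ e)))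
   (solve (# 51185893014090757 :* ((# 1 :+ τ) :* (# 256 :* (hE s4 τ :* ((P23E τ :* Q4*E τ) :^ 0 :* (P2E τ :* P23E τ :* Q6*E τ) :^ 1))))) (:- (# 7311616 :* (hE h4* τ :* (P2E τ :* P23E τ :^ 3)))) refl (t ∷ [])))

 Z5 : ℒ (Γ∞ 5) (Γx 5) ~ 0#
 Z5 = vanish h5 h5* refl
  (solve (homE h5 (# 1) (# 13 :* τ)) (hE h5* τ) refl (t ∷ []))
  (agrees-horner 15 h5* (agrees-eval (v0 :^ 15 :* (hE h5* v1 :* v2)) (v ∷ t ∷ E ∷ []) (List.take 3 vT ∷ List.take 3 tT ∷ List.take 3 ET ∷ []) 3 (2797292172447732960 ,, 1329860213130889439 ,- 0 ,, []) (agrees-take 3 agrees-v ∷ agrees-take 3 agrees-t ∷ agrees-take 3 agrees-E ∷ []) refl))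
  (Γ∞ 5) (Γx 5) (Q ^ 1 * R ^ 0) (horner r5 t * ((P23 * Q4) ^ 1 * (P2 * P23 * Q6) ^ 0)) (ι (+ 1024) * (horner s5 t * ((P23 * Q4*) ^ 1 * (P2 * P23 * Q6*) ^ 0))) (+ 380204032)
  (regular-QR 1 0)
  (tr (*-cong Γ∞5 (*-cong (^-cong 1 Q≈) (^-cong 0 R≈))) (solve (# 380204032 :* (v0 :^ 3 :* (v1 :^ 5 :* v2)) :* ((v3 :* v4 :* v1 :^ 2) :^ 1 :* (v5 :* v3 :* v6 :* v1 :^ 3) :^ 0)) (# 380204032 :* (v0 :^ 3 :* (v2 :* ((v3 :* v4) :^ 1 :* (v5 :* v3 :* v6) :^ 0) :* v1 :^ 7))) refl (V π ∷ e ∷ horner r5 t ∷ P23 ∷ Q4 ∷ P2 ∷ Q6 ∷ [])))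
  (tr (*-cong Γx5 (V-QR 1 0)) (solve (# 1024 :* (v0 :^ 3 :* (v1 :^ 5 :* v2)) :* ((v3 :* v4 :* v1 :^ 2) :^ 1 :* (v5 :* v3 :* v6 :* v1 :^ 3) :^ 0)) (v0 :^ 3 :* (# 1024 :* (v2 :* ((v3 :* v4) :^ 1 :* (v5 :* v3 :* v6) :^ 0)) :* v1 :^ 7)) refl (π ∷ e ∷ horner s5 t ∷ P23 ∷ Q4* ∷ P2 ∷ Q6* ∷ [])))
  (to-horner r5 h5 (\ x -> (ι (+ 1) + ι (+ 13) * t) * (x * ((P23 * Q4) ^ 1 * (P2 * P23 * Q6) ^ 0))) (\ x -> x * (P2 * P23 ^ 3)) (\ e -> *ˡ (*ʳ e)) *ʳ
   (solve ((# 1 :+ # 13 :* τ) :* (hE r5 τ :* ((P23E τ :* Q4E τ) :^ 1 :* (P2E τ :* P23E τ :* Q6E τ) :^ 0))) (hE h5 τ :* (P2E τ :* P23E τ :^ 3)) refl (t ∷ [])))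
  (to-horner s5 h5* (\ x -> ι (+ 51185893014090757) * ((ι (+ 1) + t) * (ι (+ 1024) * (x * ((P23 * Q4*) ^ 1 * (P2 * P23 * Q6*) ^ 0))))) (\ x -> - (ι (+ 380204032) * (x * (P2 * P23 ^ 3)))) (\ e -> *ˡ (*ˡ (*ˡ (*ʳ e)))) (\ e -> -‿cong (*ˡ (*ʳ e)))
   (solve (# 51185893014090757 :* ((# 1 :+ τ) :* (# 1024 :* (hE s5 τ :* ((P23E τ :* Q4*E τ) :^ 1 :* (P2E τ :* P23E τ :* Q6*E τ) :^ 0))))) (:- (# 380204032 :* (hE h5* τ :* (P2E τ :* P23E τ :^ 3)))) refl (t ∷ [])))

M0 M0* : Ser
M0 = Q4 ^ 2 * Q6
M0* = Q4* ^ 2 * Q6*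

opaque
 X6M0 : X6 * (M0 * E) ~ Q ^ 2 * R ^ 1
 X6M0 = tr (*ˡ {X6} (*ˡ {M0} (sy P23*e))) (tr (solve (v0 :* v1 :^ 2 :* v2 :^ 6 :* (v3 :^ 2 :* v4 :* (v1 :* v2))) ((v1 :* v3 :* v2 :^ 2) :^ 2 :* (v0 :* v1 :* v4 :* v2 :^ 3) :^ 1) refl (P2 ∷ P23 ∷ e ∷ Q4 ∷ Q6 ∷ []))
  (*-cong (^-cong 2 (sy Q≈)) (^-cong 1 (sy R≈))))

 X6M0* : X6 * (M0* * E) ~ V (Q ^ 2 * R ^ 1)
 X6M0* = tr (*ˡ {X6} (*ˡ {M0*} (sy P23*e))) (tr (solve (v0 :* v1 :^ 2 :* v2 :^ 6 :* (v3 :^ 2 :* v4 :* (v1 :* v2))) ((v1 :* v3 :* v2 :^ 2) :^ 2 :* (v0 :* v1 :* v4 :* v2 :^ 3) :^ 1) refl (P2 ∷ P23 ∷ e ∷ Q4* ∷ Q6* ∷ []))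
  (sy (V-QR 2 1)))

 h6-star : hom h6 1# 13t ~ horner h6* t
 h6-star = hom-star h6 h6* (solve (homE h6 (# 1) (# 13 :* τ)) (hE h6* τ) refl (t ∷ []))

 h6-low : Agrees (v ^ 28 * (horner h6* t * E)) (23278226591593974319391323322957281556159 ,- 10169398059065865608737193086590996727680 ,, 0 ,, 43129461674255094240853968724884681769919 ,- 49495883656650191740699583795689851213119 ,- 109161165372366249090136360677970699153919 ,- 95544851435129547371854625263832205494639 ,- 197871958158868069377749494506260757552959 ,- 206578673111522101098451465279087974555839 ,- 336526346899014729278842224088460029228319 ,- 436034741386438779729669216997072964108639 ,- 624004522438373914689764876339449569306719 ,- 781067387524007842335900893416330077060239 ,- 1264163455564224571151466013625815234933919 ,- 1089952171427315163703804964101062494473679 ,- 4139021224937934439521815245720240026285120 ,, [])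
 h6-low = agrees-horner 28 h6* (agrees-eval (v0 :^ 28 :* (hE h6* v1 :* v2)) (v ∷ t ∷ E ∷ []) (vT ∷ tT ∷ ET ∷ []) 16 (23278226591593974319391323322957281556159 ,- 10169398059065865608737193086590996727680 ,, 0 ,, 43129461674255094240853968724884681769919 ,- 49495883656650191740699583795689851213119 ,- 109161165372366249090136360677970699153919 ,- 95544851435129547371854625263832205494639 ,- 197871958158868069377749494506260757552959 ,- 206578673111522101098451465279087974555839 ,- 336526346899014729278842224088460029228319 ,- 436034741386438779729669216997072964108639 ,- 624004522438373914689764876339449569306719 ,- 781067387524007842335900893416330077060239 ,- 1264163455564224571151466013625815234933919 ,- 1089952171427315163703804964101062494473679 ,- 4139021224937934439521815245720240026285120 ,, []) (agrees-v ∷ agrees-t ∷ agrees-E ∷ []) refl)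

 h6-head : Agrees (v ^ 1 * (horner h6 t * E)) (266983110720 ,, [])
 h6-head = agrees-horner 1 h6 (agrees-eval (v0 :^ 1 :* (hE h6 v1 :* v2)) (v ∷ t ∷ E ∷ []) (List.take 1 vT ∷ List.take 1 tT ∷ List.take 1 ET ∷ []) 1 (266983110720 ,, []) (agrees-take 1 agrees-v ∷ agrees-take 1 agrees-t ∷ agrees-take 1 agrees-E ∷ []) refl)

-- One order of pole more than in `vanish`: p = 1 and r = 28, so off + r = 39 and M = 3.
module T6 = Trace h6 1 28 2 11 refl refl

opaque
 T6-zero : ι ((+ 13) Z.^ 28) * (q ^ 2 * (v ^ 1 * (horner h6 t * E))) - H 0 (q ^ 11 * (v ^ 28 * (hom h6 1# 13t * E))) ~ 0#
 T6-zero = T6.trace-zero small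
  where
  small : ∀ i -> i N.< 3 -> T6.trace i ≡ + 0
  small zero _ = T6.trace-value 0 (+ 0) (+ 0) (T6.upper-low 0 (s≤s z≤n)) (T6.lower-low 0 (s≤s z≤n))
  small (suc zero) _ = T6.trace-value 1 (+ 0) (+ 0) (T6.upper-low 1 (s≤s (s≤s z≤n))) (T6.lower-at 2 13 (horner h6* t) refl h6-star (agrees-nth h6-low 2 (NP.m≤m+n 3 13)))
  -- Here the two contributions are not zero separately: 13²⁸ times the constant term at infinity
  -- equals the coefficient 15 = 26 - 11 at the other cusp.
  small (2+ zero) _ = trans (T6.trace-value 2 (+ 266983110720) (+ 4139021224937934439521815245720240026285120) (T6.upper-at 0 2 refl (agrees-head h6-head)) (T6.lower-at 15 26 (horner h6* t) refl h6-star (agrees-nth h6-low 15 NP.≤-refl))) refl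
  small (3+ i) (s≤s (s≤s (s≤s ())))

 id∞ : (ι (+ 1) + ι (+ 13) * t) * (ι (+ 4826809) * (horner r6 t * ((P23 * Q4) ^ 2 * (P2 * P23 * Q6) ^ 1))) ~ (horner h6 t + ι (+ 24942297600) * M0) * (P2 * P23 ^ 3 * (P2 * P23 ^ 2))
 id∞ = (to-horner r6 h6 (\ x -> (ι (+ 1) + ι (+ 13) * t) * (ι (+ 4826809) * (x * ((P23 * Q4) ^ 2 * (P2 * P23 * Q6) ^ 1)))) (\ x -> (x + ι (+ 24942297600) * M0) * (P2 * P23 ^ 3 * (P2 * P23 ^ 2))) (\ e -> *ˡ (*ˡ (*ʳ e))) (\ e -> *ʳ (+ʳ e))
     (solve ((# 1 :+ # 13 :* τ) :* (# 4826809 :* (hE r6 τ :* ((P23E τ :* Q4E τ) :^ 2 :* (P2E τ :* P23E τ :* Q6E τ) :^ 1)))) ((hE h6 τ :+ # 24942297600 :* (Q4E τ :^ 2 :* Q6E τ)) :* (P2E τ :* P23E τ :^ 3 :* (P2E τ :* P23E τ :^ 2))) refl (t ∷ [])))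

 idx : ι (+ 15502932802662396215269535105521) * ((ι (+ 1) + t) * (ι (+ 4826809) * (ι (+ 4096) * (horner s6 t * ((P23 * Q4*) ^ 2 * (P2 * P23 * Q6*) ^ 1))))) ~ - (ι (+ 19770609664) * ((horner h6* t - ι (+ 24942297600) * (ι (+ 201538126434611150798503956371773) * (t ^ 15 * M0*))) * (P2 * P23 ^ 3 * (P2 * P23 ^ 2))))
 idx = (to-horner s6 h6* (\ x -> ι (+ 15502932802662396215269535105521) * ((ι (+ 1) + t) * (ι (+ 4826809) * (ι (+ 4096) * (x * ((P23 * Q4*) ^ 2 * (P2 * P23 * Q6*) ^ 1)))))) (\ x -> - (ι (+ 19770609664) * ((x - ι (+ 24942297600) * (ι (+ 201538126434611150798503956371773) * (t ^ 15 * M0*))) * (P2 * P23 ^ 3 * (P2 * P23 ^ 2))))) (\ e -> *ˡ (*ˡ (*ˡ (*ˡ (*ʳ e))))) (\ e -> -‿cong (*ˡ (*ʳ (+ʳ e))))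
       (solve (# 15502932802662396215269535105521 :* ((# 1 :+ τ) :* (# 4826809 :* (# 4096 :* (hE s6 τ :* ((P23E τ :* Q4*E τ) :^ 2 :* (P2E τ :* P23E τ :* Q6*E τ) :^ 1))))))
       (:- (# 19770609664 :* ((hE h6* τ :- # 24942297600 :* (# 201538126434611150798503956371773 :* (τ :^ 15 :* (Q4*E τ :^ 2 :* Q6*E τ)))) :* (P2E τ :* P23E τ :^ 3 :* (P2E τ :* P23E τ :^ 2))))) refl (t ∷ [])))

 gather : ∀ (n c w a r S x S' y : Ser) -> n * (c * (w * (a * r))) * ((S * x) ^ 2 * (S' * y) ^ 1) ~ c * (w * (n * (r * (S ^ 2 * S' ^ 1)) * (a * x ^ 2 * y ^ 1)))
 gather n c w a r S x S' y = tr (solve (v0 :* (v1 :* (v2 :* (v3 :* v4))) :* (v5 :* v6)) (v1 :* (v2 :* (v0 :* v4 :* v3 :* (v5 :* v6)))) refl (n ∷ c ∷ w ∷ a ∷ r ∷ (S * x) ^ 2 ∷ (S' * y) ^ 1 ∷ []))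
  (*ˡ {c} (*ˡ {w} (solve (v0 :* v1 :* v2 :* ((v3 :* v4) :^ 2 :* (v5 :* v6) :^ 1)) (v0 :* (v1 :* (v3 :^ 2 :* v5 :^ 1)) :* (v2 :* v4 :^ 2 :* v6 :^ 1)) refl (n ∷ r ∷ a ∷ S ∷ x ∷ S' ∷ y ∷ []))))

 gather' : ∀ (n c w a r S x S' y : Ser) -> n * (c * (w * (a * r))) * ((S * x) ^ 2 * (S' * y) ^ 1) ~ w * (n * (c * (r * (S ^ 2 * S' ^ 1))) * (a * x ^ 2 * y ^ 1))
 gather' n c w a r S x S' y = tr (gather n c w a r S x S' y) (solve (v0 :* (v1 :* (v2 :* (v3 :* v4) :* v5))) (v1 :* (v2 :* (v0 :* (v3 :* v4)) :* v5)) refl (c ∷ w ∷ n ∷ r ∷ S ^ 2 * S' ^ 1 ∷ a * x ^ 2 * y ^ 1 ∷ []))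

 e¹³ : e ^ 6 * (e ^ 2) ^ 2 * (e ^ 3) ^ 1 ~ e ^ 7 * e ^ 6
 e¹³ = solve (v0 :^ 6 :* (v0 :^ 2) :^ 2 :* (v0 :^ 3) :^ 1) (v0 :^ 7 :* v0 :^ 6) refl (e ∷ [])

 lower-form : ∀ (g a y x x' s M E : Ser) -> x * x' ~ y -> g * (a * (y * (s * M * E))) ~ a * (s * x') * (x * g * (M * E))
 lower-form g a y x x' s M E h = tr (*ˡ {g} (*ˡ {a} (*ʳ {s * M * E} (sy h)))) (solve (v0 :* (v1 :* (v2 :* v3 :* (v4 :* v5 :* v6)))) (v1 :* (v4 :* v3) :* (v2 :* v0 :* (v5 :* v6))) refl (g ∷ a ∷ x ∷ x' ∷ s ∷ M ∷ E ∷ []))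

 V-q² : V (q ^ 2) ~ q ^ 26
 V-q² = tr (V13.V-^ q 2) (tr (^-cong 2 V-q) (tr (*ˡ {q ^ 13} (*-identityʳ (q ^ 13))) (power-+ q 13 13 26 refl)))

 split-form : ∀ (a y h M E : Ser) -> a * (y * ((h - ι (+ 24942297600) * (ι (+ 201538126434611150798503956371773) * M)) * E)) ~ a * (y * (h * E)) + ι (Z.- (+ 24942297600 Z.* + 201538126434611150798503956371773)) * (a * (y * (M * E)))
 split-form a y h M E = solve (v0 :* (v1 :* ((v2 :- # 24942297600 :* (# 201538126434611150798503956371773 :* v3)) :* v4))) (v0 :* (v1 :* (v2 :* v4)) :+ K (Z.- (+ 24942297600 Z.* + 201538126434611150798503956371773)) :* (v0 :* (v1 :* (v3 :* v4)))) refl (a ∷ y ∷ h ∷ M ∷ E ∷ [])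

 upper-form : ∀ (g a y Z : Ser) -> g * (a * (y ^ 1 * Z)) ~ a * (y * g * Z)
 upper-form g a y Z = solve (v0 :* (v1 :* (v2 :^ 1 :* v3))) (v1 :* (v2 :* v0 :* v3)) refl (g ∷ a ∷ y ∷ Z ∷ [])

 final-form : ∀ (g s F : Ser) -> ι (+ 19770609664) * (g * (ι (+ 24942297600) * (ι (+ 15502932802662396215269535105521) * (s * F)) - ι (Z.- (+ 24942297600 Z.* + 201538126434611150798503956371773)) * (s * F))) ~ F * (ι (+ 74829695578286078013428929473144712489) * (ι (+ 1430291113574400) * (s * g)))
 final-form g s F = solve (# 19770609664 :* (v0 :* (# 24942297600 :* (# 15502932802662396215269535105521 :* (v1 :* v2)) :- K (Z.- (+ 24942297600 Z.* + 201538126434611150798503956371773)) :* (v1 :* v2)))) (v2 :* (# 74829695578286078013428929473144712489 :* (# 1430291113574400 :* (v1 :* v0)))) refl (g ∷ s ∷ F ∷ [])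

 evaluate-algebra : ∀ (c N C n F s z h M E W Y L g g' g″ : Ser) -> g * g' ~ g″ -> N * (s * (z * (h * E))) - W ~ 0# -> g' * (s * (z * (M * E))) ~ F -> g' * Y ~ F -> L ~ W + n * Y ->
  c * (g″ * (N * (s * (z * ((h + C * M) * E))) - L)) ~ c * (g * (C * (N * F) - n * F))
 evaluate-algebra c N C n F s z h M E W Y L g g' g″ hg hz hM hY hL = *ˡ {c} (tr (*-cong (sy hg) (tr (+-cong (*ˡ {N} (solve (v0 :* (v1 :* ((v2 :+ v3 :* v4) :* v5))) (v0 :* (v1 :* (v2 :* v5)) :+ v3 :* (v0 :* (v1 :* (v4 :* v5)))) refl (s ∷ z ∷ h ∷ C ∷ M ∷ E ∷ []))) (-‿cong hL))
   (tr (solve (v0 :* (v1 :+ v2 :* v3) :- (v4 :+ v5 :* v6)) ((v0 :* v1 :- v4) :+ (v2 :* (v0 :* v3) :- v5 :* v6)) refl (N ∷ s * (z * (h * E)) ∷ C ∷ s * (z * (M * E)) ∷ W ∷ n ∷ Y ∷ [])) (tr (+ʳ hz) (+-identityˡ _)))))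
  (tr (solve (v0 :* v1 :* (v2 :* (v3 :* v4) :- v5 :* v6)) (v0 :* (v2 :* (v3 :* (v1 :* v4)) :- v5 :* (v1 :* v6))) refl (g ∷ g' ∷ C ∷ N ∷ s * (z * (M * E)) ∷ n ∷ Y ∷ []))
   (*ˡ {g} (+-cong (*ˡ {C} (*ˡ {N} hM)) (-‿cong (*ˡ {n} hY))))))

 -- Weight 14 - 2k is now 2, and level 1 has no such form. The multiplier is again Q²R, at the price
 -- of one more Δ in Φ = π⁵⁰ and of a part that is not a vanishing trace. That part is C =
 -- 24942297600 = 729·13!/182 times the preimage `M0` of Q²R; the two cusps contribute 13²⁸ and 13²⁹
 -- of it, in total 14·13²⁸. The other large numerals are 13⁶, 13³⁴ and 52⁶.
 Z6 : ℒ (Γ∞ 6) (Γx 6) ~ ι (+ 1430291113574400) * (q ^ 2 * π ^ 26)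
 Z6 = regular-cancel {ι (+ 74829695578286078013428929473144712489)} (regular-ι (+ 74829695578286078013428929473144712489) (\ ())) (regular-cancel {F} (regular-QR 2 1) (tr rearrange (tr transferred evaluate)))
  where
  F A B hh hm Y W : Ser
  F = Q ^ 2 * R ^ 1
  A = ι (+ 4826809) * (horner r6 t * ((P23 * Q4) ^ 2 * (P2 * P23 * Q6) ^ 1))
  B = ι (+ 4826809) * (ι (+ 4096) * (horner s6 t * ((P23 * Q4*) ^ 2 * (P2 * P23 * Q6*) ^ 1)))
  hh = horner h6 t + ι (+ 24942297600) * M0
  hm = hom h6 1# 13t - ι (+ 24942297600) * (ι (+ 201538126434611150798503956371773) * (t ^ 15 * M0*))
  rearrange : F * (ι (+ 74829695578286078013428929473144712489) * ℒ (Γ∞ 6) (Γx 6)) ~ ι (+ 15502932802662396215269535105521) * (F * ℒ (ι (+ 4826809) * Γ∞ 6) (ι (+ 4826809) * Γx 6))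
  rearrange = tr (solve (v0 :* (# 74829695578286078013428929473144712489 :* v1)) (# 15502932802662396215269535105521 :* (v0 :* (# 4826809 :* v1))) refl (F ∷ ℒ (Γ∞ 6) (Γx 6) ∷ []))
   (*ˡ {ι (+ 15502932802662396215269535105521)} (*ˡ {F} (tr (ℒ-* (ι (+ 4826809)) (Γ∞ 6) (Γx 6)) (ℒ-cong ≈-refl (*ʳ {Γx 6} (V13.V-ι (+ 4826809)))))))
  transferred : ι (+ 15502932802662396215269535105521) * (F * ℒ (ι (+ 4826809) * Γ∞ 6) (ι (+ 4826809) * Γx 6)) ~ ι (+ 19770609664) * (π ^ 50 * (ι (+ 15502932802662396215269535105521) * (q ^ 2 * (v ^ 1 * (hh * E))) - H 0 (q ^ 11 * (v ^ 28 * (hm * E)))))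
  transferred = transfer 1 28 F (ι (+ 4826809) * Γ∞ 6) (ι (+ 4826809) * Γx 6) A B (e ^ 7 * e ^ 6) (P2 * P23 ^ 3 * (P2 * P23 ^ 2)) (π ^ 50) hh hm (+ 19770609664) (+ 15502932802662396215269535105521) κ∞1 κx1
   (tr (*-cong (*ˡ {ι (+ 4826809)} Γ∞6) (*-cong (^-cong 2 Q≈) (^-cong 1 R≈))) (tr (gather (ι (+ 4826809)) (ι (+ 19770609664)) (V π ^ 3) (e ^ 6) (horner r6 t) (P23 * Q4) (e ^ 2) (P2 * P23 * Q6) (e ^ 3))
     (*ˡ {ι (+ 19770609664)} (*ˡ {V π ^ 3} (*ˡ {A} e¹³)))))
   (tr (*-cong (*ˡ {ι (+ 4826809)} Γx6) (V-QR 2 1)) (tr (gather' (ι (+ 4826809)) (ι (+ 4096)) (π ^ 3) (e ^ 6) (horner s6 t) (P23 * Q4*) (e ^ 2) (P2 * P23 * Q6*) (e ^ 3))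
     (*ˡ {π ^ 3} (*ˡ {B} e¹³))))
   id∞ (tr idx (-‿cong (*ˡ {ι (+ 19770609664)} (*ʳ {P2 * P23 ^ 3 * (P2 * P23 ^ 2)} (+ʳ (sy h6-star))))))
  Y = q ^ 11 * (v ^ 28 * (t ^ 15 * M0* * E))
  Vπ²⁴Y : V (π ^ 24) * Y ~ V (q ^ 2 * F)
  Vπ²⁴Y = tr (*ʳ {Y} (V13.V-^ π 24)) (tr (lower-form (V π ^ 24) (q ^ 11) (v ^ 28) (v ^ 13) (v ^ 15) (t ^ 15) M0* E (power-+ v 13 15 28 refl))
   (tr (*-cong (*ˡ {q ^ 11} (tv^ 15)) (tr (*ʳ {M0* * E} (sy X6≈V)) X6M0*))
     (tr (*ʳ {V F} (tr (power-+ q 11 15 26 refl) (sy V-q²))) (sy (V13.V-* (q ^ 2) F)))))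
  lowerM : π ^ 24 * H 0 Y ~ q ^ 2 * F
  lowerM = tr (H-scale (π ^ 24) Y) (tr (V13.H-cong 0 Vπ²⁴Y) (V13.H-V (q ^ 2 * F)))
  upperM : π ^ 24 * (q ^ 2 * (v ^ 1 * (M0 * E))) ~ q ^ 2 * F
  upperM = tr (upper-form (π ^ 24) (q ^ 2) v (M0 * E)) (*ˡ {q ^ 2} (tr (*ʳ {M0 * E} (sy X6≈)) X6M0))
  W = q ^ 11 * (v ^ 28 * (hom h6 1# 13t * E))
  split-lower : H 0 (q ^ 11 * (v ^ 28 * (hm * E))) ~ H 0 W + ι (Z.- (+ 24942297600 Z.* + 201538126434611150798503956371773)) * H 0 Y
  split-lower = tr (V13.H-cong 0 (split-form (q ^ 11) (v ^ 28) (hom h6 1# 13t) (t ^ 15 * M0*) E))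
   (tr (H-+ W (ι (Z.- (+ 24942297600 Z.* + 201538126434611150798503956371773)) * Y)) (+ˡ (sy (H-ι (Z.- (+ 24942297600 Z.* + 201538126434611150798503956371773)) Y))))
  evaluate : ι (+ 19770609664) * (π ^ 50 * (ι (+ 15502932802662396215269535105521) * (q ^ 2 * (v ^ 1 * (hh * E))) - H 0 (q ^ 11 * (v ^ 28 * (hm * E))))) ~ F * (ι (+ 74829695578286078013428929473144712489) * (ι (+ 1430291113574400) * (q ^ 2 * π ^ 26)))
  evaluate = tr (evaluate-algebra (ι (+ 19770609664)) (ι (+ 15502932802662396215269535105521)) (ι (+ 24942297600)) (ι (Z.- (+ 24942297600 Z.* + 201538126434611150798503956371773))) (q ^ 2 * F) (q ^ 2) (v ^ 1) (horner h6 t) M0 E (H 0 W) (H 0 Y) (H 0 (q ^ 11 * (v ^ 28 * (hm * E)))) (π ^ 26) (π ^ 24) (π ^ 50)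
     (power-+ π 26 24 50 refl) T6-zero upperM lowerM split-lower)
   (final-form (π ^ 26) (q ^ 2) F)

-- Vanishing moments

𝓐^ 𝓑^ : ℕ -> Ser -> Ser
𝓐^ zero f = f
𝓐^ (suc j) f = 𝓐^ j (𝓐 f)
𝓑^ zero f = f
𝓑^ (suc j) f = 𝓑^ j (𝓑 f)

ℒ^ : ℕ -> Ser -> Ser -> Ser
ℒ^ j a b = ℒ (𝓐^ j a) (𝓑^ j b)

private
 𝓐-cong : ∀ {f g} -> f ~ g -> 𝓐 f ~ 𝓐 g
 𝓐-cong h = +-cong (*ˡ {ι (+ 104)} (D-cong h)) (*ˡ {ι (+ 169)} h)

 𝓑-cong : ∀ {f g} -> f ~ g -> 𝓑 f ~ 𝓑 g
 𝓑-cong h = +-cong (*ˡ {ι (+ 8)} (D-cong h)) h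

 𝓐-+ : ∀ f g -> 𝓐 (f + g) ~ 𝓐 f + 𝓐 g
 𝓐-+ f g = tr (+ʳ (*ˡ {ι (+ 104)} (D-+ f g))) (solve (# 104 :* (v2 :+ v3) :+ # 169 :* (v0 :+ v1)) (# 104 :* v2 :+ # 169 :* v0 :+ (# 104 :* v3 :+ # 169 :* v1)) refl (f ∷ g ∷ D f ∷ D g ∷ []))

 𝓑-+ : ∀ f g -> 𝓑 (f + g) ~ 𝓑 f + 𝓑 g
 𝓑-+ f g = tr (+ʳ (*ˡ {ι (+ 8)} (D-+ f g))) (solve (# 8 :* (v2 :+ v3) :+ (v0 :+ v1)) (# 8 :* v2 :+ v0 :+ (# 8 :* v3 :+ v1)) refl (f ∷ g ∷ D f ∷ D g ∷ []))

 𝓐-* : ∀ p f -> 𝓐 (p * f) ~ p * 𝓐 f + ι (+ 104) * D p * f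
 𝓐-* p f = tr (+ʳ (*ˡ {ι (+ 104)} (D-* p f))) (solve (# 104 :* (v2 :* v1 :+ v0 :* v3) :+ # 169 :* (v0 :* v1)) (v0 :* (# 104 :* v3 :+ # 169 :* v1) :+ # 104 :* v2 :* v1) refl (p ∷ f ∷ D p ∷ D f ∷ []))

 𝓑-V* : ∀ p f -> 𝓑 (V p * f) ~ V p * 𝓑 f + V (ι (+ 104) * D p) * f
 𝓑-V* p f = tr (+ʳ (*ˡ {ι (+ 8)} (tr (D-* (V p) f) (+ʳ (*ʳ {f} (D-V p))))))
  (tr (solve (# 8 :* (# 13 :* v2 :* v1 :+ v0 :* v3) :+ v0 :* v1) (v0 :* (# 8 :* v3 :+ v1) :+ # 104 :* v2 :* v1) refl (V p ∷ f ∷ V (D p) ∷ D f ∷ []))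
   (+ˡ (*ʳ {f} (sy (tr (V13.V-* (ι (+ 104)) (D p)) (*ʳ {V (D p)} (V13.V-ι (+ 104))))))))

 𝓐^-cong : ∀ j {f g} -> f ~ g -> 𝓐^ j f ~ 𝓐^ j g
 𝓐^-cong zero h = h
 𝓐^-cong (suc j) h = 𝓐^-cong j (𝓐-cong h)

 𝓑^-cong : ∀ j {f g} -> f ~ g -> 𝓑^ j f ~ 𝓑^ j g
 𝓑^-cong zero h = h
 𝓑^-cong (suc j) h = 𝓑^-cong j (𝓑-cong h)

 𝓐^-+ : ∀ j f g -> 𝓐^ j (f + g) ~ 𝓐^ j f + 𝓐^ j g
 𝓐^-+ zero f g = ≈-refl
 𝓐^-+ (suc j) f g = tr (𝓐^-cong j (𝓐-+ f g)) (𝓐^-+ j (𝓐 f) (𝓐 g))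

 𝓑^-+ : ∀ j f g -> 𝓑^ j (f + g) ~ 𝓑^ j f + 𝓑^ j g
 𝓑^-+ zero f g = ≈-refl
 𝓑^-+ (suc j) f g = tr (𝓑^-cong j (𝓑-+ f g)) (𝓑^-+ j (𝓑 f) (𝓑 g))

 ℒ^-cong : ∀ j {a a' b b'} -> a ~ a' -> b ~ b' -> ℒ^ j a b ~ ℒ^ j a' b'
 ℒ^-cong j h k = ℒ-cong (𝓐^-cong j h) (𝓑^-cong j k)

 ℒ^-+ : ∀ j a a' b b' -> ℒ^ j (a + a') (b + b') ~ ℒ^ j a b + ℒ^ j a' b'
 ℒ^-+ j a a' b b' = tr (ℒ-cong (𝓐^-+ j a a') (𝓑^-+ j b b')) (ℒ-+ (𝓐^ j a) (𝓐^ j a') (𝓑^ j b) (𝓑^ j b'))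

 -- Leibniz: each operator replaces the multiplier p by p or by 104 D p. The pair (p, V p) is
 -- preserved because D (V p) = 13 V (D p) and 8·13 = 104.
 annihilate : ∀ j a b -> (∀ i -> i N.≤ j -> ℒ^ i a b ~ 0#) -> ∀ p -> ℒ^ j (p * a) (V p * b) ~ 0#
 annihilate zero a b h p = tr (sy (ℒ-* p a b)) (tr (*ˡ {p} (h 0 z≤n)) (zeroʳ p))
 annihilate (suc j) a b h p = tr (ℒ^-cong j (𝓐-* p a) (𝓑-V* p b)) (tr (ℒ^-+ j (p * 𝓐 a) (ι (+ 104) * D p * a) (V p * 𝓑 b) (V (ι (+ 104) * D p) * b))
  (tr (+-cong (annihilate j (𝓐 a) (𝓑 b) (\ i l -> h (suc i) (s≤s l)) p) (annihilate j a b (\ i l -> h i (NP.m≤n⇒m≤1+n l)) (ι (+ 104) * D p))) (+-identityʳ 0#)))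

 𝓐^-ι : ∀ j c f -> 𝓐^ j (ι c * f) ~ ι c * 𝓐^ j f
 𝓐^-ι zero c f = ≈-refl
 𝓐^-ι (suc j) c f = tr (𝓐^-cong j (tr (+ʳ (*ˡ {ι (+ 104)} (D-ι* c f))) (solve (# 104 :* (v0 :* v1) :+ # 169 :* (v0 :* v2)) (v0 :* (# 104 :* v1 :+ # 169 :* v2)) refl (ι c ∷ D f ∷ f ∷ [])))) (𝓐^-ι j c (𝓐 f))

 𝓑^-ι : ∀ j c f -> 𝓑^ j (ι c * f) ~ ι c * 𝓑^ j f
 𝓑^-ι zero c f = ≈-refl
 𝓑^-ι (suc j) c f = tr (𝓑^-cong j (tr (+ʳ (*ˡ {ι (+ 8)} (D-ι* c f))) (solve (# 8 :* (v0 :* v1) :+ (v0 :* v2)) (v0 :* (# 8 :* v1 :+ v2)) refl (ι c ∷ D f ∷ f ∷ [])))) (𝓑^-ι j c (𝓑 f))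

 ℒ^-ι : ∀ j c a b -> ℒ^ j (ι c * a) (ι c * b) ~ ι c * ℒ^ j a b
 ℒ^-ι j c a b = tr (ℒ-cong (𝓐^-ι j c a) (tr (𝓑^-ι j c b) (*ʳ {𝓑^ j b} (sy (V13.V-ι c))))) (sy (ℒ-* (ι c) (𝓐^ j a) (𝓑^ j b)))

 -- The correction by `P` in the Serre derivative, which is `V P` at the other cusp, is removed by
 -- `annihilate`. An iterate of the operators is thus exchanged for a Serre derivative at the cost
 -- of a factor 3.
 raise : ∀ j k -> (∀ i -> i N.≤ j -> ℒ^ i (Γ∞ k) (Γx k) ~ 0#) -> ℒ^ j (Γ∞ (suc k)) (Γx (suc k)) ~ ι (+ 3) * ℒ^ (suc j) (Γ∞ k) (Γx k)
 raise j k h = tr (ℒ^-cong j (tr (Γ∞-suc k) (+ˡ (lem c P (Γ∞ k)))) (tr (Γx-suc k) (+ˡ (tr (lem c (V P) (Γx k)) (*ʳ {Γx k} (sy (tr (V13.V-neg (ι c * P)) (-‿cong (tr (V13.V-* (ι c) P) (*ʳ {V P} (V13.V-ι c)))))))))))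
  (tr (ℒ^-+ j (ι (+ 3) * 𝓐 (Γ∞ k)) (- (ι c * P) * Γ∞ k) (ι (+ 3) * 𝓑 (Γx k)) (V (- (ι c * P)) * Γx k))
   (tr (+-cong (ℒ^-ι j (+ 3) (𝓐 (Γ∞ k)) (𝓑 (Γx k))) (annihilate j (Γ∞ k) (Γx k) h (- (ι c * P)))) (+-identityʳ _)))
  where
  c = + (39 N.+ 52 N.* k)
  lem : ∀ c p g -> - (ι c * (p * g)) ~ - (ι c * p) * g
  lem c p g = solve (:- (v0 :* (v1 :* v2))) ((:- (v0 :* v1)) :* v2) refl (ι c ∷ p ∷ g ∷ [])

 level-zero : ∀ k -> k N.≤ 5 -> ℒ (Γ∞ k) (Γx k) ~ 0#
 level-zero 0 l = Z0
 level-zero 1 l = Z1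
 level-zero 2 l = Z2
 level-zero 3 l = Z3
 level-zero 4 l = Z4
 level-zero 5 l = Z5
 level-zero (4+ (2+ k)) (s≤s (s≤s (s≤s (s≤s (s≤s ())))))

 iterated-zero : ∀ n j k -> j N.≤ n -> k N.+ j N.≤ 5 -> ℒ^ j (Γ∞ k) (Γx k) ~ 0#
 iterated-zero n zero k l h = level-zero k (subst (N._≤ 5) (NP.+-identityʳ k) h)
 iterated-zero (suc n) (suc j) k (s≤s l) h = regular-ι (+ 3) (\ ()) (ℒ^ (suc j) (Γ∞ k) (Γx k))
  (tr (sy (raise j k (\ i l' -> iterated-zero n i k (NP.≤-trans l' l) (NP.≤-trans (NP.+-monoʳ-≤ k (NP.≤-trans l' (NP.n≤1+n j))) h))))
   (iterated-zero n j (suc k) l (subst (N._≤ 5) (NP.+-suc k j) h)))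

 climb : ∀ j k -> k N.+ j ≡ 6 -> ι ((+ 3) Z.^ j) * ℒ^ j (Γ∞ k) (Γx k) ~ ℒ (Γ∞ 6) (Γx 6)
 climb zero k e = tr (*ʳ {ℒ (Γ∞ k) (Γx k)} ι-1) (tr (*-identityˡ _) (reflexive (cong (\ k -> ℒ (Γ∞ k) (Γx k)) (trans (sym (NP.+-identityʳ k)) e))))
 climb (suc j) k e = tr (*ʳ {ℒ^ (suc j) (Γ∞ k) (Γx k)} (tr (reflexive (cong ι (ZP.*-comm (+ 3) ((+ 3) Z.^ j)))) (ι-* ((+ 3) Z.^ j) (+ 3))))
  (tr (*-assoc (ι ((+ 3) Z.^ j)) (ι (+ 3)) (ℒ^ (suc j) (Γ∞ k) (Γx k))) (tr (*ˡ {ι ((+ 3) Z.^ j)} (sy (raise j k \ i l -> iterated-zero 5 i k (NP.≤-trans (NP.m≤n+m i k) (small i l)) (small i l)))) (climb j (suc k) (trans (sym (NP.+-suc k j)) e))))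
  where
  small : ∀ i -> i N.≤ j -> k N.+ i N.≤ 5
  small i l = NP.≤-trans (NP.+-monoʳ-≤ k l) (NP.≤-reflexive (NP.suc-injective (trans (sym (NP.+-suc k j)) e)))

moment-zero : ∀ j -> j N.≤ 5 -> ℒ^ j (V π ^ 3) (π ^ 3) ~ 0#
moment-zero j l = tr (ℒ^-cong j (sy Γ∞-zero) (sy Γx-zero)) (iterated-zero 5 j 0 l l)

-- 729 = 3⁶, one factor 3 for each step of `climb`.
moment-six : ι (+ 729) * ℒ^ 6 (V π ^ 3) (π ^ 3) ~ ι (+ 1430291113574400) * (q ^ 2 * π ^ 26)
moment-six = tr (*ˡ {ι (+ 729)} (ℒ^-cong 6 (sy Γ∞-zero) (sy Γx-zero))) (tr (climb 6 0 refl) Z6)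

-- The sum of the roots of a monic polynomial with separated roots.
-- Coefficients are listed in descending order, the leading one excepted.
module Vieta (R : CommutativeRing 0ℓ 0ℓ) where

 module W = RingTheory R
 open W using (C)

 ev : List C -> C -> C -> C
 ev [] a x = a
 ev (c ∷ cs) a x = ev cs (a W.* x W.+ c) x

 partials : List C -> C -> C -> List C
 partials [] bᵒ y = []
 partials (c ∷ cs) bᵒ y = bᵒ ∷ partials cs (bᵒ W.* y W.+ c) y

 length-partials : ∀ cs bᵒ y -> length (partials cs bᵒ y) ≡ length cs
 length-partials [] bᵒ y = refl
 length-partials (c ∷ cs) bᵒ y = cong suc (length-partials cs (bᵒ W.* y W.+ c) y)

 ev-cong : ∀ cs {a a'} x -> a W.≈ a' -> ev cs a x W.≈ ev cs a' x
 ev-cong [] x h = h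
 ev-cong (c ∷ cs) x h = ev-cong cs x (W.+ʳ (W.*ʳ h))

 -- Horner's scheme run at x and at y side by side; A = (x - y) B + bᵒ is an invariant, and the
 -- intermediate values at y are the coefficients of the quotient.
 division : ∀ cs x y {A B bᵒ} -> A W.≈ (x W.- y) W.* B W.+ bᵒ -> ev cs A x W.≈ (x W.- y) W.* ev (partials cs bᵒ y) B x W.+ ev cs bᵒ y
 division [] x y h = h
 division (c ∷ cs) x y {A} {B} {bᵒ} h = division cs x y {A W.* x W.+ c} {B W.* x W.+ bᵒ} {bᵒ W.* y W.+ c}
  (W.tr (W.+ʳ (W.*ʳ h)) (W.solve (((v0 :- v1) :* v2 :+ v3) :* v0 :+ v4) ((v0 :- v1) :* (v2 :* v0 :+ v3) :+ (v3 :* v1 :+ v4)) refl (x ∷ y ∷ B ∷ bᵒ ∷ c ∷ [])))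

 Forall : (C -> Set) -> List C -> Set
 Forall A [] = ⊤
 Forall A (y ∷ ys) = A y × Forall A ys

 Forall-zip : ∀ {A B D : C -> Set} -> (∀ x -> A x -> B x -> D x) -> ∀ ys -> Forall A ys -> Forall B ys -> Forall D ys
 Forall-zip f [] _ _ = tt
 Forall-zip f (y ∷ ys) (a , as) (bᵒ , bs) = f y a bᵒ , Forall-zip f ys as bs

 Regularᵂ : C -> Set
 Regularᵂ f = ∀ g -> f W.* g W.≈ W.0# -> g W.≈ W.0#

 Separated : List C -> Set
 Separated [] = ⊤
 Separated (y ∷ ys) = Forall (\ x -> Regularᵂ (x W.- y)) ys × Separated ys

 sumL : List C -> C
 sumL [] = W.0#
 sumL (y ∷ ys) = y W.+ sumL ys

 -- The first root y is divided out, which adds y to the second coefficient. Separation makes the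
 -- remaining roots roots of the quotient.
 vieta : ∀ c cs ys -> length ys ≡ suc (length cs) -> Separated ys -> Forall (\ y -> ev (c ∷ cs) W.1# y W.≈ W.0#) ys -> c W.+ sumL ys W.≈ W.0#
 vieta c [] (y ∷ []) l s (h , _) = W.tr (W.+ˡ (W.+-identityʳ y)) (W.tr (W.+-comm c y) (W.tr (W.+ʳ (W.sy (W.*-identityˡ y))) h))
 vieta c (c' ∷ cs) (y ∷ ys) l (sep , s) (h , hs) = W.tr (W.sy (W.+-assoc c y (sumL ys))) (W.tr (W.+ʳ (W.tr (W.+-comm c y) (W.+ʳ (W.sy (W.*-identityˡ y)))))
  (vieta bᵒ (partials cs (bᵒ W.* y W.+ c') y) ys (trans (NP.suc-injective l) (cong suc (sym (length-partials cs (bᵒ W.* y W.+ c') y)))) s (Forall-zip quotient ys sep hs)))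
  where
  bᵒ = W.1# W.* y W.+ c
  initialᵒ : ∀ x -> W.1# W.≈ (x W.- y) W.* W.0# W.+ W.1#
  initialᵒ x = W.sy (W.tr (W.+ʳ (W.zeroʳ (x W.- y))) (W.+-identityˡ W.1#))
  quotient : ∀ x -> Regularᵂ (x W.- y) -> ev (c ∷ c' ∷ cs) W.1# x W.≈ W.0# -> ev (partials (c' ∷ cs) bᵒ y) W.1# x W.≈ W.0#
  quotient x reg hx = W.tr (ev-cong (partials (c' ∷ cs) bᵒ y) x (W.sy (W.tr (W.+ʳ (W.zeroˡ x)) (W.+-identityˡ W.1#))))
   (reg (ev (partials (c ∷ c' ∷ cs) W.1# y) W.0# x) (W.tr (W.sy (W.+-identityʳ _)) (W.tr (W.+ˡ (W.sy h)) (W.tr (W.sy (division (c ∷ c' ∷ cs) x y {W.1#} {W.0#} {W.1#} (initialᵒ x))) hx))))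

-- Twelve conjugates: power series over ℤ[ζ13], tested by the 13-periodic
-- functions of sum zero.

allB : ℕ -> (ℕ -> Bool) -> Bool
allB zero F = true
allB (suc n) F = F n ∧ allB n F

allB-sound : ∀ n F -> allB n F ≡ true -> ∀ k -> k N.< n -> F k ≡ true
allB-sound (suc n) F h k l with F n in eq | NP.m≤n⇒m<n∨m≡n l
... | true | inj₁ (s≤s l') = allB-sound n F h k l'
... | true | inj₂ refl = eq

isZero-sound : ∀ i -> isZero 0 i ≡ true -> i ≡ + 0
isZero-sound (+ zero) h = refl

sumN : ℕ -> (ℕ -> ℤ) -> ℤ
sumN zero f = + 0
sumN (suc n) f = f n Z.+ sumN n f

sumN-cong : ∀ n {f g : ℕ -> ℤ} -> (∀ i -> f i ≡ g i) -> sumN n f ≡ sumN n g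
sumN-cong zero h = refl
sumN-cong (suc n) h = cong₂ Z._+_ (h n) (sumN-cong n h)

sumN-const : ∀ n c -> sumN n (\ _ -> c) ≡ + n Z.* c
sumN-const zero c = sym (ZP.*-zeroˡ c)
sumN-const (suc n) c = trans (cong (\ z -> c Z.+ z) (sumN-const n c)) (lem (+ n) c)
 where
 lem : ∀ n c -> c Z.+ n Z.* c ≡ (+ 1 Z.+ n) Z.* c
 lem = solve-∀

Periodic : (ℤ -> ℤ) -> Set
Periodic φ = ∀ n -> φ (+ 13 Z.+ n) ≡ φ n

-- As 7(k + 1) is prime to 13, each condition says that the sum over all residues is zero. The steps
-- 7(k + 1) are those of the conjugates of a series with leading exponent 7.
Test : (ℤ -> ℤ) -> Set
Test φ = Periodic φ × (∀ k -> k N.< 12 -> ∀ n -> sumN 13 (\ i -> φ (+ (7 N.* suc k N.* i) Z.+ n)) ≡ + 0)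

private
 exchange : ∀ x y n -> x Z.+ (y Z.+ n) ≡ y Z.+ (x Z.+ n)
 exchange = solve-∀

Test-shift : ∀ φ -> Test φ -> ∀ k -> Test (\ n -> φ (k Z.+ n))
Test-shift φ (per , zer) x = (\ n -> trans (cong φ (exchange x (+ 13) n)) (per (x Z.+ n)))
 , \ k l n -> trans (sumN-cong 13 (\ i -> cong φ (exchange x (+ (7 N.* suc k N.* i)) n))) (zer k l (x Z.+ n))

module ζ = Moments Test Test-shift
module ζS = ζ.PSL

periodic-multiple : ∀ φ -> Periodic φ -> ∀ k -> φ (+ (k N.* 13)) ≡ φ (+ 0)
periodic-multiple φ per zero = refl
periodic-multiple φ per (suc k) = trans (per (+ (k N.* 13))) (periodic-multiple φ per k)

periodic-zero : ∀ (g : ℤ -> ℤ) -> Periodic g -> (∀ r -> r N.< 13 -> g (+ r) ≡ + 0) -> ∀ n -> g n ≡ + 0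
periodic-zero g per h (+ n) = go n
 where
 go : ∀ n -> g (+ n) ≡ + 0
 go n with n NP.<? 13
 ... | yes l = h n l
 go (8+ (4+ (suc n))) | no _ = trans (per (+ n)) (go n)
 go 0 | no ¬l = ⊥-elim (¬l (NP.m≤m+n 1 12))
 go 1 | no ¬l = ⊥-elim (¬l (NP.m≤m+n 2 11))
 go 2 | no ¬l = ⊥-elim (¬l (NP.m≤m+n 3 10))
 go 3 | no ¬l = ⊥-elim (¬l (NP.m≤m+n 4 9))
 go 4 | no ¬l = ⊥-elim (¬l (NP.m≤m+n 5 8))
 go 5 | no ¬l = ⊥-elim (¬l (NP.m≤m+n 6 7))
 go 6 | no ¬l = ⊥-elim (¬l (NP.m≤m+n 7 6))
 go 7 | no ¬l = ⊥-elim (¬l (NP.m≤m+n 8 5))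
 go 8 | no ¬l = ⊥-elim (¬l (NP.m≤m+n 9 4))
 go 9 | no ¬l = ⊥-elim (¬l (NP.m≤m+n 10 3))
 go 10 | no ¬l = ⊥-elim (¬l (NP.m≤m+n 11 2))
 go 11 | no ¬l = ⊥-elim (¬l (NP.m≤m+n 12 1))
 go 12 | no ¬l = ⊥-elim (¬l (NP.m≤m+n 13 0))
periodic-zero g per h -[1+ n ] = trans (sym (many (suc n) -[1+ n ])) (trans (cong g (lem (+ n))) (periodic-zero g per h (+ (12 N.+ n N.* 12))))
 where
 many : ∀ k n -> g (+ (k N.* 13) Z.+ n) ≡ g n
 many zero n = cong g (ZP.+-identityˡ n)
 many (suc k) n = trans (cong g (ZP.+-assoc (+ 13) (+ (k N.* 13)) n)) (trans (per (+ (k N.* 13) Z.+ n)) (many k n))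
 lem1 : ∀ n -> (+ 1 Z.+ n) Z.* + 13 Z.+ Z.- (+ 1 Z.+ n) ≡ + 12 Z.+ n Z.* + 12
 lem1 = solve-∀
 lem : ∀ _ -> + (suc n N.* 13) Z.+ -[1+ n ] ≡ + (12 N.+ n N.* 12)
 lem _ = trans (cong (Z._+ -[1+ n ]) (ZP.pos-* (suc n) 13)) (trans (lem1 (+ n)) (cong (\ z -> + 12 Z.+ z) (sym (ZP.pos-* n 12))))

residue-class : ℤ -> ℕ
residue-class (+ n) = n % 13
residue-class -[1+ n ] = 12 ∸ n % 13

-- The trace of ζⁿ from ℚ(ζ₁₃) to ℚ; it detects integers up to the factor 12.
φ0 : ℤ -> ℤ
φ0 n = value0 (residue-class n)
 where
 value0 : ℕ -> ℤ
 value0 zero = + 12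
 value0 (suc _) = Z.- + 1

φ0-periodic : Periodic φ0
φ0-periodic (+ n) = refl
φ0-periodic -[1+ 0 ] = refl
φ0-periodic -[1+ 1 ] = refl
φ0-periodic -[1+ 2 ] = refl
φ0-periodic -[1+ 3 ] = refl
φ0-periodic -[1+ 4 ] = refl
φ0-periodic -[1+ 5 ] = refl
φ0-periodic -[1+ 6 ] = refl
φ0-periodic -[1+ 7 ] = refl
φ0-periodic -[1+ 8 ] = refl
φ0-periodic -[1+ 9 ] = refl
φ0-periodic -[1+ 10 ] = refl
φ0-periodic -[1+ 11 ] = refl
φ0-periodic -[1+ 12 ] = refl
φ0-periodic -[1+ 8+ (4+ (suc n)) ] = refl

φ0-test : Test φ0
φ0-test = φ0-periodic , \ k l -> periodic-zero (total k) (\ n -> sumN-cong 13 (\ i -> trans (cong φ0 (exchange (+ (7 N.* suc k N.* i)) (+ 13) n)) (φ0-periodic (+ (7 N.* suc k N.* i) Z.+ n))))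
  (\ r l' -> isZero-sound (total k (+ r)) (allB-sound 13 (\ r -> isZero 0 (total k (+ r))) (allB-sound 12 (\ k -> allB 13 (\ r -> isZero 0 (total k (+ r)))) refl k l) r l'))
 where
 total : ℕ -> ℤ -> ℤ
 total k n = sumN 13 (\ i -> φ0 (+ (7 N.* suc k N.* i) Z.+ n))

-- The substitution of ζʲ q for q, the second component of a term being its exponent of ζ.
twist : ℕ -> Ser -> ζS.Ser
twist j f n = (f n , + (j N.* n)) ∷ []

private
 single : Ser -> (ℕ -> ℤ) -> ζS.Ser
 single f a n = (f n , a n) ∷ []

 moment2-single : ∀ (φ : ℤ -> ℤ) n (f g : Ser) (a b c : ℕ -> ℤ) -> (∀ i k -> a i Z.+ b k ≡ c (i N.+ k)) -> ζ.moment2 (\ x y -> φ (x Z.+ y)) (single f a) (single g b) n ≡ (f * g) n Z.* φ (c n)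
 moment2-single φ zero f g a b c h = trans (cong (\ z -> f 0 Z.* (g 0 Z.* φ z Z.+ + 0) Z.+ + 0) (h 0 0)) (lem (f 0) (g 0) (φ (c 0)))
  where
  lem : ∀ x y z -> x Z.* (y Z.* z Z.+ + 0) Z.+ + 0 ≡ x Z.* y Z.* z
  lem = solve-∀
 moment2-single φ (suc n) f g a b c h = trans (cong₂ Z._+_ (trans (cong (\ z -> f 0 Z.* (g (suc n) Z.* φ z Z.+ + 0) Z.+ + 0) (h 0 (suc n))) (lem (f 0) (g (suc n)) (φ (c (suc n)))))
   (moment2-single φ n (f ∘ suc) g (a ∘ suc) b (c ∘ suc) (\ i k -> h (suc i) k)))
  (sym (ZP.*-distribʳ-+ (φ (c (suc n))) (f 0 Z.* g (suc n)) (((f ∘ suc) * g) n)))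
  where
  lem : ∀ x y z -> x Z.* (y Z.* z Z.+ + 0) Z.+ + 0 ≡ x Z.* y Z.* z
  lem = solve-∀

twist-* : ∀ j f g -> twist j (f * g) ζS.~ twist j f ζS.* twist j g
twist-* j f g = ζS.mk \ n -> ζ.mk∼ \ φ _ -> trans (ZP.+-identityʳ ((f * g) n Z.* φ (+ (j N.* n)))) (sym (trans (ζ.moment-* φ (twist j f) (twist j g) n)
 (moment2-single φ n f g (\ i -> + (j N.* i)) (\ i -> + (j N.* i)) (\ i -> + (j N.* i)) (\ i k -> cong +_ (sym (NP.*-distribˡ-+ j i k))))))

twist-+ : ∀ j f g -> twist j (f + g) ζS.~ twist j f ζS.+ twist j g
twist-+ j f g = ζS.mk \ n -> ζ.mk∼ \ φ _ -> trans (cong (\ z -> z Z.* φ (+ (j N.* n)) Z.+ + 0) (+-at f g n)) (trans (lem (f n) (g n) (φ (+ (j N.* n))))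
 (sym (cong (\ p -> ζ.⟪ p , φ ⟫) (ζS.+-at (twist j f) (twist j g) n))))
 where
 lem : ∀ x y z -> (x Z.+ y) Z.* z Z.+ + 0 ≡ x Z.* z Z.+ (y Z.* z Z.+ + 0)
 lem = solve-∀

twist-cong : ∀ j {f g} -> f ~ g -> twist j f ζS.~ twist j g
twist-cong j h = ζS.mk \ n -> ζ.mk∼ \ φ _ -> cong (\ z -> z Z.* φ (+ (j N.* n)) Z.+ + 0) (at h n)

twist-1 : ∀ j -> twist j 1# ζS.~ ζS.1#
twist-1 j = ζS.mk \ { zero -> ζ.mk∼ \ φ _ -> cong (\ z -> + 1 Z.* φ (+ z) Z.+ + 0) (NP.*-zeroʳ j)
                ; (suc n) -> ζ.mk∼ \ φ _ -> trans (ZP.+-identityʳ _) (ZP.*-zeroˡ (φ (+ (j N.* suc n)))) }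

twist-0 : ∀ j -> twist j 0# ζS.~ ζS.0#
twist-0 j = ζS.mk \ n -> ζ.mk∼ \ φ _ -> trans (ZP.+-identityʳ _) (ZP.*-zeroˡ (φ (+ (j N.* n))))

twist-V : ∀ j f -> twist j (V f) ζS.~ twist 0 (V f)
twist-V j f = ζS.mk \ n -> ζ.mk∼ \ φ τ' -> cong (Z._+ + 0) (V13.V-elim (\ n -> V f n Z.* φ (+ (j N.* n)) ≡ V f n Z.* φ (+ 0))
 (\ i -> cong (V f (i N.* 13) Z.*_) (trans (cong (\ z -> φ (+ z)) (sym (NP.*-assoc j i 13))) (periodic-multiple φ (proj₁ τ') (j N.* i))))
 (\ r i l -> trans (cong (Z._* φ (+ (j N.* (suc r N.+ i N.* 13)))) (V13.V-other f r i l)) (trans (ZP.*-zeroˡ (φ (+ (j N.* (suc r N.+ i N.* 13))))) (sym (trans (cong (Z._* φ (+ 0)) (V13.V-other f r i l)) (ZP.*-zeroˡ (φ (+ 0))))))) n)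

-- Conjugates of a series with leading term x⁷ are separated.

private
 ⟪⟫-sumN : ∀ n a (ψ : ℕ -> ℤ -> ℤ) -> sumN n (\ i -> ζ.⟪ a , ψ i ⟫) ≡ ζ.⟪ a , (\ y -> sumN n (\ i -> ψ i y)) ⟫
 ⟪⟫-sumN zero a ψ = sym (ζ.⟪⟫-zero a)
 ⟪⟫-sumN (suc n) a ψ = trans (cong (\ z -> ζ.⟪ a , ψ n ⟫ Z.+ z) (⟪⟫-sumN n a ψ)) (sym (ζ.⟪⟫-+ a (ψ n) (\ y -> sumN n (\ i -> ψ i y))))

 -- If multiplication by ζᶜ fixes a, then 13 a is the sum of a ζ^(c i) over i < 13, which every test
 -- function sends to 0. So ζᶜ - 1 is regular.
 fixed-zero : ∀ k -> k N.< 12 -> ∀ a -> (∀ ψ -> Test ψ -> ζ.⟪ a , (\ y -> ψ (+ (7 N.* suc k) Z.+ y)) ⟫ ≡ ζ.⟪ a , ψ ⟫) -> ∀ ψ -> Test ψ -> ζ.⟪ a , ψ ⟫ ≡ + 0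
 fixed-zero k l a step ψ τ' = case ZP.i*j≡0⇒i≡0∨j≡0 (+ 13) thirteen of \ { (inj₂ z) -> z }
  where
  c = 7 N.* suc k
  iterate : ∀ n -> ζ.⟪ a , (\ y -> ψ (+ (c N.* n) Z.+ y)) ⟫ ≡ ζ.⟪ a , ψ ⟫
  iterate zero = ζ.⟪⟫-cong a (\ y -> cong ψ (trans (cong (\ z -> + z Z.+ y) (NP.*-zeroʳ c)) (ZP.+-identityˡ y)))
  iterate (suc n) = trans (ζ.⟪⟫-cong a (\ y -> cong ψ (trans (cong (\ z -> + z Z.+ y) (trans (NP.*-suc c n) (NP.+-comm c (c N.* n)))) (ZP.+-assoc (+ (c N.* n)) (+ c) y))))
   (trans (step (\ y -> ψ (+ (c N.* n) Z.+ y)) (Test-shift ψ τ' (+ (c N.* n)))) (iterate n))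
  thirteen : + 13 Z.* ζ.⟪ a , ψ ⟫ ≡ + 0
  thirteen = trans (sym (sumN-const 13 ζ.⟪ a , ψ ⟫)) (trans (sym (sumN-cong 13 {\ i -> ζ.⟪ a , (\ y -> ψ (+ (c N.* i) Z.+ y)) ⟫} iterate)) (trans (⟪⟫-sumN 13 a (\ i y -> ψ (+ (c N.* i) Z.+ y)))
   (trans (ζ.⟪⟫-cong a (\ y -> proj₂ τ' k l y)) (ζ.⟪⟫-zero a))))

 shifted : ∀ k F -> (∀ n -> n N.< k -> F n ζ.∼ []) -> F ζS.~ ζS.q ζS.^ k ζS.* (\ n -> F (k N.+ n))
 shifted k F low = ζS.mk \ n -> go n (n NP.<? k)
  where
  go : ∀ n -> Dec (n N.< k) -> F n ζ.∼ (ζS.q ζS.^ k ζS.* (\ n -> F (k N.+ n))) n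
  go n (yes l) = ζ.mk∼ \ φ τ' -> trans (ζ.test (low n l) φ τ') (sym (ζ.test (ζS.q^-low k (\ n -> F (k N.+ n)) n l) φ τ'))
  go n (no ¬l) = subst (\ i -> F i ζ.∼ (ζS.q ζS.^ k ζS.* (\ n -> F (k N.+ n))) i) (NP.m+[n∸m]≡n (NP.≮⇒≥ ¬l))
   (ζ.mk∼ \ φ τ' -> sym (ζ.test (ζS.q^-shift k (\ n -> F (k N.+ n)) (n ∸ k)) φ τ'))

module VZ = Vieta ζS.seriesRing
module VS = Vieta seriesRing

V-horner : ∀ p -> V (horner p t) ~ horner p (V t)
V-horner p = tr (V13.V-cong (reflexive (sym (⟦hornerE⟧ p v0 (t ∷ []))))) (tr (V13.V-⟦⟧ (hE p v0) (t ∷ [])) (reflexive (⟦hornerE⟧ p v0 (V t ∷ []))))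

module Conjugates (f : Ser) (low : ∀ n -> n N.< 7 -> f n ≡ + 0) (lead : f 7 ≡ + 1) where

 difference : ∀ j i n -> (twist j f ζS.- twist i f) n ≡ (f n , + (j N.* n)) ∷ (Z.- f n , + (i N.* n)) ∷ []
 difference j i n = trans (ζS.+-at (twist j f) (ζS.- twist i f) n) (cong (twist j f n ++_) (ζS.neg-at (twist i f) n))

 -- The leading coefficient, in degree 7, is ζ^(7 i) times ζ^(7(k + 1)) - 1, and the latter is
 -- regular by `fixed-zero`.
 separated : ∀ i k -> k N.< 12 -> ζS.Regular (twist (suc k N.+ i) f ζS.- twist i f)
 separated i k l g h = ζS.regular-* {ζS.q ζS.^ 7} {F7} (ζS.regular-q^ 7) (ζS.regular-head F7 headᵒ) g
   (ζS.tr (ζS.*ʳ {g} (ζS.sy (shifted 7 F below))) h)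
  where
  F F7 : ζS.Ser
  F = twist (suc k N.+ i) f ζS.- twist i f
  F7 n = F (7 N.+ n)
  pair-zero : ∀ x y -> + 0 Z.* x Z.+ ((Z.- + 0) Z.* y Z.+ + 0) ≡ + 0
  pair-zero = solve-∀
  below : ∀ n -> n N.< 7 -> F n ζ.∼ []
  below n l' = ζ.mk∼ \ φ _ -> trans (cong (\ p -> ζ.⟪ p , φ ⟫) (difference (suc k N.+ i) i n))
   (trans (cong (\ z -> z Z.* φ (+ ((suc k N.+ i) N.* n)) Z.+ ((Z.- z) Z.* φ (+ (i N.* n)) Z.+ + 0)) (low n l')) (pair-zero (φ (+ ((suc k N.+ i) N.* n))) (φ (+ (i N.* n)))))
  l1 : ∀ x y -> + 1 Z.* x Z.+ ((Z.- + 1) Z.* y Z.+ + 0) ≡ x Z.- y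
  l1 = solve-∀
  l2 : ∀ c i y -> Z.- i Z.+ ((c Z.+ i) Z.+ y) ≡ c Z.+ y
  l2 = solve-∀
  l3 : ∀ i y -> Z.- i Z.+ (i Z.+ y) ≡ y
  l3 = solve-∀
  headᵒ : ∀ a -> ζ.mulE (F 7) a ζ.∼ [] -> a ζ.∼ []
  headᵒ a h' = ζ.mk∼ (fixed-zero k l a step)
   where
   equal : ∀ φ -> Test φ -> ζ.⟪ a , (\ y -> φ (+ ((suc k N.+ i) N.* 7) Z.+ y)) ⟫ ≡ ζ.⟪ a , (\ y -> φ (+ (i N.* 7) Z.+ y)) ⟫
   equal φ τ' = ZP.i-j≡0⇒i≡j ζ.⟪ a , (\ y -> φ (+ ((suc k N.+ i) N.* 7) Z.+ y)) ⟫ ζ.⟪ a , (\ y -> φ (+ (i N.* 7) Z.+ y)) ⟫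
     (trans (sym (l1 ζ.⟪ a , (\ y -> φ (+ ((suc k N.+ i) N.* 7) Z.+ y)) ⟫ ζ.⟪ a , (\ y -> φ (+ (i N.* 7) Z.+ y)) ⟫))
     (trans (cong (\ z -> z Z.* ζ.⟪ a , (\ y -> φ (+ ((suc k N.+ i) N.* 7) Z.+ y)) ⟫ Z.+ ((Z.- z) Z.* ζ.⟪ a , (\ y -> φ (+ (i N.* 7) Z.+ y)) ⟫ Z.+ + 0)) (sym lead))
     (trans (sym (ζ.⟪⟫-mul ((f 7 , + ((suc k N.+ i) N.* 7)) ∷ (Z.- f 7 , + (i N.* 7)) ∷ []) a φ)) (trans (cong (\ p -> ζ.⟪ ζ.mulE p a , φ ⟫) (sym (difference (suc k N.+ i) i 7))) (ζ.test h' φ τ')))))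
   idxʳ : + ((suc k N.+ i) N.* 7) ≡ + (7 N.* suc k) Z.+ + (i N.* 7)
   idxʳ = cong +_ (trans (NP.*-distribʳ-+ 7 (suc k) i) (cong (N._+ i N.* 7) (NP.*-comm (suc k) 7)))
   step : ∀ ψ -> Test ψ -> ζ.⟪ a , (\ y -> ψ (+ (7 N.* suc k) Z.+ y)) ⟫ ≡ ζ.⟪ a , ψ ⟫
   step ψ τ' = trans (ζ.⟪⟫-cong a (\ y -> cong ψ (sym (trans (cong (\ z -> Z.- + (i N.* 7) Z.+ (z Z.+ y)) idxʳ) (l2 (+ (7 N.* suc k)) (+ (i N.* 7)) y)))))
     (trans (equal (\ y -> ψ (Z.- + (i N.* 7) Z.+ y)) (Test-shift ψ τ' (Z.- + (i N.* 7)))) (ζ.⟪⟫-cong a (\ y -> cong ψ (l3 (+ (i N.* 7)) y))))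

 roots : ℕ -> ℕ -> List ζS.Ser
 roots s zero = []
 roots s (suc n) = twist s f ∷ roots (suc s) n

 length-roots : ∀ s n -> length (roots s n) ≡ n
 length-roots s zero = refl
 length-roots s (suc n) = cong suc (length-roots (suc s) n)

 forall-roots : ∀ (A : ζS.Ser -> Set) s n -> (∀ k -> k N.< n -> A (twist (k N.+ s) f)) -> VZ.Forall A (roots s n)
 forall-roots A s zero h = tt
 forall-roots A s (suc n) h = h 0 (s≤s z≤n) , forall-roots A (suc s) n (\ k l -> subst (\ j -> A (twist j f)) (sym (NP.+-suc k s)) (h (suc k) (s≤s l)))

 separated-roots : ∀ s n -> n N.≤ 13 -> VZ.Separated (roots s n)
 separated-roots s zero l = tt
 separated-roots s (suc n) (s≤s l) = forall-roots (\ x -> VZ.Regularᵂ (x ζS.- twist s f)) (suc s) n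
   (\ k l' -> subst (\ j -> ζS.Regular (twist j f ζS.- twist s f)) (sym (NP.+-suc k s)) (separated s k (NP.<-≤-trans l' l)))
  , separated-roots (suc s) n (NP.m≤n⇒m≤1+n l)

 twist-horner : ∀ j p -> twist j (horner p (V t)) ζS.~ twist 0 (horner p (V t))
 twist-horner j p = ζS.tr (twist-cong j (sy (V-horner p))) (ζS.tr (twist-V j (horner p t)) (twist-cong 0 (V-horner p)))

 twist-ev : ∀ j ps a -> twist j (VS.ev (List.map (\ p -> horner p (V t)) ps) a f) ζS.~ VZ.ev (List.map (\ p -> twist 0 (horner p (V t))) ps) (twist j a) (twist j f)
 twist-ev j [] a = ζS.≈-refl
 twist-ev j (p ∷ ps) a = ζS.tr (twist-ev j ps (a * f + horner p (V t))) (VZ.ev-cong (List.map (\ p -> twist 0 (horner p (V t))) ps) (twist j f)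
  (ζS.tr (twist-+ j (a * f) (horner p (V t))) (ζS.+-cong (twist-* j a f) (twist-horner j p))))

 length-map : ∀ (g : List ℤ -> ζS.Ser) ps -> length (List.map g ps) ≡ length ps
 length-map g [] = refl
 length-map g (p ∷ ps) = cong suc (length-map g ps)

 -- The coefficients of the equation are series in q¹³, unchanged by q ↦ ζ q, so all thirteen twists
 -- of f are roots. In their sum the exponents divisible by 13 appear thirteen times.
 trace-of-root : ∀ p ps -> length ps ≡ 12 -> VS.ev (List.map (\ p -> horner p (V t)) (p ∷ ps)) 1# f ~ 0# -> horner p t + ι (+ 13) * H 0 f ~ 0#
 trace-of-root p ps len root = mk coefficient
  where
  cs = List.map (\ p -> twist 0 (horner p (V t))) ps
  sum-zero : twist 0 (horner p (V t)) ζS.+ VZ.sumL (roots 0 13) ζS.~ ζS.0#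
  sum-zero = VZ.vieta (twist 0 (horner p (V t))) cs (roots 0 13) (trans (length-roots 0 13) (cong suc (sym (trans (length-map (\ p -> twist 0 (horner p (V t))) ps) len))))
   (separated-roots 0 13 NP.≤-refl) (forall-roots (\ y -> VZ.ev (twist 0 (horner p (V t)) ∷ cs) ζS.1# y ζS.~ ζS.0#) 0 13 (\ k _ -> subst (\ j -> VZ.ev (twist 0 (horner p (V t)) ∷ cs) ζS.1# (twist j f) ζS.~ ζS.0#) (sym (NP.+-identityʳ k))
     (ζS.tr (VZ.ev-cong (twist 0 (horner p (V t)) ∷ cs) (twist k f) (ζS.sy (twist-1 k))) (ζS.tr (ζS.sy (twist-ev k (p ∷ ps) 1#)) (ζS.tr (twist-cong k root) (twist-0 k))))))
  sum-at : ∀ s k n -> ζ.⟪ VZ.sumL (roots s k) (n N.* 13) , φ0 ⟫ ≡ + k Z.* (f (n N.* 13) Z.* + 12)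
  sum-at s zero n = sym (ZP.*-zeroˡ (f (n N.* 13) Z.* + 12))
  sum-at s (suc k) n = trans (cong (\ p -> ζ.⟪ p , φ0 ⟫) (ζS.+-at (twist s f) (VZ.sumL (roots (suc s) k)) (n N.* 13)))
   (trans (cong₂ (\ x y -> f (n N.* 13) Z.* x Z.+ y) (trans (cong (\ z -> φ0 (+ z)) (sym (NP.*-assoc s n 13))) (periodic-multiple φ0 φ0-periodic (s N.* n))) (sum-at (suc s) k n))
     (lem (f (n N.* 13) Z.* + 12) (+ k)))
   where
   lem : ∀ x k -> x Z.+ k Z.* x ≡ (+ 1 Z.+ k) Z.* x
   lem = solve-∀
  coefficient : ∀ n -> (horner p t + ι (+ 13) * H 0 f) n ≡ + 0
  coefficient n = trans (+-at (horner p t) (ι (+ 13) * H 0 f) n) (trans (cong (\ z -> horner p t n Z.+ z) (coefficient-ι (+ 13) (H 0 f) n)) (case ZP.i*j≡0⇒i≡0∨j≡0 (+ 12) twelve of \ { (inj₂ z) -> z }))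
   where
   l1 : ∀ x y -> + 12 Z.* (x Z.+ + 13 Z.* y) ≡ x Z.* + 12 Z.+ + 13 Z.* (y Z.* + 12)
   l1 = solve-∀
   twelve : + 12 Z.* (horner p t n Z.+ + 13 Z.* f (n N.* 13)) ≡ + 0
   twelve = trans (l1 (horner p t n) (f (n N.* 13))) (trans (cong₂ (\ x y -> x Z.* + 12 Z.+ y) (sym (trans (sym (at (V-horner p) (n N.* 13))) (V13.V-multiple (horner p t) n))) (sym (sum-at 0 13 n)))
     (trans (sym (cong (\ p -> ζ.⟪ p , φ0 ⟫) (ζS.+-at (twist 0 (horner p (V t))) (VZ.sumL (roots 0 13)) (n N.* 13)))) (ζ.test (ζS.at sum-zero (n N.* 13)) φ0 φ0-test)))

-- The equation of degree 13 over the functions of level 13 satisfied by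
-- v̂ = η(q¹³)/η(q), q = x¹³, where v̂² = t V(t).  It comes from the two
-- expressions of V Ĵ, whose difference is Ψ(v̂) Ψ(-v̂) (13 v̂² - 1).

q^-lead : ∀ k f -> (q ^ k * f) k ≡ f 0
q^-lead k f = trans (cong (q ^ k * f) (sym (NP.+-identityʳ k))) (q^-shift k f 0)

private
 h7 g13 : Ser
 h7 = V (V π) * π⁻¹
 g13 = V (V π) ^ 2 * V π⁻¹ ^ 2

opaque
 v̂ : Ser
 v̂ = q ^ 7 * (V (V π) * π⁻¹)

 v̂-def : v̂ ~ q ^ 7 * (V (V π) * π⁻¹)
 v̂-def = ≈-refl

 v̂-low : ∀ n -> n N.< 7 -> v̂ n ≡ + 0
 v̂-low n l = q^-low 7 (V (V π) * π⁻¹) n l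

 v̂-lead : v̂ 7 ≡ + 1
 v̂-lead = trans (q^-lead 7 (V (V π) * π⁻¹)) (trans (cong (\ z -> z Z.* π⁻¹ 0) (trans (V13.V-0 (V π)) (trans (V13.V-0 π) refl))) refl)

Vt : V t ~ q ^ 13 * (V (V π) ^ 2 * V π⁻¹ ^ 2)
Vt = tr (V13.V-* q (V π ^ 2 * π⁻¹ ^ 2)) (*-cong V-q (tr (V13.V-* (V π ^ 2) (π⁻¹ ^ 2)) (*-cong (V13.V-^ (V π) 2) (V13.V-^ π⁻¹ 2))))

private
 square-algebra : ∀ (a b c y w i j : Ser) -> a * a ~ b * c -> w * j ~ ι (+ 1) -> a * (y * i) * (a * (y * i)) ~ b * (w ^ 2 * i ^ 2) * (c * (y ^ 2 * j ^ 2))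
 square-algebra a b c y w i j h k = tr (solve (v0 :* (v1 :* v2) :* (v0 :* (v1 :* v2))) (v0 :* v0 :* (v1 :^ 2 :* v2 :^ 2)) refl (a ∷ y ∷ i ∷ [])) (tr (*ʳ h)
  (sy (by1 {c = b * c * (y ^ 2 * i ^ 2) * (w * j + ι (+ 1))} k (solve (v0 :* (v4 :^ 2 :* v3 :^ 2) :* (v1 :* (v2 :^ 2 :* v5 :^ 2))) (v0 :* v1 :* (v2 :^ 2 :* v3 :^ 2) :+ v0 :* v1 :* (v2 :^ 2 :* v3 :^ 2) :* (v4 :* v5 :+ # 1) :* (v4 :* v5 :- # 1)) refl (b ∷ c ∷ y ∷ i ∷ w ∷ j ∷ [])))))

v̂² : t * V t ~ v̂ * v̂
v̂² = sy (tr (*-cong v̂-def v̂-def) (tr (square-algebra (q ^ 7) q (q ^ 13) (V (V π)) (V π) π⁻¹ (V π⁻¹) (power-+ q 7 7 14 refl) Vπ*Vπ⁻¹) (*ˡ {t} (sy Vt))))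

private
 modular-algebra : ∀ (n v' m s v T Q : Ser) -> n * v' ~ v * m -> T * v' ~ Q -> s * v ~ Q -> Q * (s * n) ~ Q * (T * m)
 modular-algebra n v' m s v T Q h k l = tr (*ʳ {s * n} (sy k)) (tr (solve (v0 :* v1 :* (v2 :* v3)) (v0 :* v2 :* (v3 :* v1)) refl (T ∷ v' ∷ s ∷ n ∷ [])) (tr (*ˡ {T * s} h)
  (tr (solve (v0 :* v1 :* (v2 :* v3)) (v1 :* v2 :* (v0 :* v3)) refl (T ∷ s ∷ v ∷ m ∷ [])) (*ʳ {T * m} l))))

 modular : t ^ 13 * (horner p3 (V t) * horner q4 (V t) ^ 3) ~ V t * (P3 * Q4* ^ 3)
 modular = regular-cancel {q ^ 13} (regular-q^ 13) (modular-algebra (horner p3 (V t) * horner q4 (V t) ^ 3) (V v) (P3 * Q4* ^ 3) (t ^ 13) (v ^ 13) (V t) (q ^ 13)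
  (tr (*ʳ {V v} (sy (tr (V13.V-cong horner-n) (tr (V13.V-* P3 (Q4 * (Q4 * Q4))) (*-cong (V-horner p3) (tr (V13.V-cong (cube Q4)) (tr (V13.V-^ Q4 3) (^-cong 3 (V-horner q4)))))))))
   (tr (sy (V13.V-* (horner nᴸ t) v)) VĴ))
  (tr (sy (V13.V-* t v)) (tr (V13.V-cong t*v) V-q)) (tv^ 13))
  where
  cube : ∀ x -> x * (x * x) ~ x ^ 3
  cube x = solve (v0 :* (v0 :* v0)) (v0 :^ 3) refl (x ∷ [])

 χ ω : Expr 2
 χ = v0
 ω = v1

 -- The relation `modular` multiplied by ω¹³, in the variables χ = t V t and ω = V t, so that t =
 -- χ/ω disappears.
 modE : Expr 2
 modE = χ :^ 13 :* (P3E ω :* Q4E ω :^ 3) :- (ω :^ 2 :+ # 5 :* (ω :* χ) :+ # 13 :* χ :^ 2) :* (ω :^ 4 :+ # 7 :* (ω :^ 3 :* χ) :+ # 20 :* (ω :^ 2 :* χ :^ 2) :+ # 19 :* (ω :* χ :^ 3) :+ χ :^ 4) :^ 3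

 evE : List (List ℤ) -> Expr 2 -> Expr 2
 evE [] a = a
 evE (p ∷ ps) a = evE ps (a :* χ :+ hE p ω)

 ⟦evE⟧ : ∀ ps a x y -> ⟦ evE ps a ⟧ (x ∷ y ∷ []) ~ VS.ev (List.map (\ p -> horner p y) ps) (⟦ a ⟧ (x ∷ y ∷ [])) x
 ⟦evE⟧ [] a x y = ≈-refl
 ⟦evE⟧ (p ∷ ps) a x y = tr (⟦evE⟧ ps (a :* χ :+ hE p ω) x y) (VS.ev-cong (List.map (\ p -> horner p y) ps) x (+ˡ (reflexive (⟦hornerE⟧ p ω (x ∷ y ∷ [])))))

-- The coefficient of v̂¹² in Ψ, as a polynomial in V t; by Vieta its negative is Zuckerman's
-- polynomial.
ψ12 : List ℤ
ψ12 = 0 ,, 142 ,- 6083 ,- 83485 ,- 571219 ,- 2227757 ,- 4826808 ,- 4826808 ,- []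

ψs : List (List ℤ)
ψs = (0 ,, 0 ,, 2652 ,, 58474 ,, 487734 ,, 2113514 ,, 4826809 ,, 4826809 ,, []) ∷ (0 ,, 0 ,, 467 ,- 21293 ,- 224093 ,- 1085317 ,- 2599050 ,- 2599050 ,- []) ∷ (0 ,, 0 ,, 0 ,, 4498 ,, 71318 ,, 404248 ,, 1056757 ,, 1113879 ,, []) ∷ (0 ,, 0 ,, 0 ,, 493 ,- 17237 ,- 123031 ,- 371292 ,- 428414 ,- []) ∷ (0 ,, 0 ,, 0 ,, 0 ,, 2886 ,, 31096 ,, 112047 ,, 142805 ,, []) ∷ (0 ,, 0 ,, 0 ,, 0 ,, 259 ,- 6421 ,- 28560 ,- 41742 ,- []) ∷ (0 ,, 0 ,, 0 ,, 0 ,, 0 ,, 962 ,, 6253 ,, 10985 ,, []) ∷ (0 ,, 0 ,, 0 ,, 0 ,, 0 ,, 77 ,- 1182 ,- 2534 ,- []) ∷ (0 ,, 0 ,, 0 ,, 0 ,, 0 ,, 0 ,, 169 ,, 507 ,, []) ∷ (0 ,, 0 ,, 0 ,, 0 ,, 0 ,, 0 ,, 12 ,- 90 ,- []) ∷ (0 ,, 0 ,, 0 ,, 0 ,, 0 ,, 0 ,, 0 ,, 13 ,, []) ∷ (0 ,, 0 ,, 0 ,, 0 ,, 0 ,, 0 ,, 0 ,, 0 ,- []) ∷ []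

private
 ΨE Ψ₋E : Expr 2
 ΨE = evE (ψ12 ∷ ψs) (# 1)
 Ψ₋E = substE (:- χ ∷ ω ∷ []) ΨE

 -- Ψ(-v̂) with its factor q⁹¹ taken out. The value at q = 0 is -2, from v̂¹³ and (V t)⁷, whose
 -- leading terms cancel in Ψ(v̂) but add up in Ψ(-v̂).
 lowE leadE : Expr 3
 lowE = (K (-[1+ 0 ]) :* (v0 :^ 0 :* (v1 :^ 7 :* v2 :^ 0))) :+ (K (-[1+ 12 ]) :* (v0 :^ 1 :* (v1 :^ 7 :* v2 :^ 7))) :+ (K (-[1+ 12 ]) :* (v0 :^ 2 :* (v1 :^ 6 :* v2 :^ 1))) :+ (K (-[1+ 90 ]) :* (v0 :^ 2 :* (v1 :^ 7 :* v2 :^ 14))) :+ (K (-[1+ 168 ]) :* (v0 :^ 3 :* (v1 :^ 6 :* v2 :^ 8))) :+ (K (-[1+ 506 ]) :* (v0 :^ 3 :* (v1 :^ 7 :* v2 :^ 21))) :+ (K (-[1+ 77 ]) :* (v0 :^ 4 :* (v1 :^ 5 :* v2 :^ 2))) :+ (K (-[1+ 1182 ]) :* (v0 :^ 4 :* (v1 :^ 6 :* v2 :^ 15))) :+ (K (-[1+ 2534 ]) :* (v0 :^ 4 :* (v1 :^ 7 :* v2 :^ 28))) :+ (K (-[1+ 961 ]) :* (v0 :^ 5 :* (v1 :^ 5 :* v2 :^ 9))) :+ (K (-[1+ 6252 ]) :* (v0 :^ 5 :* (v1 :^ 6 :* v2 :^ 22))) :+ (K (-[1+ 10984 ]) :*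 (v0 :^ 5 :* (v1 :^ 7 :* v2 :^ 35))) :+ (K (-[1+ 259 ]) :* (v0 :^ 6 :* (v1 :^ 4 :* v2 :^ 3))) :+ (K (-[1+ 6421 ]) :* (v0 :^ 6 :* (v1 :^ 5 :* v2 :^ 16))) :+ (K (-[1+ 28560 ]) :* (v0 :^ 6 :* (v1 :^ 6 :* v2 :^ 29))) :+ (K (-[1+ 41742 ]) :* (v0 :^ 6 :* (v1 :^ 7 :* v2 :^ 42))) :+ (K (-[1+ 2885 ]) :* (v0 :^ 7 :* (v1 :^ 4 :* v2 :^ 10))) :+ (K (-[1+ 31095 ]) :* (v0 :^ 7 :* (v1 :^ 5 :* v2 :^ 23))) :+ (K (-[1+ 112046 ]) :* (v0 :^ 7 :* (v1 :^ 6 :* v2 :^ 36))) :+ (K (-[1+ 142804 ]) :* (v0 :^ 7 :* (v1 :^ 7 :* v2 :^ 49))) :+ (K (-[1+ 493 ]) :* (v0 :^ 8 :* (v1 :^ 3 :* v2 :^ 4))) :+ (K (-[1+ 17237 ]) :* (v0 :^ 8 :* (v1 :^ 4 :* v2 :^ 17))) :+ (K (-[1+ 123031 ]) :* (v0 :^ 8 :* (v1 :^ 5 :* v2 :^ 30))) :+ (K (-[1+ 371292 ]) :* (v0 :^ 8 :* (v1 :^ 6 :* v2 :^ 43))) :+ (K (-[1+ 428414 ]) :* (v0 :^ 8 :* (v1 :^ 7 :* v2 :^ 56))) :+ (K (-[1+ 4497 ]) :* (v0 :^ 9 :* (v1 :^ 3 :* v2 :^ 11))) :+ (K (-[1+ 71317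 ]) :* (v0 :^ 9 :* (v1 :^ 4 :* v2 :^ 24))) :+ (K (-[1+ 404247 ]) :* (v0 :^ 9 :* (v1 :^ 5 :* v2 :^ 37))) :+ (K (-[1+ 1056756 ]) :* (v0 :^ 9 :* (v1 :^ 6 :* v2 :^ 50))) :+ (K (-[1+ 1113878 ]) :* (v0 :^ 9 :* (v1 :^ 7 :* v2 :^ 63))) :+ (K (-[1+ 467 ]) :* (v0 :^ 10 :* (v1 :^ 2 :* v2 :^ 5))) :+ (K (-[1+ 21293 ]) :* (v0 :^ 10 :* (v1 :^ 3 :* v2 :^ 18))) :+ (K (-[1+ 224093 ]) :* (v0 :^ 10 :* (v1 :^ 4 :* v2 :^ 31))) :+ (K (-[1+ 1085317 ]) :* (v0 :^ 10 :* (v1 :^ 5 :* v2 :^ 44))) :+ (K (-[1+ 2599050 ]) :* (v0 :^ 10 :* (v1 :^ 6 :* v2 :^ 57))) :+ (K (-[1+ 2599050 ]) :* (v0 :^ 10 :* (v1 :^ 7 :* v2 :^ 70))) :+ (K (-[1+ 2651 ]) :* (v0 :^ 11 :* (v1 :^ 2 :* v2 :^ 12))) :+ (K (-[1+ 58473 ]) :* (v0 :^ 11 :* (v1 :^ 3 :* v2 :^ 25))) :+ (K (-[1+ 487733 ]) :* (v0 :^ 11 :* (v1 :^ 4 :* v2 :^ 38))) :+ (K (-[1+ 2113513 ]) :* (v0 :^ 11 :* (v1 :^ 5 :* v2 :^ 51))) :+ (K (-[1+ 4826808 ]) :* (v0 :^ 11 :* (v1 :^ 6 :* v2 :^ 64)))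 :+ (K (-[1+ 4826808 ]) :* (v0 :^ 11 :* (v1 :^ 7 :* v2 :^ 77))) :+ (K (-[1+ 142 ]) :* (v0 :^ 12 :* (v1 :^ 1 :* v2 :^ 6))) :+ (K (-[1+ 6083 ]) :* (v0 :^ 12 :* (v1 :^ 2 :* v2 :^ 19))) :+ (K (-[1+ 83485 ]) :* (v0 :^ 12 :* (v1 :^ 3 :* v2 :^ 32))) :+ (K (-[1+ 571219 ]) :* (v0 :^ 12 :* (v1 :^ 4 :* v2 :^ 45))) :+ (K (-[1+ 2227757 ]) :* (v0 :^ 12 :* (v1 :^ 5 :* v2 :^ 58))) :+ (K (-[1+ 4826808 ]) :* (v0 :^ 12 :* (v1 :^ 6 :* v2 :^ 71))) :+ (K (-[1+ 4826808 ]) :* (v0 :^ 12 :* (v1 :^ 7 :* v2 :^ 84))) :+ (K (-[1+ 0 ]) :* (v0 :^ 13 :* (v1 :^ 0 :* v2 :^ 0)))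
 leadE = substE (v2 :^ 7 :* v0 ∷ v2 :^ 13 :* v1 ∷ []) Ψ₋E

opaque
 mod-zero : ⟦ substE (χ :* χ ∷ ω ∷ []) modE ⟧ (v̂ ∷ V t ∷ []) ~ 0#
 mod-zero = tr (sy (DD.substE-⟦⟧ (χ :* χ ∷ ω ∷ []) modE (t * V t ∷ V t ∷ []) (v̂ ∷ V t ∷ []) (\ { zero -> v̂² ; (suc zero) -> ≈-refl })))
  (tr (DD.substE-⟦⟧ (χ :* ω ∷ ω ∷ []) modE (t * V t ∷ V t ∷ []) (t ∷ V t ∷ []) (\ { zero -> ≈-refl ; (suc zero) -> ≈-refl }))
  (tr (solve (substE (χ :* ω ∷ ω ∷ []) modE) (ω :^ 13 :* (χ :^ 13 :* (P3E ω :* Q4E ω :^ 3) :- ω :* (P3E χ :* Q4*E χ :^ 3))) refl (t ∷ V t ∷ []))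
   (tr (*ˡ {V t ^ 13} (x-x modular)) (zeroʳ (V t ^ 13)))))

 v̂-factors : ⟦ substE (χ :* χ ∷ ω ∷ []) modE ⟧ (v̂ ∷ V t ∷ []) ~ ⟦ ΨE :* (Ψ₋E :* (# 13 :* (χ :* χ) :- # 1)) ⟧ (v̂ ∷ V t ∷ [])
 v̂-factors = solve (substE (χ :* χ ∷ ω ∷ []) modE) (ΨE :* (Ψ₋E :* (# 13 :* (χ :* χ) :- # 1))) refl (v̂ ∷ V t ∷ [])

 Ψ₋-leading : ⟦ Ψ₋E ⟧ (v̂ ∷ V t ∷ []) ~ q ^ 91 * ⟦ lowE ⟧ (h7 ∷ g13 ∷ q ∷ [])
 Ψ₋-leading = tr (DD.substE-⟦⟧ (v2 :^ 7 :* v0 ∷ v2 :^ 13 :* v1 ∷ []) Ψ₋E (v̂ ∷ V t ∷ []) (h7 ∷ g13 ∷ q ∷ []) (\ { zero -> v̂-def ; (suc zero) -> Vt }))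
  (solve leadE (v2 :^ 91 :* lowE) refl (h7 ∷ g13 ∷ q ∷ []))

 regular-low : Regular (⟦ lowE ⟧ (h7 ∷ g13 ∷ q ∷ []))
 regular-low = regular-nz {⟦ lowE ⟧ (h7 ∷ g13 ∷ q ∷ [])} (\ e -> case trans (sym head-value) e of \ ())
  where
  head-value : ⟦ lowE ⟧ (h7 ∷ g13 ∷ q ∷ []) 0 ≡ -[1+ 1 ]
  head-value = agrees-head (agrees-eval lowE (h7 ∷ g13 ∷ q ∷ []) ((1 ,, []) ∷ (1 ,, []) ∷ (0 ,, []) ∷ []) 1 (1 ,- [])
   ((trans (cong (\ z -> z Z.* π⁻¹ 0) (trans (V13.V-0 (V π)) (trans (V13.V-0 π) refl))) refl ∷ []) ∷ (cong₂ (\ x y -> x Z.* (x Z.* + 1) Z.* (y Z.* (y Z.* + 1))) (trans (V13.V-0 (V π)) (trans (V13.V-0 π) refl)) (trans (V13.V-0 π⁻¹) refl) ∷ []) ∷ (refl ∷ []) ∷ []) refl)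

 regular-cofactor : Regular (⟦ Ψ₋E ⟧ (v̂ ∷ V t ∷ []) * ⟦ # 13 :* (χ :* χ) :- # 1 ⟧ (v̂ ∷ V t ∷ []))
 regular-cofactor = regular-* {⟦ Ψ₋E ⟧ (v̂ ∷ V t ∷ [])} {⟦ # 13 :* (χ :* χ) :- # 1 ⟧ (v̂ ∷ V t ∷ [])}
  (\ g h -> regular-* {q ^ 91} {⟦ lowE ⟧ (h7 ∷ g13 ∷ q ∷ [])} (regular-q^ 91) regular-low g (tr (*ʳ {g} (sy Ψ₋-leading)) h))
  (regular-nz {⟦ # 13 :* (χ :* χ) :- # 1 ⟧ (v̂ ∷ V t ∷ [])} (\ e -> case trans (sym head-value) e of \ ()))
  where
  head-value : ⟦ # 13 :* (v0 :* v0) :- # 1 ⟧ (v̂ ∷ V t ∷ []) 0 ≡ -[1+ 0 ]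
  head-value = agrees-head (agrees-eval (# 13 :* (v0 :* v0) :- # 1) (v̂ ∷ V t ∷ []) ((0 ,, []) ∷ (0 ,, []) ∷ []) 1 (0 ,- [])
   ((v̂-low 0 (s≤s z≤n) ∷ []) ∷ (trans (V13.V-0 t) (agrees-head agrees-t) ∷ []) ∷ []) refl)

 Ψ-zero : ⟦ ΨE ⟧ (v̂ ∷ V t ∷ []) ~ 0#
 Ψ-zero = regular-cofactor (⟦ ΨE ⟧ (v̂ ∷ V t ∷ [])) (tr (*-comm (⟦ Ψ₋E ⟧ (v̂ ∷ V t ∷ []) * ⟦ # 13 :* (χ :* χ) :- # 1 ⟧ (v̂ ∷ V t ∷ [])) (⟦ ΨE ⟧ (v̂ ∷ V t ∷ []))) (tr (sy v̂-factors) mod-zero))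

module v̂-conjugates = Conjugates v̂ v̂-low v̂-lead

opaque
 v̂-trace : horner ψ12 t + ι (+ 13) * H 0 v̂ ~ 0#
 v̂-trace = v̂-conjugates.trace-of-root ψ12 ψs refl (tr (VS.ev-cong (List.map (\ p -> horner p (V t)) (ψ12 ∷ ψs)) v̂ (sy ι-1)) (tr (sy (⟦evE⟧ (ψ12 ∷ ψs) (# 1) v̂ (V t))) Ψ-zero))

 zuckerman : ι (+ 13) * (V π * H 0 (q ^ 7 * π⁻¹)) ~ horner (negP 1 ψ12) t
 zuckerman = tr (*ˡ {ι (+ 13)} (tr (H-scale (V π) (q ^ 7 * π⁻¹)) (V13.H-cong 0 (tr (solve (v0 :* (v1 :* v2)) (v1 :* (v0 :* v2)) refl (V (V π) ∷ q ^ 7 ∷ π⁻¹ ∷ [])) (sy v̂-def)))))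
  (tr (from-diff (tr (+ˡ (tr (-‿involutive' (horner ψ12 t)) ≈-refl)) (tr (+-comm (ι (+ 13) * H 0 v̂) (horner ψ12 t)) v̂-trace))) (sy (horner-neg ψ12 t)))
  where
  -‿involutive' : ∀ x -> - (- x) ~ x
  -‿involutive' x = solve (:- (:- v0)) v0 refl (x ∷ [])

-- Dissection of theta series: the terms in the residue classes modulo 13 on
-- which the quadratic exponent has a double root.

q^-ind : ∀ k n -> (q ^ k) n ≡ ind (n NP.≟ k)
q^-ind k n with NP.<-cmp n k
... | Relation.Binary.Definitions.tri< l ¬e _ = trans (q^-zero k n l) (sym (ind-no (n NP.≟ k) ¬e))
... | Relation.Binary.Definitions.tri≈ _ refl _ = trans (sym (at (*-identityʳ (q ^ n)) n)) (trans (cong (q ^ n * 1#) (sym (NP.+-identityʳ n))) (trans (q^-shift n 1# 0) (sym (ind-yes (n NP.≟ n) refl))))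
... | Relation.Binary.Definitions.tri> _ ¬e l = trans (sym (at (*-identityʳ (q ^ k)) n)) (trans (cong (q ^ k * 1#) (sym (NP.m+[n∸m]≡n (NP.<⇒≤ l)))) (trans (q^-shift k 1# (n ∸ k))
  (trans (positive (n ∸ k) (NP.m<n⇒0<n∸m l)) (sym (ind-no (n NP.≟ k) ¬e)))))
 where
 positive : ∀ j -> 0 N.< j -> 1# j ≡ + 0
 positive (suc j) _ = refl

q^-product : ∀ a b n -> (q ^ a * q ^ b) n ≡ ind (n NP.≟ a N.+ b)
q^-product a b n = trans (at (power-+ q a b (a N.+ b) refl) n) (q^-ind (a N.+ b) n)

-- Reindexes a sum along the class that carries f; the bound of l by j keeps the new sum inside the
-- old range.
class-sum : ∀ B (f : ℤ -> ℤ) (c : ℤ -> ℤ) -> (∀ x y -> c x ≡ c y -> x ≡ y) -> Supp B f -> (∀ j -> f j ≡ + 0 ⊎ ∃ \ l -> j ≡ c l × Z.∣ l ∣ N.≤ Z.∣ j ∣) -> Zsum B f ≡ Zsum B (\ l -> f (c l))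
class-sum B f c inj supp class = trans (Zsum-cong B spread) (trans (Zsum-swap B B (\ j l -> f (c l) Z.* δ (c l) j)) (Zsum-cong B collapse))
 where
 vanish0 : ∀ j -> f j ≡ + 0 -> ∀ l -> f (c l) Z.* δ (c l) j ≡ + 0
 vanish0 j z l with j ZP.≟ c l
 ... | yes refl = trans (cong (Z._* + 1) z) refl
 ... | no _ = ZP.*-zeroʳ (f (c l))
 spread0 : ∀ j -> f j ≡ + 0 -> f j ≡ Zsum B (\ l -> f (c l) Z.* δ (c l) j)
 spread0 j z = trans z (sym (Zsum-supp0 B (\ l -> f (c l) Z.* δ (c l) j) (\ l _ -> vanish0 j z l)))
 spread : ∀ j -> f j ≡ Zsum B (\ l -> f (c l) Z.* δ (c l) j)
 spread j with Z.∣ j ∣ NP.≤? B | class j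
 ... | no ¬l | _ = spread0 j (supp j (NP.≰⇒> ¬l))
 ... | yes _ | inj₁ z = spread0 j z
 ... | yes l | inj₂ (l0 , refl , le) = sym (trans (Zsum-cong B (\ l -> cong (f (c l) Z.*_) (ind-iff (c l0 ZP.≟ c l) (l0 ZP.≟ l) (inj l0 l) (cong c))))
   (Zsum-δ B l0 (\ l -> f (c l)) (NP.≤-trans le l)))
 flip : ∀ l j -> f (c l) Z.* δ (c l) j ≡ f j Z.* δ j (c l)
 flip l j with j ZP.≟ c l
 ... | yes refl = cong (f (c l) Z.*_) (sym (ind-yes (c l ZP.≟ c l) refl))
 ... | no ¬e = trans (ZP.*-zeroʳ (f (c l))) (sym (trans (cong (f j Z.*_) (ind-no (c l ZP.≟ j) (¬e ∘ sym))) (ZP.*-zeroʳ (f j))))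
 collapse : ∀ l -> Zsum B (\ j -> f (c l) Z.* δ (c l) j) ≡ f (c l)
 collapse l with Z.∣ c l ∣ NP.≤? B
 ... | yes le = trans (Zsum-cong B (flip l)) (Zsum-δ B (c l) f le)
 ... | no ¬le = trans (Zsum-* B (f (c l)) (δ (c l))) (trans (cong (Z._* Zsum B (δ (c l))) (supp (c l) (NP.≰⇒> ¬le))) (trans (ZP.*-zeroˡ (Zsum B (δ (c l)))) (sym (supp (c l) (NP.≰⇒> ¬le)))))

module _ (α : ℤ -> ℤ) (x : ℤ -> ℕ) (gr : Growing x) where

 private
  gr13 : Growing (\ l -> x l N.* 13)
  gr13 j l = NP.<-≤-trans (gr j l) (NP.m≤m*n (x j) 13)

  far : ∀ n b l -> suc n N.< Z.∣ l ∣ -> ¬ n ≡ x l N.* 13 N.+ b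
  far n b l h eq = NP.<-irrefl eq (NP.<-≤-trans (gr13 l h) (NP.m≤m+n (x l N.* 13) b))

  supp13 : ∀ n b -> Supp (suc n) (\ l -> α l Z.* ind (n NP.≟ x l N.* 13 N.+ b))
  supp13 n b l h = trans (cong (α l Z.*_) (ind-no (n NP.≟ x l N.* 13 N.+ b) (far n b l h))) (ZP.*-zeroʳ (α l))

  widen : ∀ n -> suc n N.≤ suc (n N.* 13)
  widen n = s≤s (NP.m≤m*n n 13)

 V-family : V (family α x) ~ family α (\ l -> x l N.* 13)
 V-family = mk (V13.V-elim (\ n -> V (family α x) n ≡ family α (\ l -> x l N.* 13) n)
  (\ n -> trans (V13.V-multiple (family α x) n) (trans (Zsum-cong (suc n) (\ l -> cong (α l Z.*_) (trans (q^-ind (x l) n) (ind-iff (n NP.≟ x l) (n N.* 13 NP.≟ x l N.* 13) (cong (N._* 13)) (NP.*-cancelʳ-≡ n (x l) 13)))))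
   (trans (sym (Zsum-mono {suc n} {suc (n N.* 13)} {\ l -> α l Z.* ind (n N.* 13 NP.≟ x l N.* 13)} (widen n)
       (\ l h -> trans (cong (α l Z.*_) (ind-no (n N.* 13 NP.≟ x l N.* 13) (\ eq -> NP.<-irrefl (NP.*-cancelʳ-≡ n (x l) 13 eq) (gr l h)))) (ZP.*-zeroʳ (α l)))))
     (Zsum-cong (suc (n N.* 13)) (\ l -> cong (α l Z.*_) (sym (q^-ind (x l N.* 13) (n N.* 13))))))))
  (\ r n l -> trans (V13.V-other (family α x) r n l) (sym (trans (Zsum-cong (suc (suc r N.+ n N.* 13)) (\ j -> trans (cong (α j Z.*_) (trans (q^-ind (x j N.* 13) (suc r N.+ n N.* 13)) (ind-no (suc r N.+ n N.* 13 NP.≟ x j N.* 13) (apart r n (x j) l)))) (ZP.*-zeroʳ (α j))))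
   (Zsum-zero (suc (suc r N.+ n N.* 13)))))))
  where
  apart : ∀ r n y -> suc r N.< 13 -> ¬ suc r N.+ n N.* 13 ≡ y N.* 13
  apart r n y l eq = case trans (sym (m<n⇒m%n≡m l)) (trans (sym ([m+kn]%n≡m%n (suc r) n 13)) (trans (cong (_% 13) eq) (m*n%n≡0 y 13))) of \ ()

 -- At a double root modulo 13 the exponent on the surviving class is 13 (13 x + b), so the
 -- extracted series reproduces the original one in q¹³.
 dissect : ∀ (c : ℤ -> ℤ) (c0 : ℤ) s b -> (∀ l k -> c l ≡ c k -> l ≡ k) -> (∀ j n -> x j N.+ s ≡ n N.* 13 -> ∃ \ l -> j ≡ c l × Z.∣ l ∣ N.≤ Z.∣ j ∣) ->
  (∀ l -> x (c l) N.+ s ≡ (x l N.* 13 N.+ b) N.* 13) -> (∀ l -> α (c l) ≡ c0 Z.* α l) -> H 0 (q ^ s * family α x) ~ ι c0 * (q ^ b * V (family α x))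
 dissect c c0 s b inj class xc αc = mk \ n -> trans (left n) (sym (right n))
  where
  common : ℕ -> ℤ
  common n = c0 Z.* Zsum (suc (n N.* 13)) (\ l -> α l Z.* ind (n NP.≟ x l N.* 13 N.+ b))
  left : ∀ n -> H 0 (q ^ s * family α x) n ≡ common n
  left n = trans (at (*-comm (q ^ s) (family α x)) (n N.* 13)) (trans (family-* α x gr (q ^ s) (n N.* 13))
   (trans (Zsum-cong (suc (n N.* 13)) (\ j -> cong (α j Z.*_) (q^-product (x j) s (n N.* 13))))
   (trans (class-sum (suc (n N.* 13)) (\ j -> α j Z.* ind (n N.* 13 NP.≟ x j N.+ s)) c inj
       (\ j h -> trans (cong (α j Z.*_) (ind-no (n N.* 13 NP.≟ x j N.+ s) (\ eq -> NP.<-irrefl eq (NP.<-≤-trans (gr j h) (NP.m≤m+n (x j) s))))) (ZP.*-zeroʳ (α j))) classify)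
   (trans (Zsum-cong (suc (n N.* 13)) (\ l -> trans (cong₂ Z._*_ (αc l) (ind-iff (n N.* 13 NP.≟ x (c l) N.+ s) (n NP.≟ x l N.* 13 N.+ b) (\ eq -> NP.*-cancelʳ-≡ n (x l N.* 13 N.+ b) 13 (trans eq (xc l))) (\ eq -> trans (cong (N._* 13) eq) (sym (xc l)))))
       (ZP.*-assoc c0 (α l) (ind (n NP.≟ x l N.* 13 N.+ b))))) (Zsum-* (suc (n N.* 13)) c0 (\ l -> α l Z.* ind (n NP.≟ x l N.* 13 N.+ b)))))))
   where
   classify : ∀ j -> α j Z.* ind (n N.* 13 NP.≟ x j N.+ s) ≡ + 0 ⊎ ∃ \ l -> j ≡ c l × Z.∣ l ∣ N.≤ Z.∣ j ∣
   classify j with n N.* 13 NP.≟ x j N.+ s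
   ... | yes eq = inj₂ (class j n (sym eq))
   ... | no _ = inj₁ (ZP.*-zeroʳ (α j))
  right : ∀ n -> (ι c0 * (q ^ b * V (family α x))) n ≡ common n
  right n = trans (coefficient-ι c0 (q ^ b * V (family α x)) n) (cong (c0 Z.*_) (trans (at (tr (*ˡ {q ^ b} V-family) (*-comm (q ^ b) (family α (\ l -> x l N.* 13)))) n)
   (trans (family-* α (\ l -> x l N.* 13) gr13 (q ^ b) n) (trans (Zsum-cong (suc n) (\ l -> cong (α l Z.*_) (q^-product (x l N.* 13) b n)))
     (sym (Zsum-mono {suc n} {suc (n N.* 13)} {\ l -> α l Z.* ind (n NP.≟ x l N.* 13 N.+ b)} (widen n) (supp13 n b)))))))

private
 shift-residue : ∀ (f g : ℕ -> ℕ) c m -> f (13 N.+ m) ≡ f m N.+ g m N.* 13 -> (f (13 N.+ m) N.+ c) % 13 ≡ 0 -> (f m N.+ c) % 13 ≡ 0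
 shift-residue f g c m e h = trans (sym ([m+kn]%n≡m%n (f m N.+ c) (g m) 13)) (trans (cong (_% 13) (trans (swap (f m) c (g m N.* 13)) (cong (N._+ c) (sym e)))) h)
  where
  swap : ∀ a b c -> a N.+ b N.+ c ≡ a N.+ c N.+ b
  swap a b c = trans (NP.+-assoc a b c) (trans (cong (a N.+_) (NP.+-comm b c)) (sym (NP.+-assoc a c b)))

 tri-13 : ∀ m -> tri (13 N.+ m) ≡ tri m N.+ (m N.+ 7) N.* 13
 tri-13 m = ZP.+-injective (trans (lem (+ m) (+ tri m)) (cong (\ z -> + tri m Z.+ z) (sym (ZP.pos-* (m N.+ 7) 13))))
  where
  lem : ∀ m y -> (+ 13 Z.+ m) Z.+ ((+ 12 Z.+ m) Z.+ ((+ 11 Z.+ m) Z.+ ((+ 10 Z.+ m) Z.+ ((+ 9 Z.+ m) Z.+ ((+ 8 Z.+ m) Z.+ ((+ 7 Z.+ m) Z.+ ((+ 6 Z.+ m) Z.+ ((+ 5 Z.+ m) Z.+ ((+ 4 Z.+ m) Z.+ ((+ 3 Z.+ m) Z.+ ((+ 2 Z.+ m) Z.+ ((+ 1 Z.+ m) Z.+ y)))))))))))) ≡ y Z.+ (m Z.+ + 7) Z.* + 13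
  lem = solve-∀

 square-13 : ∀ a m -> tri (13 N.+ m) N.+ (13 N.+ (a N.+ m)) N.* (13 N.+ (a N.+ m)) ≡ tri m N.+ (a N.+ m) N.* (a N.+ m) N.+ (m N.+ 7 N.+ ((a N.+ m) N.+ (a N.+ m) N.+ 13)) N.* 13
 square-13 a m = trans (cong (N._+ (13 N.+ (a N.+ m)) N.* (13 N.+ (a N.+ m))) (tri-13 m)) (ZP.+-injective (trans (cong₂ (\ x y -> + tri m Z.+ x Z.+ y) (ZP.pos-* (m N.+ 7) 13) (ZP.pos-* (13 N.+ (a N.+ m)) (13 N.+ (a N.+ m))))
  (trans (lem (+ tri m) (+ m) (+ (a N.+ m))) (sym (cong₂ (\ x y -> + tri m Z.+ x Z.+ y) (ZP.pos-* (a N.+ m) (a N.+ m)) (ZP.pos-* (m N.+ 7 N.+ ((a N.+ m) N.+ (a N.+ m) N.+ 13)) 13))))))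
  where
  lem : ∀ y m b -> y Z.+ (m Z.+ + 7) Z.* + 13 Z.+ (+ 13 Z.+ b) Z.* (+ 13 Z.+ b) ≡ y Z.+ b Z.* b Z.+ (m Z.+ + 7 Z.+ (b Z.+ b Z.+ + 13)) Z.* + 13
  lem = solve-∀

 -- Modulo 13 the values of f have period 13, and `table` evaluates one period: either r is r0, or f
 -- r + c is not divisible by 13.
 residueʳ : ∀ (f g : ℕ -> ℕ) c r0 -> (∀ m -> f (13 N.+ m) ≡ f m N.+ g m N.* 13) -> allB 13 (\ r -> isZero 0 ((+ r Z.- + r0) Z.* ind ((f r N.+ c) % 13 NP.≟ 0))) ≡ true ->
  ∀ m -> (f m N.+ c) % 13 ≡ 0 -> ∃ \ l -> m ≡ r0 N.+ l N.* 13
 residueʳ f g c r0 shift-f table m h = m / 13 , trans (m≡m%n+[m/n]*n m 13) (cong (N._+ m / 13 N.* 13) r≡r0)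
  where
  descend : ∀ l r -> (f (r N.+ l N.* 13) N.+ c) % 13 ≡ 0 -> (f r N.+ c) % 13 ≡ 0
  descend zero r h = trans (cong (\ z -> (f z N.+ c) % 13) (sym (NP.+-identityʳ r))) h
  descend (suc l) r h = descend l r (shift-residue f g c (r N.+ l N.* 13) (shift-f (r N.+ l N.* 13)) (trans (cong (\ z -> (f z N.+ c) % 13) (index r (l N.* 13))) h))
   where
   index : ∀ r y -> 13 N.+ (r N.+ y) ≡ r N.+ (13 N.+ y)
   index r y = trans (sym (NP.+-assoc 13 r y)) (trans (cong (N._+ y) (NP.+-comm 13 r)) (NP.+-assoc r 13 y))
  small : (f (m % 13) N.+ c) % 13 ≡ 0
  small = descend (m / 13) (m % 13) (trans (cong (\ z -> (f z N.+ c) % 13) (sym (m≡m%n+[m/n]*n m 13))) h)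
  r≡r0 : m % 13 ≡ r0
  r≡r0 = case ZP.i*j≡0⇒i≡0∨j≡0 (+ (m % 13) Z.- + r0) (isZero-sound _ (allB-sound 13 (\ r -> isZero 0 ((+ r Z.- + r0) Z.* ind ((f r N.+ c) % 13 NP.≟ 0))) table (m % 13) (m%n<n m 13))) of λ
   { (inj₁ z) -> ZP.+-injective (ZP.i-j≡0⇒i≡j (+ (m % 13)) (+ r0) z)
   ; (inj₂ z) -> case trans (sym (ind-yes ((f (m % 13) N.+ c) % 13 NP.≟ 0) small)) z of \ () }

 residue-6 : ∀ m -> (tri m N.+ 5) % 13 ≡ 0 -> ∃ \ l -> m ≡ 6 N.+ l N.* 13
 residue-6 = residueʳ tri (\ m -> m N.+ 7) 5 6 tri-13 refl

 residue-2 : ∀ m -> (tri m N.+ m N.* m N.+ 6) % 13 ≡ 0 -> ∃ \ l -> m ≡ 2 N.+ l N.* 13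
 residue-2 = residueʳ (\ m -> tri m N.+ m N.* m) (\ m -> m N.+ 7 N.+ (m N.+ m N.+ 13)) 6 2 (square-13 0) refl

 residue-10 : ∀ m -> (tri m N.+ suc m N.* suc m N.+ 6) % 13 ≡ 0 -> ∃ \ l -> m ≡ 10 N.+ l N.* 13
 residue-10 = residueʳ (\ m -> tri m N.+ suc m N.* suc m) (\ m -> m N.+ 7 N.+ (suc m N.+ suc m N.+ 13)) 6 10 (square-13 1) refl

 affine-injective : ∀ c x y -> c Z.+ x Z.* + 13 ≡ c Z.+ y Z.* + 13 -> x ≡ y
 affine-injective c x y e = ZP.*-cancelʳ-≡ x y (+ 13) (trans (lem c (x Z.* + 13)) (trans (cong (Z._- c) e) (sym (lem c (y Z.* + 13)))))
  where
  lem : ∀ c z -> z ≡ (c Z.+ z) Z.- c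
  lem = solve-∀

 quotient-small : ∀ c l -> l N.≤ c N.+ l N.* 13
 quotient-small c l = NP.≤-trans (NP.m≤m*n l 13) (NP.m≤n+m (l N.* 13) c)

 σ-13 : ∀ l -> σ (l Z.* + 13) ≡ σ l
 σ-13 l = trans (cong σ (lem l)) (trans (σ-+ (twice (twice (l Z.+ twice l))) l) (trans (cong (Z._* σ l) (even (twice (l Z.+ twice l)))) (ZP.*-identityˡ (σ l))))
  where
  twice : ℤ -> ℤ
  twice x = x Z.+ x
  lem : ∀ l -> l Z.* + 13 ≡ ((l Z.+ (l Z.+ l)) Z.+ (l Z.+ (l Z.+ l))) Z.+ ((l Z.+ (l Z.+ l)) Z.+ (l Z.+ (l Z.+ l))) Z.+ l
  lem = solve-∀
  square-one : ∀ n -> σ (+ n) Z.* σ (+ n) ≡ + 1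
  square-one zero = refl
  square-one (suc n) = trans (cong₂ Z._*_ (σ-suc (+ n)) (σ-suc (+ n))) (trans (lem2 (σ (+ n))) (square-one n))
   where
   lem2 : ∀ x -> (Z.- x) Z.* (Z.- x) ≡ x Z.* x
   lem2 = solve-∀
  inverse : ∀ n -> σ -[1+ n ] Z.* σ (+ suc n) ≡ + 1
  inverse n = trans (sym (σ-+ -[1+ n ] (+ suc n))) (cong σ (ZP.+-inverseˡ (+ suc n)))
  unit : ∀ x y -> x Z.* x ≡ + 1 -> y Z.* x ≡ + 1 -> y Z.* y ≡ + 1
  unit x y h k = trans (sym (trans (cong (y Z.* y Z.*_) h) (ZP.*-identityʳ (y Z.* y)))) (trans (lem3 x y) (cong₂ Z._*_ k k))
   where
   lem3 : ∀ x y -> y Z.* y Z.* (x Z.* x) ≡ y Z.* x Z.* (y Z.* x)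
   lem3 = solve-∀
  even : ∀ x -> σ (x Z.+ x) ≡ + 1
  even (+ n) = trans (σ-+ (+ n) (+ n)) (square-one n)
  even -[1+ n ] = trans (σ-+ -[1+ n ] -[1+ n ]) (unit (σ (+ suc n)) (σ -[1+ n ]) (square-one (suc n)) (inverse n))

 halveᵒ : ∀ a b -> + 2 Z.* + a ≡ + 2 Z.* + b -> a ≡ b
 halveᵒ a b e = ZP.+-injective (ZP.*-cancelˡ-≡ (+ 2) (+ a) (+ b) e)

 c6 c2 : ℤ -> ℤ
 c6 l = + 6 Z.+ l Z.* + 13
 c2 l = + 2 Z.+ l Z.* + 13

 remainder : ∀ a n -> a ≡ n N.* 13 -> a % 13 ≡ 0
 remainder a n e = trans (cong (_% 13) e) (m*n%n≡0 n 13)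

 neg-class : ∀ a b l -> a N.+ suc b ≡ 13 -> -[1+ b N.+ l N.* 13 ] ≡ + a Z.+ -[1+ l ] Z.* + 13
 neg-class a b l e = trans (cong (\ z -> Z.- (+ 1 Z.+ (+ b Z.+ z))) (ZP.pos-* l 13)) (trans (lem1 (+ a) (+ b) (+ l)) (trans (cong (\ z -> + a Z.+ (z Z.* Z.- + 1 Z.+ Z.- + l Z.* + 13)) (cong +_ e)) (lem2 (+ a) (+ l))))
  where
  lem1 : ∀ a b l -> Z.- (+ 1 Z.+ (b Z.+ l Z.* + 13)) ≡ a Z.+ ((a Z.+ (+ 1 Z.+ b)) Z.* Z.- + 1 Z.+ Z.- l Z.* + 13)
  lem1 = solve-∀
  lem2 : ∀ a l -> a Z.+ (+ 13 Z.* Z.- + 1 Z.+ Z.- l Z.* + 13) ≡ a Z.+ Z.- (+ 1 Z.+ l) Z.* + 13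
  lem2 = solve-∀

 pos-class : ∀ a l -> + (a N.+ l N.* 13) ≡ + a Z.+ + l Z.* + 13
 pos-class a l = cong (\ z -> + a Z.+ z) (ZP.pos-* l 13)

 Class : (ℤ -> ℤ) -> ℤ -> Set
 Class c j = ∃ \ l -> j ≡ c l × Z.∣ l ∣ N.≤ Z.∣ j ∣

 class⁺ : ∀ a m -> (∃ \ l -> m ≡ a N.+ l N.* 13) -> Class (\ l -> + a Z.+ l Z.* + 13) (+ m)
 class⁺ a _ (l , refl) = + l , pos-class a l , quotient-small a l

 class⁻ : ∀ a b m -> a N.+ suc b ≡ 13 -> (∃ \ l -> m ≡ b N.+ l N.* 13) -> Class (\ l -> + a Z.+ l Z.* + 13) -[1+ m ]
 class⁻ a b _ e (l , refl) = -[1+ l ] , neg-class a b l e , s≤s (quotient-small b l)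

 class-6 : ∀ j n -> T j N.+ 5 ≡ n N.* 13 -> Class c6 j
 class-6 (+ m) n e = class⁺ 6 m (residue-6 m (remainder (tri m N.+ 5) n e))
 class-6 -[1+ m ] n e = class⁻ 6 6 m refl (residue-6 m (remainder (tri m N.+ 5) n e))

 class-2 : ∀ j n -> G j N.+ 6 ≡ n N.* 13 -> Class c2 j
 class-2 (+ m) n e = class⁺ 2 m (residue-2 m (remainder (tri m N.+ m N.* m N.+ 6) n e))
 class-2 -[1+ m ] n e = class⁻ 2 10 m refl (residue-10 m (remainder (tri m N.+ suc m N.* suc m N.+ 6) n e))

 rhs-double : ∀ y b -> + 2 Z.* + ((y N.* 13 N.+ b) N.* 13) ≡ (+ 2 Z.* + y) Z.* + 169 Z.+ + b Z.* + 26
 rhs-double y b = trans (cong (+ 2 Z.*_) (trans (ZP.pos-* (y N.* 13 N.+ b) 13) (cong (\ z -> (z Z.+ + b) Z.* + 13) (ZP.pos-* y 13)))) (lem (+ y) (+ b))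
  where
  lem : ∀ y b -> + 2 Z.* ((y Z.* + 13 Z.+ b) Z.* + 13) ≡ (+ 2 Z.* y) Z.* + 169 Z.+ b Z.* + 26
  lem = solve-∀

 T-6 : ∀ l -> T (c6 l) N.+ 5 ≡ (T l N.* 13 N.+ 2) N.* 13
 T-6 l = halveᵒ (T (c6 l) N.+ 5) ((T l N.* 13 N.+ 2) N.* 13) (trans (ZP.*-distribˡ-+ (+ 2) (+ T (c6 l)) (+ 5)) (trans (cong (Z._+ + 10) (T-double (c6 l)))
  (trans (lem l) (sym (trans (rhs-double (T l) 2) (cong (\ z -> z Z.* + 169 Z.+ + 52) (T-double l)))))))
  where
  lem : ∀ l -> (+ 6 Z.+ l Z.* + 13) Z.* (+ 6 Z.+ l Z.* + 13) Z.+ (+ 6 Z.+ l Z.* + 13) Z.+ + 10 ≡ (l Z.* l Z.+ l) Z.* + 169 Z.+ + 52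
  lem = solve-∀

 G-2 : ∀ l -> G (c2 l) N.+ 6 ≡ (G l N.* 13 N.+ 1) N.* 13
 G-2 l = halveᵒ (G (c2 l) N.+ 6) ((G l N.* 13 N.+ 1) N.* 13) (trans (ZP.*-distribˡ-+ (+ 2) (+ G (c2 l)) (+ 6)) (trans (cong (Z._+ + 12) (G-double (c2 l)))
  (trans (lem l) (sym (trans (rhs-double (G l) 1) (cong (\ z -> z Z.* + 169 Z.+ + 26) (G-double l)))))))
  where
  lem : ∀ l -> + 3 Z.* ((+ 2 Z.+ l Z.* + 13) Z.* (+ 2 Z.+ l Z.* + 13)) Z.+ (+ 2 Z.+ l Z.* + 13) Z.+ + 12 ≡ (+ 3 Z.* (l Z.* l) Z.+ l) Z.* + 169 Z.+ + 26
  lem = solve-∀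

odd : ℤ -> ℤ
odd j = + 1 Z.+ (j Z.+ j)

-- 8(T j + 5) = (2j + 1)² + 39, so divisibility by 13 forces j = 6 + 13 l; there 2j + 1 = 13(2l +
-- 1), the origin of the factor 13.
H-π³ : H 0 (q ^ 5 * π ^ 3) ~ ι (+ 13) * (q ^ 2 * V π ^ 3)
H-π³ = regular-cancel {ι (+ 2)} (regular-ι (+ 2) (\ ())) (tr (H-ι (+ 2) (q ^ 5 * π ^ 3)) (tr (V13.H-cong 0 (tr (solve (v0 :* (v1 :* v2)) (v1 :* (v0 :* v2)) refl (ι (+ 2) ∷ q ^ 5 ∷ π ^ 3 ∷ [])) (*ˡ {q ^ 5} (sy jacobi-cube))))
 (tr (dissect (\ l -> σ l Z.* odd l) T T-growing c6 (+ 13) 5 2 (affine-injective (+ 6)) class-6 T-6 weights)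
  (tr (*ˡ {ι (+ 13)} (*ˡ {q ^ 2} (tr (V13.V-cong jacobi-cube) (tr (V13.V-* (ι (+ 2)) (π ^ 3)) (*-cong (V13.V-ι (+ 2)) (V13.V-^ π 3))))))
   (solve (v0 :* (v1 :* (v2 :* v3))) (v2 :* (v0 :* (v1 :* v3))) refl (ι (+ 13) ∷ q ^ 2 ∷ ι (+ 2) ∷ V π ^ 3 ∷ []))))))
 where
 weights : ∀ l -> σ (c6 l) Z.* odd (c6 l) ≡ + 13 Z.* (σ l Z.* odd l)
 weights l = trans (cong (Z._* odd (c6 l)) (trans (σ-+ (+ 6) (l Z.* + 13)) (trans (ZP.*-identityˡ (σ (l Z.* + 13))) (σ-13 l)))) (lem (σ l) l)
  where
  lem : ∀ s l -> s Z.* (+ 1 Z.+ ((+ 6 Z.+ l Z.* + 13) Z.+ (+ 6 Z.+ l Z.* + 13))) ≡ + 13 Z.* (s Z.* (+ 1 Z.+ (l Z.+ l)))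
  lem = solve-∀

-- 24(G j + 6) = (6j + 1)² + 11·13, so divisibility by 13 forces j = 2 + 13 l.
H-π : H 0 (q ^ 6 * π) ~ q ^ 1 * V π
H-π = tr (V13.H-cong 0 (*ˡ {q ^ 6} (sy pentagonal))) (tr (dissect σ G G-growing c2 (+ 1) 6 1 (affine-injective (+ 2)) class-2 G-2 weights)
 (tr (*ʳ {q ^ 1 * V (family σ G)} ι-1) (tr (*-identityˡ (q ^ 1 * V (family σ G))) (*ˡ {q ^ 1} (V13.V-cong pentagonal)))))
 where
 weights : ∀ l -> σ (c2 l) ≡ + 1 Z.* σ l
 weights l = trans (σ-+ (+ 2) (l Z.* + 13)) (cong (+ 1 Z.*_) (σ-13 l))

-- The array obtained from the right-hand side, and its moments

hz : List ℤ -> ℤ -> ℤ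
hz [] x = + 0
hz (c ∷ p) x = c Z.+ x Z.* hz p x

horner-hz : ∀ p x -> ℤR.horner p x ≡ hz p x
horner-hz [] x = ι-ℤ (+ 0)
horner-hz (c ∷ p) x = cong₂ (\ a b -> a Z.+ x Z.* b) (ι-ℤ c) (horner-hz p x)

opA opB : List ℤ -> Ser -> Ser
opA [] f = 0#
opA (c ∷ g) f = ι c * f + opA g (𝓐 f)
opB [] f = 0#
opB (c ∷ g) f = ι c * f + opB g (𝓑 f)

private
 𝓑-cong' : ∀ {f g} -> f ~ g -> 𝓑 f ~ 𝓑 g
 𝓑-cong' h = +-cong (*ˡ {ι (+ 8)} (D-cong h)) h

 𝓑-ι : ∀ c f -> 𝓑 (ι c * f) ~ ι c * 𝓑 f
 𝓑-ι c f = tr (+ʳ (*ˡ {ι (+ 8)} (D-ι* c f))) (solve (# 8 :* (v0 :* v1) :+ v0 :* v2) (v0 :* (# 8 :* v1 :+ v2)) refl (ι c ∷ D f ∷ f ∷ []))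

opB-cong : ∀ g {f h} -> f ~ h -> opB g f ~ opB g h
opB-cong [] e = ≈-refl
opB-cong (c ∷ g) e = +-cong (*ˡ {ι c} e) (opB-cong g (𝓑-cong' e))

opB-ι : ∀ g c f -> opB g (ι c * f) ~ ι c * opB g f
opB-ι [] c f = sy (zeroʳ (ι c))
opB-ι (a ∷ g) c f = tr (+ˡ (tr (opB-cong g (𝓑-ι c f)) (opB-ι g c (𝓑 f)))) (solve (v1 :* (v0 :* v2) :+ v0 :* v3) (v0 :* (v1 :* v2 :+ v3)) refl (ι c ∷ ι a ∷ f ∷ opB g (𝓑 f) ∷ []))

family-+ : ∀ (α β : ℤ -> ℤ) x -> family (\ j -> α j Z.+ β j) x ~ family α x + family β x
family-+ α β x = mk \ n -> trans (Zsum-cong (suc n) (\ j -> ZP.*-distribʳ-+ ((q ^ x j) n) (α j) (β j)))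
 (trans (Zsum-+ (suc n) (\ j -> α j Z.* (q ^ x j) n) (\ j -> β j Z.* (q ^ x j) n)) (sym (+-at (family α x) (family β x) n)))

family-scale : ∀ c (α : ℤ -> ℤ) x -> family (\ j -> c Z.* α j) x ~ ι c * family α x
family-scale c α x = mk \ n -> trans (Zsum-cong (suc n) (\ j -> ZP.*-assoc c (α j) ((q ^ x j) n))) (trans (Zsum-* (suc n) c (\ j -> α j Z.* (q ^ x j) n)) (sym (coefficient-ι c (family α x) n)))

family-zero : ∀ x -> family (\ _ -> + 0) x ~ 0#
family-zero x = mk \ n -> trans (Zsum-cong (suc n) (\ j -> ZP.*-zeroˡ ((q ^ x j) n))) (Zsum-zero (suc n))

family-𝓑 : ∀ (α : ℤ -> ℤ) -> 𝓑 (family α T) ~ family (\ j -> α j Z.* (odd j Z.* odd j)) T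
family-𝓑 α = tr (family-D α T (+ 8)) (family-cong T (\ j -> cong (α j Z.*_) (sq j)))
 where
 l1 : ∀ y -> + 8 Z.* y Z.+ + 1 ≡ + 4 Z.* (+ 2 Z.* y) Z.+ + 1
 l1 = solve-∀
 l2 : ∀ l -> + 4 Z.* (l Z.* l Z.+ l) Z.+ + 1 ≡ (+ 1 Z.+ (l Z.+ l)) Z.* (+ 1 Z.+ (l Z.+ l))
 l2 = solve-∀
 sq : ∀ l -> + 8 Z.* + T l Z.+ + 1 ≡ odd l Z.* odd l
 sq l = trans (l1 (+ T l)) (trans (cong (\ z -> + 4 Z.* z Z.+ + 1) (T-double l)) (l2 l))

family-op : ∀ g (α : ℤ -> ℤ) -> family (\ j -> α j Z.* hz g (odd j Z.* odd j)) T ~ opB g (family α T)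
family-op [] α = tr (family-cong T (\ j -> ZP.*-zeroʳ (α j))) (family-zero T)
family-op (c ∷ g) α = tr (family-cong T (\ j -> lem (α j) c (odd j Z.* odd j) (hz g (odd j Z.* odd j))))
 (tr (family-+ (\ j -> c Z.* α j) (\ j -> α j Z.* (odd j Z.* odd j) Z.* hz g (odd j Z.* odd j)) T)
  (+-cong (family-scale c α T) (tr (family-op g (\ j -> α j Z.* (odd j Z.* odd j))) (opB-cong g (sy (family-𝓑 α))))))
 where
 lem : ∀ a c z h -> a Z.* (c Z.+ z Z.* h) ≡ c Z.* a Z.+ a Z.* z Z.* h
 lem = solve-∀

-- Under j ↦ -1 - j both the sign and 2j + 1 change sign, so the weight is invariant; weights of the
-- other parity would give 0 on any symmetric array.
weight : List ℤ -> ℤ -> ℤ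
weight g j = σ j Z.* odd j Z.* hz g (odd j Z.* odd j)

family-weight : ∀ g -> family (weight g) T ~ ι (+ 2) * opB g (π ^ 3)
family-weight g = tr (family-op g (\ j -> σ j Z.* odd j)) (tr (opB-cong g jacobi-cube) (opB-ι g (+ 2) (π ^ 3)))

ℒ-ι : ∀ c a b -> ℒ (ι c * a) (ι c * b) ~ ι c * ℒ a b
ℒ-ι c a b = tr (ℒ-cong ≈-refl (*ʳ {b} (sy (V13.V-ι c)))) (sy (ℒ-* (ι c) a b))

-- The lower iterates vanish, so only the leading coefficient of the polynomial contributes.
ℒ-monic : ∀ cs a b -> (∀ i -> i N.< length cs -> ℒ^ i a b ~ 0#) -> ℒ (opA (cs ++ + 1 ∷ []) a) (opB (cs ++ + 1 ∷ []) b) ~ ℒ^ (length cs) a b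
ℒ-monic [] a b h = ℒ-cong (unit a) (unit b)
 where
 unit : ∀ f -> ι (+ 1) * f + 0# ~ f
 unit f = tr (+-identityʳ (ι (+ 1) * f)) (tr (*ʳ {f} ι-1) (*-identityˡ f))
ℒ-monic (c ∷ cs) a b h = tr (ℒ-+ (ι c * a) (opA (cs ++ + 1 ∷ []) (𝓐 a)) (ι c * b) (opB (cs ++ + 1 ∷ []) (𝓑 b)))
 (tr (+-cong (tr (ℒ-ι c a b) (tr (*ˡ {ι c} (h 0 (s≤s z≤n))) (zeroʳ (ι c)))) (ℒ-monic cs (𝓐 a) (𝓑 b) (\ i l -> h (suc i) (s≤s l)))) (+-identityˡ _))

D-H : ∀ Y -> ι (+ 13) * D (H 0 Y) ~ H 0 (D Y)
D-H Y = mk \ n -> trans (coefficient-ι (+ 13) (D (H 0 Y)) n) (trans (lem (+ n) (Y (n N.* 13))) (cong (Z._* Y (n N.* 13)) (sym (ZP.pos-* n 13))))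
 where
 lem : ∀ n y -> + 13 Z.* (n Z.* y) ≡ n Z.* + 13 Z.* y
 lem = solve-∀

private
 D-q^ : ∀ k f -> D (q ^ suc k * f) ~ q ^ suc k * (ι (+ suc k) * f + D f)
 D-q^ k f = tr (D-* (q ^ suc k) f) (tr (+ʳ (*ʳ {f} (tr (DD.𝒟-^ q k) (*ˡ {ι (+ suc k) * q ^ k} Dq))))
  (solve (v0 :* v1 :* v2 :* v3 :+ v2 :* v1 :* v4) (v2 :* v1 :* (v0 :* v3 :+ v4)) refl (ι (+ suc k) ∷ q ^ k ∷ q ∷ f ∷ D f ∷ [])))

 H-linear : ∀ a b Y Z -> H 0 (ι a * Y + ι b * Z) ~ ι a * H 0 Y + ι b * H 0 Z
 H-linear a b Y Z = tr (H-+ (ι a * Y) (ι b * Z)) (+-cong (sy (H-ι a Y)) (sy (H-ι b Z)))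

 -- q⁵ 𝓑 f = 8 D (q⁵ f) - 39 q⁵ f, and extraction turns D into 13 D. The factor q² then accounts for
 -- the constant of `𝓐`: 169 = 2·104 - 39.
 H-𝓑 : ∀ f a -> H 0 (q ^ 5 * f) ~ ι (+ 13) * (q ^ 2 * a) -> H 0 (q ^ 5 * 𝓑 f) ~ ι (+ 13) * (q ^ 2 * 𝓐 a)
 H-𝓑 f a h = tr (V13.H-cong 0 (tr (solve (v0 :* (# 8 :* v2 :+ v1)) (# 8 :* (v0 :* (# 5 :* v1 :+ v2)) :+ K (Z.- + 39) :* (v0 :* v1)) refl (q ^ 5 ∷ f ∷ D f ∷ [])) (+ʳ (*ˡ {ι (+ 8)} (sy (D-q^ 4 f))))))
  (tr (H-linear (+ 8) (Z.- + 39) (D (q ^ 5 * f)) (q ^ 5 * f)) (tr (+-cong (*ˡ {ι (+ 8)} (tr (sy (D-H (q ^ 5 * f))) (*ˡ {ι (+ 13)} (tr (D-cong h) (tr (D-ι* (+ 13) (q ^ 2 * a)) (*ˡ {ι (+ 13)} (D-q^ 1 a))))))) (*ˡ {ι (Z.- + 39)} h))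
   (solve (# 8 :* (# 13 :* (# 13 :* (v0 :* (# 2 :* v1 :+ v2)))) :+ K (Z.- + 39) :* (# 13 :* (v0 :* v1))) (# 13 :* (v0 :* (# 104 :* v2 :+ # 169 :* v1))) refl (q ^ 2 ∷ a ∷ D a ∷ []))))

H-op : ∀ g f a -> H 0 (q ^ 5 * f) ~ ι (+ 13) * (q ^ 2 * a) -> H 0 (q ^ 5 * opB g f) ~ ι (+ 13) * (q ^ 2 * opA g a)
H-op [] f a h = tr (V13.H-cong 0 (zeroʳ (q ^ 5))) (sy (tr (*ˡ {ι (+ 13)} (zeroʳ (q ^ 2))) (zeroʳ (ι (+ 13)))))
H-op (c ∷ g) f a h = tr (V13.H-cong 0 (solve (v0 :* (v1 :* v2 :+ v3)) (v1 :* (v0 :* v2) :+ v0 :* v3) refl (q ^ 5 ∷ ι c ∷ f ∷ opB g (𝓑 f) ∷ []))) (tr (H-+ (ι c * (q ^ 5 * f)) (q ^ 5 * opB g (𝓑 f)))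
 (tr (+-cong (tr (sy (H-ι c (q ^ 5 * f))) (*ˡ {ι c} h)) (H-op g (𝓑 f) (𝓐 a) (H-𝓑 f a h)))
  (solve (v1 :* (v4 :* (v0 :* v2)) :+ v4 :* (v0 :* v3)) (v4 :* (v0 :* (v1 :* v2 :+ v3))) refl (q ^ 2 ∷ ι c ∷ a ∷ opA g (𝓐 a) ∷ ι (+ 13) ∷ []))))

opaque
 -- Its exponents divisible by 13 carry π¹³ times the right-hand side of the second formula; through
 -- `position` this one series supplies the array for all m.
 X13 : Ser
 X13 = ι (+ 13) * (q ^ 6 * (V π ^ 13 * ((q + v) * π⁻¹))) + V (π ^ 13 * (V π⁻¹ * (ι (+ 1) + ι (+ 13) * t)))

 X13-def : X13 ~ ι (+ 13) * (q ^ 6 * (V π ^ 13 * ((q + v) * π⁻¹))) + V (π ^ 13 * (V π⁻¹ * (ι (+ 1) + ι (+ 13) * t)))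
 X13-def = ≈-refl

opaque
 -- In the first summand of `X13` a factor V (π¹³) leaves `H 0`, and the second part of `ℒ` remains.
 -- The second summand is itself a series in q¹³ and leaves entirely, so that `H-π³` and `H-op`
 -- apply and give the first part.
 array-moment : ∀ g -> H 0 (q ^ 5 * (family (weight g) T * X13)) ~ ι (+ 26) * (π ^ 13 * ℒ (opA g (V π ^ 3)) (opB g (π ^ 3)))
 array-moment g = tr (V13.H-cong 0 (tr (*ˡ {q ^ 5} (*-cong (family-weight g) X13-def)) (tr (expand-algebra (q ^ 5) (ι (+ 2)) (opB g (π ^ 3)) (ι (+ 13)) (q ^ 6) (V π ^ 13) (q + v) π⁻¹ (V Y))
   (+-cong (tr (*-cong (sy Vc) (*ʳ {(q + v) * (π⁻¹ * opB g (π ^ 3))} (power-+ q 5 6 11 refl))) ≈-refl) (*ʳ {q ^ 5 * opB g (π ^ 3)} (tr (*ʳ {V Y} (sy (V13.V-ι (+ 2)))) (sy (V13.V-* (ι (+ 2)) Y))))))))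
  (tr (H-+ (V (ι (+ 26) * π ^ 13) * (q ^ 11 * ((q + v) * (π⁻¹ * opB g (π ^ 3))))) (V (ι (+ 2) * Y) * (q ^ 5 * opB g (π ^ 3))))
  (tr (+-cong (V13.H-V* 0 (ι (+ 26) * π ^ 13) (q ^ 11 * ((q + v) * (π⁻¹ * opB g (π ^ 3)))) (s≤s z≤n)) (tr (V13.H-V* 0 (ι (+ 2) * Y) (q ^ 5 * opB g (π ^ 3)) (s≤s z≤n)) (*ˡ {ι (+ 2) * Y} (H-op g (π ^ 3) (V π ^ 3) H-π³))))
   (collect-algebra (π ^ 13) (H 0 (q ^ 11 * ((q + v) * (π⁻¹ * opB g (π ^ 3))))) (V π⁻¹) (ι (+ 1) + ι (+ 13) * t) (q ^ 2) (opA g (V π ^ 3)))))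
  where
  Y : Ser
  Y = π ^ 13 * (V π⁻¹ * (ι (+ 1) + ι (+ 13) * t))
  Vc : V (ι (+ 26) * π ^ 13) ~ ι (+ 2) * ι (+ 13) * V π ^ 13
  Vc = tr (V13.V-* (ι (+ 26)) (π ^ 13)) (*-cong (tr (V13.V-ι (+ 26)) (ι-* (+ 2) (+ 13))) (V13.V-^ π 13))
  expand-algebra : ∀ (a c f d b w s i y : Ser) -> a * (c * f * (d * (b * (w * (s * i))) + y)) ~ c * d * w * (a * b * (s * (i * f))) + c * y * (a * f)
  expand-algebra a c f d b w s i y = tr (solve (v0 :* (v1 :* v2 :* (v3 :+ v4))) (v1 :* (v0 :* v2) :* v3 :+ v1 :* v4 :* (v0 :* v2)) refl (a ∷ c ∷ f ∷ d * (b * (w * (s * i))) ∷ y ∷ []))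
   (+ʳ (solve (v1 :* (v0 :* v2) :* (v3 :* (v4 :* (v5 :* (v6 :* v7))))) (v1 :* v3 :* v5 :* (v0 :* v4 :* (v6 :* (v7 :* v2)))) refl (a ∷ c ∷ f ∷ d ∷ b ∷ w ∷ s ∷ i ∷ [])))
  collect-algebra : ∀ (p h w s b a : Ser) -> ι (+ 26) * p * h + ι (+ 2) * (p * (w * s)) * (ι (+ 13) * (b * a)) ~ ι (+ 26) * (p * (b * (s * (w * a)) + h))
  collect-algebra p h w s b a = solve (# 26 :* v0 :* v1 :+ # 2 :* (v0 :* (v2 :* v3)) :* (# 13 :* (v4 :* v5))) (# 26 :* (v0 :* (v4 :* (v3 :* (v2 :* v5)) :+ v1))) refl (p ∷ h ∷ w ∷ s ∷ b ∷ a ∷ [])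

 -- 51011754393600 = 2¹³·13!, obtained from 26·1430291113574400 = 729·2¹³·13!. It is also the
 -- thirteenth difference of a polynomial with leading term (2m)¹³.
 array-moment-monic : ∀ cs -> length cs ≡ 6 -> H 0 (q ^ 5 * (family (weight (cs ++ + 1 ∷ [])) T * X13)) ~ ι (+ 51011754393600) * (q ^ 2 * π ^ 39)
 array-moment-monic cs len = regular-cancel {ι (+ 729)} (regular-ι (+ 729) (\ ())) (tr (*ˡ {ι (+ 729)} (tr (array-moment (cs ++ + 1 ∷ [])) (*ˡ {ι (+ 26)} (*ˡ {π ^ 13} (tr (ℒ-monic cs (V π ^ 3) (π ^ 3) low) (reflexive (cong (\ k -> ℒ^ k (V π ^ 3) (π ^ 3)) len)))))))
  (tr (solve (# 729 :* (# 26 :* (v0 :* v1))) (# 26 :* (v0 :* (# 729 :* v1))) refl (π ^ 13 ∷ ℒ^ 6 (V π ^ 3) (π ^ 3) ∷ [])) (tr (*ˡ {ι (+ 26)} (*ˡ {π ^ 13} moment-six))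
   (tr (solve (# 26 :* (v0 :* (# 1430291113574400 :* (v1 :* v2)))) (# 729 :* (# 51011754393600 :* (v1 :* (v0 :* v2)))) refl (π ^ 13 ∷ q ^ 2 ∷ π ^ 26 ∷ [])) (*ˡ {ι (+ 729)} (*ˡ {ι (+ 51011754393600)} (*ˡ {q ^ 2} (power-+ π 13 26 39 refl))))))))
  where
  low : ∀ i -> i N.< length cs -> ℒ^ i (V π ^ 3) (π ^ 3) ~ 0#
  low i l = moment-zero i (NP.≤-pred (subst (i N.<_) len l))

-- Uniqueness.  The coefficients c(m, N) of ϑ¹³ are quasi-periodic and
-- symmetric in m, so for the least N at which they could differ from another
-- such array only -13 ≤ m ≤ 0 matter; seven odd moments then separate the
-- seven pairs {m, -13 - m}.

opaque
 Θ : L.Ser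
 Θ = ϑ L.^ 13

 Θ-quasi : ∀ m N -> extend (coef (m Z.+ + 13) Θ) (N Z.+ m Z.+ + 13) ≡ extend (coef m Θ) N
 Θ-quasi = quasi 13

 Θ-symm : ∀ m N -> extend (coef (Z.- + 13 Z.- m) Θ) N ≡ extend (coef m Θ) N
 Θ-symm = symm 13

 Θ-moment : ∀ p c -> (∀ m -> ℤR.horner (∇^ 13 p) m ≡ c) -> Laurent.moment (signed p) Θ ~ π ^ 13 * (ι c * (π * π) ^ 13)
 Θ-moment = moment-ϑ^ 13

 Θ-constant : coef (+ 0) Θ ~ π ^ 13 * CΦ 13
 Θ-constant = tr (Laurent.moment-cong (δ (+ 0)) tt (ϑ^ 13)) (tr (moment-lift^ (δ (+ 0)) π 13 ((pre L.* half) L.^ 13)) (*ˡ {π ^ 13} (mk \ n -> sym (Rows.frobenius 13 n))))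

T-add13 : ∀ x -> + T (x Z.+ + 13) ≡ + T x Z.+ (+ 13 Z.* x Z.+ + 91)
T-add13 x = ZP.*-cancelˡ-≡ (+ 2) (+ T (x Z.+ + 13)) (+ T x Z.+ (+ 13 Z.* x Z.+ + 91)) (trans (T-double (x Z.+ + 13)) (trans (l1 x) (sym (trans (l2 (+ T x) x) (cong (Z._+ + 2 Z.* (+ 13 Z.* x Z.+ + 91)) (T-double x))))))
 where
 l1 : ∀ x -> (x Z.+ + 13) Z.* (x Z.+ + 13) Z.+ (x Z.+ + 13) ≡ x Z.* x Z.+ x Z.+ + 2 Z.* (+ 13 Z.* x Z.+ + 91)
 l1 = solve-∀
 l2 : ∀ y x -> + 2 Z.* (y Z.+ (+ 13 Z.* x Z.+ + 91)) ≡ + 2 Z.* y Z.+ + 2 Z.* (+ 13 Z.* x Z.+ + 91)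
 l2 = solve-∀

-- The combination of m and N that is invariant under both symmetries of the coefficients of ϑ¹³; as
-- 21 = T 6, the constant term m = 0 sits at 13 N.
position : ℤ -> ℤ -> ℤ
position m N = N Z.* + 13 Z.+ + 21 Z.- + T (+ 6 Z.+ m)

position-quasi : ∀ m N -> position (m Z.+ + 13) (N Z.+ m Z.+ + 13) ≡ position m N
position-quasi m N = trans (cong (\ y -> (N Z.+ m Z.+ + 13) Z.* + 13 Z.+ + 21 Z.- y) (trans (cong (\ x -> + T x) (sym (ZP.+-assoc (+ 6) m (+ 13)))) (T-add13 (+ 6 Z.+ m)))) (lem N m (+ T (+ 6 Z.+ m)))
 where
 lem : ∀ N m y -> (N Z.+ m Z.+ + 13) Z.* + 13 Z.+ + 21 Z.- (y Z.+ (+ 13 Z.* (+ 6 Z.+ m) Z.+ + 91)) ≡ N Z.* + 13 Z.+ + 21 Z.- y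
 lem = solve-∀

position-symm : ∀ m N -> position (Z.- + 13 Z.- m) N ≡ position m N
position-symm m N = cong (\ y -> N Z.* + 13 Z.+ + 21 Z.- + y) (trans (cong T (lem m)) (T-reflect (+ 6 Z.+ m)))
 where
 lem : ∀ m -> + 6 Z.+ (Z.- + 13 Z.- m) ≡ Z.- + 1 Z.- (+ 6 Z.+ m)
 lem = solve-∀

gap : ℤ -> ℤ -> ℤ
gap m N = extend (coef m Θ) N Z.- extend X13 (position m N)

gap-quasi : ∀ m N -> gap (m Z.+ + 13) (N Z.+ m Z.+ + 13) ≡ gap m N
gap-quasi m N = cong₂ Z._-_ (Θ-quasi m N) (cong (extend X13) (position-quasi m N))

gap-symm : ∀ m N -> gap (Z.- + 13 Z.- m) N ≡ gap m N
gap-symm m N = cong₂ Z._-_ (Θ-symm m N) (cong (extend X13) (position-symm m N))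

private
 lowT : List ℤ
 lowT = 0 ,, 0 ,, 0 ,, 0 ,, 0 ,, 0 ,, 13 ,, 0 ,, 0 ,, []

 agrees-low : Agrees (ι (+ 13) * (q ^ 6 * (V π ^ 13 * ((q + v) * π⁻¹)))) lowT
 agrees-low = agrees-eval (# 13 :* (v0 :^ 6 :* (v1 :^ 13 :* ((v0 :+ v2) :* v3)))) (q ∷ V π ∷ v ∷ π⁻¹ ∷ []) (List.take 9 qT ∷ List.take 9 VπT ∷ List.take 9 vT ∷ List.take 9 iπT ∷ []) 9 lowT
  (agrees-take 9 agrees-q ∷ agrees-take 9 agrees-Vπ ∷ agrees-take 9 agrees-v ∷ agrees-take 9 agrees-π⁻¹ ∷ []) refl

 X13-low : ∀ r -> suc r N.< 9 -> nth lowT (suc r) ≡ + 0 -> X13 (suc r) ≡ + 0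
 X13-low r l z = trans (at X13-def (suc r)) (trans (+-at (ι (+ 13) * (q ^ 6 * (V π ^ 13 * ((q + v) * π⁻¹)))) (V (π ^ 13 * (V π⁻¹ * (ι (+ 1) + ι (+ 13) * t)))) (suc r))
  (cong₂ Z._+_ (trans (agrees-nth agrees-low (suc r) l) z) (trans (cong (V (π ^ 13 * (V π⁻¹ * (ι (+ 1) + ι (+ 13) * t)))) (sym (NP.+-identityʳ (suc r)))) (V13.V-other (π ^ 13 * (V π⁻¹ * (ι (+ 1) + ι (+ 13) * t))) r 0 (NP.<-≤-trans l (NP.m≤m+n 9 4))))))

 -- In degrees below 9 `X13` lives only in degrees 0 and 6, while 8 minus a triangular number is 8,
 -- 7, 5, 2 or negative.
 below-tri : ∀ n -> extend X13 (+ 8 Z.- + tri n) ≡ + 0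
 below-tri 0 = X13-low 7 (NP.m≤m+n 9 0) refl
 below-tri 1 = X13-low 6 (NP.m≤m+n 8 1) refl
 below-tri 2 = X13-low 4 (NP.m≤m+n 6 3) refl
 below-tri 3 = X13-low 1 (NP.m≤m+n 3 6) refl
 below-tri (4+ n) = extend-below X13 8 (tri (4 N.+ n)) (NP.+-mono-≤ (NP.m≤m+n 4 n) (NP.+-mono-≤ (NP.m≤m+n 3 n) (NP.≤-trans (NP.m≤m+n 2 n) (NP.m≤m+n (2 N.+ n) (tri (suc n))))))

 below-T : ∀ x -> extend X13 (+ 8 Z.- + T x) ≡ + 0
 below-T (+ n) = below-tri n
 below-T -[1+ n ] = below-tri n

gap-negative : ∀ m k -> gap m -[1+ k ] ≡ + 0
gap-negative m zero = cong (\ z -> + 0 Z.- z) (below-T (+ 6 Z.+ m))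
gap-negative m (suc k) = cong (\ z -> + 0 Z.- extend X13 z) (trans (lem (+ k) (+ T (+ 6 Z.+ m))) (cong (\ z -> Z.- (+ 1 Z.+ (+ 4 Z.+ z Z.+ + T (+ 6 Z.+ m)))) (sym (ZP.pos-* k 13))))
 where
 lem : ∀ k y -> Z.- (+ 2 Z.+ k) Z.* + 13 Z.+ + 21 Z.- y ≡ Z.- (+ 1 Z.+ (+ 4 Z.+ k Z.* + 13 Z.+ y))
 lem = solve-∀

private
 H-shift : ∀ s Y n j -> s N.+ j ≡ n N.* 13 -> H 0 (q ^ s * Y) n ≡ Y j
 H-shift s Y n j e = trans (cong (q ^ s * Y) (sym e)) (q^-shift s Y j)

 scale-shift : ∀ c s Y n -> (ι c * (q ^ s * Y)) (s N.+ n) ≡ c Z.* Y n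
 scale-shift c s Y n = trans (coefficient-ι c (q ^ s * Y) (s N.+ n)) (cong (c Z.*_) (q^-shift s Y n))

 H-scaled : ∀ s Y c s' Z n j -> s N.+ j ≡ (s' N.+ n) N.* 13 -> H 0 (q ^ s * Y) ~ ι c * (q ^ s' * Z) -> Y j ≡ c Z.* Z n
 H-scaled s Y c s' Z n j e h = trans (sym (H-shift s Y (s' N.+ n) j e)) (trans (at h (s' N.+ n)) (scale-shift c s' Z n))

 array-sum : ∀ (α : ℤ -> ℤ) B M -> suc M N.+ 6 N.≤ B -> Zsum B (\ m -> α (+ 6 Z.+ m) Z.* extend X13 (+ M Z.- + T (+ 6 Z.+ m))) ≡ (family α T * X13) M
 array-sum α B M l = trans (Zsum-mono {suc M N.+ 6} {B} {\ m -> F (+ 6 Z.+ m)} l (Supp-shift {suc M} {F} (+ 6) supp))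
  (trans (Zsum-shift {suc M} {F} (+ 6) supp) (trans (Zsum-cong (suc M) (\ j -> cong (α j Z.*_) (sym (extend-q^ (T j) X13 M)))) (sym (family-* α T T-growing X13 M))))
  where
  F : ℤ -> ℤ
  F j = α j Z.* extend X13 (+ M Z.- + T j)
  supp : Supp (suc M) F
  supp j l = trans (cong (α j Z.*_) (extend-T X13 (+ M) j l)) (ZP.*-zeroʳ (α j))

 power-product : ∀ (x y : Ser) k -> (x * y) ^ k ~ x ^ k * y ^ k
 power-product x y zero = sy (*-identityˡ 1#)
 power-product x y (suc k) = tr (*ˡ {x * y} (power-product x y k)) (solve (v0 :* v1 :* (v2 :* v3)) (v0 :* v2 :* (v1 :* v3)) refl (x ∷ y ∷ x ^ k ∷ y ^ k ∷ []))

 thirty-nine : ∀ (x c : Ser) -> x ^ 13 * (c * (x * x) ^ 13) ~ c * x ^ 39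
 thirty-nine x c = tr (*ˡ {x ^ 13} (*ˡ {c} (tr (power-product x x 13) (power-+ x 13 13 26 refl)))) (tr (solve (v0 :* (v1 :* v2)) (v1 :* (v0 :* v2)) refl (x ^ 13 ∷ c ∷ x ^ 26 ∷ [])) (*ˡ {c} (power-+ x 13 26 39 refl)))

 Zsum-two : ∀ B (f : ℤ -> ℤ) a b -> Z.∣ a ∣ N.≤ B -> Z.∣ b ∣ N.≤ B -> ¬ a ≡ b -> (∀ m -> ¬ m ≡ a -> ¬ m ≡ b -> f m ≡ + 0) -> Zsum B f ≡ f a Z.+ f b
 Zsum-two B f a b la lb ne h = trans (Zsum-cong B point) (trans (Zsum-+ B (\ m -> f m Z.* ind (a ZP.≟ m)) (\ m -> f m Z.* ind (b ZP.≟ m))) (cong₂ Z._+_ (Zsum-δ B a f la) (Zsum-δ B b f lb)))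
  where
  point : ∀ m -> f m ≡ f m Z.* ind (a ZP.≟ m) Z.+ f m Z.* ind (b ZP.≟ m)
  point m with a ZP.≟ m | b ZP.≟ m
  ... | yes refl | yes e = ⊥-elim (ne (sym e))
  ... | yes _ | no _ = sym (trans (cong₂ Z._+_ (ZP.*-identityʳ (f m)) (ZP.*-zeroʳ (f m))) (ZP.+-identityʳ (f m)))
  ... | no _ | yes _ = sym (trans (cong₂ Z._+_ (ZP.*-zeroʳ (f m)) (ZP.*-identityʳ (f m))) (ZP.+-identityˡ (f m)))
  ... | no ¬e | no ¬e' = trans (h m (¬e ∘ sym) (¬e' ∘ sym)) (sym (cong₂ Z._+_ (ZP.*-zeroʳ (f m)) (ZP.*-zeroʳ (f m))))

-- Lagrange interpolation. Below, `P1` is (2m + 13) times the product of (2m + 13)² - s over six of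
-- the seven squares s = 1, 9, 25, 49, 81, 121, 169, so on -13 ≤ m ≤ 0 it vanishes except at the
-- pair -k1, -k2. All seven products are monic of degree 6 in (2m + 13)², hence share the value of
-- the moment.
module Row (P1 cs : List ℤ) (k1 k2 : ℕ) (w : ℤ) (w≢0 : ¬ w Z.+ w ≡ + 0) (len : length cs ≡ 6)
 (poly : isZero 1 (norm {1} (hE P1 v0 :- (# 2 :* v0 :+ # 13) :* hE (cs ++ + 1 ∷ []) ((# 2 :* v0 :+ # 13) :* (# 2 :* v0 :+ # 13)))) ≡ true)
 (differences : isZero 1 (norm {1} (hE (∇^ 13 P1) v0 :- # 51011754393600)) ≡ true)
 (k1≢k2 : ¬ Z.- + k1 ≡ Z.- + k2) (k1≤ : k1 N.≤ 13) (k2≤ : k2 N.≤ 13) (reflected : Z.- + 13 Z.- (Z.- + k1) ≡ Z.- + k2)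
 (table : allB 14 (\ k -> isZero 0 ((+ k Z.- + k1) Z.* ((+ k Z.- + k2) Z.* hz P1 (Z.- + k)))) ≡ true)
 (w1 : σ (Z.- + k1) Z.* hz P1 (Z.- + k1) ≡ w) (w2 : σ (Z.- + k2) Z.* hz P1 (Z.- + k2) ≡ w) (small : Z.∣ Z.- + k1 ∣ N.+ Z.∣ Z.- + k2 ∣ ≡ 13) where

 signed-weight : ∀ m -> signed P1 m ≡ weight (cs ++ + 1 ∷ []) (+ 6 Z.+ m)
 signed-weight m = trans (cong (σ m Z.*_) (trans (sym (ℤR.⟦hornerE⟧ P1 v0 (m ∷ []))) (trans (ℤR.solve (hE P1 v0) ((# 2 :* v0 :+ # 13) :* hE (cs ++ + 1 ∷ []) ((# 2 :* v0 :+ # 13) :* (# 2 :* v0 :+ # 13))) poly (m ∷ []))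
   (trans (cong (y Z.*_) (ℤR.⟦hornerE⟧ (cs ++ + 1 ∷ []) ((# 2 :* v0 :+ # 13) :* (# 2 :* v0 :+ # 13)) (m ∷ []))) (trans (cong (\ z -> z Z.* ℤR.horner (cs ++ + 1 ∷ []) (z Z.* z)) y≡) (cong (odd (+ 6 Z.+ m) Z.*_) (horner-hz (cs ++ + 1 ∷ []) (odd (+ 6 Z.+ m) Z.* odd (+ 6 Z.+ m)))))))))
  (trans (sym (ZP.*-assoc (σ m) (odd (+ 6 Z.+ m)) _)) (cong (\ s -> s Z.* odd (+ 6 Z.+ m) Z.* hz (cs ++ + 1 ∷ []) (odd (+ 6 Z.+ m) Z.* odd (+ 6 Z.+ m))) (sym (trans (σ-+ (+ 6) m) (ZP.*-identityˡ (σ m))))))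
  where
  y = ℤR.ι (+ 2) Z.* m Z.+ ℤR.ι (+ 13)
  lem : ∀ m -> + 2 Z.* m Z.+ + 13 ≡ + 1 Z.+ ((+ 6 Z.+ m) Z.+ (+ 6 Z.+ m))
  lem = solve-∀
  y≡ : y ≡ odd (+ 6 Z.+ m)
  y≡ = trans (cong₂ (\ a b -> a Z.* m Z.+ b) (ι-ℤ (+ 2)) (ι-ℤ (+ 13))) (lem m)

 bound1 : ℕ -> ℕ
 bound1 n = 13 N.⊔ (bound (Θ n) N.⊔ (suc (21 N.+ n N.* 13) N.+ 6))

 theta-side : ∀ n -> Zsum (bound1 n) (\ m -> signed P1 m Z.* extend (coef m Θ) (+ n)) ≡ + 51011754393600 Z.* (π ^ 39) n
 theta-side n = trans (sym (expand (Θ n) (bound1 n) (signed P1) (NP.≤-trans (NP.m≤m⊔n (bound (Θ n)) _) (NP.m≤n⊔m 13 _))))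
  (trans (at (tr (Θ-moment P1 (+ 51011754393600) (constant-horner (∇^ 13 P1) (+ 51011754393600) differences)) (thirty-nine π (ι (+ 51011754393600)))) n) (coefficient-ι (+ 51011754393600) (π ^ 39) n))

 array-side : ∀ n -> Zsum (bound1 n) (\ m -> signed P1 m Z.* extend X13 (position m (+ n))) ≡ + 51011754393600 Z.* (π ^ 39) n
 array-side n = trans (Zsum-cong (bound1 n) (\ m -> cong₂ Z._*_ (signed-weight m) (cong (\ z -> extend X13 (z Z.- + T (+ 6 Z.+ m))) index)))
  (trans (array-sum (weight (cs ++ + 1 ∷ [])) (bound1 n) M (NP.≤-trans (NP.m≤n⊔m (bound (Θ n)) (suc M N.+ 6)) (NP.m≤n⊔m 13 _)))
   (H-scaled 5 (family (weight (cs ++ + 1 ∷ [])) T * X13) (+ 51011754393600) 2 (π ^ 39) n M refl (array-moment-monic cs len)))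
  where
  M : ℕ
  M = 21 N.+ n N.* 13
  index : + n Z.* + 13 Z.+ + 21 ≡ + M
  index = trans (ZP.+-comm (+ n Z.* + 13) (+ 21)) (cong (\ z -> + 21 Z.+ z) (sym (ZP.pos-* n 13)))

 gap-sum : ∀ n -> Zsum (bound1 n) (\ m -> signed P1 m Z.* gap m (+ n)) ≡ + 0
 gap-sum n = trans (Zsum-cong (bound1 n) (\ m -> lem (signed P1 m) (extend (coef m Θ) (+ n)) (extend X13 (position m (+ n)))))
  (trans (Zsum-+ (bound1 n) (\ m -> signed P1 m Z.* extend (coef m Θ) (+ n)) (\ m -> Z.- + 1 Z.* (signed P1 m Z.* extend X13 (position m (+ n)))))
  (trans (cong₂ Z._+_ (theta-side n) (trans (Zsum-* (bound1 n) (Z.- + 1) (\ m -> signed P1 m Z.* extend X13 (position m (+ n)))) (cong (Z.- + 1 Z.*_) (array-side n)))) (lem2 (+ 51011754393600 Z.* (π ^ 39) n))))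
  where
  lem : ∀ x a b -> x Z.* (a Z.- b) ≡ x Z.* a Z.+ Z.- + 1 Z.* (x Z.* b)
  lem = solve-∀
  lem2 : ∀ x -> x Z.+ Z.- + 1 Z.* x ≡ + 0
  lem2 = solve-∀

 root : ∀ k -> k N.< 14 -> ¬ Z.- + k ≡ Z.- + k1 -> ¬ Z.- + k ≡ Z.- + k2 -> hz P1 (Z.- + k) ≡ + 0
 root k l n1 n2 = case ZP.i*j≡0⇒i≡0∨j≡0 (+ k Z.- + k1) (isZero-sound _ (allB-sound 14 (\ k -> isZero 0 ((+ k Z.- + k1) Z.* ((+ k Z.- + k2) Z.* hz P1 (Z.- + k)))) table k l)) of λ
  { (inj₁ z) -> ⊥-elim (n1 (cong Z.-_ (ZP.i-j≡0⇒i≡j (+ k) (+ k1) z)))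
  ; (inj₂ z) -> case ZP.i*j≡0⇒i≡0∨j≡0 (+ k Z.- + k2) z of λ
   { (inj₁ z') -> ⊥-elim (n2 (cong Z.-_ (ZP.i-j≡0⇒i≡j (+ k) (+ k2) z')))
   ; (inj₂ z') -> z' } }

 module _ (n : ℕ) (outer⁺ : ∀ k -> gap (+ suc k) (+ n) ≡ + 0) (outer⁻ : ∀ k -> gap -[1+ 13 N.+ k ] (+ n) ≡ + 0) where

  private
   f : ℤ -> ℤ
   f m = signed P1 m Z.* gap m (+ n)

   at-root : ∀ m -> hz P1 m ≡ + 0 -> f m ≡ + 0
   at-root m h = trans (cong (\ z -> σ m Z.* z Z.* gap m (+ n)) (trans (horner-hz P1 m) h)) (trans (cong (Z._* gap m (+ n)) (ZP.*-zeroʳ (σ m))) (ZP.*-zeroˡ (gap m (+ n))))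

   outside : ∀ m -> gap m (+ n) ≡ + 0 -> f m ≡ + 0
   outside m h = trans (cong (signed P1 m Z.*_) h) (ZP.*-zeroʳ (signed P1 m))

   elsewhere : ∀ m -> ¬ m ≡ Z.- + k1 -> ¬ m ≡ Z.- + k2 -> f m ≡ + 0
   elsewhere (+ zero) n1 n2 = at-root (+ 0) (root 0 (s≤s z≤n) n1 n2)
   elsewhere (+ suc k) n1 n2 = outside (+ suc k) (outer⁺ k)
   elsewhere -[1+ k ] n1 n2 = negative (k NP.<? 13)
     where
     negative : Dec (k N.< 13) -> f -[1+ k ] ≡ + 0
     negative (yes l) = at-root -[1+ k ] (root (suc k) (s≤s l) n1 n2)
     negative (no ¬l) = outside -[1+ k ] (trans (cong (\ j -> gap -[1+ j ] (+ n)) (sym (NP.m+[n∸m]≡n (NP.≮⇒≥ ¬l)))) (outer⁻ (k ∸ 13)))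

   abs-neg : ∀ k -> Z.∣ Z.- + k ∣ ≡ k
   abs-neg zero = refl
   abs-neg (suc k) = refl

   within : ∀ k -> k N.≤ 13 -> Z.∣ Z.- + k ∣ N.≤ bound1 n
   within k l = NP.≤-trans (NP.≤-reflexive (abs-neg k)) (NP.≤-trans l (NP.m≤m⊔n 13 (bound (Θ n) N.⊔ (suc (21 N.+ n N.* 13) N.+ 6))))

   reflect : gap (Z.- + k2) (+ n) ≡ gap (Z.- + k1) (+ n)
   reflect = trans (cong (\ m -> gap m (+ n)) (sym reflected)) (gap-symm (Z.- + k1) (+ n))

   signed-value : ∀ m -> σ m Z.* hz P1 m ≡ w -> signed P1 m ≡ w
   signed-value m h = trans (cong (σ m Z.*_) (horner-hz P1 m)) h

  -- Two terms of the sum survive. They are equal by the symmetry of the gap and of the weight, so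
  -- (w + w) times the gap is zero.
  zero-at : gap (Z.- + k1) (+ n) ≡ + 0
  zero-at = case ZP.i*j≡0⇒i≡0∨j≡0 (w Z.+ w) (trans (ZP.*-distribʳ-+ (gap (Z.- + k1) (+ n)) w w) (trans (sym (cong₂ Z._+_ (cong (Z._* gap (Z.- + k1) (+ n)) (signed-value (Z.- + k1) w1)) (cong₂ Z._*_ (signed-value (Z.- + k2) w2) reflect)))
     (trans (sym (Zsum-two (bound1 n) f (Z.- + k1) (Z.- + k2) (within k1 k1≤) (within k2 k2≤) k1≢k2 elsewhere)) (gap-sum n)))) of λ
   { (inj₁ z) -> ⊥-elim (w≢0 z) ; (inj₂ z) -> z }

  zero-at' : gap (Z.- + k2) (+ n) ≡ + 0
  zero-at' = trans reflect zero-at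

module Row0 = Row (0 ,, 7894676275200 ,, 23877101813760 ,, 30003552190464 ,, 21086279778304 ,, 9345544896512 ,, 2777066639360 ,, 571386068992 ,, 82493878272 ,, 8334237696 ,, 576942080 ,, 26066944 ,, 692224 ,, 8192 ,, []) (18261468225 ,, 3616621253 ,- 224657551 ,, 6015891 ,- 76623 ,, 453 ,- []) 6 7 (+ 14863564800) (\ ()) refl refl refl (\ ()) (NP.m≤m+n 6 7) (NP.m≤m+n 7 6) refl refl refl refl refl
module Row1 = Row (0 ,, 8289410088960 ,, 24942668414976 ,, 31147552309248 ,, 21742154563584 ,, 9571062833152 ,, 2826229772288 ,, 578339405824 ,, 83129659392 ,, 8370487296 ,, 578113536 ,, 26083328 ,, 692224 ,, 8192 ,, []) (2029052025 ,, 2205448605 ,- 181758911 ,, 5434947 ,- 73063 ,, 445 ,- []) 5 8 (+ 19818086400) (\ ()) refl refl refl (\ ()) (NP.m≤m+n 5 8) (NP.m≤m+n 8 5) refl refl refl refl refl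
module Row2 = Row (0 ,, 9210455654400 ,, 27381476229120 ,, 33702126256128 ,, 23167719817216 ,, 10048766418944 ,, 2928152195072 ,, 592524476416 ,, 84412723200 ,, 8443183104 ,, 580456448 ,, 26116096 ,, 692224 ,, 8192 ,, []) (730458729 ,, 845905229 ,- 119814943 ,, 4434339 ,- 66327 ,, 429 ,- []) 4 9 (+ 35672555520) (\ ()) refl refl refl (\ ()) (NP.m≤m+n 4 9) (NP.m≤m+n 9 4) refl refl refl refl refl
module Row3 = Row (0 ,, 11052546785280 ,, 32059531984896 ,, 38353990975488 ,, 25629520543744 ,, 10836677230592 ,, 3090294591488 ,, 614503972864 ,, 86366072832 ,, 8552718336 ,, 583970816 ,, 26165248 ,, 692224 ,, 8192 ,, []) (372683025 ,, 438885845 ,- 69436591 ,, 3290547 ,- 57183 ,, 405 ,- []) 3 10 (+ 89181388800) (\ ()) refl refl refl (\ ()) (NP.m≤m+n 3 10) (NP.m≤m+n 10 3) refl refl refl refl refl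
module Row4 = Row (0 ,, 15071654707200 ,, 41342616207360 ,, 46632751202304 ,, 29635393142784 ,, 12033873313792 ,, 3324518912000 ,, 645136678912 ,, 89024212992 ,, 8699682816 ,, 588656640 ,, 26230784 ,, 692224 ,, 8192 ,, []) (225450225 ,, 267316533 ,- 44122991 ,, 2303091 ,- 46783 ,, 373 ,- []) 2 11 (+ 326998425600) (\ ()) refl refl refl (\ ()) (NP.m≤m+n 2 11) (NP.m≤m+n 11 2) refl refl refl refl refl
module Row5 = Row (0 ,, 27631366963200 ,, 62188441436160 ,, 61863757185024 ,, 36094145511424 ,, 13795868844032 ,, 3647893483520 ,, 685595164672 ,, 92433149952 ,, 8884862976 ,, 594513920 ,, 26312704 ,, 692224 ,, 8192 ,, []) (150921225 ,, 179563373 ,- 30262111 ,, 1656291 ,- 36663 ,, 333 ,- []) 1 12 (+ 1961990553600) (\ ()) refl refl refl (\ ()) (NP.m≤m+n 1 12) (NP.m≤m+n 12 1) refl refl refl refl refl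
module Row6 = Row (25505877196800 ,, 83074091581440 ,, 115028623097856 ,, 91116800606208 ,, 46578559565824 ,, 16356661747712 ,, 4083766489088 ,, 737389379584 ,, 96650391552 ,, 9109241856 ,, 601542656 ,, 26411008 ,, 692224 ,, 8192 ,, []) (108056025 ,, 128816765 ,- 21967231 ,, 1234947 ,- 28743 ,, 285 ,- []) 0 13 (+ 25505877196800) (\ ()) refl refl refl (\ ()) (NP.m≤m+n 0 13) (NP.m≤m+n 13 0) refl refl refl refl refl

private
 sub-cases : ∀ n k -> (∃ \ j -> j N.< n × + n Z.- + suc k ≡ + j) ⊎ (∃ \ r -> + n Z.- + suc k ≡ -[1+ r ])
 sub-cases zero k = inj₂ (k , refl)
 sub-cases (suc n) zero = inj₁ (n , NP.≤-refl , refl)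
 sub-cases (suc n) (suc k) with sub-cases n k
 ... | inj₁ (j , l , e) = inj₁ (j , NP.m≤n⇒m≤1+n l , trans (ZP.[1+m]⊖[1+n]≡m⊖n n (suc k)) e)
 ... | inj₂ (r , e) = inj₂ (r , trans (ZP.[1+m]⊖[1+n]≡m⊖n n (suc k)) e)

gap-zero : ∀ n m -> gap m (+ n) ≡ + 0
gap-zero = strong (\ n -> ∀ m -> gap m (+ n) ≡ + 0) induct
 where
 induct : ∀ n -> (∀ i -> i N.< n -> ∀ m -> gap m (+ i) ≡ + 0) -> ∀ m -> gap m (+ n) ≡ + 0
 induct n ih = all
  where
  outer⁺ : ∀ k -> gap (+ suc k) (+ n) ≡ + 0
  -- For m > 0 quasi-periodicity leads from (m, n) back to (m - 13, n - m), where the second entry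
  -- is smaller than n, possibly negative.
  outer⁺ k = trans (cong₂ gap (l1 (+ suc k)) (l2 (+ n) (+ suc k))) (trans (gap-quasi (+ suc k Z.- + 13) (+ n Z.- + suc k)) (go (sub-cases n k)))
   where
   l1 : ∀ x -> x ≡ x Z.- + 13 Z.+ + 13
   l1 = solve-∀
   l2 : ∀ n x -> n ≡ n Z.- x Z.+ (x Z.- + 13) Z.+ + 13
   l2 = solve-∀
   go : (∃ \ j -> j N.< n × + n Z.- + suc k ≡ + j) ⊎ (∃ \ r -> + n Z.- + suc k ≡ -[1+ r ]) -> gap (+ suc k Z.- + 13) (+ n Z.- + suc k) ≡ + 0
   go (inj₁ (j , l , e)) = trans (cong (gap (+ suc k Z.- + 13)) e) (ih j l (+ suc k Z.- + 13))
   go (inj₂ (r , e)) = trans (cong (gap (+ suc k Z.- + 13)) e) (gap-negative (+ suc k Z.- + 13) r)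
  outer⁻ : ∀ k -> gap -[1+ 13 N.+ k ] (+ n) ≡ + 0
  outer⁻ k = trans (sym (gap-symm -[1+ 13 N.+ k ] (+ n))) (outer⁺ k)
  middle : ∀ k -> k N.< 14 -> gap (Z.- + k) (+ n) ≡ + 0
  middle 0 _ = Row6.zero-at n outer⁺ outer⁻
  middle 1 _ = Row5.zero-at n outer⁺ outer⁻
  middle 2 _ = Row4.zero-at n outer⁺ outer⁻
  middle 3 _ = Row3.zero-at n outer⁺ outer⁻
  middle 4 _ = Row2.zero-at n outer⁺ outer⁻
  middle 5 _ = Row1.zero-at n outer⁺ outer⁻
  middle 6 _ = Row0.zero-at n outer⁺ outer⁻
  middle 7 _ = Row0.zero-at' n outer⁺ outer⁻
  middle 8 _ = Row1.zero-at' n outer⁺ outer⁻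
  middle 9 _ = Row2.zero-at' n outer⁺ outer⁻
  middle 10 _ = Row3.zero-at' n outer⁺ outer⁻
  middle 11 _ = Row4.zero-at' n outer⁺ outer⁻
  middle 12 _ = Row5.zero-at' n outer⁺ outer⁻
  middle 13 _ = Row6.zero-at' n outer⁺ outer⁻
  middle (8+ (4+ (2+ k))) l = ⊥-elim (NP.<-irrefl refl (NP.≤-trans (NP.≤-trans (s≤s (NP.m≤m+n 14 k)) l) NP.≤-refl))
  all : ∀ m -> gap m (+ n) ≡ + 0
  all (+ zero) = middle 0 (s≤s z≤n)
  all (+ suc k) = outer⁺ k
  all -[1+ k ] = negative (k NP.<? 13)
   where
   negative : Dec (k N.< 13) -> gap -[1+ k ] (+ n) ≡ + 0
   negative (yes l) = middle (suc k) (s≤s l)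
   negative (no ¬l) = trans (cong (\ j -> gap -[1+ j ] (+ n)) (sym (NP.m+[n∸m]≡n (NP.≮⇒≥ ¬l)))) (outer⁻ (k ∸ 13))

-- From the array to the generating function

π¹³CΦ : π ^ 13 * CΦ 13 ~ H 0 X13
π¹³CΦ = tr (sy Θ-constant) (mk \ n -> trans (ZP.i-j≡0⇒i≡j (coef (+ 0) Θ n) (extend X13 (position (+ 0) (+ n))) (gap-zero n (+ 0))) (cong (extend X13) (trans (lem (+ n)) (sym (ZP.pos-* n 13)))))
 where
 lem : ∀ n -> n Z.* + 13 Z.+ + 21 Z.- + 21 ≡ n Z.* + 13
 lem = solve-∀

private
 v*π⁻¹ : v * π⁻¹ ~ V (π⁻¹ ^ 2) * π
 v*π⁻¹ = tr (by1 {c = π * V π⁻¹ ^ 2} π*π⁻¹ (solve (v0 :^ 2 :* v1 :^ 2 :* v2) (v1 :^ 2 :* v0 :+ v0 :* v1 :^ 2 :* (v0 :* v2 :- # 1)) refl (π ∷ V π⁻¹ ∷ π⁻¹ ∷ []))) (*ʳ {π} (sy (V13.V-^ π⁻¹ 2)))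

 t/Vπ : π⁻¹ ^ 2 * (q ^ 1 * V π) ~ V π⁻¹ * t
 t/Vπ = sy (by1 {c = q * V π * π⁻¹ ^ 2} Vπ*Vπ⁻¹ (solve (v3 :* (v0 :* (v1 :^ 2 :* v2 :^ 2))) (v2 :^ 2 :* (v0 :^ 1 :* v1) :+ v0 :* v1 :* v2 :^ 2 :* (v1 :* v3 :- # 1)) refl (q ∷ V π ∷ π⁻¹ ∷ V π⁻¹ ∷ [])))

 -- The summand q yields the partition numbers. For the summand v, `v * π⁻¹` is π divided by a
 -- series in q¹³, so `H-π` evaluates it.
 H-π⁻¹ : H 0 (q ^ 6 * ((q + v) * π⁻¹)) ~ H 0 (q ^ 7 * π⁻¹) + V π⁻¹ * t
 H-π⁻¹ = tr (V13.H-cong 0 (tr (solve (v0 :* ((v1 :+ v2) :* v3)) (v1 :* v0 :* v3 :+ v0 :* (v2 :* v3)) refl (q ^ 6 ∷ q ∷ v ∷ π⁻¹ ∷ []))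
   (+ˡ (tr (*ˡ {q ^ 6} v*π⁻¹) (solve (v0 :* (v1 :* v2)) (v1 :* (v0 :* v2)) refl (q ^ 6 ∷ V (π⁻¹ ^ 2) ∷ π ∷ []))))))
  (tr (H-+ (q ^ 7 * π⁻¹) (V (π⁻¹ ^ 2) * (q ^ 6 * π))) (+ˡ (tr (V13.H-V* 0 (π⁻¹ ^ 2) (q ^ 6 * π) (s≤s z≤n)) (tr (*ˡ {π⁻¹ ^ 2} H-π) t/Vπ))))

CΦ-formula : CΦ 13 ~ V π⁻¹ + ι (+ 26) * (V π⁻¹ * t) + ι (+ 13) * H 0 (q ^ 7 * π⁻¹)
CΦ-formula = regular-cancel {π ^ 13} (regular-power {π} regular-π 13) (tr π¹³CΦ (tr (V13.H-cong 0 (tr X13-def (+ʳ (tr (solve (v0 :* (v1 :* (v2 :* v3))) (v0 :* v2 :* (v1 :* v3)) refl (ι (+ 13) ∷ q ^ 6 ∷ V π ^ 13 ∷ (q + v) * π⁻¹ ∷ [])) (*ʳ {q ^ 6 * ((q + v) * π⁻¹)} (sy (tr (V13.V-* (ι (+ 13)) (π ^ 13)) (*-cong (V13.V-ι (+ 13)) (V13.V-^ π 13)))))))))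
 (tr (H-+ (V (ι (+ 13) * π ^ 13) * (q ^ 6 * ((q + v) * π⁻¹))) (V Y)) (tr (+-cong (tr (V13.H-V* 0 (ι (+ 13) * π ^ 13) (q ^ 6 * ((q + v) * π⁻¹)) (s≤s z≤n)) (*ˡ {ι (+ 13) * π ^ 13} H-π⁻¹)) (V13.H-V Y))
  (solve (# 13 :* v0 :* (v1 :+ v2 :* v3) :+ v0 :* (v2 :* (# 1 :+ # 13 :* v3))) (v0 :* (v2 :+ # 26 :* (v2 :* v3) :+ # 13 :* v1)) refl (π ^ 13 ∷ H 0 (q ^ 7 * π⁻¹) ∷ V π⁻¹ ∷ t ∷ []))))))
 where
 Y : Ser
 Y = π ^ 13 * (V π⁻¹ * (ι (+ 1) + ι (+ 13) * t))

-- Translation of the statement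

open import Data.Nat.Divisibility using (_∣?_; ∣⇒≤; ∣m∣n⇒∣m+n; ∣m+n∣m⇒∣n; _∣0; ∣-refl)
open import Data.List.Properties using (map-++)

⊛-at : ∀ f g n -> (f ⊛ g) n ≡ (f * g) n
⊛-at f g n = sym (conv-sum f g n)

one-≋ : one ~ 1#
one-≋ = mk \ { zero -> refl ; (suc n) -> refl }

pow-≋ : ∀ {f g} -> f ~ g -> ∀ k -> pow f k ~ g ^ k
pow-≋ h zero = one-≋
pow-≋ {f} {g} h (suc k) = mk \ n -> trans (⊛-at f (pow f k) n) (at (*-cong h (pow-≋ h k)) n)

prodTo-≋ : ∀ {F F' : ℕ -> Ser} -> (∀ j -> F (suc j) ~ F' (suc j)) -> ∀ N -> prodTo N F ~ prod N F'
prodTo-≋ h zero = one-≋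
prodTo-≋ {F} h (suc N) = mk \ n -> trans (⊛-at (prodTo N F) (F (suc N)) n) (at (*-cong (prodTo-≋ h N) (h N)) n)

mono-q^ : ∀ k -> mono k ~ q ^ k
mono-q^ k = mk \ n -> trans (point n) (sym (q^-ind k n))
 where
 point : ∀ n -> mono k n ≡ ind (n NP.≟ k)
 point n with n NP.≟ k
 ... | yes _ = refl
 ... | no _ = refl

factor-≋ : ∀ k -> one ⊖ mono k ~ 1# - q ^ k
factor-≋ k = mk \ n -> sym (trans (+-at 1# (- (q ^ k)) n) (cong₂ Z._+_ (sym (at one-≋ n)) (trans (neg-at (q ^ k) n) (cong Z.-_ (sym (at (mono-q^ k) n))))))

oneMinus⋆ : ℕ -> ℕ -> Ser
oneMinus⋆ m j = 1# - q ^ (m N.* j)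

poch-≋ : ∀ m -> poch m ~ prod∞ (oneMinus⋆ m)
poch-≋ m = mk \ n -> at (prodTo-≋ (\ j -> factor-≋ (m N.* suc j)) n) n

poch-1 : poch 1 ~ π
poch-1 = tr (poch-≋ 1) (prod∞-cong (\ j -> reflexive (cong (\ i -> 1# - q ^ i) (NP.*-identityˡ (suc j)))))

private
 power-* : ∀ j -> (q ^ 13) ^ j ~ q ^ (13 N.* j)
 power-* zero = reflexive (cong (q ^_) (sym (NP.*-zeroʳ 13)))
 power-* (suc j) = tr (*ˡ {q ^ 13} (power-* j)) (power-+ q 13 (13 N.* j) (13 N.* suc j) (sym (NP.*-suc 13 j)))

 V-1 : V 1# ~ 1#
 V-1 = tr (V13.V-cong (sy ι-1)) (tr (V13.V-ι (+ 1)) ι-1)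

 V-oneMinus : ∀ j -> V (oneMinus j) ~ oneMinus⋆ 13 j
 V-oneMinus j = tr (V13.V-+ 1# (- (q ^ j))) (+-cong V-1 (tr (V13.V-neg (q ^ j)) (-‿cong (tr (V13.V-^ q j) (tr (^-cong j V-q) (power-* j))))))

 V-prod : ∀ N -> V (prod N oneMinus) ~ prod N (oneMinus⋆ 13)
 V-prod zero = V-1
 V-prod (suc N) = tr (V13.V-* (prod N oneMinus) (oneMinus (suc N))) (*-cong (V-prod N) (V-oneMinus (suc N)))

poch-13 : poch 13 ~ V π
poch-13 = tr (poch-≋ 13) (mk (V13.V-elim (\ n -> prod n (oneMinus⋆ 13) n ≡ V π n)
 (\ n -> trans (sym (at (V-prod (n N.* 13)) (n N.* 13))) (trans (V13.V-multiple (prod (n N.* 13) oneMinus) n) (trans (prod-approx oneMinus oneMinus-unital (n N.* 13) n (NP.m≤m*n n 13)) (sym (V13.V-multiple π n)))))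
 (\ r n l -> trans (sym (at (V-prod (suc r N.+ n N.* 13)) (suc r N.+ n N.* 13))) (trans (V13.V-other (prod (suc r N.+ n N.* 13) oneMinus) r n l) (sym (V13.V-other π r n l))))))

geom-ind : ∀ k n -> geom k n ≡ ind (k ∣? n)
geom-ind k n with k ∣? n
... | yes _ = refl
... | no _ = refl

private
 geom-0 : ∀ k -> geom k 0 ≡ + 1
 geom-0 k = trans (geom-ind k 0) (ind-yes (k ∣? 0) (k ∣0))

 geom-small : ∀ k n -> suc n N.< k -> geom k (suc n) ≡ + 0
 geom-small k n l = trans (geom-ind k (suc n)) (ind-no (k ∣? suc n) (\ h -> NP.<-irrefl refl (NP.<-≤-trans l (∣⇒≤ h))))

 geom-step : ∀ k n -> geom k (k N.+ n) ≡ geom k n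
 geom-step k n = trans (geom-ind k (k N.+ n)) (trans (ind-iff (k ∣? k N.+ n) (k ∣? n) (\ h -> ∣m+n∣m⇒∣n h ∣-refl) (∣m∣n⇒∣m+n ∣-refl)) (sym (geom-ind k n)))

geom-rec : ∀ k -> geom (suc k) ~ 1# + q ^ suc k * geom (suc k)
geom-rec k = mk \ n -> trans (point n) (sym (+-at 1# (q ^ suc k * geom (suc k)) n))
 where
 point : ∀ n -> geom (suc k) n ≡ 1# n Z.+ (q ^ suc k * geom (suc k)) n
 point n with n NP.<? suc k
 point zero | yes l = trans (geom-0 (suc k)) (sym (cong (\ z -> + 1 Z.+ z) (q^-low (suc k) (geom (suc k)) 0 l)))
 point (suc n) | yes l = trans (geom-small (suc k) n l) (sym (cong (\ z -> + 0 Z.+ z) (q^-low (suc k) (geom (suc k)) (suc n) l)))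
 point n | no ¬l = subst (\ i -> geom (suc k) i ≡ 1# i Z.+ (q ^ suc k * geom (suc k)) i) (NP.m+[n∸m]≡n (NP.≮⇒≥ ¬l))
  (trans (geom-step (suc k) (n ∸ suc k)) (trans (sym (q^-shift (suc k) (geom (suc k)) (n ∸ suc k))) (sym (ZP.+-identityˡ ((q ^ suc k * geom (suc k)) (suc k N.+ (n ∸ suc k)))))))

geom-inverse : ∀ k -> (1# - q ^ suc k) * geom (suc k) ~ 1#
geom-inverse k = tr (distribʳ (geom (suc k)) 1# (- (q ^ suc k))) (tr (+-cong (tr (*-identityˡ (geom (suc k))) (geom-rec k)) (sy (-‿distribˡ-* (q ^ suc k) (geom (suc k)))))
 (tr (+-assoc 1# (q ^ suc k * geom (suc k)) (- (q ^ suc k * geom (suc k)))) (tr (+ˡ (-‿inverseʳ (q ^ suc k * geom (suc k)))) (+-identityʳ 1#))))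

geom⋆ : ℕ -> ℕ -> Ser
geom⋆ m j = geom (m N.* j)

invPoch-≋ : ∀ m -> invPoch m ~ prod∞ (geom⋆ m)
invPoch-≋ m = mk \ n -> at (prodTo-≋ (\ j -> ≈-refl) n) n

private
 oneMinus⋆-unital : ∀ m -> Unital (oneMinus⋆ (suc m))
 oneMinus⋆-unital m j i l = trans (+-at 1# (- (q ^ (suc m N.* j))) i) (trans (cong (\ z -> 1# i Z.+ z) (trans (neg-at (q ^ (suc m N.* j)) i) (cong Z.-_ (q^-zero (suc m N.* j) i (NP.<-≤-trans l (NP.m≤m+n j (m N.* j))))))) (ZP.+-identityʳ (1# i)))

 geom⋆-unital : ∀ m -> Unital (geom⋆ (suc m))
 geom⋆-unital m j zero l = geom-0 (suc m N.* j)
 geom⋆-unital m j (suc i) l = geom-small (suc m N.* j) i (NP.<-≤-trans l (NP.m≤m+n j (m N.* j)))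

 prod-1 : ∀ N -> prod N (\ _ -> 1#) ~ 1#
 prod-1 zero = ≈-refl
 prod-1 (suc N) = tr (*-identityʳ (prod N (\ _ -> 1#))) (prod-1 N)

poch-inverse : ∀ m -> prod∞ (oneMinus⋆ (suc m)) * prod∞ (geom⋆ (suc m)) ~ 1#
poch-inverse m = tr (sy (prod∞-* (oneMinus⋆ (suc m)) (geom⋆ (suc m)) (oneMinus⋆-unital m) (geom⋆-unital m)))
 (tr (prod∞-cong (\ j -> geom-inverse (j N.+ m N.* suc j))) (mk \ n -> at (prod-1 n) n))

invPoch-1 : invPoch 1 ~ π⁻¹
invPoch-1 = regular-cancel {π} regular-π (tr (*-cong (tr (sy poch-1) (poch-≋ 1)) (invPoch-≋ 1)) (tr (poch-inverse 0) (sy (tr π*π⁻¹ ι-1))))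

invPoch-13 : invPoch 13 ~ V π⁻¹
invPoch-13 = regular-cancel {V π} (regular-1 {V π} (V-head π)) (tr (*-cong (tr (sy poch-13) (poch-≋ 13)) (invPoch-≋ 13)) (tr (poch-inverse 12) (sy (tr Vπ*Vπ⁻¹ ι-1))))

-- Partitions

decide : ∀ {A : Set} -> Dec A -> ℕ -> ℕ
decide (yes _) x = x
decide (no _) x = 0

decide-yes : ∀ {A : Set} (d : Dec A) x -> A -> decide d x ≡ x
decide-yes (yes _) x aᵒ = refl
decide-yes (no ¬a) x aᵒ = ⊥-elim (¬a aᵒ)

decide-no : ∀ {A : Set} (d : Dec A) x -> ¬ A -> decide d x ≡ 0
decide-no (yes aᵒ) x ¬a = ⊥-elim (¬a aᵒ)
decide-no (no _) x ¬a = refl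

private
 -- Gives access to the summand, which is local to partsCount.
 record AsSum (n s : ℕ) : Set where
  field
   summand : ℕ -> ℕ
   is-sum : s ≡ sumℕ n summand
 open AsSum

 parts-sum : ∀ k xs n -> AsSum n (partsCount (k ∷ xs) n)
 parts-sum k xs n = record { summand = _ ; is-sum = refl }

 parts-summand : ∀ k xs n m -> summand (parts-sum k xs n) m ≡ decide (m N.* k NP.≤? n) (partsCount xs (n ∸ m N.* k))
 parts-summand k xs n m with m N.* k NP.≤? n
 ... | yes _ = refl
 ... | no _ = refl

 sumℕ-cong' : ∀ n {f g : ℕ -> ℕ} -> (∀ i -> f i ≡ g i) -> sumℕ n f ≡ sumℕ n g
 sumℕ-cong' zero h = h 0
 sumℕ-cong' (suc n) h = cong₂ N._+_ (sumℕ-cong' n h) (h (suc n))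

 sumℕ-suc' : ∀ n (f : ℕ -> ℕ) -> sumℕ (suc n) f ≡ f 0 N.+ sumℕ n (f ∘ suc)
 sumℕ-suc' zero f = refl
 sumℕ-suc' (suc n) f = trans (cong (N._+ f (2+ n)) (sumℕ-suc' n f)) (NP.+-assoc (f 0) (sumℕ n (f ∘ suc)) (f (2+ n)))

 sumℕ-extend : ∀ k n (f : ℕ -> ℕ) -> (∀ i -> n N.< i -> f i ≡ 0) -> sumℕ (k N.+ n) f ≡ sumℕ n f
 sumℕ-extend zero n f h = refl
 sumℕ-extend (suc k) n f h = trans (cong₂ N._+_ (sumℕ-extend k n f h) (h (suc (k N.+ n)) (s≤s (NP.m≤n+m n k)))) (NP.+-identityʳ (sumℕ n f))

 sumℕ-head : ∀ n (f : ℕ -> ℕ) -> (∀ i -> f (suc i) ≡ 0) -> sumℕ n f ≡ f 0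
 sumℕ-head zero f h = refl
 sumℕ-head (suc n) f h = trans (cong₂ N._+_ (sumℕ-head n f h) (h n)) (NP.+-identityʳ (f 0))

 term⋆ : ℕ -> List ℕ -> ℕ -> ℕ -> ℕ
 term⋆ k xs n m = decide (m N.* k NP.≤? n) (partsCount xs (n ∸ m N.* k))

 parts-unfold : ∀ k xs n -> partsCount (k ∷ xs) n ≡ sumℕ n (term⋆ k xs n)
 parts-unfold k xs n = trans (is-sum (parts-sum k xs n)) (sumℕ-cong' n (parts-summand k xs n))

 parts-low : ∀ k xs n -> n N.< suc k -> partsCount (suc k ∷ xs) n ≡ partsCount xs n
 parts-low k xs n l = trans (parts-unfold (suc k) xs n) (trans (sumℕ-head n (term⋆ (suc k) xs n) (\ i -> decide-no (suc i N.* suc k NP.≤? n) _ (\ h -> NP.<-irrefl refl (NP.<-≤-trans l (NP.≤-trans (NP.m≤m+n (suc k) (i N.* suc k)) h)))))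
  (decide-yes (0 NP.≤? n) (partsCount xs n) z≤n))

 -- Multiplicity 0 is split off; the positive ones correspond to the partitions of n, with one part
 -- fewer.
 parts-high : ∀ k xs n -> partsCount (suc k ∷ xs) (suc k N.+ n) ≡ partsCount xs (suc k N.+ n) N.+ partsCount (suc k ∷ xs) n
 parts-high k xs n = trans (parts-unfold (suc k) xs (suc k N.+ n)) (trans (sumℕ-suc' (k N.+ n) (term⋆ (suc k) xs (suc k N.+ n))) (cong₂ N._+_ (decide-yes (0 NP.≤? suc k N.+ n) (partsCount xs (suc k N.+ n)) z≤n)
  (trans (sumℕ-cong' (k N.+ n) shift-term) (trans (sumℕ-extend k n (term⋆ (suc k) xs n) (\ i l -> decide-no (i N.* suc k NP.≤? n) _ (\ h -> NP.<-irrefl refl (NP.<-≤-trans l (NP.≤-trans (NP.m≤m*n i (suc k)) h))))) (sym (parts-unfold (suc k) xs n))))))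
  where
  shift-term : ∀ m -> term⋆ (suc k) xs (suc k N.+ n) (suc m) ≡ term⋆ (suc k) xs n m
  shift-term m with m N.* suc k NP.≤? n
  ... | yes l = trans (decide-yes (suc m N.* suc k NP.≤? suc k N.+ n) _ (NP.+-monoʳ-≤ (suc k) l)) (cong (partsCount xs) (NP.[m+n]∸[m+o]≡n∸o (suc k) n (m N.* suc k)))
  ... | no ¬l = decide-no (suc m N.* suc k NP.≤? suc k N.+ n) _ (\ h -> ¬l (NP.+-cancelˡ-≤ (suc k) (m N.* suc k) n h))

parts : List ℕ -> Ser
parts xs n = + partsCount xs n

parts-cons : ∀ k xs -> parts (suc k ∷ xs) ~ geom (suc k) * parts xs
parts-cons k xs = regular-cancel {1# - q ^ suc k} (regular-1 {1# - q ^ suc k} (oneMinus-unital (suc k) 0 (s≤s z≤n))) (tr recurrence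
  (sy (tr (sy (*-assoc (1# - q ^ suc k) (geom (suc k)) (parts xs))) (tr (*ʳ {parts xs} (geom-inverse k)) (*-identityˡ (parts xs))))))
 where
 aᵒ : Ser
 aᵒ = parts (suc k ∷ xs)
 point : ∀ n -> aᵒ n ≡ parts xs n Z.+ (q ^ suc k * aᵒ) n
 point n with n NP.<? suc k
 ... | yes l = trans (cong +_ (parts-low k xs n l)) (sym (trans (cong (\ z -> parts xs n Z.+ z) (q^-low (suc k) aᵒ n l)) (ZP.+-identityʳ (parts xs n))))
 ... | no ¬l = subst (\ i -> aᵒ i ≡ parts xs i Z.+ (q ^ suc k * aᵒ) i) (NP.m+[n∸m]≡n (NP.≮⇒≥ ¬l))
  (trans (cong +_ (parts-high k xs (n ∸ suc k))) (cong (\ z -> parts xs (suc k N.+ (n ∸ suc k)) Z.+ z) (sym (q^-shift (suc k) aᵒ (n ∸ suc k)))))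
 recurrence : (1# - q ^ suc k) * aᵒ ~ parts xs
 recurrence = tr (distribʳ aᵒ 1# (- (q ^ suc k))) (tr (+-cong (tr (*-identityˡ aᵒ) (mk \ n -> trans (point n) (sym (+-at (parts xs) (q ^ suc k * aᵒ) n)))) (sy (-‿distribˡ-* (q ^ suc k) aᵒ)))
  (tr (+-assoc (parts xs) (q ^ suc k * aᵒ) (- (q ^ suc k * aᵒ))) (tr (+ˡ (-‿inverseʳ (q ^ suc k * aᵒ))) (+-identityʳ (parts xs)))))

parts-snoc : ∀ xs k -> parts (List.map suc xs ++ suc k ∷ []) ~ parts (List.map suc xs) * geom (suc k)
parts-snoc [] k = tr (parts-cons k []) (*-comm (geom (suc k)) (parts []))
parts-snoc (x ∷ xs) k = tr (parts-cons x (List.map suc xs ++ suc k ∷ [])) (tr (*ˡ {geom (suc x)} (parts-snoc xs k)) (tr (sy (*-assoc (geom (suc x)) (parts (List.map suc xs)) (geom (suc k)))) (*ʳ {geom (suc k)} (sy (parts-cons x (List.map suc xs))))))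

parts-upTo : ∀ n -> parts (List.map suc (List.upTo n)) ~ prod n geom
parts-upTo zero    = mk \ { zero -> refl ; (suc n) -> refl }
parts-upTo (suc n) = tr (reflexive (cong parts (trans (cong (List.map suc) (sym (upTo-∷ʳ n))) (map-++ suc (List.upTo n) (n ∷ []))))) (tr (parts-snoc (List.upTo n) n) (*ʳ {geom (suc n)} (parts-upTo n)))

p-π⁻¹ : ∀ n -> + p n ≡ π⁻¹ n
p-π⁻¹ n = trans (at (parts-upTo n) n) (trans (at (prod-cong (\ j -> reflexive (cong geom (sym (NP.*-identityˡ (suc j))))) n) n) (trans (sym (at (invPoch-≋ 1) n)) (at invPoch-1 n)))

-- The index i = 13 j - 7 satisfies 7 + i = 13 j, whence the factor q⁷; it also makes the
-- coefficient at j = 0 vanish.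
pSeries-≋ : pSeries ~ H 0 (q ^ 7 * π⁻¹)
pSeries-≋ = mk \ { zero -> sym (q^-low 7 π⁻¹ 0 (s≤s z≤n)) ; (suc j) -> trans (p-π⁻¹ (13 N.* suc j ∸ 7)) (sym (shifted-index 7 (13 N.* suc j ∸ 7) (suc j N.* 13) (index j))) }
 where
 shifted-index : ∀ s i n -> s N.+ i ≡ n -> (q ^ s * π⁻¹) n ≡ π⁻¹ i
 shifted-index s i n refl = q^-shift s π⁻¹ i
 index : ∀ j -> 7 N.+ (13 N.* suc j ∸ 7) ≡ suc j N.* 13
 index j = trans (NP.m+[n∸m]≡n (NP.≤-trans (NP.m≤m+n 7 6) (NP.m≤m*n 13 (suc j)))) (NP.*-comm 13 (suc j))

private
 shift-≋ : ∀ k f -> shift k f ~ q ^ k * f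
 shift-≋ k f = mk point
  where
  point : ∀ n -> shift k f n ≡ (q ^ k * f) n
  point n with k NP.≤? n
  ... | yes l = trans (sym (q^-shift k f (n ∸ k))) (cong (q ^ k * f) (NP.m+[n∸m]≡n l))
  ... | no ¬l = sym (q^-low k f n (NP.≰⇒> ¬l))

 scale-≋ : ∀ c {f g} -> f ~ g -> scale c f ~ ι c * g
 scale-≋ c {f} {g} h = mk \ n -> trans (cong (c Z.*_) (at h n)) (sym (coefficient-ι c g n))

 ⊕-≋ : ∀ {f f' g g'} -> f ~ f' -> g ~ g' -> f ⊕ g ~ f' + g'
 ⊕-≋ {f} {f'} {g} {g'} h k = mk \ n -> trans (cong₂ Z._+_ (at h n) (at k n)) (sym (+-at f' g' n))

 term-≋ : ∀ c k -> term c k ~ ι c * (q ^ k * (V π ^ (2 N.* k ∸ 1) * π⁻¹ ^ (2 N.* k)))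
 term-≋ c k = scale-≋ c (tr (shift-≋ k (pow (poch 13) (2 N.* k ∸ 1) ⊛ pow (invPoch 1) (2 N.* k))) (*ˡ {q ^ k} (mk \ n -> trans (⊛-at (pow (poch 13) (2 N.* k ∸ 1)) (pow (invPoch 1) (2 N.* k)) n) (at (*-cong (pow-≋ poch-13 (2 N.* k ∸ 1)) (pow-≋ invPoch-1 (2 N.* k))) n))))

 t-step : ∀ (s w i j : Ser) k -> w * j ~ ι (+ 1) -> ∀ aᵒ b c -> aᵒ * (b * c) ~ j * (s * (w ^ 2 * i ^ 2)) ^ k -> s * aᵒ * (w * (w * b) * (i * (i * c))) ~ j * (s * (w ^ 2 * i ^ 2)) ^ suc k
 t-step s w i j k _ aᵒ b c h = tr (solve (v0 :* v3 :* (v1 :* (v1 :* v4) :* (v2 :* (v2 :* v5)))) (v0 :* (v1 :^ 2 :* v2 :^ 2) :* (v3 :* (v4 :* v5))) refl (s ∷ w ∷ i ∷ aᵒ ∷ b ∷ c ∷ []))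
  (tr (*ˡ {s * (w ^ 2 * i ^ 2)} h) (solve (v0 :* (v1 :* v2)) (v1 :* (v0 :* v2)) refl (s * (w ^ 2 * i ^ 2) ∷ j ∷ (s * (w ^ 2 * i ^ 2)) ^ k ∷ [])))

 t-base : ∀ (s w i j : Ser) -> w * j ~ ι (+ 1) -> s ^ 1 * (w ^ 1 * i ^ 2) ~ j * (s * (w ^ 2 * i ^ 2)) ^ 1
 t-base s w i j h = sy (by1 {c = s * w * i ^ 2} h (solve (v3 :* (v0 :* (v1 :^ 2 :* v2 :^ 2)) :^ 1) (v0 :^ 1 :* (v1 :^ 1 :* v2 :^ 2) :+ v0 :* v1 :* v2 :^ 2 :* (v1 :* v3 :- # 1)) refl (s ∷ w ∷ i ∷ j ∷ [])))

 double : ∀ k -> 2 N.* suc k ≡ suc (suc (2 N.* k))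
 double k = cong suc (NP.+-suc k (k N.+ 0))

 t-power : ∀ k -> q ^ suc k * (V π ^ suc (2 N.* k) * π⁻¹ ^ suc (suc (2 N.* k))) ~ V π⁻¹ * t ^ suc k
 t-power zero = t-base q (V π) π⁻¹ (V π⁻¹) Vπ*Vπ⁻¹
 t-power (suc k) = tr (reflexive (cong (\ z -> q ^ 2+ k * (V π ^ suc z * π⁻¹ ^ 2+ z)) (double k)))
  (t-step q (V π) π⁻¹ (V π⁻¹) (suc k) Vπ*Vπ⁻¹ (q ^ suc k) (V π ^ suc (2 N.* k)) (π⁻¹ ^ suc (suc (2 N.* k))) (t-power k))

term-t : ∀ c k -> term c (suc k) ~ ι c * (V π⁻¹ * t ^ suc k)
term-t c k = tr (term-≋ c (suc k)) (*ˡ {ι c} (tr (reflexive (cong (\ z -> q ^ suc k * (V π ^ (z ∸ 1) * π⁻¹ ^ z)) (double k))) (t-power k)))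

rhs2-≋ : rhs2 ~ V π⁻¹ + ι (+ 13) * H 0 (q ^ 7 * π⁻¹) + ι (+ 26) * (V π⁻¹ * t ^ 1)
rhs2-≋ = ⊕-≋ (⊕-≋ invPoch-13 (scale-≋ (+ 13) pSeries-≋)) (term-t (+ 26) 0)

rhs1-≋ : rhs1 ~ V π⁻¹ + ι (+ 169) * (ι (+ 1) * (V π⁻¹ * t ^ 1) + ι (+ 36) * (V π⁻¹ * t ^ 2) + ι (+ 494) * (V π⁻¹ * t ^ 3) + ι (+ 3380) * (V π⁻¹ * t ^ 4)
 + ι (+ 13182) * (V π⁻¹ * t ^ 5) + ι (+ 28561) * (V π⁻¹ * t ^ 6) + ι (+ 28561) * (V π⁻¹ * t ^ 7))
rhs1-≋ = ⊕-≋ invPoch-13 (scale-≋ (+ 169) (⊕-≋ (⊕-≋ (⊕-≋ (⊕-≋ (⊕-≋ (⊕-≋ (term-t (+ 1) 0) (term-t (+ 36) 1)) (term-t (+ 494) 2)) (term-t (+ 3380) 3)) (term-t (+ 13182) 4)) (term-t (+ 28561) 5)) (term-t (+ 28561) 6)))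

rhs2-CΦ : CΦ 13 ~ rhs2
rhs2-CΦ = tr CΦ-formula (sy (tr rhs2-≋ (solve (v0 :+ # 13 :* v1 :+ # 26 :* (v0 :* v2 :^ 1)) (v0 :+ # 26 :* (v0 :* v2) :+ # 13 :* v1) refl (V π⁻¹ ∷ H 0 (q ^ 7 * π⁻¹) ∷ t ∷ []))))

private
 zuckermanᴸ : List ℤ
 zuckermanᴸ = 0 ,, 143 ,, 6084 ,, 83486 ,, 571220 ,, 2227758 ,, 4826809 ,, 4826809 ,, []

 -- In the linear term 143 + 26 = 169; every other coefficient of `zuckermanᴸ` is itself 169 times
 -- the one in the statement.
 compare : ∀ (w j h s : Ser) -> w * j ~ ι (+ 1) -> ι (+ 13) * (w * h) ~ horner zuckermanᴸ s ->
  j + ι (+ 26) * (j * s) + ι (+ 13) * h ~ j + ι (+ 169) * (ι (+ 1) * (j * s ^ 1) + ι (+ 36) * (j * s ^ 2) + ι (+ 494) * (j * s ^ 3) + ι (+ 3380) * (j * s ^ 4) + ι (+ 13182) * (j * s ^ 5) + ι (+ 28561) * (j * s ^ 6) + ι (+ 28561) * (j * s ^ 7))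
 compare w j h s hw hz' = by2 {c = - (ι (+ 13) * h)} {c' = j} hw hz'
  (solve (v1 :+ # 26 :* (v1 :* v3) :+ # 13 :* v2)
   ((v1 :+ # 169 :* (# 1 :* (v1 :* v3 :^ 1) :+ # 36 :* (v1 :* v3 :^ 2) :+ # 494 :* (v1 :* v3 :^ 3) :+ # 3380 :* (v1 :* v3 :^ 4) :+ # 13182 :* (v1 :* v3 :^ 5) :+ # 28561 :* (v1 :* v3 :^ 6) :+ # 28561 :* (v1 :* v3 :^ 7)))
     :+ (:- (# 13 :* v2)) :* (v0 :* v1 :- # 1) :+ v1 :* (# 13 :* (v0 :* v2) :- hE zuckermanᴸ v3)) refl (w ∷ j ∷ h ∷ s ∷ []))

rhs1-CΦ : CΦ 13 ~ rhs1
rhs1-CΦ = tr CΦ-formula (tr (compare (V π) (V π⁻¹) (H 0 (q ^ 7 * π⁻¹)) t Vπ*Vπ⁻¹ zuckerman) (sy rhs1-≋))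

theorem3p6 : (n : ℕ) -> (CΦ 13 n ≡ rhs1 n) × (CΦ 13 n ≡ rhs2 n)
theorem3p6 n = at rhs1-CΦ n , at rhs2-CΦ n
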